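{- For each $k \in \{0,1,2,\ldots\}$ the following holds: every language in $\mathrm{NE}$ has (nonuniform) $\mathrm{ACC}^k$ circuits if and only if every language in $\mathrm{NE}$ has $\mathrm{P}^{\mathrm{NE}}$-uniform $\mathrm{ACC}^k$ circuits.
   Context: $\mathrm{NE} = \mathrm{NTIME}[2^{O(n)}]$, the class of languages accepted by nondeterministic Turing machines in time $2^{O(n)}$. $\mathrm{ACC}^k$ circuits are families $\{C_j\}_{j\ge 0}$ of Boolean circuits of size polynomial in $j$ and depth $O((\log j)^k)$, built from NOT gates and unbounded fan-in AND, OR, and $\mathrm{MOD}_m$ gates (for some fixed constant $m$); a language $A$ "has $\mathrm{ACC}^k$ circuits" if there is such a family with $C_j$ deciding membership in $A$ for all inputs of length $j$. The family is $\mathrm{P}^{\mathrm{NE}}$-uniform if there is a function in $\mathrm{FP}^{\mathrm{NE}}$ (computable in deterministic polynomial time with an oracle for a set in $\mathrm{NE}$) that on input $1^j$ outputs a description of $C_j$. -}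

module Defs where

open import Data.Nat using (ℕ; zero; suc; _+_; _*_; _^_; _≤_; _⊔_)
open import Data.Nat.Divisibility using (_∣?_)
open import Data.Nat.Logarithm using (⌊log₂_⌋)
open import Data.Bool using (Bool; true; false; not; _∧_; _∨_)
open import Data.Fin using (Fin; zero; suc; toℕ)
open import Data.List using (List; []; _∷_; _++_; length; replicate; map; foldr; concat)
open import Data.List.Membership.Propositional using (_∈_)
open import Data.Vec using (Vec; lookup; toList)
open import Data.Product using (Σ; _×_; _,_; ∃; ∃-syntax)
open import Relation.Nullary using (¬_)
open import Relation.Nullary.Decidable using (⌊_⌋)
open import Relation.Binary.PropositionalEquality using (_≡_; _≢_)
open import Function.Bundles using (_⇔_)

Str : Set
Str = List Bool

Language : Set₁
Language = Str → Set

-- Turing machines (single two-way-infinite tape).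
-- Tape alphabet Fin (3 + g): zero = blank, 1 = bit 0, 2 = bit 1, rest extra.

Sym : ℕ → Set
Sym g = Fin (3 + g)

blank : ∀ {g} → Sym g
blank = zero

bitSym : ∀ {g} → Bool → Sym g
bitSym false = suc zero
bitSym true  = suc (suc zero)

data Move : Set where
  L R S : Move

record Tape (g : ℕ) : Set where
  constructor tape
  field
    left  : List (Sym g)   -- cells left of the head, nearest first
    head  : Sym g
    right : List (Sym g)   -- cells right of the head, nearest first
open Tape public

write : ∀ {g} → Sym g → Tape g → Tape g
write a (tape l _ r) = tape l a r

move : ∀ {g} → Move → Tape g → Tape g
move L (tape []      h r) = tape [] blank (h ∷ r)
move L (tape (x ∷ l) h r) = tape l x (h ∷ r)
move R (tape l h [])      = tape (h ∷ l) blank []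
move R (tape l h (x ∷ r)) = tape (h ∷ l) x r
move S t = t

initTape : ∀ {g} → Str → Tape g
initTape []      = tape [] blank []
initTape (b ∷ x) = tape [] (bitSym b) (map bitSym x)

readBitsList : ∀ {g} → List (Sym g) → Str
readBitsList [] = []
readBitsList (zero ∷ _) = []
readBitsList (suc zero ∷ r) = false ∷ readBitsList r
readBitsList (suc (suc zero) ∷ r) = true ∷ readBitsList r
readBitsList (suc (suc (suc _)) ∷ _) = []

readBits : ∀ {g} → Tape g → Str
readBits (tape _ h r) = readBitsList (h ∷ r)

record Config (nQ g : ℕ) : Set where
  constructor cfg
  field
    state : Fin nQ
    tp    : Tape g
open Config public

record NTM : Set where
  field
    nQ nΓ   : ℕ
    start   : Fin nQ
    accept  : Fin nQ
    δ       : Fin nQ → Sym nΓ → List (Fin nQ × Sym nΓ × Move)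

module _ (M : NTM) where
  open NTM M

  data NStep : Config nQ nΓ → Config nQ nΓ → Set where
    nstep : ∀ {q t q' a mv} → (q' , a , mv) ∈ δ q (head t) →
            NStep (cfg q t) (cfg q' (move mv (write a t)))

  data NRun : ℕ → Config nQ nΓ → Config nQ nΓ → Set where
    done : ∀ {c} → NRun zero c c
    more : ∀ {n c c' c''} → NStep c c' → NRun n c' c'' → NRun (suc n) c c''

  nInit : Str → Config nQ nΓ
  nInit x = cfg start (initTape x)

  NTimeBounded : Str → ℕ → Set
  NTimeBounded x T = ∀ c → ¬ NRun (suc T) (nInit x) c

  NAccepts : Str → Set
  NAccepts x = ∃[ n ] ∃[ c ] (NRun n (nInit x) c × state c ≡ accept)

InNE : Language → Set
InNE A = ∃[ M ] ∃[ c ] (∀ (x : Str) →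
           NTimeBounded M x (2 ^ (c * (length x + 1))) × (A x ⇔ NAccepts M x))

-- Deterministic oracle Turing machines and FP^NE.
-- Query state: the oracle is asked about the bit string written from the
-- head rightwards; the machine moves to qyes / qno accordingly.
-- On halting, the output is the bit string written from the head rightwards.

record OTM : Set where
  field
    nQ nΓ  : ℕ
    start halt qquery qyes qno : Fin nQ
    δ      : Fin nQ → Sym nΓ → Fin nQ × Sym nΓ × Move

module _ (M : OTM) (O : Language) where
  open OTM M

  data OStep : Config nQ nΓ → Config nQ nΓ → Set where
    ostep : ∀ {q t q' a mv} → q ≢ halt → q ≢ qquery →
            δ q (head t) ≡ (q' , a , mv) →
            OStep (cfg q t) (cfg q' (move mv (write a t)))
    oyes  : ∀ {q t} → q ≢ halt → q ≡ qquery → O (readBits t) →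
            OStep (cfg q t) (cfg qyes t)
    ono   : ∀ {q t} → q ≢ halt → q ≡ qquery → ¬ O (readBits t) →
            OStep (cfg q t) (cfg qno t)

  data ORun : ℕ → Config nQ nΓ → Config nQ nΓ → Set where
    done : ∀ {c} → ORun zero c c
    more : ∀ {n c c' c''} → OStep c c' → ORun n c' c'' → ORun (suc n) c c''

  oInit : Str → Config nQ nΓ
  oInit x = cfg start (initTape x)

  OComputesIn : Str → ℕ → Str → Set
  OComputesIn x T y = ∃[ n ] ∃[ c ] (n ≤ T × ORun n (oInit x) c ×
                        state c ≡ halt × readBits (tp c) ≡ y)

FP^NE-unary : (ℕ → Str) → Set₁
FP^NE-unary g = ∃[ B ] (InNE B × ∃[ M ] ∃[ c ] (∀ j →
                  OComputesIn M B (replicate j true) (c * (j + 1) ^ c) (g j)))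

-- Circuits with NOT, unbounded fan-in AND, OR and MOD_m gates,
-- as straight-line programs.  Wires are indexed de Bruijn style:
-- in a program with g gates on n inputs there are g + n wires,
-- wire zero being the most recently added gate (or the last input).

data Gate (m w : ℕ) : Set where
  NOT : Fin w → Gate m w
  AND OR MOD : List (Fin w) → Gate m w

data SLP (m n : ℕ) : ℕ → Set where
  inputs : SLP m n zero
  _▷_    : ∀ {g} → SLP m n g → Gate m (g + n) → SLP m n (suc g)

record Circuit (m n : ℕ) : Set where
  constructor circuit
  field
    size  : ℕ
    gates : SLP m n size
    out   : Fin (size + n)
open Circuit public

countTrue : List Bool → ℕ
countTrue [] = 0
countTrue (true ∷ bs) = suc (countTrue bs)
countTrue (false ∷ bs) = countTrue bs

gateVal : ∀ {m w} → (Fin w → Bool) → Gate m w → Bool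
gateVal v (NOT i) = not (v i)
gateVal v (AND is) = foldr (λ i b → v i ∧ b) true is
gateVal v (OR is) = foldr (λ i b → v i ∨ b) false is
gateVal {m} v (MOD is) = ⌊ m ∣? countTrue (map v is) ⌋

wireVal : ∀ {m n g} → SLP m n g → Vec Bool n → Fin (g + n) → Bool
wireVal inputs x i = lookup x i
wireVal (s ▷ gt) x zero = gateVal (wireVal s x) gt
wireVal (s ▷ gt) x (suc i) = wireVal s x i

maxList : List ℕ → ℕ
maxList = foldr _⊔_ 0

gateInputs : ∀ {m w} → Gate m w → List (Fin w)
gateInputs (NOT i) = i ∷ []
gateInputs (AND is) = is
gateInputs (OR is) = is
gateInputs (MOD is) = is

wireDepth : ∀ {m n g} → SLP m n g → Fin (g + n) → ℕ
wireDepth inputs i = 0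
wireDepth (s ▷ gt) zero = suc (maxList (map (wireDepth s) (gateInputs gt)))
wireDepth (s ▷ gt) (suc i) = wireDepth s i

eval : ∀ {m n} → Circuit m n → Vec Bool n → Bool
eval C x = wireVal (gates C) x (out C)

depth : ∀ {m n} → Circuit m n → ℕ
depth C = wireDepth (gates C) (out C)

IsACC : (k m : ℕ) → ((j : ℕ) → Circuit m j) → Set
IsACC k m C =
  (∃[ c ] ∃[ j₀ ] ∀ j → j₀ ≤ j → size (C j) ≤ c * j ^ c) ×
  (∃[ d ] ∃[ j₀ ] ∀ j → j₀ ≤ j → depth (C j) ≤ d * ⌊log₂ j ⌋ ^ k)

Decides : ∀ {m} → ((j : ℕ) → Circuit m j) → Language → Set
Decides C A = ∀ j (x : Vec Bool j) → (eval (C j) x ≡ true ⇔ A (toList x))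

HasACC : ℕ → Language → Set
HasACC k A = ∃[ m ] (2 ≤ m × Σ ((j : ℕ) → Circuit m j) λ C → IsACC k m C × Decides C A)

unary : ℕ → Str
unary a = replicate a true ++ (false ∷ [])

encGate : ∀ {m w} → Gate m w → Str
encGate (NOT i) = unary 0 ++ unary (toℕ i)
encGate (AND is) = unary 1 ++ unary (length is) ++ concat (map (λ i → unary (toℕ i)) is)
encGate (OR is) = unary 2 ++ unary (length is) ++ concat (map (λ i → unary (toℕ i)) is)
encGate (MOD is) = unary 3 ++ unary (length is) ++ concat (map (λ i → unary (toℕ i)) is)

encSLP : ∀ {m n g} → SLP m n g → Str
encSLP inputs = []
encSLP (s ▷ gt) = encSLP s ++ encGate gt

encode : ∀ {m n} → Circuit m n → Str
encode {m} {n} C = unary m ++ unary n ++ unary (size C) ++ encSLP (gates C) ++ unary (toℕ (out C))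

HasUniformACC : ℕ → Language → Set₁
HasUniformACC k A = ∃[ m ] (2 ≤ m × Σ ((j : ℕ) → Circuit m j) λ C →
  IsACC k m C × Decides C A × FP^NE-unary (λ j → encode (C j)))

{-# OPTIONS --safe #-}
module Submission where

-- Let A ∈ NE be accepted by M, and suppose that all NE languages have ACC^k circuits.  Call a
-- circuit D with j inputs sound if it accepts only members of A.  A certificate (t , d , D),
-- of length at most a fixed polynomial in j, states that D is sound, accepts exactly t
-- inputs and has depth at most d.  An exponential-time nondeterministic machine can check
-- it: it runs through all inputs of D and guesses an accepting path of M for each accepted
-- one.  Hence "p extends to a certificate" is an NE oracle, and greedy search with it finds
-- the lexicographically largest certificate in polynomial time.  Certificates are ordered by
-- t, then by decreasing d.  A nonuniform circuit for A has a certificate in which t is the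
-- number of members of A of length j, so the circuit found also accepts that many members,
-- that is, decides A, and it is no deeper.
--
-- Constructively, the oracle answers are decidable because the oracle, being in NE, has
-- circuits by assumption.

open import Defs
open import Data.Nat
open import Data.Nat.Properties
open import Data.Bool using (Bool; true; false; not; _∧_; _∨_; if_then_else_)
open import Data.Fin using (Fin; zero; suc; toℕ; fromℕ; inject₁; #_; combine; remQuot; splitAt; join)
import Data.Fin.Properties as Fin
open import Data.List using (List; []; _∷_; _++_; length; replicate; map; foldr; foldl; concat; _ʳ++_; reverse; take; drop; tabulate)
import Data.List as List
import Data.List.Properties as List
open import Data.List.Relation.Unary.Any using (here; there)
open import Data.List.Relation.Unary.All using (All; []; _∷_)
import Data.List.Relation.Unary.All as All
import Data.List.Relation.Unary.All.Properties as All
open import Data.List.Membership.Propositional using (_∈_)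
open import Data.List.Membership.Propositional.Properties using (∈-map⁺; ∈-map⁻)
open import Data.Vec using (Vec; []; _∷_; lookup; toList)
import Data.Vec as Vec
open import Data.Nat.DivMod using (_mod_; m%n<n; m%n%n≡m%n; %-distribˡ-+)
open import Data.Nat.Divisibility using (_∣_; _∣?_; m%n≡0⇒n∣m; n∣m⇒m%n≡0)
open import Relation.Nullary.Decidable using (⌊_⌋; map′)
import Data.Maybe as Maybe
import Data.Sum as Sum
open import Data.Maybe using (Maybe; just; nothing; fromMaybe)
open import Data.Product using (Σ; _×_; _,_; ∃; ∃-syntax; proj₁; proj₂)
open import Data.Sum using (_⊎_; inj₁; inj₂)
open import Data.Unit using (⊤; tt)
open import Data.Empty using (⊥; ⊥-elim)
open import Function using (_∘_; id; _⇔_; mk⇔; Equivalence)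
open import Relation.Nullary using (¬_; Dec; yes; no)
open import Relation.Binary.PropositionalEquality using (_≡_; _≢_; refl; sym; trans; cong; cong₂; subst; subst₂; module ≡-Reasoning)

-- Transition systems and machines over finite types

-- A nondeterministic machine can confirm membership but not non-membership, so no certificate can
-- say directly that D misses no member; maximality of the count for a sound circuit takes the place
-- of that claim. Depth has to be optimised as well, since among correct circuits of polynomial size
-- the search could otherwise return a deep one. The oracle sees only a prefix of a certificate. The
-- verifier therefore does not parse: it guesses a certificate along the inductive structure of
-- `Circuit`, compares each symbol with the prefix and keeps the circuit in a form suited to
-- evaluation. Well-formedness then comes for free. `size` counts gates and not the entries of input
-- lists, so a circuit of polynomial size may have an arbitrarily long encoding; multiplicities must
-- be reduced first. Membership in NE asks for a time bound on all paths and for the exact language.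
-- Programs are therefore specified by the exact set of their halting states together with a bound
-- for every path, and are compiled through stack machines to one tape.

record Finite (A : Set) : Set where
  field
    card    : ℕ
    index   : A → Fin card
    unindex : Fin card → A
    unindex-index : ∀ a → unindex (index a) ≡ a
open Finite

-- A one-sided inverse is enough: indices outside the image only add machine states that no run from
-- an encoded configuration visits.
finite-retract : ∀ {A B : Set} (f : A → B) (g : B → A) → (∀ a → g (f a) ≡ a) → Finite B → Finite A
finite-retract f g gf F = record
  { card = card F ; index = index F ∘ f ; unindex = g ∘ unindex F
  ; unindex-index = λ a → trans (cong g (unindex-index F (f a))) (gf a) }

finite-Fin : ∀ n → Finite (Fin n)
finite-Fin n = record { card = n ; index = id ; unindex = id ; unindex-index = λ _ → refl }

finite-⊤ : Finite ⊤
finite-⊤ = record { card = 1 ; index = λ _ → zero ; unindex = λ _ → tt ; unindex-index = λ _ → refl }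

finite-⊎ : ∀ {A B : Set} → Finite A → Finite B → Finite (A ⊎ B)
finite-⊎ {A} {B} FA FB = record
  { card = card FA + card FB
  ; index = λ { (inj₁ a) → join (card FA) (card FB) (inj₁ (index FA a))
              ; (inj₂ b) → join (card FA) (card FB) (inj₂ (index FB b)) }
  ; unindex = λ i → un (splitAt (card FA) i)
  ; unindex-index = λ
      { (inj₁ a) → trans (cong un (Fin.splitAt-join (card FA) (card FB) (inj₁ (index FA a))))
                         (cong inj₁ (unindex-index FA a))
      ; (inj₂ b) → trans (cong un (Fin.splitAt-join (card FA) (card FB) (inj₂ (index FB b))))
                         (cong inj₂ (unindex-index FB b)) } }
  where
  un : Fin (card FA) ⊎ Fin (card FB) → A ⊎ B
  un (inj₁ i) = inj₁ (unindex FA i)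
  un (inj₂ i) = inj₂ (unindex FB i)

finite-× : ∀ {A B : Set} → Finite A → Finite B → Finite (A × B)
finite-× {A} {B} FA FB = record
  { card = card FA * card FB
  ; index = λ { (a , b) → combine (index FA a) (index FB b) }
  ; unindex = λ i → un (remQuot (card FB) i)
  ; unindex-index = λ { (a , b) →
      trans (cong un (Fin.remQuot-combine (index FA a) (index FB b)))
            (cong₂ _,_ (unindex-index FA a) (unindex-index FB b)) } }
  where
  un : Fin (card FA) × Fin (card FB) → A × B
  un (i , j) = unindex FA i , unindex FB j

finite-Maybe : ∀ {A : Set} → Finite A → Finite (Maybe A)
finite-Maybe FA = finite-retract
  (λ { (just a) → inj₁ a ; nothing → inj₂ tt })
  (λ { (inj₁ a) → just a ; (inj₂ _) → nothing })
  (λ { (just _) → refl ; nothing → refl }) (finite-⊎ FA finite-⊤)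

finite-Bool : Finite Bool
finite-Bool = finite-retract
  (λ { true → inj₁ tt ; false → inj₂ tt })
  (λ { (inj₁ _) → true ; (inj₂ _) → false })
  (λ { true → refl ; false → refl }) (finite-⊎ finite-⊤ finite-⊤)

index-injective : ∀ {A} (F : Finite A) {a b} → index F a ≡ index F b → a ≡ b
index-injective F {a} {b} e =
  trans (sym (unindex-index F a)) (trans (cong (unindex F) e) (unindex-index F b))

module Transition {C : Set} (succs : C → List C) (Live : C → Set) where

  -- Every path from c is stuck or reaches Φ within n steps; configurations
  -- passed on the way are Live.
  data Bounded (Φ : C → Set) : ℕ → C → Set where
    now  : ∀ {n c} → Φ c → Bounded Φ n c
    step : ∀ {n c} → Live c → (∀ {c'} → c' ∈ succs c → Bounded Φ n c') → Bounded Φ (suc n) c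

  data _⇒_ : C → C → Set where
    stop : ∀ {c} → c ⇒ c
    go   : ∀ {c c' c''} → c' ∈ succs c → c' ⇒ c'' → c ⇒ c''

  -- A stretch without choices. Having exactly one successor at each step, it carries bounds from
  -- its end back to its start (`path-bounded`), which mere reachability does not. The index is only
  -- an upper bound for its length.
  data Path : ℕ → C → C → Set where
    stop : ∀ {n c} → Path n c c
    go   : ∀ {n c c' c''} → Live c → succs c ≡ c' ∷ [] → Path n c' c'' → Path (suc n) c c''

  ⇒-trans : ∀ {a b c} → a ⇒ b → b ⇒ c → a ⇒ c
  ⇒-trans stop q = q
  ⇒-trans (go e p) q = go e (⇒-trans p q)

  bounded-mono : ∀ {Φ m n c} → m ≤ n → Bounded Φ m c → Bounded Φ n c
  bounded-mono le (now x) = now x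
  bounded-mono (s≤s le) (step l f) = step l (λ e → bounded-mono le (f e))

  bounded-bind : ∀ {Φ Ψ m n c} → Bounded Φ m c → (∀ {c'} → Φ c' → Bounded Ψ n c') → Bounded Ψ (m + n) c
  bounded-bind {m = m} {n} (now x) k = bounded-mono (m≤n+m n m) (k x)
  bounded-bind (step l f) k = step l (λ e → bounded-bind (f e) k)

  bounded-map : ∀ {Φ Ψ n c} → (∀ {c'} → Φ c' → Ψ c') → Bounded Φ n c → Bounded Ψ n c
  bounded-map h (now x) = now (h x)
  bounded-map h (step l f) = step l (λ e → bounded-map h (f e))

  path-trans : ∀ {m n a b c} → Path m a b → Path n b c → Path (m + n) a c
  path-trans {m} {n} stop q = weaken (m≤n+m n m) q
    where
    weaken : ∀ {m n a b} → m ≤ n → Path m a b → Path n a b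
    weaken le stop = stop
    weaken (s≤s le) (go l e p) = go l e (weaken le p)
  path-trans (go l e p) q = go l e (path-trans p q)

  path-weaken : ∀ {m n a b} → m ≤ n → Path m a b → Path n a b
  path-weaken le stop = stop
  path-weaken (s≤s le) (go l e p) = go l e (path-weaken le p)

  path-bounded : ∀ {Φ m n c c'} → Path m c c' → Bounded Φ n c' → Bounded Φ (m + n) c
  path-bounded {m = m} {n} stop b = bounded-mono (m≤n+m n m) b
  path-bounded {Φ} {suc m} {n} {c} (go {c' = d} l e p) b = step l λ i → sub (subst (_ ∈_) e i)
    where
    sub : ∀ {d'} → d' ∈ (d ∷ []) → Bounded Φ (m + n) d'
    sub (here refl) = path-bounded p b

  path-reach : ∀ {m c c'} → Path m c c' → c ⇒ c'
  path-reach stop = stop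
  path-reach (go l e p) = go (subst (_ ∈_) (sym e) (here refl)) (path-reach p)

-- Mirrors the convention of `Sym`, where the codes 0, 1 and 2 are the blank and the two bits, so
-- that input words need no translation; all further symbols come from O.
data Cell (O : Set) : Set where
  blk : Cell O
  bit : Bool → Cell O
  oth : O → Cell O

record CTape (O : Set) : Set where
  constructor ctape
  field
    lft : List (Cell O)
    cur : Cell O
    rgt : List (Cell O)

module _ {O : Set} where
  cmove : Move → CTape O → CTape O
  cmove L (ctape [] h r)      = ctape [] blk (h ∷ r)
  cmove L (ctape (x ∷ l) h r) = ctape l x (h ∷ r)
  cmove R (ctape l h [])      = ctape (h ∷ l) blk []
  cmove R (ctape l h (x ∷ r)) = ctape (h ∷ l) x r
  cmove S t = t

  cwrite : Cell O → CTape O → CTape O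
  cwrite a (ctape l _ r) = ctape l a r

  cinit : List Bool → CTape O
  cinit []      = ctape [] blk []
  cinit (b ∷ x) = ctape [] (bit b) (map bit x)

module Transfer {Z O : Set} (finZ : Finite Z) (finO : Finite O) (z₀ zacc : Z)
                (δ : Z → Cell O → List (Z × Cell O × Move)) where

  private
    g = card finO

  enc : Cell O → Sym g
  enc blk     = zero
  enc (bit b) = bitSym b
  enc (oth o) = suc (suc (suc (index finO o)))

  dec : Sym g → Cell O
  dec zero                = blk
  dec (suc zero)          = bit false
  dec (suc (suc zero))    = bit true
  dec (suc (suc (suc i))) = oth (unindex finO i)

  dec-enc : ∀ c → dec (enc c) ≡ c
  dec-enc blk         = refl
  dec-enc (bit false) = refl
  dec-enc (bit true)  = refl
  dec-enc (oth o)     = cong oth (unindex-index finO o)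

  CConfig : Set
  CConfig = Z × CTape O

  apply : CTape O → Z × Cell O × Move → CConfig
  apply t (z , a , mv) = z , cmove mv (cwrite a t)

  csuccs : CConfig → List CConfig
  csuccs (z , t) = map (apply t) (δ z (CTape.cur t))

  encΔ : Z × Cell O × Move → Fin (card finZ) × Sym g × Move
  encΔ (z , a , mv) = index finZ z , enc a , mv

  machine : NTM
  machine = record
    { nQ = card finZ ; nΓ = g ; start = index finZ z₀ ; accept = index finZ zacc
    ; δ = λ q a → map encΔ (δ (unindex finZ q) (dec a)) }

  encTape : CTape O → Tape g
  encTape (ctape l h r) = tape (map enc l) (enc h) (map enc r)

  encConfig : CConfig → Config (card finZ) g
  encConfig (z , t) = cfg (index finZ z) (encTape t)

  enc-move : ∀ mv a t → encTape (cmove mv (cwrite a t)) ≡ move mv (write (enc a) (encTape t))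
  enc-move L a (ctape [] h r)      = refl
  enc-move L a (ctape (x ∷ l) h r) = refl
  enc-move R a (ctape l h [])      = refl
  enc-move R a (ctape l h (x ∷ r)) = refl
  enc-move S a (ctape l h r)       = refl

  enc-init : ∀ x → encTape (cinit x) ≡ initTape x
  enc-init []      = refl
  enc-init (b ∷ x) = cong (tape [] (bitSym b)) (trans (sym (List.map-∘ x)) refl)

  enc-δ : ∀ z t → NTM.δ machine (index finZ z) (head (encTape t)) ≡ map encΔ (δ z (CTape.cur t))
  enc-δ z (ctape l h r) rewrite unindex-index finZ z | dec-enc h = refl

  nstep-enc : ∀ {c c'} → c' ∈ csuccs c → NStep machine (encConfig c) (encConfig c')
  nstep-enc {z , t} c'∈ with ∈-map⁻ (apply t) c'∈
  ... | (z' , a , mv) , e∈ , refl rewrite enc-move mv a t =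
    nstep (subst (_ ∈_) (sym (enc-δ z t)) (∈-map⁺ encΔ e∈))

  nstep-dec : ∀ {c d} → NStep machine (encConfig c) d → ∃[ c' ] (c' ∈ csuccs c × d ≡ encConfig c')
  nstep-dec {z , t} (nstep m) with ∈-map⁻ encΔ (subst (_ ∈_) (enc-δ z t) m)
  ... | (z' , a , mv) , e∈ , refl =
    apply t (z' , a , mv) , ∈-map⁺ (apply t) e∈ , cong (cfg _) (sym (enc-move mv a t))

  Live : CConfig → Set
  Live (z , _) = z ≢ zacc

  open Transition csuccs Live

  bounded⇒time : ∀ {Φ T c} → Bounded Φ T c → (∀ {c} → Φ c → csuccs c ≡ []) →
                 ∀ {d} → ¬ NRun machine (suc T) (encConfig c) d
  bounded⇒time {T = T} (now φ) stuck (more s r) with nstep-dec s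
  ... | c' , c'∈ , refl with subst (c' ∈_) (stuck φ) c'∈
  ... | ()
  bounded⇒time (step l f) stuck (more s r) with nstep-dec s
  ... | c' , c'∈ , refl = bounded⇒time (f c'∈) stuck r

  -- Acceptance before Φ is excluded because every configuration passed on the way is `Live`, that
  -- is, not accepting. This turns a description of the final configurations into a description of
  -- the accepted language.
  bounded⇒final : ∀ {Φ T c} → Bounded Φ T c → (∀ {c} → Φ c → csuccs c ≡ []) →
                  ∀ {n d} → NRun machine n (encConfig c) d → state d ≡ index finZ zacc → ∃ Φ
  bounded⇒final (now φ) stuck r e = _ , φ
  bounded⇒final (step l f) stuck done e = ⊥-elim (l (index-injective finZ e))
  bounded⇒final (step l f) stuck (more s r) e with nstep-dec s
  ... | c' , c'∈ , refl = bounded⇒final (f c'∈) stuck r e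

  reach⇒nrun : ∀ {c c'} → c ⇒ c' → ∃[ n ] NRun machine n (encConfig c) (encConfig c')
  reach⇒nrun stop = _ , done
  reach⇒nrun (go e p) = _ , more (nstep-enc e) (proj₂ (reach⇒nrun p))

  nInit-enc : ∀ x → nInit machine x ≡ encConfig (z₀ , cinit x)
  nInit-enc x = cong (cfg _) (sym (enc-init x))

-- Machines with finitely many stacks, and their simulation on one tape

module _ {A : Set} where

  Regs : ℕ → Set
  Regs zero    = ⊤
  Regs (suc n) = List A × Regs n

  get : ∀ {n} → Fin n → Regs n → List A
  get zero    (xs , _) = xs
  get (suc r) (_ , ρ)  = get r ρ

  set : ∀ {n} → Fin n → List A → Regs n → Regs n
  set zero    xs (_ , ρ)  = xs , ρ
  set (suc r) xs (ys , ρ) = ys , set r xs ρ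

  get-set : ∀ {n} (r : Fin n) xs ρ → get r (set r xs ρ) ≡ xs
  get-set zero    xs ρ = refl
  get-set (suc r) xs (_ , ρ) = get-set r xs ρ

  get-set-≢ : ∀ {n} {r s : Fin n} → r ≢ s → ∀ xs ρ → get r (set s xs ρ) ≡ get r ρ
  get-set-≢ {r = zero}  {zero}  ne xs ρ = ⊥-elim (ne refl)
  get-set-≢ {r = zero}  {suc s} ne xs ρ = refl
  get-set-≢ {r = suc r} {zero}  ne xs ρ = refl
  get-set-≢ {r = suc r} {suc s} ne xs (_ , ρ) = get-set-≢ (ne ∘ cong suc) xs ρ

  set-get : ∀ {n} (r : Fin n) ρ → set r (get r ρ) ρ ≡ ρ
  set-get zero    ρ = refl
  set-get (suc r) (xs , ρ) = cong (xs ,_) (set-get r ρ)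

  set-set : ∀ {n} (r : Fin n) xs ys ρ → set r xs (set r ys ρ) ≡ set r xs ρ
  set-set zero    xs ys ρ = refl
  set-set (suc r) xs ys (zs , ρ) = cong (zs ,_) (set-set r xs ys ρ)

  set-comm : ∀ {n} {r s : Fin n} → r ≢ s → ∀ xs ys ρ → set r xs (set s ys ρ) ≡ set s ys (set r xs ρ)
  set-comm {r = zero}  {zero}  ne xs ys ρ = ⊥-elim (ne refl)
  set-comm {r = zero}  {suc s} ne xs ys ρ = refl
  set-comm {r = suc r} {zero}  ne xs ys ρ = refl
  set-comm {r = suc r} {suc s} ne xs ys (zs , ρ) = cong (zs ,_) (set-comm (ne ∘ cong suc) xs ys ρ)

  size-regs : ∀ {n} → Regs n → ℕ
  size-regs {zero}  _ = 0
  size-regs {suc n} (xs , ρ) = suc (length xs + size-regs ρ)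

  initRegs : ∀ n → List A → Regs (suc n)
  initRegs zero    u = u , tt
  initRegs (suc n) u = [] , initRegs n u

all-ʳ++ : ∀ {A : Set} {P : A → Set} {xs ys} → All P xs → All P ys → All P (xs ʳ++ ys)
all-ʳ++ []       qs = qs
all-ʳ++ (p ∷ ps) qs = all-ʳ++ ps (p ∷ qs)

-- All nondeterminism sits in `jump`; `jump []` is a dead end and serves both for failed guesses and
-- for the exit state.
data Instr (K : ℕ) (A Y : Set) : Set where
  push : Fin K → A → Y → Instr K A Y
  pop  : Fin K → (Maybe A → Y) → Instr K A Y
  jump : List Y → Instr K A Y

module RegMachine {K : ℕ} {A Y : Set} (instr : Y → Instr K A Y) where
  RConfig : Set
  RConfig = Y × Regs {A} K

  exec : Instr K A Y → Regs {A} K → List RConfig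
  exec (push r a y) ρ = (y , set r (a ∷ get r ρ) ρ) ∷ []
  exec (pop r k) ρ    = (k (List.head (get r ρ)) , set r (drop 1 (get r ρ)) ρ) ∷ []
  exec (jump ys) ρ    = map (_, ρ) ys

  rsuccs : RConfig → List RConfig
  rsuccs (y , ρ) = exec (instr y) ρ

-- The registers are kept on one tape as sep 0, contents of register 0, sep 1, … ,
-- the top of each stack next to its separator; the head rests on sep 0 between
-- instructions.  The input fills the last register, so that the initial layout
-- is obtained by writing separators to the left of it.
module Compile {k : ℕ} {O Y : Set} (finY : Finite Y) (finO : Finite O)
               (instr : Y → Instr (suc k) (Bool ⊎ O) Y) (y₀ yexit : Y) where

  private
    K = suc k
    A = Bool ⊎ O

  open RegMachine {K} {A} {Y} instr

  P : Set
  P = O ⊎ Fin K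

  sym′ : A → Cell P
  sym′ (inj₁ b) = bit b
  sym′ (inj₂ o) = oth (inj₁ o)

  sep : Fin K → Cell P
  sep i = oth (inj₂ i)

  unsym : Cell P → Maybe A
  unsym (bit b)        = just (inj₁ b)
  unsym (oth (inj₁ o)) = just (inj₂ o)
  unsym _              = nothing

  unsym-sym : ∀ a → unsym (sym′ a) ≡ just a
  unsym-sym (inj₁ b) = refl
  unsym-sym (inj₂ o) = refl

  sep-injective : ∀ {i j} → sep i ≡ sep j → i ≡ j
  sep-injective refl = refl

  sym≢sep : ∀ a {i} → sym′ a ≢ sep i
  sym≢sep (inj₁ b) ()
  sym≢sep (inj₂ o) ()

  isSep : Fin K → Cell P → Bool
  isSep r (oth (inj₂ i)) with i Fin.≟ r
  ... | yes _ = true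
  ... | no _  = false
  isSep r _ = false

  isSep-refl : ∀ r → isSep r (sep r) ≡ true
  isSep-refl r with r Fin.≟ r
  ... | yes _ = refl
  ... | no n  = ⊥-elim (n refl)

  isSep-≢ : ∀ r {c} → c ≢ sep r → isSep r c ≡ false
  isSep-≢ r {blk} ne = refl
  isSep-≢ r {bit b} ne = refl
  isSep-≢ r {oth (inj₁ o)} ne = refl
  isSep-≢ r {oth (inj₂ i)} ne with i Fin.≟ r
  ... | yes refl = ⊥-elim (ne refl)
  ... | no _     = refl

  -- One instruction as head movements. `seek` walks right to the separator of the register. For a
  -- push, `ins c` shifts all that follows one cell to the right, carrying the displaced symbol c. A
  -- pop tests for emptiness (`look`), walks to the first blank (`toEnd`) and shifts left
  -- (`back c`). `home` returns to the first separator.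
  data Phase : Set where
    main seek home look toEnd : Phase
    ins back : Cell P → Phase

  data Z : Set where
    ini : Z
    wr  : Fin K → Z
    at  : Phase → Y → Z

  private
    finP = finite-⊎ finO (finite-Fin K)

    finCell : Finite (Cell P)
    finCell = finite-retract
      (λ { blk → inj₁ tt ; (bit b) → inj₂ (inj₁ b) ; (oth o) → inj₂ (inj₂ o) })
      (λ { (inj₁ _) → blk ; (inj₂ (inj₁ b)) → bit b ; (inj₂ (inj₂ o)) → oth o })
      (λ { blk → refl ; (bit b) → refl ; (oth o) → refl })
      (finite-⊎ finite-⊤ (finite-⊎ finite-Bool finP))

    finPhase : Finite Phase
    finPhase = finite-retract
      (λ { main → inj₁ zero ; seek → inj₁ (suc zero) ; home → inj₁ (suc (suc zero))
         ; look → inj₁ (suc (suc (suc zero))) ; toEnd → inj₁ (suc (suc (suc (suc zero))))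
         ; (ins c) → inj₂ (inj₁ c) ; (back c) → inj₂ (inj₂ c) })
      (λ { (inj₁ zero) → main ; (inj₁ (suc zero)) → seek ; (inj₁ (suc (suc zero))) → home
         ; (inj₁ (suc (suc (suc zero)))) → look ; (inj₁ (suc (suc (suc (suc zero))))) → toEnd
         ; (inj₂ (inj₁ c)) → ins c ; (inj₂ (inj₂ c)) → back c })
      (λ { main → refl ; seek → refl ; home → refl ; look → refl ; toEnd → refl
         ; (ins c) → refl ; (back c) → refl })
      (finite-⊎ (finite-Fin 5) (finite-⊎ finCell finCell))

    finZ : Finite Z
    finZ = finite-retract
      (λ { ini → inj₁ tt ; (wr i) → inj₂ (inj₁ i) ; (at p y) → inj₂ (inj₂ (p , y)) })
      (λ { (inj₁ _) → ini ; (inj₂ (inj₁ i)) → wr i ; (inj₂ (inj₂ (p , y))) → at p y })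
      (λ { ini → refl ; (wr i) → refl ; (at p y) → refl })
      (finite-⊎ finite-⊤ (finite-⊎ (finite-Fin K) (finite-× finPhase finY)))

  Action : Set
  Action = Z × Cell P × Move

  isBlk : Cell P → Bool
  isBlk blk = true
  isBlk _   = false

  onMain : Instr K A Y → Y → Cell P → List Action
  onMain (push _ _ _) y c = (at seek y , c , S) ∷ []
  onMain (pop _ _)    y c = (at seek y , c , S) ∷ []
  onMain (jump ys)    y c = map (λ y' → at main y' , c , S) ys

  onFound : Instr K A Y → Y → Phase
  onFound (push _ a _) y = ins (sym′ a)
  onFound _            y = look

  target : Instr K A Y → Fin K
  target (push r _ _) = r
  target (pop r _)    = r
  target (jump _)     = zero

  onPopped : Instr K A Y → Y → Maybe A → Y
  onPopped (push _ _ y') y m = y'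
  onPopped (pop _ κ)     y m = κ m
  onPopped (jump _)      y m = y

  δ : Z → Cell P → List Action
  δ ini c            = (wr (fromℕ k) , c , L) ∷ []
  δ (wr zero) c      = (at main y₀ , sep zero , S) ∷ []
  δ (wr (suc i)) c   = (wr (inject₁ i) , sep (suc i) , L) ∷ []
  δ (at main y) c    = onMain (instr y) y c
  δ (at seek y) c    =
    (if isSep (target (instr y)) c then (at (onFound (instr y) y) y , c , R) else (at seek y , c , R)) ∷ []
  δ (at (ins d) y) c =
    (if isBlk c then (at home (onPopped (instr y) y nothing) , d , L) else (at (ins c) y , d , R)) ∷ []
  δ (at home y) c    = (if isSep zero c then (at main y , c , S) else (at home y , c , L)) ∷ []
  δ (at look y) c    with unsym c
  ... | just _       = (at toEnd y , c , S) ∷ []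
  ... | nothing      = (at home (onPopped (instr y) y nothing) , c , L) ∷ []
  δ (at toEnd y) c   = (if isBlk c then (at (back blk) y , c , L) else (at toEnd y , c , R)) ∷ []
  δ (at (back d) y) c =
    (if isSep (target (instr y)) c then (at home (onPopped (instr y) y (unsym d)) , c , S)
     else (at (back c) y , d , L)) ∷ []

  open Transfer finZ finP ini (at main yexit) δ public
  open Transition csuccs Live public

  onList : List (Cell P) → List (Cell P) → CTape P
  onList l []       = ctape l blk []
  onList l (c ∷ xs) = ctape l c xs

  onList-R : ∀ l c xs → cmove R (ctape l c xs) ≡ onList (c ∷ l) xs
  onList-R l c []       = refl
  onList-R l c (x ∷ xs) = refl

  blanks : ℕ → List (Cell P)
  blanks n = replicate n blk

  path-seek : ∀ y pre {l xs} → All (_≢ sep (target (instr y))) pre →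
              Path (suc (length pre)) (at seek y , onList l (pre ++ sep (target (instr y)) ∷ xs))
                   (at (onFound (instr y) y) y , onList (sep (target (instr y)) ∷ (pre ʳ++ l)) xs)
  path-seek y [] {l} {xs} [] = go (λ ()) eq stop
    where
    r = target (instr y)
    eq : csuccs (at seek y , onList l (sep r ∷ xs)) ≡ (at (onFound (instr y) y) y , onList (sep r ∷ l) xs) ∷ []
    eq rewrite isSep-refl r | onList-R l (sep r) xs = refl
  path-seek y (p ∷ pre) {l} {xs} (ne ∷ nes) = go (λ ()) eq (path-seek y pre nes)
    where
    r = target (instr y)
    eq : csuccs (at seek y , ctape l p (pre ++ sep r ∷ xs)) ≡ (at seek y , onList (p ∷ l) (pre ++ sep r ∷ xs)) ∷ []
    eq rewrite isSep-≢ r ne | onList-R l p (pre ++ sep r ∷ xs) = refl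

  data NonBlank : Cell P → Set where
    bit : ∀ {b} → NonBlank (bit b)
    oth : ∀ {o} → NonBlank (oth o)

  isBlk-non : ∀ {c} → NonBlank c → isBlk c ≡ false
  isBlk-non bit = refl
  isBlk-non oth = refl

  blank-tail : ∀ n → ∃[ n' ] (∀ l → onList l (blanks n) ≡ ctape l blk (blanks n'))
  blank-tail zero    = 0 , λ _ → refl
  blank-tail (suc n) = n , λ _ → refl

  -- The result is phrased through the whole tape word `us ʳ++ (v ∷ vs)`, because the walk home only
  -- needs that word and a bound on its own length. One trailing blank, if there is any, is absorbed
  -- by the shift.
  path-ins : ∀ y c u l xs n → All NonBlank xs → ∃[ n' ] ∃[ us ] ∃[ v ] ∃[ vs ]
             (Path (suc (length xs)) (at (ins c) y , onList (u ∷ l) (xs ++ blanks n))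
                   (at home (onPopped (instr y) y nothing) , ctape us v vs)
              × us ʳ++ (v ∷ vs) ≡ (u ∷ l) ʳ++ (c ∷ xs ++ blanks n') × length us ≤ length xs + length l)
  path-ins y c u l [] n [] with blank-tail n
  ... | n' , e rewrite e (u ∷ l) = n' , l , u , c ∷ blanks n' , go (λ ()) refl stop , refl , ≤-refl
  path-ins y c u l (x ∷ xs) n (nb ∷ nbs) with path-ins y x c (u ∷ l) xs n nbs
  ... | n' , us , v , vs , p , e , le =
    n' , us , v , vs , go (λ ()) eq p , e , ≤-trans le (≤-reflexive (+-suc (length xs) (length l)))
    where
    eq : csuccs (at (ins c) y , onList (u ∷ l) (x ∷ xs ++ blanks n)) ≡
         (at (ins x) y , onList (c ∷ u ∷ l) (xs ++ blanks n)) ∷ []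
    eq rewrite isBlk-non nb | onList-R (u ∷ l) c (xs ++ blanks n) = refl

  ∈-tail-ʳ++ : ∀ us (u v s : Cell P) zs W → v ∈ zs → us ʳ++ (u ∷ zs) ≡ s ∷ W → v ∈ W
  ∈-tail-ʳ++ [] u v s zs .zs i refl = i
  ∈-tail-ʳ++ (w ∷ us) u v s zs W i e = ∈-tail-ʳ++ us w v s (u ∷ zs) W (there i) e

  path-home : ∀ y us v xs W → us ʳ++ (v ∷ xs) ≡ sep zero ∷ W → All (_≢ sep zero) W →
              Path (suc (length us)) (at home y , ctape us v xs) (at main y , ctape [] (sep zero) W)
  path-home y [] v xs W refl nes = go (λ ()) eq stop
    where
    eq : csuccs (at home y , ctape [] (sep zero) W) ≡ (at main y , ctape [] (sep zero) W) ∷ []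
    eq = refl
  path-home y (u ∷ us) v xs W e nes = go (λ ()) eq (path-home y us u (v ∷ xs) W e nes)
    where
    eq : csuccs (at home y , ctape (u ∷ us) v xs) ≡ (at home y , ctape us u (v ∷ xs)) ∷ []
    eq rewrite isSep-≢ zero (All.lookup nes (∈-tail-ʳ++ us u v (sep zero) (v ∷ xs) W (here refl) e)) = refl

  path-toEnd : ∀ y u l xs n → All NonBlank xs → ∃[ n' ] ∃[ us ] ∃[ v ]
             (Path (suc (length xs)) (at toEnd y , onList (u ∷ l) (xs ++ blanks n))
                   (at (back blk) y , ctape us v (blanks n'))
              × v ∷ us ≡ xs ʳ++ (u ∷ l))
  path-toEnd y u l [] n [] with blank-tail n
  ... | n' , e rewrite e (u ∷ l) = suc n' , l , u , go (λ ()) refl stop , refl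
  path-toEnd y u l (x ∷ xs) n (nb ∷ nbs) with path-toEnd y x (u ∷ l) xs n nbs
  ... | n' , us , v , p , e = n' , us , v , go (λ ()) eq p , e
    where
    eq : csuccs (at toEnd y , onList (u ∷ l) (x ∷ xs ++ blanks n)) ≡
         (at toEnd y , onList (x ∷ u ∷ l) (xs ++ blanks n)) ∷ []
    eq rewrite isBlk-non nb | onList-R (u ∷ l) x (xs ++ blanks n) = refl

  -- Each cell receives the symbol of its right neighbour, so on arrival at the separator the symbol
  -- still carried is the former top `a`; it decides where the program continues.
  path-back : ∀ y qs c a l zs v us → All (_≢ sep (target (instr y))) qs → a ≢ sep (target (instr y)) →
              v ∷ us ≡ qs ++ a ∷ sep (target (instr y)) ∷ l →
              Path (suc (suc (length qs))) (at (back c) y , ctape us v zs)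
                   (at home (onPopped (instr y) y (unsym a)) ,
                    ctape l (sep (target (instr y))) ((c ∷ qs) ʳ++ zs))
  path-back y [] c a l zs .a .(sep (target (instr y)) ∷ l) [] na refl = go (λ ()) eq₁ (go (λ ()) eq₂ stop)
    where
    r = target (instr y)
    eq₁ : csuccs (at (back c) y , ctape (sep r ∷ l) a zs) ≡ (at (back a) y , ctape l (sep r) (c ∷ zs)) ∷ []
    eq₁ rewrite isSep-≢ r na = refl
    eq₂ : csuccs (at (back a) y , ctape l (sep r) (c ∷ zs)) ≡
          (at home (onPopped (instr y) y (unsym a)) , ctape l (sep r) (c ∷ zs)) ∷ []
    eq₂ rewrite isSep-refl r = refl
  path-back y (q ∷ qs) c a l zs .q us (nq ∷ nqs) na refl with qs ++ a ∷ sep (target (instr y)) ∷ l in e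
  ... | [] = ⊥-elim (absurd qs e)
    where
    absurd : ∀ qs {a : Cell P} {xs} → qs ++ a ∷ xs ≢ []
    absurd [] ()
    absurd (_ ∷ _) ()
  ... | v' ∷ us' = go (λ ()) eq (path-back y qs q a l (c ∷ zs) v' us' nqs na (sym e))
    where
    eq : csuccs (at (back c) y , ctape (v' ∷ us') q zs) ≡ (at (back q) y , ctape us' v' (c ∷ zs)) ∷ []
    eq rewrite isSep-≢ (target (instr y)) nq = refl

  -- `emb` keeps the global names of the separators while the recursion drops the first register.
  flat : ∀ {n} → (Fin n → Fin K) → Regs {A} n → List (Cell P)
  flat {zero}  emb ρ = []
  flat {suc n} emb (xs , ρ) = sep (emb zero) ∷ map sym′ xs ++ flat (emb ∘ suc) ρ

  length-flat : ∀ {n} (emb : Fin n → Fin K) ρ → length (flat emb ρ) ≡ size-regs ρ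
  length-flat {zero}  emb ρ = refl
  length-flat {suc n} emb (xs , ρ) = cong suc (trans (List.length-++ (map sym′ xs))
    (cong₂ _+_ (List.length-map sym′ xs) (length-flat (emb ∘ suc) ρ)))

  sym-nonblank : ∀ a → NonBlank (sym′ a)
  sym-nonblank (inj₁ b) = bit
  sym-nonblank (inj₂ o) = oth

  all-sym : ∀ {Q : Cell P → Set} → (∀ a → Q (sym′ a)) → ∀ xs → All Q (map sym′ xs)
  all-sym f []       = []
  all-sym f (x ∷ xs) = f x ∷ all-sym f xs

  flat-nonblank : ∀ {n} (emb : Fin n → Fin K) ρ → All NonBlank (flat emb ρ)
  flat-nonblank {zero}  emb ρ = []
  flat-nonblank {suc n} emb (xs , ρ) = oth ∷ All.++⁺ (all-sym sym-nonblank xs) (flat-nonblank (emb ∘ suc) ρ)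

  flat-no-sep : ∀ {n} (emb : Fin n → Fin K) ρ {i} → (∀ j → emb j ≢ i) → All (_≢ sep i) (flat emb ρ)
  flat-no-sep {zero}  emb ρ ne = []
  flat-no-sep {suc n} emb (xs , ρ) ne =
    (λ e → ne zero (sep-injective e)) ∷
    All.++⁺ (all-sym (λ a → sym≢sep a) xs) (flat-no-sep (emb ∘ suc) ρ (λ j → ne (suc j)))

  -- The surroundings `pre` and `post` of register r do not depend on its contents, so one splitting
  -- describes the tape both before and after an instruction. `post-starts` is what a pop from an
  -- empty register meets: a separator or, at the end, a blank.
  record Split {n} (emb : Fin n → Fin K) (ρ : Regs {A} n) (r : Fin n) : Set where
    field
      pre post : List (Cell P)
      flat-set : ∀ xs → flat emb (set r xs ρ) ≡ pre ++ sep (emb r) ∷ map sym′ xs ++ post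
      pre-free : All (_≢ sep (emb r)) pre
      post-free : All (_≢ sep (emb r)) post
      post-nonblank : All NonBlank post
      post-starts : (post ≡ []) ⊎ (∃[ i ] ∃[ ps ] post ≡ sep i ∷ ps)

  split : ∀ {n} (emb : Fin n → Fin K) → (∀ {i j} → emb i ≡ emb j → i ≡ j) → ∀ ρ r → Split emb ρ r
  split {suc n} emb inj (xs , ρ) zero = record
    { pre = [] ; post = flat (emb ∘ suc) ρ ; flat-set = λ _ → refl ; pre-free = []
    ; post-free = flat-no-sep (emb ∘ suc) ρ apart
    ; post-nonblank = flat-nonblank (emb ∘ suc) ρ
    ; post-starts = starts (emb ∘ suc) ρ }
    where
    apart : ∀ j → emb (suc j) ≢ emb zero
    apart j e with inj e
    ... | ()
    starts : ∀ {n} (emb : Fin n → Fin K) (ρ : Regs {A} n) →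
             (flat emb ρ ≡ []) ⊎ (∃[ i ] ∃[ ps ] flat emb ρ ≡ sep i ∷ ps)
    starts {zero}  emb ρ = inj₁ refl
    starts {suc n} emb ρ = inj₂ (_ , _ , refl)
  split {suc n} emb inj (ys , ρ) (suc r) = record
    { pre = sep (emb zero) ∷ map sym′ ys ++ pre ; post = post
    ; flat-set = λ xs → cong (sep (emb zero) ∷_)
        (trans (cong (map sym′ ys ++_) (flat-set xs)) (sym (List.++-assoc (map sym′ ys) pre _)))
    ; pre-free = apart ∷ All.++⁺ (all-sym (λ a → sym≢sep a) ys) pre-free
    ; post-free = post-free ; post-nonblank = post-nonblank ; post-starts = post-starts }
    where
    open Split (split (emb ∘ suc) (Fin.suc-injective ∘ inj) ρ r)
    apart : sep (emb zero) ≢ sep (emb (suc r))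
    apart e with inj (sep-injective e)
    ... | ()

  layout : Regs {A} K → ℕ → List (Cell P)
  layout (xs , ρ) n = map sym′ xs ++ flat suc ρ ++ blanks n

  layout-flat : ∀ ρ n → sep zero ∷ layout ρ n ≡ flat id ρ ++ blanks n
  layout-flat (xs , ρ) n = cong (sep zero ∷_) (sym (List.++-assoc (map sym′ xs) (flat suc ρ) (blanks n)))

  layout-free : ∀ ρ n → All (_≢ sep zero) (layout ρ n)
  layout-free (xs , ρ) n = All.++⁺ (all-sym (λ a → sym≢sep a) xs)
    (All.++⁺ (flat-no-sep suc ρ (λ j ())) (bl n))
    where
    bl : ∀ n → All (_≢ sep zero) (blanks n)
    bl zero = []
    bl (suc n) = (λ ()) ∷ bl n

  -- Tapes that differ only in trailing blanks are different values of `CTape`; n records how many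
  -- there are and is always existentially quantified in the results.
  conf : Y → Regs {A} K → ℕ → CConfig
  conf y ρ n = at main y , ctape [] (sep zero) (layout ρ n)

  conf-list : ∀ ρ n → ctape [] (sep zero) (layout ρ n) ≡ onList [] (flat id ρ ++ blanks n)
  conf-list ρ n = cong (onList []) (layout-flat ρ n)

  private
    -- The primed variants replace the terms that depend on `instr y` by variables with equations,
    -- so that they apply when the instruction is known only up to a propositional equality.
    seek′ : ∀ y {r ph} → target (instr y) ≡ r → onFound (instr y) y ≡ ph → ∀ pre {l xs} → All (_≢ sep r) pre →
            Path (suc (length pre)) (at seek y , onList l (pre ++ sep r ∷ xs))
                 (at ph y , onList (sep r ∷ (pre ʳ++ l)) xs)
    seek′ y refl refl pre = path-seek y pre

    back′ : ∀ y {r y'} → target (instr y) ≡ r → ∀ qs c a → onPopped (instr y) y (unsym a) ≡ y' → ∀ l zs v us →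
            All (_≢ sep r) qs → a ≢ sep r → v ∷ us ≡ qs ++ a ∷ sep r ∷ l →
            Path (suc (suc (length qs))) (at (back c) y , ctape us v zs)
                 (at home y' , ctape l (sep r) ((c ∷ qs) ʳ++ zs))
    back′ y refl qs c a refl = path-back y qs c a

    ins′ : ∀ y {y'} → onPopped (instr y) y nothing ≡ y' → ∀ c u l xs n → All NonBlank xs → ∃[ n' ] ∃[ us ] ∃[ v ] ∃[ vs ]
           (Path (suc (length xs)) (at (ins c) y , onList (u ∷ l) (xs ++ blanks n)) (at home y' , ctape us v vs)
            × us ʳ++ (v ∷ vs) ≡ (u ∷ l) ʳ++ (c ∷ xs ++ blanks n') × length us ≤ length xs + length l)
    ins′ y refl = path-ins y

    look′ : ∀ y {y'} → onPopped (instr y) y nothing ≡ y' → ∀ u l h t → unsym h ≡ nothing →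
            Path 1 (at look y , ctape (u ∷ l) h t) (at home y' , ctape l u (h ∷ t))
    look′ y refl u l h t e = go (λ ()) (eq e) stop
      where
      eq : unsym h ≡ nothing → csuccs (at look y , ctape (u ∷ l) h t) ≡
           (at home (onPopped (instr y) y nothing) , ctape l u (h ∷ t)) ∷ []
      eq e with unsym h | e
      ... | nothing | _ = refl

    look-sym : ∀ y l a t → Path 1 (at look y , ctape l (sym′ a) t) (at toEnd y , ctape l (sym′ a) t)
    look-sym y l a t = go (λ ()) eq stop
      where
      eq : csuccs (at look y , ctape l (sym′ a) t) ≡ (at toEnd y , ctape l (sym′ a) t) ∷ []
      eq rewrite unsym-sym a = refl

    path-from : ∀ {m z t t' c} → t ≡ t' → Path m (z , t') c → Path m (z , t) c
    path-from refl p = p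

    main′ : ∀ y → y ≢ yexit → ∀ {r t} → onMain (instr y) y (CTape.cur t) ≡ (at seek y , CTape.cur t , S) ∷ [] →
            target (instr y) ≡ r → Path 1 (at main y , t) (at seek y , t)
    main′ y ne {t = t} e _ = go (λ { refl → ne refl }) (cong (map (apply t)) e) stop

    list-home : ∀ y us v xs ρ n → us ʳ++ (v ∷ xs) ≡ flat id ρ ++ blanks n →
                Path (suc (length us)) (at home y , ctape us v xs) (conf y ρ n)
    list-home y us v xs ρ n e =
      path-home y us v xs (layout ρ n) (trans e (sym (layout-flat ρ n))) (layout-free ρ n)

    unwind : ∀ (pre : List (Cell P)) zs → (pre ʳ++ []) ʳ++ zs ≡ pre ++ zs
    unwind pre zs = List.ʳ++-ʳ++ pre

    length-unwind : ∀ (pre : List (Cell P)) → length (pre ʳ++ []) ≡ length pre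
    length-unwind pre = trans (List.length-ʳ++ pre) (+-identityʳ _)

  -- Six phases of at most B steps: the worst case is a pop from a nonempty register, which goes
  -- through `main`, `seek`, `look`, `toEnd`, `back` and `home`.
  stepCost : ℕ → ℕ
  stepCost B = B + (B + (B + (B + (B + B))))

  module Step (y : Y) (live : y ≢ yexit) (ρ : Regs {A} K) (n : ℕ) (B : ℕ) (fits : size-regs ρ + 3 ≤ B) where

    private
      module At (r : Fin K) where
        open Split (split id id ρ r) public

        xs = get r ρ
        cells = map sym′ xs ++ post

        flat-ρ : flat id ρ ≡ pre ++ sep r ∷ cells
        flat-ρ = trans (cong (flat id) (sym (set-get r ρ))) (flat-set xs)

        start : onList [] (flat id ρ ++ blanks n) ≡ onList [] (pre ++ sep r ∷ (cells ++ blanks n))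
        start = cong (onList []) (trans (cong (_++ blanks n) flat-ρ) (List.++-assoc pre (sep r ∷ cells) (blanks n)))

        total : length pre + (suc (length cells)) + 3 ≤ B
        total = ≤-trans (≤-reflexive (cong (_+ 3) (trans (sym (List.length-++ pre)) (trans (cong length (sym flat-ρ)) (length-flat id ρ))))) fits

        pre≤ : 3 + length pre ≤ B
        pre≤ = ≤-trans (≤-reflexive (+-comm 3 (length pre))) (≤-trans (+-monoˡ-≤ 3 (m≤m+n (length pre) _)) total)

        cells≤ : 3 + length cells ≤ B
        cells≤ = ≤-trans (≤-reflexive (+-comm 3 (length cells)))
          (≤-trans (+-monoˡ-≤ 3 (≤-trans (n≤1+n _) (m≤n+m (suc (length cells)) (length pre)))) total)

        both≤ : suc (length cells + length pre) ≤ B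
        both≤ = ≤-trans (≤-reflexive (trans (cong suc (+-comm (length cells) (length pre))) (sym (+-suc (length pre) (length cells)))))
          (≤-trans (m≤m+n _ 3) total)

        cells-nonblank : All NonBlank cells
        cells-nonblank = All.++⁺ (all-sym sym-nonblank xs) post-nonblank

        1≤B : 1 ≤ B
        1≤B = ≤-trans (s≤s z≤n) pre≤

    sim-push : ∀ {r a y'} → instr y ≡ push r a y' →
               ∃[ n' ] Path (stepCost B) (conf y ρ n) (conf y' (set r (a ∷ get r ρ) ρ) n')
    sim-push {r} {a} {y'} e =
      let n' , us , v , vs , p-ins , eq , us≤ =
            ins′ y (cong (λ i → onPopped i y nothing) e) (sym′ a) (sep r) (pre ʳ++ []) cells n cells-nonblank
          final : us ʳ++ (v ∷ vs) ≡ flat id (set r (a ∷ xs) ρ) ++ blanks n'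
          final = trans eq (trans (unwind pre _) (trans (sym (List.++-assoc pre (sep r ∷ sym′ a ∷ cells) (blanks n')))
                    (cong (_++ blanks n') (sym (flat-set (a ∷ xs))))))
          us≤B = ≤-trans (s≤s (≤-trans us≤ (+-monoʳ-≤ (length cells) (≤-reflexive (length-unwind pre))))) both≤
      in n' , path-weaken (+-monoʳ-≤ B (+-monoʳ-≤ B (+-monoʳ-≤ B (m≤m+n B (B + B)))))
              (path-trans (path-weaken 1≤B (main′ y live {r = r} (cong (λ i → onMain i y _) e) (cong target e)))
              (path-trans (path-weaken (≤-trans (m≤n+m _ 2) pre≤)
                 (path-from (trans (conf-list ρ n) start)
                   (seek′ y (cong target e) (cong (λ i → onFound i y) e) pre pre-free)))
              (path-trans (path-weaken (≤-trans (m≤n+m _ 2) cells≤) p-ins)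
                 (path-weaken us≤B (list-home y' us v vs _ n' final)))))
      where open At r

    sim-pop : ∀ {r κ} → instr y ≡ pop r κ →
              ∃[ n' ] Path (stepCost B) (conf y ρ n)
                (conf (κ (List.head (get r ρ))) (set r (drop 1 (get r ρ)) ρ) n')
    sim-pop {r} {κ} e = finish xs refl
      where
      open At r
      p-seek : Path (B + B) (conf y ρ n) (at look y , onList (sep r ∷ (pre ʳ++ [])) (cells ++ blanks n))
      p-seek =
        path-trans (path-weaken 1≤B (main′ y live {r = r} (cong (λ i → onMain i y _) e) (cong target e)))
          (path-weaken (≤-trans (m≤n+m _ 2) pre≤)
                 (path-from (trans (conf-list ρ n) start)
                   (seek′ y (cong target e) (cong (λ i → onFound i y) e) pre pre-free)))

      empty-look : ∀ ps → (ps ≡ []) ⊎ (∃[ i ] ∃[ qs ] ps ≡ sep i ∷ qs) →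
                   ∃[ n' ] ∃[ h ] ∃[ t ] ((∀ l → onList l (ps ++ blanks n) ≡ ctape l h t) ×
                     h ∷ t ≡ ps ++ blanks n' × unsym h ≡ nothing)
      empty-look ps (inj₁ refl) with blank-tail n
      ... | n' , f = suc n' , blk , blanks n' , f , refl , refl
      empty-look ps (inj₂ (i , qs , refl)) = n , sep i , qs ++ blanks n , (λ _ → refl) , refl , refl

      finish : ∀ ys → xs ≡ ys →
               ∃[ n' ] Path (stepCost B) (conf y ρ n) (conf (κ (List.head ys)) (set r (drop 1 ys) ρ) n')
      finish [] xs≡ =
        let n' , h , t , f , ht , un = empty-look post post-starts
            final : (pre ʳ++ []) ʳ++ (sep r ∷ h ∷ t) ≡ flat id (set r [] ρ) ++ blanks n'
            final = trans (unwind pre _) (trans (cong (λ z → pre ++ sep r ∷ z) ht)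
              (trans (sym (List.++-assoc pre (sep r ∷ post) (blanks n'))) (cong (_++ blanks n') (sym (flat-set [])))))
        in n' , path-weaken (≤-trans (≤-reflexive (+-assoc B B (B + B))) (+-monoʳ-≤ B (+-monoʳ-≤ B (+-monoʳ-≤ B (m≤m+n B (B + B))))))
              (path-trans p-seek
              (path-trans (path-weaken 1≤B
                 (path-from (trans (cong (λ zs → onList (sep r ∷ (pre ʳ++ [])) ((map sym′ zs ++ post) ++ blanks n)) xs≡) (f _))
                   (look′ y (cong (λ i → onPopped i y nothing) e) (sep r) (pre ʳ++ []) h t un)))
                 (path-weaken (≤-trans (s≤s (≤-reflexive (length-unwind pre))) (≤-trans (m≤n+m _ 2) pre≤))
                   (list-home _ (pre ʳ++ []) (sep r) (h ∷ t) (set r [] ρ) n' final))))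
      finish (a ∷ as) xs≡ =
        let ws = map sym′ as ++ post
            cells≡ : cells ≡ sym′ a ∷ ws
            cells≡ = cong (λ zs → map sym′ zs ++ post) xs≡
            ws-nonblank = All.++⁺ (all-sym sym-nonblank as) post-nonblank
            ws-free = All.++⁺ (all-sym (λ a → sym≢sep a) as) post-free
            n' , us , v , p-end , vus = path-toEnd y (sep r) (pre ʳ++ []) (sym′ a ∷ ws) n (sym-nonblank a ∷ ws-nonblank)
            vus' = trans vus (List.ʳ++-defn ws)
            right : (blk ∷ reverse ws) ʳ++ blanks n' ≡ ws ++ blanks (suc n')
            right = trans (cong (_ʳ++ (blk ∷ blanks n')) (sym (trans (List.ʳ++-defn ws) (List.++-identityʳ (reverse ws)))))
                          (unwind ws _)
            final : (pre ʳ++ []) ʳ++ (sep r ∷ (blk ∷ reverse ws) ʳ++ blanks n') ≡ flat id (set r as ρ) ++ blanks (suc n')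
            final = trans (unwind pre _) (trans (cong (λ z → pre ++ sep r ∷ z) right)
              (trans (sym (List.++-assoc pre (sep r ∷ ws) (blanks (suc n'))))
                     (cong (_++ blanks (suc n')) (sym (flat-set as)))))
            len : length cells ≡ suc (length ws)
            len = cong length cells≡
        in suc n' , path-weaken (≤-reflexive (+-assoc B B (B + (B + (B + B)))))
              (path-trans p-seek
              (path-trans (path-weaken 1≤B
                 (path-from (cong (λ zs → onList (sep r ∷ (pre ʳ++ [])) (zs ++ blanks n)) cells≡)
                   (look-sym y _ a (ws ++ blanks n))))
              (path-trans (path-weaken (≤-trans (≤-reflexive (cong suc (sym len))) (≤-trans (m≤n+m _ 2) cells≤)) p-end)
              (path-trans (path-weaken (≤-trans (≤-trans (s≤s (s≤s (≤-reflexive (List.length-reverse ws)))) (≤-reflexive (cong suc (sym len))))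
                             (≤-trans (m≤n+m _ 2) cells≤))
                 (back′ y (cong target e) (reverse ws) blk (sym′ a)
                   (trans (cong (λ i → onPopped i y (unsym (sym′ a))) e) (cong κ (unsym-sym a)))
                   (pre ʳ++ []) (blanks n') v us (all-ʳ++ ws-free []) (sym≢sep a) vus'))
                 (path-weaken (≤-trans (s≤s (≤-reflexive (length-unwind pre))) (≤-trans (m≤n+m _ 2) pre≤))
                   (list-home _ (pre ʳ++ []) (sep r) _ (set r as ρ) (suc n') final))))))

  RLive : RConfig → Set
  RLive (y , _) = y ≢ yexit

  module RT = Transition rsuccs RLive

  size-set : ∀ {n} (r : Fin n) xs (ρ : Regs {A} n) →
             size-regs (set r xs ρ) + length (get r ρ) ≡ size-regs ρ + length xs
  size-set zero xs (ys , ρ) = cong suc (trans (+-assoc (length xs) (size-regs ρ) (length ys))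
    (trans (+-comm (length xs) _) (cong (_+ length xs) (+-comm (size-regs ρ) (length ys)))))
  size-set (suc r) xs (ys , ρ) = cong suc (trans (+-assoc (length ys) _ _)
    (trans (cong (length ys +_) (size-set r xs ρ)) (sym (+-assoc (length ys) _ _))))

  size-push : ∀ {n} (r : Fin n) a (ρ : Regs {A} n) → size-regs (set r (a ∷ get r ρ) ρ) ≡ suc (size-regs ρ)
  size-push r a ρ = +-cancelʳ-≡ (length (get r ρ)) _ _ (trans (size-set r _ ρ) (+-suc _ _))

  size-pop : ∀ {n} (r : Fin n) (ρ : Regs {A} n) → size-regs (set r (drop 1 (get r ρ)) ρ) ≤ size-regs ρ
  size-pop r ρ = +-cancelʳ-≤ (length (get r ρ)) _ _ (≤-trans (≤-reflexive (size-set r _ ρ))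
    (+-monoʳ-≤ (size-regs ρ) (≤-trans (≤-reflexive (List.length-drop 1 (get r ρ))) (m∸n≤m _ 1))))

  Simulated : (RConfig → Set) → CConfig → Set
  Simulated Φ c = ∃[ y ] ∃[ ρ ] ∃[ n ] (c ≡ conf y ρ n × Φ (y , ρ))

  1≤stepCost : ∀ {s t B} → s + suc t + 3 ≤ B → 1 ≤ stepCost B
  1≤stepCost {s} {t} h = ≤-trans (≤-trans (≤-trans (s≤s z≤n) (m≤n+m 3 (s + suc t))) h) (m≤m+n _ _)

  -- An instruction adds at most one symbol, so register size plus remaining time never grows. Hence
  -- a single B bounds the cost of every step of the run.
  sim-bounded : ∀ {Φ T y ρ} → RT.Bounded Φ T (y , ρ) → ∀ n B → size-regs ρ + T + 3 ≤ B →
                Bounded (Simulated Φ) (T * stepCost B) (conf y ρ n)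
  sim-bounded (RT.now φ) n B fits = now (_ , _ , n , refl , φ)
  sim-bounded {Φ} {suc T} {y} {ρ} (RT.step l f) n B fits = go-on (instr y) refl
    where
    fits₀ : size-regs ρ + 3 ≤ B
    fits₀ = ≤-trans (+-monoˡ-≤ 3 (m≤m+n (size-regs ρ) (suc T))) fits
    open Step y l ρ n B fits₀
    next : ∀ y' ρ' {i} → instr y ≡ i → (y' , ρ') ∈ exec i ρ → RT.Bounded Φ T (y' , ρ')
    next y' ρ' refl m = f m
    go-on : ∀ i → instr y ≡ i → Bounded (Simulated Φ) (stepCost B + T * stepCost B) (conf y ρ n)
    go-on (push r a y') e =
      let n' , p = sim-push e
      in path-bounded p (sim-bounded (next y' (set r (a ∷ get r ρ) ρ) e (here refl)) n' B
           (≤-trans (≤-reflexive (cong (_+ 3) (trans (cong (_+ T) (size-push r a ρ)) (sym (+-suc _ T))))) fits))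
    go-on (pop r κ) e =
      let n' , p = sim-pop e
      in path-bounded p (sim-bounded (next (κ (List.head (get r ρ))) (set r (drop 1 (get r ρ)) ρ) e (here refl)) n' B
           (≤-trans (+-monoˡ-≤ 3 (+-mono-≤ (size-pop r ρ) (n≤1+n T))) fits))
    go-on (jump ys) e = bounded-mono (+-monoˡ-≤ (T * stepCost B) (1≤stepCost {size-regs ρ} {T} fits))
      (step (λ { refl → l refl }) λ {c'} i → sub (subst (λ i → c' ∈ map (apply (ctape [] (sep zero) (layout ρ n))) (onMain i y (sep zero))) e i))
      where
      sub : ∀ {c'} → c' ∈ map (apply (ctape [] (sep zero) (layout ρ n))) (map (λ y' → at main y' , sep zero , S) ys) →
            Bounded (Simulated Φ) (T * stepCost B) c'
      sub i with ∈-map⁻ _ i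
      ... | _ , i₁ , refl with ∈-map⁻ _ i₁
      ... | y' , i₂ , refl = sim-bounded (next y' ρ e (∈-map⁺ (_, ρ) i₂)) n B
           (≤-trans (+-monoˡ-≤ 3 (+-monoʳ-≤ (size-regs ρ) (n≤1+n T))) fits)

  sim-reach : instr yexit ≡ jump [] → ∀ {y ρ y' ρ'} → (y , ρ) RT.⇒ (y' , ρ') → ∀ n → ∃[ n' ] (conf y ρ n ⇒ conf y' ρ' n')
  sim-reach ex RT.stop n = n , stop
  sim-reach ex {y} {ρ} {y'} {ρ'} (RT.go {c' = c'} i p) n = go-on (instr y) refl
    where
    go-on : ∀ j → instr y ≡ j → ∃[ n' ] (conf y ρ n ⇒ conf y' ρ' n')
    go-on (push r a z) e with subst (λ j → c' ∈ exec j ρ) e i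
    ... | here refl =
      let n₁ , q = Step.sim-push y (λ { refl → absurd (trans (sym ex) e) }) ρ n _ ≤-refl e
          n₂ , q' = sim-reach ex p n₁
      in n₂ , ⇒-trans (path-reach q) q'
      where
      absurd : jump [] ≢ push r a z
      absurd ()
    go-on (pop r κ) e with subst (λ j → c' ∈ exec j ρ) e i
    ... | here refl =
      let n₁ , q = Step.sim-pop y (λ { refl → absurd (trans (sym ex) e) }) ρ n _ ≤-refl e
          n₂ , q' = sim-reach ex p n₁
      in n₂ , ⇒-trans (path-reach q) q'
      where
      absurd : jump [] ≢ pop r κ
      absurd ()
    go-on (jump ys) e with ∈-map⁻ (_, ρ) (subst (λ j → c' ∈ exec j ρ) e i)
    ... | z , z∈ , refl =
      let n₂ , q' = sim-reach ex p n
      in n₂ , go (∈-map⁺ (apply (ctape [] (sep zero) (layout ρ n))) (subst (λ j → (at main z , sep zero , S) ∈ onMain j y (sep zero)) (sym e) (∈-map⁺ (λ y' → at main y' , sep zero , S) z∈))) q'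

  start-conf : List Bool → RConfig
  start-conf u = y₀ , initRegs k (map inj₁ u)

  private
    path-wr : ∀ i xs c → Path (suc (toℕ i)) (wr i , ctape [] c xs)
              (at main y₀ , onList [] (take (suc (toℕ i)) (tabulate sep) ++ xs))
    path-wr = <-weakInduction (λ i → ∀ xs c → Path (suc (toℕ i)) (wr i , ctape [] c xs)
                (at main y₀ , onList [] (take (suc (toℕ i)) (tabulate sep) ++ xs)))
      (λ xs c → go (λ ()) refl stop)
      (λ i ih xs c → go (λ ()) refl (subst₂ (λ m l → Path m (wr (inject₁ i) , ctape [] blk (sep (suc i) ∷ xs)) (at main y₀ , onList [] l))
         (cong suc (Fin.toℕ-inject₁ i)) (eq i xs) (ih (sep (suc i) ∷ xs) blk)))
      where
      open import Data.Fin.Induction using (<-weakInduction)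
      eq : ∀ i xs → take (suc (toℕ (inject₁ i))) (tabulate sep) ++ sep (suc i) ∷ xs ≡
                    take (suc (suc (toℕ i))) (tabulate sep) ++ xs
      eq i xs = trans (cong (λ m → take (suc m) (tabulate sep) ++ sep (suc i) ∷ xs) (Fin.toℕ-inject₁ i))
        (trans (sym (List.++-assoc (take (suc (toℕ i)) (tabulate sep)) (sep (suc i) ∷ []) xs))
          (cong (_++ xs) (sym (List.take-suc-tabulate sep (suc i)))))

    flat-init : ∀ n (emb : Fin (suc n) → Fin K) u →
                flat emb (initRegs n (map inj₁ u)) ≡ tabulate (sep ∘ emb) ++ map bit u
    flat-init zero emb u = cong (sep (emb zero) ∷_) (trans (List.++-identityʳ _) (sym (List.map-∘ u)))
    flat-init (suc n) emb u = cong (sep (emb zero) ∷_) (flat-init n (emb ∘ suc) u)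

    size-init : ∀ n (u : List Bool) → size-regs (initRegs n (map (inj₁ {B = O}) u)) ≡ suc n + length u
    size-init zero u = cong suc (trans (+-identityʳ _) (List.length-map inj₁ u))
    size-init (suc n) u = cong suc (size-init n u)

  path-init : ∀ u → ∃[ n ] Path (2 + k) (ini , cinit u) (conf y₀ (initRegs k (map inj₁ u)) n)
  path-init u =
    let n , xs , e , xs≡ = input u
    in n , go (λ ()) (cong (λ t → (wr (fromℕ k) , t) ∷ []) (e))
         (subst₂ (λ m t → Path m (wr (fromℕ k) , ctape [] blk xs) (at main y₀ , t)) (cong suc (Fin.toℕ-fromℕ k))
           (trans (cong (onList []) (final n xs xs≡)) (sym (conf-list _ n)))
           (path-wr (fromℕ k) xs blk))
    where
    input : ∀ u → ∃[ n ] ∃[ xs ] (cmove L (cwrite (CTape.cur (cinit u)) (cinit u)) ≡ ctape [] blk xs × xs ≡ map bit u ++ blanks n)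
    input [] = 1 , blk ∷ [] , refl , refl
    input (b ∷ u) = 0 , map bit (b ∷ u) , refl , sym (List.++-identityʳ _)
    final : ∀ n xs → xs ≡ map bit u ++ blanks n →
            take (suc (toℕ (fromℕ k))) (tabulate sep) ++ xs ≡ flat id (initRegs k (map inj₁ u)) ++ blanks n
    final n xs e = begin
      take (suc (toℕ (fromℕ k))) (tabulate sep) ++ xs
        ≡⟨ cong₂ _++_ (trans (cong (λ m → take (suc m) (tabulate sep)) (Fin.toℕ-fromℕ k))
              (List.take-all (suc k) (tabulate sep) (≤-reflexive (List.length-tabulate sep)))) e ⟩
      tabulate sep ++ map bit u ++ blanks n
        ≡⟨ sym (List.++-assoc (tabulate sep) (map bit u) (blanks n)) ⟩
      (tabulate sep ++ map bit u) ++ blanks n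
        ≡⟨ cong (_++ blanks n) (sym (flat-init k id u)) ⟩
      flat id (initRegs k (map inj₁ u)) ++ blanks n ∎
      where open ≡-Reasoning

  runTime : ℕ → ℕ → ℕ
  runTime u T = (2 + k) + T * stepCost (suc k + u + T + 3)

  -- J is the acceptance condition: by `bounded` every path that reaches the exit yields a proof of
  -- J, and by `reach` every proof of J yields such a path.
  module _ (exit-stuck : instr yexit ≡ jump []) {J : Set} {u : List Bool} {T : ℕ}
           (bounded : RT.Bounded (λ c → proj₁ c ≡ yexit × J) T (start-conf u))
           (reach : J → ∃[ ρ ] (start-conf u RT.⇒ (yexit , ρ))) where

    private
      Φ = Simulated (λ c → proj₁ c ≡ yexit × J)

      stuck : ∀ {c} → Φ c → csuccs c ≡ []
      stuck (y , ρ , n , refl , refl , j) = cong (λ i → map (apply (ctape [] (sep zero) (layout ρ n))) (onMain i y (sep zero))) exit-stuck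

      b : Bounded Φ (runTime (length u) T) (ini , cinit u)
      b = let n , p = path-init u in path-bounded p (sim-bounded bounded n _
            (≤-reflexive (cong (λ s → s + T + 3) (size-init k u))))

    compiled-time : NTimeBounded machine u (runTime (length u) T)
    compiled-time c r = bounded⇒time b stuck (subst (λ d → NRun machine (suc (runTime (length u) T)) d c) (nInit-enc u) r)

    compiled-accepts : J ⇔ NAccepts machine u
    compiled-accepts = mk⇔
      (λ j → let n , p = path-init u
                 ρ , q = reach j
                 n' , q' = sim-reach exit-stuck q n
                 m , r = reach⇒nrun (⇒-trans (path-reach p) q')
             in m , _ , subst (λ d → NRun machine m d (encConfig (conf yexit ρ n'))) (sym (nInit-enc u)) r , refl)
      (λ { (m , c , r , e) → let _ , _ , _ , _ , _ , _ , j = bounded⇒final b stuck (subst (λ d → NRun machine m d c) (nInit-enc u) r) e in j })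

-- Structured programs over stack machines

module Programs (K : ℕ) (A F : Set) where

  infixr 5 _⨾_

  data Prog : Set where
    push   : Fin K → (F → A) → Prog
    pop    : Fin K → (F → Maybe A → F) → Prog
    choose : (F → List F) → Prog
    _⨾_    : Prog → Prog → Prog
    ite    : (F → Bool) → Prog → Prog → Prog
    while  : (F → Bool) → Prog → Prog

  -- Control points. Branches and loops have one extra point, `nothing`, at which the test is made.
  Pos : Prog → Set
  Pos (push _ _)  = ⊤
  Pos (pop _ _)   = ⊤
  Pos (choose _)  = ⊤
  Pos (p ⨾ q)     = Pos p ⊎ Pos q
  Pos (ite _ p q) = Maybe (Pos p ⊎ Pos q)
  Pos (while _ p) = Maybe (Pos p)

  finite-Pos : ∀ p → Finite (Pos p)
  finite-Pos (push _ _)  = finite-⊤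
  finite-Pos (pop _ _)   = finite-⊤
  finite-Pos (choose _)  = finite-⊤
  finite-Pos (p ⨾ q)     = finite-⊎ (finite-Pos p) (finite-Pos q)
  finite-Pos (ite _ p q) = finite-Maybe (finite-⊎ (finite-Pos p) (finite-Pos q))
  finite-Pos (while _ p) = finite-Maybe (finite-Pos p)

  first : ∀ p → Pos p
  first (push _ _)  = tt
  first (pop _ _)   = tt
  first (choose _)  = tt
  first (p ⨾ q)     = inj₁ (first p)
  first (ite _ p q) = nothing
  first (while _ p) = nothing

  code : ∀ p {X : Set} → (Pos p → X) → X → Pos p → F → Instr K A (X × F)
  code (push r a) inj e _ f         = push r (a f) (e , f)
  code (pop r κ) inj e _ f          = pop r (λ m → e , κ f m)
  code (choose c) inj e _ f         = jump (map (e ,_) (c f))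
  code (p ⨾ q) inj e (inj₁ x)       = code p (inj ∘ inj₁) (inj (inj₂ (first q))) x
  code (p ⨾ q) inj e (inj₂ x)       = code q (inj ∘ inj₂) e x
  code (ite b p q) inj e nothing f  =
    jump (((if b f then inj (just (inj₁ (first p))) else inj (just (inj₂ (first q)))) , f) ∷ [])
  code (ite b p q) inj e (just (inj₁ x)) = code p (inj ∘ just ∘ inj₁) e x
  code (ite b p q) inj e (just (inj₂ x)) = code q (inj ∘ just ∘ inj₂) e x
  code (while b p) inj e nothing f  = jump (((if b f then inj (just (first p)) else e) , f) ∷ [])
  code (while b p) inj e (just x)   = code p (inj ∘ just) (inj nothing) x

  State : Set
  State = F × Regs {A} K

  -- A program is verified once for all machines that contain it: X are the control points of the
  -- whole machine, `inj` places p among them, and `exit` is where control goes when p is finished.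
  -- No point inside p is final, by `live-inj`.
  record Context (p : Prog) : Set₁ where
    field
      {X}   : Set
      instr : X × F → Instr K A (X × F)
      live  : X × F → Set
      inj   : Pos p → X
      exit  : X
      instr-inj : ∀ x f → instr (inj x , f) ≡ code p inj exit x f
      live-inj  : ∀ x f → live (inj x , f)

    open RegMachine instr public
    open Transition rsuccs (λ c → live (proj₁ c)) public

    enter : State → RConfig
    enter (f , ρ) = (inj (first p) , f) , ρ

    leave : State → RConfig
    leave (f , ρ) = (exit , f) , ρ

  -- The halting states of p from s are exactly the out i, and all paths halt or get
  -- stuck within T instructions.
  record Exec (p : Prog) (s : State) (T : ℕ) {I : Set} (out : I → State) : Set₁ where
    constructor mk
    field
      bounded : (Γ : Context p) → let open Context Γ in
                Bounded (λ c → ∃[ i ] c ≡ leave (out i)) T (enter s)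
      reaches : (Γ : Context p) → let open Context Γ in ∀ i → enter s ⇒ leave (out i)
  open Exec

  Det : Prog → State → ℕ → State → Set₁
  Det p s T s' = Exec p s T {⊤} (λ _ → s')

  exec-mono : ∀ {p s T T'} {I : Set} {out : I → State} → T ≤ T' → Exec p s T out → Exec p s T' out
  exec-mono le (mk b r) = mk (λ Γ → Context.bounded-mono Γ le (b Γ)) r

  -- Only the set of outcomes matters, not how often an index yields it; so f and g need not be
  -- inverse to each other.
  reindex : ∀ {p s T} {I J : Set} {out : I → State} {out' : J → State} →
            (f : I → J) → (∀ i → out i ≡ out' (f i)) → (g : J → I) → (∀ j → out' j ≡ out (g j)) →
            Exec p s T out → Exec p s T out'
  reindex f fe g ge (mk b r) = mk
    (λ Γ → let open Context Γ in bounded-map (λ { (i , e) → f i , trans e (cong leave (fe i)) }) (b Γ))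
    (λ Γ j → let open Context Γ in subst (λ z → _ ⇒ leave z) (sym (ge j)) (r Γ (g j)))

  private
    jump-bounded : ∀ {p} (Γ : Context p) → let open Context Γ in
                   ∀ {x x' f ρ T} {Φ : RConfig → Set} → live (x , f) → instr (x , f) ≡ jump ((x' , f) ∷ []) →
                   Bounded Φ T ((x' , f) , ρ) → Bounded Φ (suc T) ((x , f) , ρ)
    jump-bounded Γ {x} {x'} {f} {ρ} l e b = step l λ {c'} i → sub (subst (λ j → c' ∈ exec j ρ) e i)
      where
      open Context Γ
      sub : ∀ {c'} → c' ∈ ((x' , f) , ρ) ∷ [] → Bounded _ _ c'
      sub (here refl) = b

    jump-reach : ∀ {p} (Γ : Context p) → let open Context Γ in
                 ∀ {x x' f ρ c} → instr (x , f) ≡ jump ((x' , f) ∷ []) →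
                 ((x' , f) , ρ) ⇒ c → ((x , f) , ρ) ⇒ c
    jump-reach Γ {ρ = ρ} e r = go (subst (λ j → _ ∈ exec j ρ) (sym e) (here refl)) r
      where open Context Γ

  exec-push : ∀ {r a f ρ} → Det (push r a) (f , ρ) 1 (f , set r (a f ∷ get r ρ) ρ)
  exec-push {r} {a} {f} {ρ} = mk
    (λ Γ → let open Context Γ in step (live-inj tt f) λ {c'} i →
       sub Γ (subst (λ j → c' ∈ exec j ρ) (instr-inj tt f) i))
    (λ Γ _ → let open Context Γ in go (subst (λ j → _ ∈ exec j ρ) (sym (instr-inj tt f)) (here refl)) stop)
    where
    sub : ∀ (Γ : Context (push r a)) → let open Context Γ in ∀ {c' n} →
          c' ∈ ((exit , f) , set r (a f ∷ get r ρ) ρ) ∷ [] → Bounded (λ c → ∃[ i ] c ≡ leave (f , set r (a f ∷ get r ρ) ρ)) n c'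
    sub Γ (here refl) = Transition.now (tt , refl)

  exec-pop : ∀ {r κ f ρ} → Det (pop r κ) (f , ρ) 1 (κ f (List.head (get r ρ)) , set r (drop 1 (get r ρ)) ρ)
  exec-pop {r} {κ} {f} {ρ} = mk
    (λ Γ → let open Context Γ in step (live-inj tt f) λ {c'} i →
       sub Γ (subst (λ j → c' ∈ exec j ρ) (instr-inj tt f) i))
    (λ Γ _ → let open Context Γ in go (subst (λ j → _ ∈ exec j ρ) (sym (instr-inj tt f)) (here refl)) stop)
    where
    sub : ∀ (Γ : Context (pop r κ)) → let open Context Γ in ∀ {c' n} →
          c' ∈ ((exit , κ f (List.head (get r ρ))) , set r (drop 1 (get r ρ)) ρ) ∷ [] →
          Bounded (λ c → ∃[ i ] c ≡ leave (κ f (List.head (get r ρ)) , set r (drop 1 (get r ρ)) ρ)) n c'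
    sub Γ (here refl) = Transition.now (tt , refl)

  exec-choose : ∀ {c f ρ} → Exec (choose c) (f , ρ) 1 {∃[ f' ] f' ∈ c f} (λ i → proj₁ i , ρ)
  exec-choose {c} {f} {ρ} = mk
    (λ Γ → let open Context Γ in step (live-inj tt f) λ {c'} i →
       sub Γ (subst (λ j → c' ∈ exec j ρ) (instr-inj tt f) i))
    (λ Γ i → let open Context Γ in
       go (subst (λ j → _ ∈ exec j ρ) (sym (instr-inj tt f)) (∈-map⁺ (_, ρ) (∈-map⁺ (exit ,_) (proj₂ i)))) stop)
    where
    sub : ∀ (Γ : Context (choose c)) → let open Context Γ in ∀ {c' n} →
          c' ∈ map (_, ρ) (map (exit ,_) (c f)) →
          Bounded (λ c' → Σ (∃[ f' ] f' ∈ c f) λ i → c' ≡ leave (proj₁ i , ρ)) n c'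
    sub Γ i with ∈-map⁻ (_, ρ) i
    ... | _ , j , refl with ∈-map⁻ (Context.exit Γ ,_) j
    ... | f' , k , refl = Transition.now ((f' , k) , refl)

  exec-seq : ∀ {p q s T₁ T₂} {I : Set} {J : I → Set} {out₁ : I → State} {out₂ : ∀ i → J i → State} →
             Exec p s T₁ out₁ → (∀ i → Exec q (out₁ i) T₂ (out₂ i)) →
             Exec (p ⨾ q) s (T₁ + T₂) {Σ I J} (λ { (i , j) → out₂ i j })
  exec-seq {p} {q} {s} {T₁} {T₂} {I} {J} {out₁} {out₂} P Q = mk
    (λ Γ → let open Context Γ in
       bounded-bind (bounded P (ΓP Γ)) λ { (i , refl) →
         bounded-map (λ { (j , e) → (i , j) , e }) (bounded (Q i) (ΓQ Γ)) })
    (λ { Γ (i , j) → Context.⇒-trans Γ (reaches P (ΓP Γ) i) (reaches (Q i) (ΓQ Γ) j) })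
    where
    ΓP : Context (p ⨾ q) → Context p
    ΓP Γ = record { instr = instr ; live = live ; inj = inj ∘ inj₁ ; exit = inj (inj₂ (first q))
                  ; instr-inj = λ x → instr-inj (inj₁ x) ; live-inj = λ x → live-inj (inj₁ x) }
      where open Context Γ
    ΓQ : Context (p ⨾ q) → Context q
    ΓQ Γ = record { instr = instr ; live = live ; inj = inj ∘ inj₂ ; exit = exit
                  ; instr-inj = λ x → instr-inj (inj₂ x) ; live-inj = λ x → live-inj (inj₂ x) }
      where open Context Γ

  infixr 4 _then_
  _then_ : ∀ {p q s s' T₁ T₂} {I : Set} {out : I → State} →
           Det p s T₁ s' → Exec q s' T₂ out → Exec (p ⨾ q) s (T₁ + T₂) out
  P then Q = reindex proj₂ (λ _ → refl) (tt ,_) (λ _ → refl) (exec-seq P (λ _ → Q))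

  exec-true : ∀ {b p q f ρ T} {I : Set} {out : I → State} → b f ≡ true →
              Exec p (f , ρ) T out → Exec (ite b p q) (f , ρ) (suc T) out
  exec-true {b} {p} {q} {f} {ρ} e P = mk
    (λ Γ → jump-bounded Γ (Context.live-inj Γ nothing f) (eq Γ) (bounded P (ΓP Γ)))
    (λ Γ i → jump-reach Γ (eq Γ) (reaches P (ΓP Γ) i))
    where
    ΓP : Context (ite b p q) → Context p
    ΓP Γ = record { instr = instr ; live = live ; inj = inj ∘ just ∘ inj₁ ; exit = exit
                  ; instr-inj = λ x → instr-inj (just (inj₁ x)) ; live-inj = λ x → live-inj (just (inj₁ x)) }
      where open Context Γ
    eq : (Γ : Context (ite b p q)) → let open Context Γ in
         instr (inj nothing , f) ≡ jump ((inj (just (inj₁ (first p))) , f) ∷ [])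
    eq Γ = trans (Context.instr-inj Γ nothing f) (cong (λ z → jump (((if z then _ else _) , f) ∷ [])) e)

  exec-false : ∀ {b p q f ρ T} {I : Set} {out : I → State} → b f ≡ false →
               Exec q (f , ρ) T out → Exec (ite b p q) (f , ρ) (suc T) out
  exec-false {b} {p} {q} {f} {ρ} e P = mk
    (λ Γ → jump-bounded Γ (Context.live-inj Γ nothing f) (eq Γ) (bounded P (ΓP Γ)))
    (λ Γ i → jump-reach Γ (eq Γ) (reaches P (ΓP Γ) i))
    where
    ΓP : Context (ite b p q) → Context q
    ΓP Γ = record { instr = instr ; live = live ; inj = inj ∘ just ∘ inj₂ ; exit = exit
                  ; instr-inj = λ x → instr-inj (just (inj₂ x)) ; live-inj = λ x → live-inj (just (inj₂ x)) }
      where open Context Γ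
    eq : (Γ : Context (ite b p q)) → let open Context Γ in
         instr (inj nothing , f) ≡ jump ((inj (just (inj₂ (first q))) , f) ∷ [])
    eq Γ = trans (Context.instr-inj Γ nothing f) (cong (λ z → jump (((if z then _ else _) , f) ∷ [])) e)

  while-stop : ∀ {b p f ρ} → b f ≡ false → Det (while b p) (f , ρ) 1 (f , ρ)
  while-stop {b} {p} {f} {ρ} e = mk
    (λ Γ → jump-bounded Γ (Context.live-inj Γ nothing f) (eq Γ) (Transition.now (tt , refl)))
    (λ Γ i → jump-reach Γ (eq Γ) Transition.stop)
    where
    eq : (Γ : Context (while b p)) → let open Context Γ in instr (inj nothing , f) ≡ jump ((exit , f) ∷ [])
    eq Γ = trans (Context.instr-inj Γ nothing f) (cong (λ z → jump (((if z then _ else _) , f) ∷ [])) e)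

  -- There is no invariant rule: a loop is unrolled pass by pass, and each application supplies its
  -- own induction for the remaining passes.
  while-step : ∀ {b p f ρ T₁ T₂} {I : Set} {J : I → Set} {out₁ : I → State} {out₂ : ∀ i → J i → State} →
               b f ≡ true → Exec p (f , ρ) T₁ out₁ → (∀ i → Exec (while b p) (out₁ i) T₂ (out₂ i)) →
               Exec (while b p) (f , ρ) (suc (T₁ + T₂)) {Σ I J} (λ { (i , j) → out₂ i j })
  while-step {b} {p} {f} {ρ} {T₁} {T₂} {I} {J} {out₁} {out₂} e P W = mk
    (λ Γ → let open Context Γ in
       jump-bounded Γ (live-inj nothing f) (eq Γ)
         (bounded-bind (bounded P (ΓP Γ)) λ { (i , refl) →
            bounded-map (λ { (j , e) → (i , j) , e }) (bounded (W i) Γ) }))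
    (λ { Γ (i , j) → jump-reach Γ (eq Γ) (Context.⇒-trans Γ (reaches P (ΓP Γ) i) (reaches (W i) Γ j)) })
    where
    ΓP : Context (while b p) → Context p
    ΓP Γ = record { instr = instr ; live = live ; inj = inj ∘ just ; exit = inj nothing
                  ; instr-inj = λ x → instr-inj (just x) ; live-inj = λ x → live-inj (just x) }
      where open Context Γ
    eq : (Γ : Context (while b p)) → let open Context Γ in
         instr (inj nothing , f) ≡ jump ((inj (just (first p)) , f) ∷ [])
    eq Γ = trans (Context.instr-inj Γ nothing f) (cong (λ z → jump (((if z then _ else _) , f) ∷ [])) e)

  while-det : ∀ {b p f ρ T₁ T₂ s'} {I : Set} {out : I → State} →
              b f ≡ true → Det p (f , ρ) T₁ s' → Exec (while b p) s' T₂ out →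
              Exec (while b p) (f , ρ) (suc (T₁ + T₂)) out
  while-det e P W = reindex proj₂ (λ _ → refl) (tt ,_) (λ _ → refl) (while-step e P (λ _ → W))

-- An `NTM` has a single accepting state, here the exit with control data f₀. A complete program
-- therefore has to reset its control data before it halts.
module Assemble {k : ℕ} {O F : Set} (finO : Finite O) (finF : Finite F) (f₀ : F)
                (p : Programs.Prog (suc k) (Bool ⊎ O) F) where
  open Programs (suc k) (Bool ⊎ O) F

  private
    Y = Maybe (Pos p) × F

    instr : Y → Instr (suc k) (Bool ⊎ O) Y
    instr (just x , f)  = code p just nothing x f
    instr (nothing , f) = jump []

    yexit : Y
    yexit = nothing , f₀

  open Compile (finite-× (finite-Maybe (finite-Pos p)) finF) finO instr (just (first p) , f₀) yexit public
    using (machine; runTime)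

  private
    open module C = Compile (finite-× (finite-Maybe (finite-Pos p)) finF) finO instr (just (first p) , f₀) yexit
      using (compiled-time; compiled-accepts; start-conf; module RT)

  private
    Γ : Context p
    Γ = record { instr = instr ; live = _≢ yexit ; inj = just ; exit = nothing
               ; instr-inj = λ _ _ → refl ; live-inj = λ _ _ () }

  module _ {u : List Bool} {T : ℕ} {J : Set} {out : J → Regs (suc k)}
           (E : Exec p (f₀ , initRegs k (map inj₁ u)) T (λ j → f₀ , out j)) where
    private
      b : RT.Bounded (λ c → proj₁ c ≡ yexit × J) T (start-conf u)
      b = Context.bounded-map Γ (λ { (j , refl) → refl , j }) (Exec.bounded E Γ)
      r : J → ∃[ ρ ] (start-conf u RT.⇒ (yexit , ρ))
      r j = out j , Exec.reaches E Γ j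

    machine-time : NTimeBounded machine u (runTime (length u) T)
    machine-time = compiled-time refl b r

    machine-accepts : J ⇔ NAccepts machine u
    machine-accepts = compiled-accepts refl b r

-- Control data, registers and elementary programs of the verifier.

data Aux (g : ℕ) : Set where
  tick end : Aux g
  op       : Fin 5 → Aux g
  ms       : Sym g → Aux g

finite-Aux : ∀ g → Finite (Aux g)
finite-Aux g = finite-retract
  (λ { tick → inj₁ zero ; end → inj₁ (suc zero) ; (op o) → inj₂ (inj₁ o) ; (ms s) → inj₂ (inj₂ s) })
  (λ { (inj₁ zero) → tick ; (inj₁ (suc zero)) → end ; (inj₂ (inj₁ o)) → op o ; (inj₂ (inj₂ s)) → ms s })
  (λ { tick → refl ; end → refl ; (op o) → refl ; (ms s) → refl })
  (finite-⊎ (finite-Fin 2) (finite-⊎ (finite-Fin 5) (finite-Fin (3 + g))))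

finite-Move : Finite Move
finite-Move = finite-retract
  (λ { L → zero ; R → suc zero ; S → suc (suc zero) })
  (λ { zero → L ; (suc zero) → R ; (suc (suc zero)) → S })
  (λ { L → refl ; R → refl ; S → refl }) (finite-Fin 3)

-- The cost of n passes of cost C and of the n + 1 tests around them.
loopT : ℕ → ℕ → ℕ
loopT zero    C = 1
loopT (suc n) C = suc (C + loopT n C)

loopT-monoˡ : ∀ {m n} C → m ≤ n → loopT m C ≤ loopT n C
loopT-monoˡ {n = n} C z≤n = 1≤ n
  where
  1≤ : ∀ n → 1 ≤ loopT n C
  1≤ zero    = ≤-refl
  1≤ (suc n) = s≤s z≤n
loopT-monoˡ C (s≤s le) = s≤s (+-monoʳ-≤ C (loopT-monoˡ C le))

forT : ℕ → ℕ → ℕ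
forT n C = 1 + loopT n (C + 1)

forT-mono : ∀ {m n} C → m ≤ n → forT m C ≤ forT n C
forT-mono C le = s≤s (loopT-monoˡ (C + 1) le)

-- State of the operation accumulating the inputs of a gate: the operation, a
-- Boolean for NOT, AND, OR and a residue for MOD.  Operation 4 marks the output wire.
Accum : ℕ → Set
Accum m = Fin 5 × Bool × Fin m

module Kit (M : NTM) (m₁ : ℕ) where
  open NTM M public using (nQ; nΓ) renaming (start to startM; accept to acceptM; δ to δM)

  A : Set
  A = Bool ⊎ Aux nΓ

  -- The finite control: the symbol popped last or about to be pushed, a flag for guessed and
  -- computed loop tests, the accumulator of the gate being evaluated, and the state of M with the
  -- direction of its current move.
  record F : Set where
    constructor mkF
    field
      cur : Maybe A
      go  : Bool
      acc : Accum (suc m₁)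
      st  : Fin nQ
      dir : Move
  open F public

  finite-F : Finite F
  finite-F = finite-retract (λ f → cur f , go f , acc f , st f , dir f)
    (λ { (c , g , a , s , d) → mkF c g a s d }) (λ _ → refl)
    (finite-× (finite-Maybe (finite-⊎ finite-Bool (finite-Aux nΓ)))
      (finite-× finite-Bool (finite-× (finite-× (finite-Fin 5) (finite-× finite-Bool (finite-Fin (suc m₁))))
        (finite-× (finite-Fin nQ) finite-Move))))

  open Programs 17 A F public

  Registers : Set
  Registers = Regs {A} 17

  pattern tck    = inj₂ tick
  pattern endTok = inj₂ end
  pattern opTok o = inj₂ (op o)

  -- rJ: the input length; rTMP: scratch; rB: the remaining output budget; rT: the claimed
  -- count, least significant bit on top; rDEP: the claimed depth; rS, rN, rW: numbers of
  -- gates, inputs and wires during generation; rE, rE′: the unread and the read part of the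
  -- circuit; rX: the current input; rV, rV′: depths and values of the wires; rMX: a maximum
  -- of depths; rL, rR: the tape of M; rP: the rest of the prescribed prefix.
  rJ rTMP rB rT rDEP rS rN rW rE rE′ rX rV rV′ rMX rL rR rP : Fin 17
  rJ = # 0
  rTMP = # 1
  rB = # 2
  rT = # 3
  rDEP = # 4
  rS = # 5
  rN = # 6
  rW = # 7
  rE = # 8
  rE′ = # 9
  rX = # 10
  rV = # 11
  rV′ = # 12
  rMX = # 13
  rL = # 14
  rR = # 15
  rP = # 16

  ticks : ℕ → List A
  ticks n = replicate n tck

  bits : List Bool → List A
  bits = map inj₁

  withCur : Maybe A → F → F
  withCur c f = record f { cur = c }

  clean : F → F
  clean f = record f { cur = nothing ; go = false }

  isTick isJust isTrue isFalse isBit isNone : F → Bool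
  isTick f  = test (cur f)
    where test : Maybe A → Bool
          test (just tck) = true
          test _ = false
  isJust f  = test (cur f)
    where test : Maybe A → Bool
          test (just _) = true
          test _ = false
  isTrue f  = test (cur f)
    where test : Maybe A → Bool
          test (just (inj₁ true)) = true
          test _ = false
  isFalse f  = test (cur f)
    where test : Maybe A → Bool
          test (just (inj₁ false)) = true
          test _ = false
  isBit f  = test (cur f)
    where test : Maybe A → Bool
          test (just (inj₁ _)) = true
          test _ = false
  isNone f = not (isJust f)

  popc : Fin 17 → Prog
  popc r = pop r (λ f c → withCur c f)

  pushc : Fin 17 → Prog
  pushc r = push r (λ f → fromMaybe tck (cur f))

  pusha : Fin 17 → A → Prog
  pusha r a = push r (λ _ → a)

  upd : (F → F) → Prog
  upd g = choose (λ f → g f ∷ [])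

  guard : (F → Bool) → Prog
  guard b = choose (λ f → if b f then f ∷ [] else [])

  skip : Prog
  skip = upd id

  repeat : ℕ → Prog → Prog
  repeat zero    p = skip
  repeat (suc n) p = p ⨾ repeat n p

  forEach : Fin 17 → Prog → Prog
  forEach r p = popc r ⨾ while isJust (p ⨾ popc r)

  exec-upd : ∀ {g f ρ} → Det (upd g) (f , ρ) 1 (g f , ρ)
  exec-upd = reindex (λ _ → tt) (λ { (_ , here refl) → refl }) (λ _ → _ , here refl) (λ _ → refl) exec-choose

  exec-guard : ∀ {b f ρ} → b f ≡ true → Det (guard b) (f , ρ) 1 (f , ρ)
  exec-guard {b} {f} e = reindex (λ _ → tt) (λ { (f' , i) → cong (_, _) (only i) })
    (λ _ → f , subst (λ z → f ∈ (if z then f ∷ [] else [])) (sym e) (here refl)) (λ _ → refl) exec-choose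
    where
    only : ∀ {f'} → f' ∈ (if b f then f ∷ [] else []) → f' ≡ f
    only i rewrite e with i
    ... | here refl = refl

  -- After a failed guard nothing runs, so q, T and `out` are arbitrary; rejection shows as an empty
  -- type of outcomes.
  exec-fail : ∀ {b f ρ q T} {I : Set} {out : I → State} → b f ≡ false → (I → ⊥) → Exec (guard b ⨾ q) (f , ρ) (suc T) out
  exec-fail {b} {f} {ρ} {q} {T} {I} {out} e none = reindex {I = Σ (∃[ f' ] f' ∈ (if b f then f ∷ [] else [])) λ _ → ⊥} {out = λ i → ⊥-elim (proj₂ i)}
    (⊥-elim ∘ proj₂) (⊥-elim ∘ proj₂) (⊥-elim ∘ none) (⊥-elim ∘ none)
    (exec-seq {T₂ = T} {out₂ = λ _ → ⊥-elim} exec-choose (λ i → ⊥-elim (no-out (proj₂ i))))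
    where
    no-out : ∀ {f'} → f' ∈ (if b f then f ∷ [] else []) → ⊥
    no-out i rewrite e with i
    ... | ()

  det-≡ : ∀ {p s s' s'' T} → s' ≡ s'' → Det p s T s' → Det p s T s''
  det-≡ refl d = d

  exec-from : ∀ {p s s' T} {I : Set} {out : I → State} → s ≡ s' → Exec p s' T out → Exec p s T out
  exec-from refl E = E

  pour : Fin 17 → Fin 17 → Prog
  pour a b = forEach a (pushc b)

  private
    pour-loop : ∀ {a b} (a≢b : a ≢ b) → ∀ xs f ρ c → get a ρ ≡ xs →
                Det (while isJust (pushc b ⨾ popc a)) (withCur (List.head (c ∷ [])) f , ρ) (loopT (suc (length xs)) 2)
                    (withCur nothing f , set a [] (set b ((c ∷ xs) ʳ++ get b ρ) ρ))
    pour-loop {a} {b} a≢b [] f ρ c e = while-det refl (exec-push then exec-pop)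
      (subst₂ (λ h t → Det (while isJust (pushc b ⨾ popc a)) (withCur h f , set a t (set b (c ∷ get b ρ) ρ)) 1
                 (withCur nothing f , set a [] (set b (c ∷ get b ρ) ρ)))
         (sym (cong List.head eq)) (sym (cong (drop 1) eq)) (while-stop refl))
      where
      eq : get a (set b (c ∷ get b ρ) ρ) ≡ []
      eq = trans (get-set-≢ a≢b _ ρ) e
    pour-loop {a} {b} a≢b (x ∷ xs) f ρ c e = while-det refl (exec-push then exec-pop)
      (subst₂ (λ h t → Det (while isJust (pushc b ⨾ popc a)) (withCur h f , set a t (set b (c ∷ get b ρ) ρ)) (loopT (suc (length xs)) 2)
                 (withCur nothing f , set a [] (set b ((c ∷ x ∷ xs) ʳ++ get b ρ) ρ)))
         (sym (cong List.head eq)) (sym (cong (drop 1) eq))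
         (det-≡ (cong (withCur nothing f ,_) fin) (pour-loop a≢b xs f ρ' x (get-set a xs _))))
      where
      ρ' = set a xs (set b (c ∷ get b ρ) ρ)
      eq : get a (set b (c ∷ get b ρ) ρ) ≡ x ∷ xs
      eq = trans (get-set-≢ a≢b _ ρ) e
      gb : get b ρ' ≡ c ∷ get b ρ
      gb = trans (get-set-≢ (a≢b ∘ sym) xs _) (get-set b _ ρ)
      fin : set a [] (set b ((x ∷ xs) ʳ++ get b ρ') ρ') ≡ set a [] (set b ((c ∷ x ∷ xs) ʳ++ get b ρ) ρ)
      fin = trans (cong (λ z → set a [] (set b ((x ∷ xs) ʳ++ z) ρ')) gb)
            (trans (cong (set a []) (trans (set-comm (a≢b ∘ sym) _ xs _) (cong (set a xs) (set-set b _ _ ρ))))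
                   (set-set a [] xs _))

  pourT : ℕ → ℕ
  pourT n = forT n 1

  exec-pour : ∀ a b → a ≢ b → ∀ {f ρ N} → length (get a ρ) ≤ N →
              Det (pour a b) (f , ρ) (pourT N) (withCur nothing f , set a [] (set b (get a ρ ʳ++ get b ρ) ρ))
  exec-pour a b a≢b {f} {ρ} le = exec-mono (forT-mono 1 le) (exec-pop then start (get a ρ) refl)
    where
    start : ∀ xs → get a ρ ≡ xs →
            Det (while isJust (pushc b ⨾ popc a)) (withCur (List.head xs) f , set a (drop 1 xs) ρ) (loopT (length xs) 2)
                (withCur nothing f , set a [] (set b (xs ʳ++ get b ρ) ρ))
    start [] e = det-≡ (cong (λ z → withCur nothing f , set a [] z) (sym (set-get b ρ))) (while-stop refl)
    start (x ∷ xs) e = det-≡ (cong (withCur nothing f ,_)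
        (trans (cong (set a [])
            (trans (cong (λ z → set b ((x ∷ xs) ʳ++ z) (set a xs ρ)) (get-set-≢ (a≢b ∘ sym) xs ρ))
                   (set-comm (a≢b ∘ sym) _ xs ρ)))
          (set-set a [] xs _)))
      (pour-loop a≢b xs f (set a xs ρ) x (get-set a xs ρ))

  drain : Fin 17 → Prog
  drain a = forEach a skip

  exec-drain : ∀ a {f ρ N} → length (get a ρ) ≤ N →
               Det (drain a) (f , ρ) (pourT N) (withCur nothing f , set a [] ρ)
  exec-drain a {f} {ρ} le = exec-mono (forT-mono 1 le) (exec-pop then start (get a ρ) (get-set a (drop 1 (get a ρ)) ρ))
    where
    loop : ∀ xs ρ₁ c → get a ρ₁ ≡ xs → Det (while isJust (skip ⨾ popc a)) (withCur (just c) f , ρ₁) (loopT (suc (length xs)) 2)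
            (withCur nothing f , set a [] ρ₁)
    loop [] ρ₁ c e = while-det refl (exec-upd then exec-pop)
      (subst₂ (λ h t → Det (while isJust (skip ⨾ popc a)) (withCur h f , set a t ρ₁) 1 (withCur nothing f , set a [] ρ₁))
        (sym (cong List.head e)) (sym (cong (drop 1) e)) (while-stop refl))
    loop (x ∷ xs) ρ₁ c e = while-det refl (exec-upd then exec-pop)
      (subst₂ (λ h t → Det (while isJust (skip ⨾ popc a)) (withCur h f , set a t ρ₁) (loopT (suc (length xs)) 2) (withCur nothing f , set a [] ρ₁))
        (sym (cong List.head e)) (sym (cong (drop 1) e))
        (det-≡ (cong (withCur nothing f ,_) (set-set a [] xs ρ₁)) (loop xs (set a xs ρ₁) x (get-set a xs ρ₁))))
    start : ∀ xs → get a (set a (drop 1 xs) ρ) ≡ drop 1 xs →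
            Det (while isJust (skip ⨾ popc a)) (withCur (List.head xs) f , set a (drop 1 xs) ρ) (loopT (length xs) 2)
                (withCur nothing f , set a [] ρ)
    start [] e = while-stop refl
    start (x ∷ xs) e = det-≡ (cong (withCur nothing f ,_) (set-set a [] xs ρ)) (loop xs (set a xs ρ) x e)

-- Nondeterministic generation of certificates

-- The output stream of the generator: the remaining budget and the part of the prescribed
-- prefix that has not been matched yet.
Stream : Set
Stream = ℕ × Str

-- The emitted word itself is not stored: each symbol is charged to the budget and compared with the
-- prefix, and once the prefix is used up every symbol is allowed. `nothing` stands for a dead end
-- of the machine.
advance₁ : Bool → Stream → Maybe Stream
advance₁ b     (zero , _)            = nothing
advance₁ b     (suc β , [])          = just (β , [])
advance₁ true  (suc β , true ∷ ps)   = just (β , ps)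
advance₁ false (suc β , false ∷ ps)  = just (β , ps)
advance₁ true  (suc β , false ∷ ps)  = nothing
advance₁ false (suc β , true ∷ ps)   = nothing

advance : Str → Stream → Maybe Stream
advance []      σ = just σ
advance (b ∷ w) σ = advance₁ b σ Maybe.>>= advance w

advance₁-≤ : ∀ b {β ps β' ps'} → advance₁ b (β , ps) ≡ just (β' , ps') → β ≡ suc β'
advance₁-≤ b     {suc β} {[]}         refl = refl
advance₁-≤ true  {suc β} {true ∷ ps}  refl = refl
advance₁-≤ false {suc β} {false ∷ ps} refl = refl

advance-≤ : ∀ w {β ps β' ps'} → advance w (β , ps) ≡ just (β' , ps') → β ≡ length w + β'
advance-≤ [] refl = refl
advance-≤ (b ∷ w) {β} {ps} e with advance₁ b (β , ps) in eq
... | just (β₁ , ps₁) = trans (advance₁-≤ b eq) (cong suc (advance-≤ w e))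

advance-++ : ∀ w w' σ → advance (w ++ w') σ ≡ (advance w σ Maybe.>>= advance w')
advance-++ [] w' σ = refl
advance-++ (b ∷ w) w' σ with advance₁ b σ
... | nothing = refl
... | just σ₁ = advance-++ w w' σ₁

advance-split : ∀ w w' σ {σ'} → advance (w ++ w') σ ≡ just σ' → ∃[ σ₁ ] (advance w σ ≡ just σ₁ × advance w' σ₁ ≡ just σ')
advance-split w w' σ e with advance w σ | trans (sym (advance-++ w w' σ)) e
... | just σ₁ | e' = σ₁ , refl , e'

advance-join : ∀ w w' σ {σ₁ σ'} → advance w σ ≡ just σ₁ → advance w' σ₁ ≡ just σ' → advance (w ++ w') σ ≡ just σ'
advance-join w w' σ e e' = trans (advance-++ w w' σ) (trans (cong (Maybe._>>= advance w') e) e')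

ʳ++-snoc : ∀ {A : Set} (a : A) xs {ys} → (xs ++ a ∷ []) ʳ++ ys ≡ a ∷ (xs ʳ++ ys)
ʳ++-snoc a xs = List.++-ʳ++ xs

replicate-ʳ++ : ∀ {A : Set} (a : A) n {ys} → replicate n a ʳ++ (a ∷ ys) ≡ a ∷ (replicate n a ʳ++ ys)
replicate-ʳ++ a zero    = refl
replicate-ʳ++ a (suc n) = replicate-ʳ++ a n

replicate-ʳ++-++ : ∀ {A : Set} (a : A) n {ys} → replicate n a ʳ++ ys ≡ replicate n a ++ ys
replicate-ʳ++-++ a zero    = refl
replicate-ʳ++-++ a (suc n) = trans (replicate-ʳ++ a n) (cong (a ∷_) (replicate-ʳ++-++ a n))

power : ℕ → Str → Str
power n w = concat (replicate n w)

module Emission (M : NTM) (m₁ : ℕ) where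
  open Kit M m₁ public

  load : Stream → Registers → Registers
  load (β , ps) ρ = set rB (ticks β) (set rP (bits ps) ρ)

  det-index : ∀ {p s T s'} {J : Set} {out : J → State} → J → (∀ j → out j ≡ s') → Det p s T s' → Exec p s T out
  det-index j e = reindex (λ _ → j) (λ _ → sym (e j)) (λ _ → tt) e

  agrees : Bool → F → Bool
  agrees true  f = isTrue f ∨ isNone f
  agrees false f = isFalse f ∨ isNone f

  emitBy : (F → Bool) → Prog
  emitBy g = popc rB ⨾ guard isTick ⨾ popc rP ⨾ guard (λ f → agrees (g f) f) ⨾ upd (withCur nothing)

  emitT : ℕ
  emitT = 5

  exec-emit : ∀ g {f b} → (∀ c → g (withCur c f) ≡ b) → ∀ σ ρ →
              Exec (emitBy g) (f , load σ ρ) emitT {∃[ σ' ] advance₁ b σ ≡ just σ'}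
                   (λ i → withCur nothing f , load (proj₁ i) ρ)
  exec-emit g {f} h (zero , ps) ρ = exec-pop then exec-fail refl λ ()
  exec-emit g {f} {b} h (suc β , []) ρ =
    det-index (_ , refl) (λ { (_ , refl) → refl }) (exec-pop then exec-guard refl then exec-pop then
      exec-guard (agrees-none (g (withCur nothing f))) then exec-upd)
    where
    agrees-none : ∀ b → agrees b (withCur nothing f) ≡ true
    agrees-none true  = refl
    agrees-none false = refl
  exec-emit g {f} {true} h (suc β , true ∷ ps) ρ =
    det-index (_ , refl) (λ { (_ , refl) → refl }) (exec-pop then exec-guard refl then exec-pop then
      exec-guard (cong (λ z → agrees z (withCur (just (inj₁ true)) f)) (h _)) then exec-upd)
  exec-emit g {f} {false} h (suc β , false ∷ ps) ρ =
    det-index (_ , refl) (λ { (_ , refl) → refl }) (exec-pop then exec-guard refl then exec-pop then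
      exec-guard (cong (λ z → agrees z (withCur (just (inj₁ false)) f)) (h _)) then exec-upd)
  exec-emit g {f} {true} h (suc β , false ∷ ps) ρ =
    exec-pop then exec-guard refl then exec-pop then
      exec-fail (cong (λ z → agrees z (withCur (just (inj₁ false)) f)) (h _)) λ ()
  exec-emit g {f} {false} h (suc β , true ∷ ps) ρ =
    exec-pop then exec-guard refl then exec-pop then
      exec-fail (cong (λ z → agrees z (withCur (just (inj₁ true)) f)) (h _)) λ ()

  Outcome : ∀ {C : Set} → (C → Str) → Stream → Set
  Outcome {C} word σ = Σ C λ c → ∃[ σ' ] advance (word c) σ ≡ just σ'

  -- From registers ρ, the program p chooses some c, outputs word c and ends with registers res c.
  record Emits (p : Prog) (ρ : Registers) (N T : ℕ) (C : Set) (word : C → Str) (res : C → Registers) : Set₁ where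
    constructor emits
    field
      runs : ∀ f β ps → β ≤ N → Exec p (clean f , load (β , ps) ρ) T {Outcome word (β , ps)}
                                     (λ { (c , σ' , _) → clean f , load σ' (res c) })
  open Emits public

  -- A word longer than the budget leads to a dead end. The second program may therefore assume that
  -- the first emitted at most N symbols, which bounds the registers filled by guesses.
  emits-seq : ∀ {p q ρ N T₁ T₂ C} {D : C → Set} {w₁ : C → Str} {r₁ : C → Registers}
                {w₂ : ∀ c → D c → Str} {r₂ : ∀ c → D c → Registers} →
              Emits p ρ N T₁ C w₁ r₁ → (∀ c → length (w₁ c) ≤ N → Emits q (r₁ c) N T₂ (D c) (w₂ c) (r₂ c)) →
              Emits (p ⨾ q) ρ N (T₁ + T₂) (Σ C D) (λ { (c , d) → w₁ c ++ w₂ c d }) (λ { (c , d) → r₂ c d })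
  emits-seq {w₁ = w₁} {w₂ = w₂} P Q = emits λ f β ps le → reindex
    (λ { ((c , σ₁ , e) , (d , σ₂ , e')) → (c , d) , σ₂ , advance-join (w₁ c) (w₂ c d) (β , ps) e e' })
    (λ _ → refl)
    (λ { ((c , d) , σ₂ , e) → let σ₁ , e₁ , e₂ = advance-split (w₁ c) (w₂ c d) (β , ps) e in
         (c , σ₁ , e₁) , (d , σ₂ , e₂) })
    (λ _ → refl)
    (exec-seq (runs P f β ps le) λ { (c , (β₁ , ps₁) , e) →
       let β≡ = ≤-reflexive (sym (advance-≤ (w₁ c) e)) in
       runs (Q c (≤-trans (≤-trans (m≤m+n (length (w₁ c)) β₁) β≡) le)) f β₁ ps₁
            (≤-trans (≤-trans (m≤n+m β₁ (length (w₁ c))) β≡) le) })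

  emits-map : ∀ {p ρ N T C D} {w : C → Str} {r : C → Registers} {w' : D → Str} {r' : D → Registers} →
              (f : C → D) → (∀ c → w c ≡ w' (f c)) → (∀ c → r c ≡ r' (f c)) →
              (g : D → C) → (∀ d → w' d ≡ w (g d)) → (∀ d → r' d ≡ r (g d)) →
              Emits p ρ N T C w r → Emits p ρ N T D w' r'
  emits-map f wf rf g wg rg P = emits λ h β ps le → reindex
    (λ { (c , σ' , e) → f c , σ' , subst (λ z → advance z _ ≡ just σ') (wf c) e })
    (λ { (c , σ' , e) → cong (λ z → clean h , load σ' z) (rf c) })
    (λ { (d , σ' , e) → g d , σ' , subst (λ z → advance z _ ≡ just σ') (wg d) e })
    (λ { (d , σ' , e) → cong (λ z → clean h , load σ' z) (rg d) })
    (runs P h β ps le)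

  emits-mono : ∀ {p ρ N T T' C} {w : C → Str} {r : C → Registers} → T ≤ T' → Emits p ρ N T C w r → Emits p ρ N T' C w r
  emits-mono le P = emits λ f β ps β≤ → exec-mono le (runs P f β ps β≤)

  record Silent (p : Prog) (ρ : Registers) (T : ℕ) (ρ' : Registers) : Set₁ where
    constructor silent
    field
      runs-silent : ∀ f σ → Det p (clean f , load σ ρ) T (clean f , load σ ρ')
  open Silent public

  silent-then : ∀ {p q ρ ρ' N T₁ T₂ C} {w : C → Str} {r : C → Registers} →
                Silent p ρ T₁ ρ' → Emits q ρ' N T₂ C w r → Emits (p ⨾ q) ρ N (T₁ + T₂) C w r
  silent-then P Q = emits λ f β ps le → runs-silent P f (β , ps) then runs Q f β ps le

  emits-silent : ∀ {p ρ ρ' N T} → Silent p ρ T ρ' → Emits p ρ N T ⊤ (λ _ → []) (λ _ → ρ')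
  emits-silent P = emits λ f β ps le → det-index (tt , _ , refl) (λ { (tt , _ , refl) → refl }) (runs-silent P f (β , ps))

  then-silent : ∀ {p q ρ N T₁ T₂ C} {w : C → Str} {r : C → Registers} {r' : C → Registers} →
                Emits p ρ N T₁ C w r → (∀ c → length (w c) ≤ N → Silent q (r c) T₂ (r' c)) → Emits (p ⨾ q) ρ N (T₁ + T₂) C w r'
  then-silent {w = w} {r = r} {r' = r'} P Q = emits-map proj₁ (λ c → List.++-identityʳ (w (proj₁ c))) (λ _ → refl)
    (_, tt) (λ d → sym (List.++-identityʳ (w d))) (λ _ → refl) (emits-seq {D = λ _ → ⊤} {w₂ = λ _ _ → []} {r₂ = λ c _ → r' c} P (λ c le → emits-silent (Q c le)))

  emit : Bool → Prog
  emit b = emitBy (λ _ → b)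

  emits-emit : ∀ b {ρ N} → Emits (emit b) ρ N emitT ⊤ (λ _ → b ∷ []) (λ _ → ρ)
  emits-emit b {ρ} = emits λ f β ps le → reindex
    (λ { (σ' , e) → tt , σ' , cong (Maybe._>>= just) e }) (λ _ → refl)
    (λ { (tt , σ' , e) → σ' , unbind (β , ps) e }) (λ _ → refl)
    (exec-emit (λ _ → b) (λ _ → refl) (β , ps) ρ)
    where
    unbind : ∀ σ {σ'} → (advance₁ b σ Maybe.>>= just) ≡ just σ' → advance₁ b σ ≡ just σ'
    unbind σ e with advance₁ b σ
    ... | just _ = e

  Says : Prog → Registers → ℕ → ℕ → Str → Registers → Set₁
  Says p ρ N T w ρ' = Emits p ρ N T ⊤ (λ _ → w) (λ _ → ρ')

  says-then : ∀ {p q ρ ρ' N T₁ T₂ C} {w : C → Str} {r : C → Registers} {v} →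
              Says p ρ N T₁ v ρ' → Emits q ρ' N T₂ C w r → Emits (p ⨾ q) ρ N (T₁ + T₂) C (λ c → v ++ w c) r
  says-then {ρ' = ρ'} {C = C} {w} {r} {v} P Q = emits-map proj₂ (λ _ → refl) (λ _ → refl) (tt ,_) (λ _ → refl) (λ _ → refl) (emits-seq {C = ⊤} {D = λ _ → C} {w₁ = λ _ → v} {r₁ = λ _ → ρ'} {w₂ = λ _ → w} {r₂ = λ _ → r} P (λ _ _ → Q))

  then-says : ∀ {p q ρ N T₁ T₂ C} {w : C → Str} {r r' : C → Registers} {v} →
              Emits p ρ N T₁ C w r → (∀ c → Says q (r c) N T₂ v (r' c)) → Emits (p ⨾ q) ρ N (T₁ + T₂) C (λ c → w c ++ v) r'
  then-says {r' = r'} {v = v} P Q = emits-map proj₁ (λ _ → refl) (λ _ → refl) (_, tt) (λ _ → refl) (λ _ → refl) (emits-seq {D = λ _ → ⊤} {w₂ = λ _ _ → v} {r₂ = λ c _ → r' c} P (λ c _ → Q c))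

  emitWord : Str → Prog
  emitWord []      = skip
  emitWord (b ∷ w) = emit b ⨾ emitWord w

  emitWordT : Str → ℕ
  emitWordT []      = 1
  emitWordT (b ∷ w) = emitT + emitWordT w

  says-word : ∀ w {ρ N} → Says (emitWord w) ρ N (emitWordT w) w ρ
  says-word []      = emits-silent (silent λ f σ → exec-upd)
  says-word (b ∷ w) = says-then (emits-emit b) (says-word w)

  chooseGo : Prog
  chooseGo = choose (λ f → record f { go = true } ∷ record f { go = false } ∷ [])

  exec-chooseGo : ∀ {f ρ} → Exec chooseGo (f , ρ) 1 {Bool} (λ b → record f { go = b } , ρ)
  exec-chooseGo = reindex
    (λ { (_ , here refl) → true ; (_ , there (here refl)) → false })
    (λ { (_ , here refl) → refl ; (_ , there (here refl)) → refl })
    (λ { true → _ , here refl ; false → _ , there (here refl) })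
    (λ { true → refl ; false → refl }) exec-choose

  guessMany : Prog → Prog
  guessMany p = chooseGo ⨾ while go (upd clean ⨾ p ⨾ chooseGo)

  guessManyT : ℕ → ℕ → ℕ
  guessManyT N T = 1 + loopT (suc N) (1 + (T + 1))

  private
    -- Bookkeeping for a guessed flag: `true` commits to one round and leaves the number of later
    -- rounds open, `false` ends the loop.
    Count : Bool → Set
    Count true  = ℕ
    Count false = ⊤

    num : ∀ g → Count g → ℕ
    num true  n = suc n
    num false _ = 0

    unnum : ℕ → Σ Bool Count
    unnum zero    = false , tt
    unnum (suc n) = true , n

    num-unnum : ∀ n → num (proj₁ (unnum n)) (proj₂ (unnum n)) ≡ n
    num-unnum zero    = refl
    num-unnum (suc n) = refl

  -- Guessing whether to go on could loop for ever. Every round must emit at least one symbol, which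
  -- is why the word has the form `b ∷ w`; then the budget ends all paths.
  emits-many : ∀ {p N T w} (b : Bool) (r : ℕ → Registers) → (∀ n → Says p (r n) N T (b ∷ w) (r (suc n))) →
               Emits (guessMany p) (r 0) N (guessManyT N T) ℕ (λ n → power n (b ∷ w)) r
  emits-many {p} {N} {T} {w} b r P = emits λ f β ps le → exec-mono (s≤s (loopT-monoˡ _ (s≤s le))) (reindex
    (λ { (g , (n , σ' , e)) → num g n , σ' , e })
    (λ { (g , (n , σ' , e)) → cong (λ k → clean f , load σ' (r k)) (+-identityʳ (num g n)) })
    (λ { (n , σ' , e) → proj₁ (unnum n) , (proj₂ (unnum n) , σ' ,
         subst (λ k → advance (power k (b ∷ w)) (β , ps) ≡ just σ') (sym (num-unnum n)) e) })
    (λ { (n , σ' , e) → cong (λ k → clean f , load σ' (r k)) (trans (sym (num-unnum n)) (sym (+-identityʳ _))) })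
    (exec-seq exec-chooseGo (λ g → loop f β β ps ≤-refl le 0 g)))
    where
    body = upd clean ⨾ p ⨾ chooseGo
    shift : ∀ k n → num true n + k ≡ num (proj₁ (unnum n)) (proj₂ (unnum n)) + suc k
    shift k n = trans (sym (+-suc n k)) (cong (_+ suc k) (sym (num-unnum n)))
    loop : ∀ f n β ps → β ≤ n → β ≤ N → ∀ k g →
           Exec (while go body) (record (clean f) { go = g } , load (β , ps) (r k)) (loopT (suc n) (1 + (T + 1)))
                {Σ (Count g) λ n → ∃[ σ' ] advance (power (num g n) (b ∷ w)) (β , ps) ≡ just σ'}
                (λ { (n , σ' , _) → clean f , load σ' (r (num g n + k)) })
    loop f n β ps le₀ le k false = exec-mono (loopT-monoˡ {0} {suc n} _ z≤n)
      (det-index (tt , _ , refl) (λ { (tt , _ , refl) → refl }) (while-stop refl))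
    loop f n β ps le₀ le k true = reindex
      (λ { (((tt , σ₁ , e₁) , g) , (n , σ₂ , e₂)) → num g n , σ₂ ,
           advance-join (b ∷ w) (power (num g n) (b ∷ w)) (β , ps) e₁ e₂ })
      (λ { (((tt , σ₁ , e₁) , g) , (n , σ₂ , e₂)) → cong (λ k → clean f , load σ₂ (r k)) (+-suc (num g n) k) })
      (λ { (i , σ₂ , e) → let σ₁ , e₁ , e₂ = advance-split (b ∷ w) (power i (b ∷ w)) (β , ps) e in
           ((tt , σ₁ , e₁) , proj₁ (unnum i)) , (proj₂ (unnum i) , σ₂ ,
             subst (λ k → advance (power k (b ∷ w)) σ₁ ≡ just σ₂) (sym (num-unnum i)) e₂) })
      (λ { (i , σ₂ , e) → cong (λ k → clean f , load σ₂ (r k)) (shift k i) })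
      (while-step refl (exec-upd then exec-seq (runs (P k) f β ps le) (λ _ → exec-chooseGo))
        (λ { ((tt , (β₁ , ps₁) , e) , g) → next n le₀ β₁ ps₁ (below β₁ ps₁ e) g }))
      where
      below : ∀ β₁ ps₁ → advance (b ∷ w) (β , ps) ≡ just (β₁ , ps₁) → suc β₁ ≤ β
      below β₁ ps₁ e = ≤-trans (s≤s (m≤n+m β₁ (length w))) (≤-reflexive (sym (advance-≤ (b ∷ w) e)))
      next : ∀ n → β ≤ n → ∀ β₁ ps₁ → suc β₁ ≤ β → ∀ g →
             Exec (while go body) (record (clean f) { go = g } , load (β₁ , ps₁) (r (suc k))) (loopT n (1 + (T + 1)))
                {Σ (Count g) λ n → ∃[ σ' ] advance (power (num g n) (b ∷ w)) (β₁ , ps₁) ≡ just σ'}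
                (λ { (n , σ' , _) → clean f , load σ' (r (num g n + suc k)) })
      next zero le₀ β₁ ps₁ lt g = ⊥-elim (n≮0 (≤-trans lt le₀))
      next (suc n) le₀ β₁ ps₁ lt g =
        loop f n β₁ ps₁ (≤-pred (≤-trans lt le₀)) (≤-trans (≤-trans (n≤1+n β₁) lt) le) (suc k) g

pairs : Str → Str
pairs = List.concatMap (λ b → true ∷ b ∷ [])

opCode : ∀ {m w} → Gate m w → Fin 5
opCode (NOT _) = zero
opCode (AND _) = suc zero
opCode (OR _)  = suc (suc zero)
opCode (MOD _) = suc (suc (suc zero))

module Generator (M : NTM) (m₁ : ℕ) where
  open Emission M m₁ public

  m : ℕ
  m = suc m₁

  choice : Prog → Prog → Prog
  choice p q = chooseGo ⨾ ite go (upd clean ⨾ p) (upd clean ⨾ q)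

  emits-choice : ∀ {p q ρ N T₁ T₂ C D} {w₁ : C → Str} {r₁ : C → Registers} {w₂ : D → Str} {r₂ : D → Registers} →
                 Emits p ρ N T₁ C w₁ r₁ → Emits q ρ N T₂ D w₂ r₂ →
                 Emits (choice p q) ρ N (3 + (T₁ + T₂)) (C ⊎ D) Sum.[ w₁ , w₂ ] Sum.[ r₁ , r₂ ]
  emits-choice {p} {q} {ρ} {N} {T₁} {T₂} {C} {D} {w₁} {r₁} {w₂} {r₂} P Q = emits λ f β ps le → reindex
    (λ { (true , c , σ' , e) → inj₁ c , σ' , e ; (false , d , σ' , e) → inj₂ d , σ' , e })
    (λ { (true , _) → refl ; (false , _) → refl })
    (λ { (inj₁ c , σ' , e) → true , c , σ' , e ; (inj₂ d , σ' , e) → false , d , σ' , e })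
    (λ { (inj₁ _ , _) → refl ; (inj₂ _ , _) → refl })
    (exec-seq {J = J β ps} {out₂ = res β ps f} exec-chooseGo
      (λ { true  → exec-true refl (exec-mono (s≤s (m≤m+n T₁ T₂)) (exec-upd then runs P f β ps le))
         ; false → exec-false refl (exec-mono (s≤s (m≤n+m T₂ T₁)) (exec-upd then runs Q f β ps le)) }))
    where
    J : ℕ → Str → Bool → Set
    J β ps true  = Outcome w₁ (β , ps)
    J β ps false = Outcome w₂ (β , ps)
    res : ∀ β ps (f : F) b → J β ps b → State
    res β ps f true  (c , σ' , _) = clean f , load σ' (r₁ c)
    res β ps f false (c , σ' , _) = clean f , load σ' (r₂ c)

  -- A loop over the ticks of register r; S n is the type of loop states with n rounds left.
  module Each (r : Fin 17) (p : Prog) {S : ℕ → Set} (R : ∀ {n} → S n → Registers)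
              {C : ∀ {n} → S (suc n) → Set} (word : ∀ {n} (s : S (suc n)) → C s → Str)
              (next : ∀ {n} (s : S (suc n)) → C s → S n) where

    Chain : ∀ n → S n → Set
    Chain zero    s = ⊤
    Chain (suc n) s = Σ (C s) λ c → Chain n (next s c)

    words : ∀ n (s : S n) → Chain n s → Str
    words zero    s _       = []
    words (suc n) s (c , k) = word s c ++ words n (next s c) k

    final : ∀ n (s : S n) → Chain n s → S 0
    final zero    s _       = s
    final (suc n) s (c , k) = final n (next s c) k

    -- Both conditions hold by computation for a concrete register other than `rB` and `rP`, the two
    -- that `load` overwrites.
    module _ (get-load : ∀ σ xs ρ → get r (load σ (set r xs ρ)) ≡ xs)
             (set-load : ∀ σ xs ys ρ → set r xs (load σ (set r ys ρ)) ≡ load σ (set r xs ρ))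
             {N T n₀ : ℕ}
             (body : ∀ {n} → suc n ≤ n₀ → (s : S (suc n)) →
                     Emits p (set r (ticks n) (R s)) N T (C s) (word s) (λ c → set r (ticks n) (R (next s c)))) where

      private
        loop : ∀ n → n ≤ n₀ → (s : S n) → ∀ f β ps → β ≤ N →
               Exec (while isJust ((upd clean ⨾ p) ⨾ popc r))
                 (withCur (List.head (ticks n)) (clean f) , load (β , ps) (set r (drop 1 (ticks n)) (R s)))
                 (loopT n (suc T + 1)) {Outcome (words n s) (β , ps)}
                 (λ { (k , σ' , _) → clean f , load σ' (set r [] (R (final n s k))) })
        loop zero    le s f β ps β≤ = det-index (tt , _ , refl) (λ { (tt , _ , refl) → refl }) (while-stop refl)
        loop (suc n) le s f β ps β≤ = reindex
          (λ { (((c , σ₁ , e₁) , tt) , (k , σ₂ , e₂)) → (c , k) , σ₂ , advance-join (word s c) (words n (next s c) k) (β , ps) e₁ e₂ })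
          (λ _ → refl)
          (λ { ((c , k) , σ₂ , e) → let σ₁ , e₁ , e₂ = advance-split (word s c) (words n (next s c) k) (β , ps) e in
               ((c , σ₁ , e₁) , tt) , (k , σ₂ , e₂) })
          (λ _ → refl)
          (while-step {J = J} {out₂ = res} refl
            (exec-seq (exec-upd then runs (body le s) f β ps β≤) (λ { (c , σ₁ , e) →
              det-≡ (cong₂ (λ h ρ → withCur h (clean f) , ρ)
                  (cong List.head (get-load σ₁ (ticks n) (R (next s c))))
                  (trans (cong (λ z → set r (drop 1 z) (load σ₁ (set r (ticks n) (R (next s c))))) (get-load σ₁ (ticks n) (R (next s c))))
                         (set-load σ₁ (drop 1 (ticks n)) (ticks n) (R (next s c)))))
                exec-pop }))
            (λ { ((c , (β₁ , ps₁) , e) , tt) → loop n (≤-trans (n≤1+n n) le) (next s c) f β₁ ps₁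
                   (≤-trans (≤-trans (m≤n+m β₁ (length (word s c))) (≤-reflexive (sym (advance-≤ (word s c) e)))) β≤) }))
          where
          J : Outcome (word s) (β , ps) × ⊤ → Set
          J ((c , σ₁ , _) , _) = Outcome (words n (next s c)) σ₁
          res : ∀ i → J i → State
          res ((c , _) , _) (k , σ' , _) = clean f , load σ' (set r [] (R (final n (next s c) k)))

      emits-each : (s : S n₀) → Emits (forEach r (upd clean ⨾ p)) (set r (ticks n₀) (R s)) N (forT n₀ (suc T))
                     (Chain n₀ s) (words n₀ s) (λ k → set r [] (R (final n₀ s k)))
      emits-each s = emits λ f β ps le →
        det-≡ (cong₂ (λ h ρ → withCur h (clean f) , ρ)
                 (cong List.head (get-load (β , ps) (ticks n₀) (R s)))
                 (trans (cong (λ z → set r (drop 1 z) (load (β , ps) (set r (ticks n₀) (R s)))) (get-load (β , ps) (ticks n₀) (R s)))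
                        (set-load (β , ps) (drop 1 (ticks n₀)) (ticks n₀) (R s))))
          exec-pop
        then loop n₀ ≤-refl s f β ps le

  loopOver : Fin 17 → Prog → Prog
  loopOver r p = forEach r (upd clean ⨾ p)

  module _ (r : Fin 17) (p : Prog) (R : ℕ → Registers) (w : Str)
           (get-load : ∀ σ xs ρ → get r (load σ (set r xs ρ)) ≡ xs)
           (set-load : ∀ σ xs ys ρ → set r xs (load σ (set r ys ρ)) ≡ load σ (set r xs ρ)) where
    private
      module E = Each r p {S = λ _ → ℕ} R {C = λ _ → ⊤} (λ _ _ → w) (λ k _ → suc k)

      chain : ∀ n k → E.Chain n k
      chain zero    k = tt
      chain (suc n) k = tt , chain n (suc k)

      words-chain : ∀ n k c → E.words n k c ≡ power n w
      words-chain zero    k c = refl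
      words-chain (suc n) k (tt , c) = cong (w ++_) (words-chain n (suc k) c)

      final-chain : ∀ n k c → E.final n k c ≡ n + k
      final-chain zero    k c = refl
      final-chain (suc n) k (tt , c) = trans (final-chain n (suc k) c) (+-suc n k)

    says-each : ∀ n {N T} → (∀ i k → Says p (set r (ticks i) (R k)) N T w (set r (ticks i) (R (suc k)))) →
                Says (loopOver r p) (set r (ticks n) (R 0)) N (forT n (suc T)) (power n w) (set r [] (R n))
    says-each n B = emits-map (λ _ → tt) (words-chain n 0)
      (λ c → cong (λ k → set r [] (R k)) (trans (final-chain n 0 c) (+-identityʳ n)))
      (λ _ → chain n 0) (λ _ → sym (words-chain n 0 (chain n 0)))
      (λ _ → cong (λ k → set r [] (R k)) (sym (trans (final-chain n 0 (chain n 0)) (+-identityʳ n))))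
      (E.emits-each get-load set-load {n₀ = n} (λ {n} _ k → B n k) 0)

  power-true : ∀ n → power n (true ∷ []) ≡ replicate n true
  power-true zero    = refl
  power-true (suc n) = cong (true ∷_) (power-true n)

  length-ticks : ∀ n → length (ticks n) ≡ n
  length-ticks n = List.length-replicate n

  ticks-ʳ++ : ∀ n k → ticks n ʳ++ ticks k ≡ ticks (n + k)
  ticks-ʳ++ zero k = refl
  ticks-ʳ++ (suc n) k = trans (ticks-ʳ++ n (suc k)) (cong ticks (+-suc n k))

  ticks-ʳ++[] : ∀ n → ticks n ʳ++ [] ≡ ticks n
  ticks-ʳ++[] n = trans (ticks-ʳ++ n 0) (cong ticks (+-identityʳ n))

  -- A loop over `rJ` consumes the input length while its body counts the rounds in `rTMP`; pouring
  -- back makes j available to later loops.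
  restoreJ : Prog
  restoreJ = pour rTMP rJ

  silent-restoreJ : ∀ {j N ρ} → j ≤ N →
    Silent restoreJ (set rJ [] (set rTMP (ticks j) ρ)) (pourT N) (set rJ (ticks j) (set rTMP [] ρ))
  silent-restoreJ {j} {N} {ρ} le = silent λ f σ →
    det-≡ (cong (λ z → clean f , load σ (set rJ z (set rTMP [] ρ))) (ticks-ʳ++[] j))
      (exec-pour rTMP rJ (λ ()) {ρ = load σ (set rJ [] (set rTMP (ticks j) ρ))} (≤-trans (≤-reflexive (length-ticks j)) le))

  silent-push : ∀ {r a ρ ρ'} → (∀ f σ → (clean f , set r (a ∷ get r (load σ ρ)) (load σ ρ)) ≡ (clean f , load σ ρ')) →
                Silent (pusha r a) ρ 1 ρ'
  silent-push e = silent λ f σ → det-≡ (e f σ) exec-push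

  sayJ : Prog
  sayJ = loopOver rJ (emit true ⨾ pusha rTMP tck) ⨾ restoreJ ⨾ emit false

  sayJT : ℕ → ℕ
  sayJT j = forT j 7 + (pourT j + emitT)

  says-J : ∀ {j N ρ} → get rJ ρ ≡ ticks j → get rTMP ρ ≡ [] → Says sayJ ρ N (sayJT j) (unary j) ρ
  says-J {j} {N} {xs , ys , ρ} refl refl =
    emits-map id (λ _ → cong (_++ (false ∷ [])) (power-true j)) (λ _ → refl) id (λ _ → cong (_++ (false ∷ [])) (sym (power-true j))) (λ _ → refl)
     (says-then
      (says-each rJ (emit true ⨾ pusha rTMP tck) (λ k → set rTMP (ticks k) (ticks j , [] , ρ)) (true ∷ []) (λ _ _ _ → refl) (λ _ _ _ _ → refl) j
        (λ i k → then-silent (emits-emit true) (λ _ _ → silent-push (λ _ _ → refl))))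
      (silent-then (silent-restoreJ {ρ = ticks j , [] , ρ} ≤-refl) (emits-emit false)))

  idxTok : ∀ {w} → Fin w → List A
  idxTok i = bits (unary (toℕ i))

  -- Every emitted 1 moves a tick from `rW`, the number of wires, to `rTMP`. Overshooting goes
  -- unnoticed at first, since popping an empty `rW` makes `pushc` push a spurious tick; the guard
  -- after the loop demands that a tick be left, so exactly the indices below w survive.
  idxGuess : Prog
  idxGuess = guessMany (emit true ⨾ pusha rE′ (inj₁ true) ⨾ popc rW ⨾ pushc rTMP ⨾ upd clean) ⨾
             popc rW ⨾ guard isTick ⨾ pusha rW tck ⨾ pour rTMP rW ⨾ pusha rE′ (inj₁ false) ⨾ emit false

  idxGuessT : ℕ → ℕ → ℕ
  idxGuessT N B = guessManyT N 9 + (3 + (pourT B + (1 + emitT)))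

  ticks-head : ∀ n → fromMaybe tck (List.head (ticks n)) ≡ tck
  ticks-head zero    = refl
  ticks-head (suc n) = refl

  ticks-drop : ∀ w n → drop 1 (ticks (w ∸ n)) ≡ ticks (w ∸ suc n)
  ticks-drop zero    zero    = refl
  ticks-drop zero    (suc n) = refl
  ticks-drop (suc w) zero    = refl
  ticks-drop (suc w) (suc n) = ticks-drop w n

  idxRegs : ℕ → List A → Registers → Registers
  idxRegs w e ρ = set rW (ticks w) (set rTMP [] (set rE′ e ρ))

  emits-idx : ∀ w e ρ {N B} → w ≤ B →
              Emits idxGuess (idxRegs w e ρ) N (idxGuessT N B) (Fin w) (λ i → unary (toℕ i)) (λ i → idxRegs w (idxTok i ʳ++ e) ρ)
  emits-idx w e ρ {N} {B} w≤B =
    emits-map {C = Σ ℕ (_< w)} (λ { (n , lt) → Data.Fin.fromℕ< lt })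
      (λ { (n , lt) → trans (cong (_++ (false ∷ [])) (power-true n)) (cong unary (sym (Fin.toℕ-fromℕ< lt))) })
      (λ { (n , lt) → cong (λ k → idxRegs w (bits (unary k) ʳ++ e) ρ) (sym (Fin.toℕ-fromℕ< lt)) })
      (λ i → toℕ i , Fin.toℕ<n i)
      (λ i → cong (_++ (false ∷ [])) (sym (power-true (toℕ i)))) (λ i → refl)
      (emits-seq {w₁ = λ n → power n (true ∷ [])} {w₂ = λ _ _ → false ∷ []} {r₂ = λ n _ → idxRegs w (bits (unary n) ʳ++ e) ρ}
        (emits-many true stage step) (λ n _ → finish n (n <? w)))
    where
    stage : ℕ → Registers
    stage n = set rW (ticks (w ∸ n)) (set rTMP (ticks n) (set rE′ (bits (replicate n true) ʳ++ e) ρ))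
    push-true : ∀ n → inj₁ true ∷ (bits (replicate n true) ʳ++ e) ≡ bits (replicate (suc n) true) ʳ++ e
    push-true n rewrite List.map-replicate (inj₁ {B = Aux nΓ}) n true = sym (replicate-ʳ++ (inj₁ true) n)
    step : ∀ n → Says (emit true ⨾ pusha rE′ (inj₁ true) ⨾ popc rW ⨾ pushc rTMP ⨾ upd clean) (stage n) N 9 (true ∷ []) (stage (suc n))
    step n = then-silent (emits-emit true) (λ _ _ → silent λ f σ →
      det-≡ (eq f σ) (exec-push then exec-pop then exec-push then exec-upd))
      where
      eq : ∀ f σ → _≡_ {A = State} (clean f , load σ (set rW (drop 1 (ticks (w ∸ n)))
             (set rTMP (fromMaybe tck (List.head (ticks (w ∸ n))) ∷ ticks n)
               (set rE′ (inj₁ true ∷ (bits (replicate n true) ʳ++ e)) ρ)))) (clean f , load σ (stage (suc n)))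
      eq f σ = cong₂ (λ (z : List A × A) y → clean f , load σ (set rW (proj₁ z) (set rTMP (proj₂ z ∷ ticks n) (set rE′ y ρ))))
        (cong₂ _,_ (ticks-drop w n) (ticks-head (w ∸ n))) (push-true n)
    finish : ∀ n → Dec (n < w) →
             Emits (popc rW ⨾ guard isTick ⨾ pusha rW tck ⨾ pour rTMP rW ⨾ pusha rE′ (inj₁ false) ⨾ emit false)
               (stage n) N (3 + (pourT B + (1 + emitT))) (n < w) (λ _ → false ∷ []) (λ _ → idxRegs w (bits (unary n) ʳ++ e) ρ)
    finish n (no ≮) = emits λ f β ps le →
      exec-from (cong (λ k → clean f , load (β , ps) (set rW (ticks k) (stage n))) (m≤n⇒m∸n≡0 (≮⇒≥ ≮)))
        (exec-pop then exec-fail refl λ { (lt , _) → ≮ lt })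
    finish n (yes lt) = emits-map {C = ⊤} (λ _ → lt) (λ _ → refl) (λ _ → refl) (λ _ → tt) (λ _ → refl) (λ _ → refl)
      (go-on (w ∸ n) refl)
      where
      n≤B = ≤-trans (<⇒≤ lt) w≤B
      rest = guard isTick ⨾ pusha rW tck ⨾ pour rTMP rW ⨾ pusha rE′ (inj₁ false) ⨾ emit false
      restored : ∀ d → w ∸ n ≡ suc d → ticks n ʳ++ ticks (suc d) ≡ ticks w
      restored d eq = trans (ticks-ʳ++ n (suc d)) (cong ticks (trans (cong (n +_) (sym eq)) (m+[n∸m]≡n (<⇒≤ lt))))
      pushed : inj₁ false ∷ (bits (replicate n true) ʳ++ e) ≡ bits (unary n) ʳ++ e
      pushed = trans (sym (ʳ++-snoc (inj₁ false) (bits (replicate n true)))) (cong (_ʳ++ e) (sym (List.map-++ inj₁ (replicate n true) (false ∷ []))))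
      go-on : ∀ k → w ∸ n ≡ k → Says (popc rW ⨾ rest) (stage n) N (3 + (pourT B + (1 + emitT))) (false ∷ [])
                (idxRegs w (bits (unary n) ʳ++ e) ρ)
      go-on zero eq = ⊥-elim (≤⇒≯ (m∸n≡0⇒m≤n eq) lt)
      go-on (suc d) eq = emits λ f β ps le →
        subst (λ k → Exec (popc rW ⨾ rest) (clean f , load (β , ps) (set rW (ticks k) (stage n)))
                       (3 + (pourT B + (1 + emitT))) {Outcome {⊤} (λ _ → false ∷ []) (β , ps)}
                       (λ { (c , σ' , _) → clean f , load σ' (idxRegs w (bits (unary n) ʳ++ e) ρ) })) (sym eq)
          (exec-pop then exec-guard refl then exec-push then
           det-≡ (cong (λ z → clean f , load (β , ps) (set rW z (set rTMP [] (set rE′ (bits (replicate n true) ʳ++ e) ρ)))) (restored d eq))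
             (exec-pour rTMP rW (λ ()) {ρ = load (β , ps) (set rW (ticks (suc d)) (stage n))} (≤-trans (≤-reflexive (length-ticks n)) n≤B))
           then det-≡ (cong (λ z → clean f , load (β , ps) (set rE′ z (idxRegs w e ρ))) pushed) exec-push
           then runs (emits-emit false {ρ = idxRegs w (bits (unary n) ʳ++ e) ρ}) f β ps le)

-- A straight-line program grows at its end, but generation and evaluation meet the gates from the
-- first one on. `step` peels off the next gate after p, giving the induction in that order.
data Prefix {m j} : ∀ {g s} → SLP m j g → SLP m j s → Set where
  base : ∀ {s} {t : SLP m j s} → Prefix t t
  step : ∀ {g s} {p : SLP m j g} {t : SLP m j s} (c : Gate m (g + j)) → Prefix (p ▷ c) t → Prefix p t

prefix-snoc : ∀ {m j g s} {p : SLP m j g} {t : SLP m j s} {c} → Prefix p t → Prefix p (t ▷ c)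
prefix-snoc base       = step _ base
prefix-snoc (step c q) = step c (prefix-snoc q)

prefix-inputs : ∀ {m j s} (t : SLP m j s) → Prefix inputs t
prefix-inputs inputs  = base
prefix-inputs (t ▷ c) = prefix-snoc (prefix-inputs t)

prefix-≤ : ∀ {m j g s} {p : SLP m j g} {t : SLP m j s} → Prefix p t → g ≤ s
prefix-≤ base       = ≤-refl
prefix-≤ (step c q) = ≤-trans (n≤1+n _) (prefix-≤ q)

encIdxs : ∀ {w} → List (Fin w) → Str
encIdxs is = concat (map (λ i → unary (toℕ i)) is)

module GenCircuit (M : NTM) (m₁ : ℕ) where
  open Generator M m₁ public

  -- Internal form of a gate: a closing token replaces the number of inputs, so the evaluator can
  -- work through the list without counting.
  tokGate : ∀ {w} → Gate m w → List A
  tokGate gt = opTok (opCode gt) ∷ List.concatMap idxTok (gateInputs gt) ++ endTok ∷ []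

  tokSLP : ∀ {j g} → SLP m j g → List A
  tokSLP inputs  = []
  tokSLP (s ▷ c) = tokSLP s ++ tokGate c

  -- The output wire is appended as a pseudo-gate with a single input, so that the program
  -- evaluating gates also looks up the result.
  tokens : ∀ {j} → Circuit m j → List A
  tokens C = tokSLP (gates C) ++ opTok (suc (suc (suc (suc zero)))) ∷ idxTok (out C) ++ endTok ∷ []

  listGuess : Prog
  listGuess = guessMany (emit true ⨾ pusha rN tck) ⨾ emit false ⨾ loopOver rN idxGuess

  listGuessT : ℕ → ℕ → ℕ
  listGuessT N B = guessManyT N 6 + (emitT + forT N (suc (idxGuessT N B)))

  gateRegs : ℕ → List A → Registers → Registers
  gateRegs w e ρ = set rN [] (idxRegs w e ρ)

  module _ (w : ℕ) (ρ : Registers) where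
    private
      module E = Each rN idxGuess {S = λ _ → List A} (λ e → idxRegs w e ρ) {C = λ _ → Fin w}
                      (λ _ i → unary (toℕ i)) (λ e i → idxTok i ʳ++ e)

      toList′ : ∀ n e → E.Chain n e → List (Fin w)
      toList′ zero    e k       = []
      toList′ (suc n) e (i , k) = i ∷ toList′ n _ k

      length-toList′ : ∀ n e k → length (toList′ n e k) ≡ n
      length-toList′ zero    e k       = refl
      length-toList′ (suc n) e (i , k) = cong suc (length-toList′ n _ k)

      words-toList′ : ∀ n e k → E.words n e k ≡ encIdxs (toList′ n e k)
      words-toList′ zero    e k       = refl
      words-toList′ (suc n) e (i , k) = cong (unary (toℕ i) ++_) (words-toList′ n _ k)

      final-toList′ : ∀ n e k → E.final n e k ≡ List.concatMap idxTok (toList′ n e k) ʳ++ e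
      final-toList′ zero    e k       = refl
      final-toList′ (suc n) e (i , k) = trans (final-toList′ n _ k) (sym (List.++-ʳ++ (idxTok i)))

      fromList′ : ∀ (is : List (Fin w)) e → E.Chain (length is) e
      fromList′ []       e = tt
      fromList′ (i ∷ is) e = i , fromList′ is _

      toList-fromList : ∀ is e → toList′ (length is) e (fromList′ is e) ≡ is
      toList-fromList []       e = refl
      toList-fromList (i ∷ is) e = cong (i ∷_) (toList-fromList is _)

    emits-list : ∀ e {N B} → w ≤ B →
      Emits listGuess (gateRegs w e ρ) N (listGuessT N B) (List (Fin w))
            (λ is → unary (length is) ++ encIdxs is) (λ is → gateRegs w (List.concatMap idxTok is ʳ++ e) ρ)
    emits-list e {N} {B} w≤B = emits-map
      (λ { (n , k) → toList′ n e k })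
      (λ { (n , k) → word-eq n k })
      (λ { (n , k) → cong (λ z → gateRegs w z ρ) (final-toList′ n e k) })
      (λ is → length is , fromList′ is e)
      (λ is → sym (trans (word-eq (length is) (fromList′ is e)) (cong (λ z → unary (length z) ++ encIdxs z) (toList-fromList is e))))
      (λ is → cong (λ z → gateRegs w z ρ) (sym (trans (final-toList′ (length is) e (fromList′ is e))
                 (cong (λ z → List.concatMap idxTok z ʳ++ e) (toList-fromList is e)))))
      (emits-seq {D = λ n → E.Chain n e} {w₁ = λ n → power n (true ∷ [])} {w₂ = λ n k → false ∷ E.words n e k}
                 {r₂ = λ n k → set rN [] (idxRegs w (E.final n e k) ρ)}
        (emits-many true (λ n → set rN (ticks n) (idxRegs w e ρ))
          (λ n → then-silent (emits-emit true) (λ _ _ → silent-push (λ _ _ → refl))))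
        (λ n le → says-then (emits-emit false)
          (emits-mono (forT-mono (suc (idxGuessT N B)) (≤-trans (≤-trans (≤-reflexive (sym (List.length-replicate n {true}))) (≤-reflexive (cong length (sym (power-true n))))) le))
            (E.emits-each (λ _ _ _ → refl) (λ _ _ _ _ → refl) {n₀ = n} (λ {n} _ e → emits-idx w e (set rN (ticks n) ρ) w≤B) e))))
      where
      word-eq : ∀ n k → power n (true ∷ []) ++ false ∷ E.words n e k ≡
                        unary (length (toList′ n e k)) ++ encIdxs (toList′ n e k)
      word-eq n k = trans (cong₂ (λ a b → a ++ false ∷ b)
          (trans (power-true n) (cong (λ l → replicate l true) (sym (length-toList′ n e k)))) (words-toList′ n e k))
        (sym (List.++-assoc (replicate (length (toList′ n e k)) true) (false ∷ []) _))

  notGuess : Prog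
  notGuess = emitWord (unary 0) ⨾ pusha rE′ (opTok zero) ⨾ idxGuess

  opGuess : ℕ → Fin 5 → Prog
  opGuess k o = emitWord (unary k) ⨾ pusha rE′ (opTok o) ⨾ listGuess

  gateGuess : Prog
  gateGuess = choice notGuess (choice (opGuess 1 (suc zero)) (choice (opGuess 2 (suc (suc zero))) (opGuess 3 (suc (suc (suc zero)))))) ⨾
              pusha rE′ endTok ⨾ pusha rW tck

  opGuessT : ℕ → ℕ → ℕ → ℕ
  opGuessT k N B = emitWordT (unary k) + (1 + listGuessT N B)

  gateGuessT : ℕ → ℕ → ℕ
  gateGuessT N B = (3 + ((emitWordT (unary 0) + (1 + idxGuessT N B)) +
    (3 + (opGuessT 1 N B + (3 + (opGuessT 2 N B + opGuessT 3 N B)))))) + (1 + 1)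

  emits-gate : ∀ w e ρ {N B} → w ≤ B →
    Emits gateGuess (gateRegs w e ρ) N (gateGuessT N B) (Gate m w) encGate (λ gt → gateRegs (suc w) (tokGate gt ʳ++ e) ρ)
  emits-gate w e ρ {N} {B} le = then-silent
    (emits-map {C = Fin w ⊎ (List (Fin w) ⊎ (List (Fin w) ⊎ List (Fin w)))} {r' = res}
      (λ { (inj₁ i) → NOT i ; (inj₂ (inj₁ is)) → AND is ; (inj₂ (inj₂ (inj₁ is))) → OR is ; (inj₂ (inj₂ (inj₂ is))) → MOD is })
      (λ { (inj₁ i) → refl ; (inj₂ (inj₁ is)) → refl ; (inj₂ (inj₂ (inj₁ is))) → refl ; (inj₂ (inj₂ (inj₂ is))) → refl })
      (λ { (inj₁ i) → cong (λ z → gateRegs w (z ʳ++ (opTok zero ∷ e)) ρ) (sym (List.++-identityʳ (idxTok i)))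
         ; (inj₂ (inj₁ is)) → refl ; (inj₂ (inj₂ (inj₁ is))) → refl ; (inj₂ (inj₂ (inj₂ is))) → refl })
      (λ { (NOT i) → inj₁ i ; (AND is) → inj₂ (inj₁ is) ; (OR is) → inj₂ (inj₂ (inj₁ is)) ; (MOD is) → inj₂ (inj₂ (inj₂ is)) })
      (λ { (NOT i) → refl ; (AND is) → refl ; (OR is) → refl ; (MOD is) → refl })
      (λ { (NOT i) → cong (λ z → gateRegs w (z ʳ++ (opTok zero ∷ e)) ρ) (List.++-identityʳ (idxTok i))
         ; (AND is) → refl ; (OR is) → refl ; (MOD is) → refl })
      (emits-choice
        (says-then (says-word (unary 0)) (silent-then (silent-push {ρ' = gateRegs w (opTok zero ∷ e) ρ} (λ _ _ → refl))
          (emits-idx w (opTok zero ∷ e) (set rN [] ρ) le)))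
        (emits-choice (ops 1 (suc zero)) (emits-choice (ops 2 (suc (suc zero))) (ops 3 (suc (suc (suc zero))))))))
    (λ gt _ → silent λ f σ → exec-push then
       det-≡ (cong (λ z → clean f , load σ (gateRegs (suc w) z ρ)) (tok-eq gt)) exec-push)
    where
    res : Gate m w → Registers
    res gt = gateRegs w (List.concatMap idxTok (gateInputs gt) ʳ++ (opTok (opCode gt) ∷ e)) ρ
    ops : ∀ k o → Emits (opGuess k o) (gateRegs w e ρ) N (opGuessT k N B) (List (Fin w))
                    (λ is → unary k ++ (unary (length is) ++ encIdxs is))
                    (λ is → gateRegs w (List.concatMap idxTok is ʳ++ (opTok o ∷ e)) ρ)
    ops k o = says-then (says-word (unary k)) (silent-then (silent-push {ρ' = gateRegs w (opTok o ∷ e) ρ} (λ _ _ → refl))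
                (emits-list w ρ (opTok o ∷ e) le))
    tok-eq : ∀ (gt : Gate m w) → endTok ∷ (List.concatMap idxTok (gateInputs gt) ʳ++ (opTok (opCode gt) ∷ e)) ≡ tokGate gt ʳ++ e
    tok-eq gt = sym (ʳ++-snoc endTok (List.concatMap idxTok (gateInputs gt)))

  gatesGuess : Prog
  gatesGuess = loopOver rS gateGuess

  module _ (j s : ℕ) (ρ : Registers) where
    private
      Stage : ℕ → Set
      Stage n = ∃[ g ] (SLP m j g × n + g ≡ s)

      regs : ∀ {n} → Stage n → Registers
      regs (g , p , _) = gateRegs (g + j) (tokSLP p ʳ++ []) ρ

      NextGate : ∀ {n} → Stage (suc n) → Set
      NextGate (g , _) = Gate m (g + j)

      append : ∀ {n} (σ : Stage (suc n)) → NextGate σ → Stage n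
      append {n} (g , p , eq) c = suc g , p ▷ c , trans (+-suc n g) eq

      module E = Each rS gateGuess {S = Stage} regs {C = NextGate} (λ _ c → encGate c) append

      result : SLP m j s → Registers
      result t = set rS [] (regs {0} (s , t , refl))

      -- Relates a sequence of guessed gates to the finished program it spells. `complete` finds the
      -- program for given guesses, `chain` the guesses for a given program; together they identify
      -- the outcomes of the loop with `SLP m j s`.
      Matches : ∀ n (σ : Stage n) → E.Chain n σ → SLP m j s → Set
      Matches n (g , p , eq) k t = encSLP p ++ E.words n (g , p , eq) k ≡ encSLP t ×
                                   set rS [] (regs (E.final n (g , p , eq) k)) ≡ result t

      complete : ∀ n σ k → ∃[ t ] Matches n σ k t
      complete zero (g , p , refl) k = p , List.++-identityʳ _ , refl
      complete (suc n) (g , p , eq) (c , k) =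
        let t , e₁ , e₂ = complete n (suc g , p ▷ c , trans (+-suc n g) eq) k
        in t , trans (sym (List.++-assoc (encSLP p) (encGate c) _)) e₁ , e₂

      chain : ∀ n g p (eq : n + g ≡ s) (t : SLP m j s) → Prefix p t → ∃[ k ] Matches n (g , p , eq) k t
      chain zero    g p refl .p base = tt , List.++-identityʳ _ , refl
      chain (suc n) g p eq .p base = ⊥-elim (m≢1+n+m g (sym eq))
      chain zero    g p refl t (step c q) = ⊥-elim (1+n≰n (prefix-≤ q))
      chain (suc n) g p eq t (step c q) =
        let k , e₁ , e₂ = chain n (suc g) (p ▷ c) (trans (+-suc n g) eq) t q
        in (c , k) , trans (sym (List.++-assoc (encSLP p) (encGate c) _)) e₁ , e₂

      start : Stage s
      start = 0 , inputs , +-identityʳ s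

    emits-gates : ∀ {N B} → s + j ≤ B →
      Emits gatesGuess (set rS (ticks s) (gateRegs j [] ρ)) N (forT s (suc (gateGuessT N B)))
            (SLP m j s) encSLP (λ t → set rS [] (gateRegs (s + j) (tokSLP t ʳ++ []) ρ))
    emits-gates {N} {B} le = emits-map
      (λ k → proj₁ (complete s start k)) (λ k → proj₁ (proj₂ (complete s start k))) (λ k → proj₂ (proj₂ (complete s start k)))
      (λ t → proj₁ (ch t)) (λ t → sym (proj₁ (proj₂ (ch t)))) (λ t → sym (proj₂ (proj₂ (ch t))))
      (E.emits-each (λ _ _ _ → refl) (λ _ _ _ _ → refl) {n₀ = s} body start)
      where
      ch = λ t → chain s 0 inputs (+-identityʳ s) t (prefix-inputs t)
      body : ∀ {n} → suc n ≤ s → (σ : Stage (suc n)) → _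
      body {n} _ (g , p , eq) = emits-map id (λ _ → refl)
        (λ c → cong (λ z → set rS (ticks n) (gateRegs (suc g + j) z ρ)) (sym (List.++-ʳ++ (tokSLP p) {tokGate c} {[]})))
        id (λ _ → refl)
        (λ c → cong (λ z → set rS (ticks n) (gateRegs (suc g + j) z ρ)) (List.++-ʳ++ (tokSLP p) {tokGate c} {[]}))
        (emits-gate (g + j) (tokSLP p ʳ++ []) (set rS (ticks n) ρ)
          (≤-trans (+-monoˡ-≤ j (≤-trans (m≤n+m g (suc n)) (≤-reflexive eq))) le))

NotTrue : Str → Set
NotTrue r = ∀ {p} → r ≢ true ∷ p

split-ones : ∀ u → ∃[ j ] ∃[ r ] (u ≡ replicate j true ++ r × NotTrue r)
split-ones [] = 0 , [] , refl , λ ()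
split-ones (false ∷ u) = 0 , false ∷ u , refl , λ ()
split-ones (true ∷ u) = let j , r , e , nt = split-ones u in suc j , r , cong (true ∷_) e , nt

-- Unary in pairs 10 with terminator 11. The terminator exceeds 10, so a smaller depth, which
-- reaches it earlier, gives a lexicographically larger word. The last 0 ends the advice.
depWord : ℕ → Str
depWord d = power d (true ∷ false ∷ []) ++ true ∷ true ∷ false ∷ []

-- A candidate circuit D preceded by its claimed number t of accepted inputs and a bound d on
-- its depth.  The advice consists of pairs 1b and ends with 0; it is arranged so that
-- lexicographically larger certificates have larger t, then smaller d.
certificate : ∀ {m j} → Vec Bool (suc j) → ℕ → Circuit m j → Str
certificate t d D = pairs (toList t) ++ depWord d ++ encode D

module GenAdvice (M : NTM) (m₁ : ℕ) where
  open GenCircuit M m₁ public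

  cregs : ℕ → List A → List A → List A → List A → Registers → Registers
  cregs j s w e e′ ρ = set rJ (ticks j) (set rTMP [] (set rS s (set rN [] (set rW w (set rE e (set rE′ e′ ρ))))))

  power-[] : ∀ n → power n [] ≡ []
  power-[] zero    = refl
  power-[] (suc n) = power-[] n

  initW : Prog
  initW = loopOver rJ (pusha rTMP tck ⨾ pusha rW tck) ⨾ restoreJ

  initWT : ℕ → ℕ
  initWT j = forT j 3 + pourT j

  says-initW : ∀ {j s e ρ N} → Says initW (cregs j s [] e [] ρ) N (initWT j) [] (cregs j s (ticks j) e [] ρ)
  says-initW {j} {s} {e} {ρ} = emits-map id (λ _ → trans (cong (_++ []) (power-[] j)) refl) (λ _ → refl)
    id (λ _ → sym (cong (_++ []) (power-[] j))) (λ _ → refl)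
    (says-then
      (says-each rJ (pusha rTMP tck ⨾ pusha rW tck) (λ k → set rTMP (ticks k) (cregs j s (ticks k) e [] ρ)) [] (λ _ _ _ → refl) (λ _ _ _ _ → refl) j
        (λ i k → emits-silent (silent λ f σ → exec-push then exec-push)))
      (emits-silent (silent-restoreJ {ρ = cregs j s (ticks j) e [] ρ} ≤-refl)))

  genCircuit : Prog
  genCircuit = emitWord (unary m) ⨾ sayJ ⨾ guessMany (emit true ⨾ pusha rS tck) ⨾ emit false ⨾ initW ⨾ gatesGuess ⨾
    pusha rE′ (opTok (suc (suc (suc (suc zero))))) ⨾ idxGuess ⨾ pusha rE′ endTok ⨾ drain rW ⨾ pour rE′ rE

  -- For encodings of length at most N: an end token and the output index, then the output marker
  -- and at most twice the length of the gate encodings, as a gate has at most one token more than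
  -- its code has symbols.
  tokensBound : ℕ → ℕ
  tokensBound N = (1 + N) + (1 + (N + N))

  genCircuitT : ℕ → ℕ → ℕ
  genCircuitT N j = emitWordT (unary m) + (sayJT j + (guessManyT N 6 + (emitT + (initWT j +
    (forT N (suc (gateGuessT N (N + j))) + (1 + (idxGuessT N (N + j) + (1 + (pourT (N + j) + pourT (tokensBound N))))))))))

  length-idxToks : ∀ {w} (is : List (Fin w)) → length (List.concatMap idxTok is) ≡ length (encIdxs is)
  length-idxToks [] = refl
  length-idxToks (i ∷ is) = trans (List.length-++ (idxTok i)) (trans (cong₂ _+_ (List.length-map inj₁ (unary (toℕ i))) (length-idxToks is))
    (sym (List.length-++ (unary (toℕ i)))))

  length-tokGate : ∀ {w} (gt : Gate m w) → length (tokGate gt) ≤ suc (length (encGate gt))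
  length-tokGate gt = s≤s (≤-trans (≤-reflexive (trans (List.length-++ (List.concatMap idxTok (gateInputs gt)))
      (trans (cong (_+ 1) (length-idxToks (gateInputs gt))) (+-comm _ 1)))) (lower gt))
    where
    ++-lower : ∀ (xs : Str) {ys} → length ys ≤ length (xs ++ ys)
    ++-lower xs {ys} = ≤-trans (m≤n+m (length ys) (length xs)) (≤-reflexive (sym (List.length-++ xs)))
    lower : ∀ {w} (gt : Gate m w) → suc (length (encIdxs (gateInputs gt))) ≤ length (encGate gt)
    lower (NOT i)  = s≤s (≤-reflexive (cong length (List.++-identityʳ (unary (toℕ i)))))
    lower (AND is) = s≤s (≤-trans (++-lower (unary (length is))) (n≤1+n _))
    lower (OR is)  = s≤s (≤-trans (++-lower (unary (length is))) (≤-trans (n≤1+n _) (n≤1+n _)))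
    lower (MOD is) = s≤s (≤-trans (++-lower (unary (length is))) (≤-trans (n≤1+n _) (≤-trans (n≤1+n _) (n≤1+n _))))

  encGate-nonempty : ∀ {w} (gt : Gate m w) → 1 ≤ length (encGate gt)
  encGate-nonempty (NOT i)  = s≤s z≤n
  encGate-nonempty (AND is) = s≤s z≤n
  encGate-nonempty (OR is)  = s≤s z≤n
  encGate-nonempty (MOD is) = s≤s z≤n

  length-tokSLP : ∀ {j g} (t : SLP m j g) → length (tokSLP t) ≤ length (encSLP t) + length (encSLP t)
  length-tokSLP inputs = z≤n
  length-tokSLP (t ▷ c) = ≤-trans (≤-reflexive (List.length-++ (tokSLP t))) (≤-trans
    (+-mono-≤ (length-tokSLP t) (≤-trans (length-tokGate c) (+-monoˡ-≤ (length (encGate c)) (encGate-nonempty c))))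
    (≤-reflexive (trans (interchange a a b b) (sym (cong₂ _+_ (List.length-++ (encSLP t)) (List.length-++ (encSLP t)))))))
    where
    a = length (encSLP t)
    b = length (encGate c)
    interchange : ∀ a b c d → (a + b) + (c + d) ≡ (a + c) + (b + d)
    interchange a b c d = trans (+-assoc a b (c + d)) (trans (cong (a +_) (trans (sym (+-assoc b c d))
      (trans (cong (_+ d) (+-comm b c)) (+-assoc c b d)))) (sym (+-assoc a c (b + d))))

  emits-circuit : ∀ j ρ {N} →
    Emits genCircuit (cregs j [] [] [] [] ρ) N (genCircuitT N j) (Circuit m j) encode (λ D → cregs j [] [] (tokens D) [] ρ)
  emits-circuit j ρ {N} = emits-map
    (λ { (s , t , o) → circuit s t o }) (λ { (s , t , o) → word-eq s t o }) (λ _ → refl)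
    (λ { (circuit s t o) → s , t , o }) (λ { (circuit s t o) → sym (word-eq s t o) }) (λ _ → refl)
    (says-then (says-word (unary m)) (says-then (says-J {ρ = cregs j [] [] [] [] ρ} refl refl)
      (emits-seq {D = λ s → Σ (SLP m j s) λ _ → Fin (s + j)} {w₁ = λ s → power s (true ∷ [])}
                 {w₂ = λ s x → false ∷ (encSLP (proj₁ x) ++ unary (toℕ (proj₂ x)))}
                 {r₂ = λ s x → cregs j [] [] (tokens (circuit s (proj₁ x) (proj₂ x))) [] ρ}
        (emits-many true (λ s → cregs j (ticks s) [] [] [] ρ)
          (λ s → then-silent (emits-emit true) (λ _ _ → silent-push (λ _ _ → refl))))
        (λ s le → rest s (≤-trans (≤-reflexive (trans (sym (List.length-replicate s {true})) (cong length (sym (power-true s))))) le)))))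
    where
    word-eq : ∀ s t o → unary m ++ (unary j ++ (power s (true ∷ []) ++ false ∷ (encSLP t ++ unary (toℕ o)))) ≡ encode (circuit s t o)
    word-eq s t o = cong (λ z → unary m ++ (unary j ++ z))
      (trans (cong (_++ false ∷ (encSLP t ++ unary (toℕ o))) (power-true s))
             (sym (List.++-assoc (replicate s true) (false ∷ []) _)))
    rest : ∀ s → s ≤ N → Emits (emit false ⨾ initW ⨾ gatesGuess ⨾ pusha rE′ (opTok (suc (suc (suc (suc zero))))) ⨾ idxGuess ⨾ pusha rE′ endTok ⨾ drain rW ⨾ pour rE′ rE)
       (cregs j (ticks s) [] [] [] ρ) N (emitT + (initWT j +
         (forT N (suc (gateGuessT N (N + j))) + (1 + (idxGuessT N (N + j) + (1 + (pourT (N + j) + pourT (tokensBound N))))))))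
       (Σ (SLP m j s) λ _ → Fin (s + j)) (λ x → false ∷ (encSLP (proj₁ x) ++ unary (toℕ (proj₂ x))))
       (λ x → cregs j [] [] (tokens (circuit s (proj₁ x) (proj₂ x))) [] ρ)
    rest s s≤N = says-then (emits-emit false) (says-then (says-initW {j} {ticks s} {[]} {ρ})
      (emits-seq {D = λ _ → Fin (s + j)} {w₁ = encSLP} {w₂ = λ _ o → unary (toℕ o)}
                 {r₂ = λ t o → cregs j [] [] (tokens (circuit s t o)) [] ρ}
        (emits-mono (forT-mono (suc (gateGuessT N (N + j))) s≤N) (emits-gates j s (cregs j (ticks s) (ticks j) [] [] ρ) (+-monoˡ-≤ j s≤N)))
        (λ t t≤ → silent-then (silent-push {ρ' = cregs j [] (ticks (s + j)) [] (op₄ ∷ (tokSLP t ʳ++ [])) ρ} (λ _ _ → refl))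
          (then-silent (emits-idx (s + j) (op₄ ∷ (tokSLP t ʳ++ [])) (cregs j [] (ticks (s + j)) [] [] ρ) (+-monoˡ-≤ j s≤N))
            (λ o o≤ → silent λ f σ → exec-push then
               exec-drain rW {ρ = load σ (cregs j [] (ticks (s + j)) [] (E₁ t o) ρ)} (≤-trans (≤-reflexive (length-ticks (s + j))) (+-monoˡ-≤ j s≤N)) then
               det-≡ (cong (λ z → clean f , load σ (cregs j [] [] z [] ρ)) (reversed t o))
                 (exec-pour rE′ rE (λ ()) {ρ = load σ (cregs j [] [] [] (E₁ t o) ρ)} (bound t o t≤ o≤)))))))
      where
      op₄ = opTok (suc (suc (suc (suc zero))))
      E₁ : SLP m j s → Fin (s + j) → List A
      E₁ t o = endTok ∷ (idxTok o ʳ++ (op₄ ∷ (tokSLP t ʳ++ [])))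
      reversed : ∀ t o → E₁ t o ʳ++ [] ≡ tokens (circuit s t o)
      reversed t o = trans (List.ʳ++-ʳ++ (idxTok o)) (trans (List.ʳ++-ʳ++ (tokSLP t)) refl)
      bound : ∀ t o → length (encSLP t) ≤ N → length (unary (toℕ o)) ≤ N → length (E₁ t o) ≤ tokensBound N
      bound t o t≤ o≤ = s≤s (≤-trans (≤-reflexive (List.length-ʳ++ (idxTok o)))
        (+-mono-≤ (≤-trans (≤-reflexive (List.length-map inj₁ (unary (toℕ o)))) o≤)
          (s≤s (≤-trans (≤-reflexive (trans (List.length-ʳ++ (tokSLP t)) (+-identityʳ _)))
             (≤-trans (length-tokSLP t) (+-mono-≤ t≤ t≤))))))

  tBit : Prog
  tBit = choice (emit true ⨾ emit true ⨾ pusha rT (inj₁ true)) (emit true ⨾ emit false ⨾ pusha rT (inj₁ false))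

  tBitT : ℕ
  tBitT = 3 + (11 + 11)

  emits-tBit : ∀ a ρ {N} → Emits tBit (set rT (bits a) ρ) N tBitT Bool (λ b → true ∷ b ∷ []) (λ b → set rT (bits (b ∷ a)) ρ)
  emits-tBit a ρ = emits-map
    (λ { (inj₁ _) → true ; (inj₂ _) → false }) (λ { (inj₁ _) → refl ; (inj₂ _) → refl }) (λ { (inj₁ _) → refl ; (inj₂ _) → refl })
    (λ { true → inj₁ tt ; false → inj₂ tt }) (λ { true → refl ; false → refl }) (λ { true → refl ; false → refl })
    (emits-choice
      (says-then (emits-emit true) (then-silent {r' = λ _ → set rT (bits (true ∷ a)) ρ} (emits-emit true) (λ _ _ → silent-push (λ _ _ → refl))))
      (says-then (emits-emit true) (then-silent {r' = λ _ → set rT (bits (false ∷ a)) ρ} (emits-emit false) (λ _ _ → silent-push (λ _ _ → refl)))))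

  -- The count ranges from 0 to 2^j, hence j + 1 bits. They are emitted most significant first and
  -- pushed as they come, so the least significant one ends up on top, ready for decrementing.
  tGuess : Prog
  tGuess = tBit ⨾ loopOver rJ (tBit ⨾ pusha rTMP tck) ⨾ restoreJ

  tGuessT : ℕ → ℕ
  tGuessT j = tBitT + (forT j (suc (tBitT + 1)) + pourT j)

  tregs : ℕ → List Bool → Registers → Registers
  tregs j t ρ = set rJ (ticks j) (set rTMP [] (set rT (bits t) ρ))

  module _ (j : ℕ) (ρ : Registers) where
    private
      Stage : ℕ → Set
      Stage _ = ℕ × List Bool

      regs : Stage 0 → Registers
      regs (k , a) = set rTMP (ticks k) (set rT (bits a) ρ)

      add : Stage 0 → Bool → Stage 0
      add (k , a) b = suc k , b ∷ a

      module E = Each rJ (tBit ⨾ pusha rTMP tck) {S = Stage} regs {C = λ _ → Bool} (λ _ b → true ∷ b ∷ []) add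

      vec : ∀ n σ → E.Chain n σ → Vec Bool n
      vec zero    σ k       = []
      vec (suc n) σ (b , k) = b ∷ vec n _ k

      words-vec : ∀ n σ k → E.words n σ k ≡ pairs (toList (vec n σ k))
      words-vec zero    σ k       = refl
      words-vec (suc n) σ (b , k) = cong (λ z → true ∷ b ∷ z) (words-vec n _ k)

      final-vec : ∀ n k a c → E.final n (k , a) c ≡ (n + k , toList (vec n (k , a) c) ʳ++ a)
      final-vec zero    k a c = refl
      final-vec (suc n) k a (b , c) = trans (final-vec n (suc k) (b ∷ a) c) (cong (λ z → z , toList (vec n (suc k , b ∷ a) c) ʳ++ (b ∷ a)) (+-suc n k))

      unvec : ∀ {n} → Vec Bool n → ∀ σ → E.Chain n σ
      unvec []      σ = tt
      unvec (b ∷ v) σ = b , unvec v _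

      vec-unvec : ∀ {n} (v : Vec Bool n) σ → vec n σ (unvec v σ) ≡ v
      vec-unvec []      σ = refl
      vec-unvec (b ∷ v) σ = cong (b ∷_) (vec-unvec v _)

    emits-t : ∀ {N} → Emits tGuess (tregs j [] ρ) N (tGuessT j) (Vec Bool (suc j)) (pairs ∘ toList) (λ t → tregs j (toList t ʳ++ []) ρ)
    emits-t {N} = emits-map
      (λ { (b , c) → b ∷ vec j _ c }) (λ { (b , c) → cong (λ z → true ∷ b ∷ z) (words-vec j _ c) }) (λ { (b , c) → refl })
      (λ { (b ∷ v) → b , unvec v (0 , b ∷ []) })
      (λ { (b ∷ v) → cong (λ z → true ∷ b ∷ z) (sym (trans (words-vec j _ (unvec v (0 , b ∷ []))) (cong (pairs ∘ toList) (vec-unvec v (0 , b ∷ []))))) })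
      (λ { (b ∷ v) → cong (λ z → tregs j (toList z ʳ++ (b ∷ [])) ρ) (sym (vec-unvec v (0 , b ∷ []))) })
      (emits-seq {D = λ b → E.Chain j (0 , b ∷ [])} {w₂ = λ b c → E.words j (0 , b ∷ []) c}
                 {r₂ = λ b c → tregs j (toList (vec j (0 , b ∷ []) c) ʳ++ (b ∷ [])) ρ}
        (emits-tBit [] (set rJ (ticks j) (set rTMP [] ρ)))
        (λ b _ → then-silent (E.emits-each (λ _ _ _ → refl) (λ _ _ _ _ → refl) {n₀ = j} (λ {n} → body {n = n}) (0 , b ∷ []))
          (λ c _ → restore (toList (vec j (0 , b ∷ []) c) ʳ++ (b ∷ [])) (E.final j (0 , b ∷ []) c)
              (trans (final-vec j 0 (b ∷ []) c) (cong (λ z → z , toList (vec j (0 , b ∷ []) c) ʳ++ (b ∷ [])) (+-identityʳ j))))))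
      where
      body : ∀ {n} → suc n ≤ j → (σ : Stage (suc n)) → Emits (tBit ⨾ pusha rTMP tck)
               (set rJ (ticks n) (set rTMP (ticks (proj₁ σ)) (set rT (bits (proj₂ σ)) ρ))) N (tBitT + 1) Bool (λ b → true ∷ b ∷ [])
               (λ b → set rJ (ticks n) (set rTMP (ticks (suc (proj₁ σ))) (set rT (bits (b ∷ proj₂ σ)) ρ)))
      body {n} _ (k , a) = then-silent (emits-tBit a (set rJ (ticks n) (set rTMP (ticks k) ρ))) (λ _ _ → silent-push (λ _ _ → refl))
      restore : ∀ a σ → σ ≡ (j , a) → Silent restoreJ (set rJ [] (set rTMP (ticks (proj₁ σ)) (set rT (bits (proj₂ σ)) ρ))) (pourT j) (tregs j a ρ)
      restore a _ refl = silent-restoreJ {ρ = set rT (bits a) ρ} ≤-refl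

  depGuess : Prog
  depGuess = guessMany (emit true ⨾ emit false ⨾ pusha rDEP tck) ⨾ emitWord (true ∷ true ∷ false ∷ [])

  emits-dep : ∀ ρ {N} → Emits depGuess (set rDEP [] ρ) N (guessManyT N 11 + 16) ℕ depWord (λ d → set rDEP (ticks d) ρ)
  emits-dep ρ = then-says (emits-many true (λ d → set rDEP (ticks d) ρ)
      (λ d → says-then (emits-emit true) (then-silent {r' = λ _ → set rDEP (ticks (suc d)) ρ} (emits-emit false) (λ _ _ → silent-push (λ _ _ → refl)))))
    (λ d → says-word (true ∷ true ∷ false ∷ []))

  generator : Prog
  generator = tGuess ⨾ depGuess ⨾ genCircuit

  genRegs : ℕ → List Bool → ℕ → List A → Registers → Registers
  genRegs j t d e ρ = cregs j [] [] e [] (set rT (bits t) (set rDEP (ticks d) ρ))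

  generatorT : ℕ → ℕ → ℕ
  generatorT N j = tGuessT j + ((guessManyT N 11 + 16) + genCircuitT N j)

  emits-generator : ∀ j ρ {N} → Emits generator (genRegs j [] 0 [] ρ) N (generatorT N j)
    (Vec Bool (suc j) × ℕ × Circuit m j) (λ { (t , d , D) → certificate t d D })
    (λ { (t , d , D) → genRegs j (toList t ʳ++ []) d (tokens D) ρ })
  emits-generator j ρ = emits-seq
    {D = λ _ → ℕ × Circuit m j} {w₂ = λ _ x → depWord (proj₁ x) ++ encode (proj₂ x)}
    {r₂ = λ t x → genRegs j (toList t ʳ++ []) (proj₁ x) (tokens (proj₂ x)) ρ}
    (emits-t j (genRegs j [] 0 [] ρ))
    (λ t _ → emits-seq {D = λ _ → Circuit m j} {w₂ = λ _ → encode}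
       {r₂ = λ d D → genRegs j (toList t ʳ++ []) d (tokens D) ρ}
       (emits-dep (genRegs j (toList t ʳ++ []) 0 [] ρ))
       (λ d _ → emits-circuit j (set rT (bits (toList t ʳ++ [])) (set rDEP (ticks d) ρ))))

-- Circuit evaluation by a program

-- Depths and values of the wires, most recent first.
wires : ∀ {m j g} → SLP m j g → Vec Bool j → List (ℕ × Bool)
wires inputs  x = map (0 ,_) (toList x)
wires {g = suc g} (s ▷ c) x = (wireDepth (s ▷ c) zero , wireVal (s ▷ c) x zero) ∷ wires s x

-- With de Bruijn indices the number of a wire is the number of records in front of its own, so a
-- lookup amounts to skipping records.
wires-at : ∀ {m j g} (s : SLP m j g) (x : Vec Bool j) (i : Fin (g + j)) →
           ∃[ pre ] ∃[ post ] (wires s x ≡ pre ++ (wireDepth s i , wireVal s x i) ∷ post × length pre ≡ toℕ i)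
wires-at inputs x i = at-vec x i
  where
  at-vec : ∀ {j} (x : Vec Bool j) (i : Fin j) →
           ∃[ pre ] ∃[ post ] (map (0 ,_) (toList x) ≡ pre ++ (0 , lookup x i) ∷ post × length pre ≡ toℕ i)
  at-vec (b ∷ x) zero = [] , _ , refl , refl
  at-vec (b ∷ x) (suc i) = let pre , post , e , l = at-vec x i in (0 , b) ∷ pre , post , cong ((0 , b) ∷_) e , cong suc l
wires-at (s ▷ c) x zero = [] , wires s x , refl , refl
wires-at (s ▷ c) x (suc i) =
  let pre , post , e , l = wires-at s x i
      r = wireDepth (s ▷ c) zero , wireVal (s ▷ c) x zero
  in r ∷ pre , post , cong (r ∷_) e , cong suc l

module Accumulate (m₁ : ℕ) where
  private
    m = suc m₁

  residue : ℕ → Fin m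
  residue k = k mod m

  residue-suc : ∀ k → residue (suc (toℕ (residue k))) ≡ residue (suc k)
  residue-suc k = Fin.toℕ-injective (begin
    toℕ (residue (suc (toℕ (residue k)))) ≡⟨ toℕ-residue (suc (toℕ (residue k))) ⟩
    suc (toℕ (residue k)) % m             ≡⟨ cong (λ z → suc z % m) (toℕ-residue k) ⟩
    suc (k % m) % m                       ≡⟨ %-distribˡ-+ 1 (k % m) m ⟩
    (1 % m + (k % m) % m) % m             ≡⟨ cong (λ z → (1 % m + z) % m) (m%n%n≡m%n k m) ⟩
    (1 % m + k % m) % m                   ≡⟨ sym (%-distribˡ-+ 1 k m) ⟩
    suc k % m                             ≡⟨ sym (toℕ-residue (suc k)) ⟩
    toℕ (residue (suc k)) ∎)
    where
    open ≡-Reasoning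
    toℕ-residue : ∀ k → toℕ (residue k) ≡ k % m
    toℕ-residue k = Fin.toℕ-fromℕ< (m%n<n k m)

  isZero : Fin m → Bool
  isZero zero    = true
  isZero (suc _) = false

  isZero-residue : ∀ k → isZero (residue k) ≡ ⌊ m ∣? k ⌋
  isZero-residue k with m ∣? k | residue k in eq
  ... | yes d | zero  = refl
  ... | no n  | suc _ = refl
  ... | no n  | zero  = ⊥-elim (n (m%n≡0⇒n∣m k m (trans (sym (Fin.toℕ-fromℕ< (m%n<n k m))) (cong toℕ eq))))
  ... | yes d | suc i = ⊥-elim (0≢1+n (trans (sym (n∣m⇒m%n≡0 k m d)) (trans (sym (Fin.toℕ-fromℕ< (m%n<n k m))) (cong toℕ eq))))

  acc₀ : Accum m
  acc₀ = zero , false , zero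

  -- Operation 4 shares the clauses of AND: the conjunction over its single input is the value of
  -- the output wire.
  initAcc : Fin 5 → Accum m
  initAcc (suc (suc zero)) = suc (suc zero) , false , residue 0
  initAcc o                = o , true , residue 0

  stepAcc : Accum m → Bool → Accum m
  stepAcc (zero , b , c)                   v = zero , not v , c
  stepAcc (suc (suc zero) , b , c)         v = suc (suc zero) , b ∨ v , c
  stepAcc (suc (suc (suc zero)) , b , c)   v = suc (suc (suc zero)) , b , (if v then residue (suc (toℕ c)) else c)
  stepAcc (o , b , c)                      v = o , b ∧ v , c

  finAcc : Accum m → Bool
  finAcc (suc (suc (suc zero)) , b , c) = isZero c
  finAcc (o , b , c)                    = b

  foldAcc : Accum m → List Bool → Accum m
  foldAcc = foldl stepAcc

  fold-gate : ∀ {w} (v : Fin w → Bool) (gt : Gate m w) →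
              finAcc (foldAcc (initAcc (opCode gt)) (map v (gateInputs gt))) ≡ gateVal v gt
  fold-gate v (NOT i)  = refl
  fold-gate v (AND is) = go is true
    where
    open import Data.Bool.Properties using (∧-assoc; ∧-identityʳ)
    go : ∀ is b → finAcc (foldAcc (suc zero , b , residue 0) (map v is)) ≡ b ∧ foldr (λ i b → v i ∧ b) true is
    go []       b = sym (∧-identityʳ b)
    go (i ∷ is) b = trans (go is (b ∧ v i)) (∧-assoc b (v i) _)
  fold-gate v (OR is)  = go is false
    where
    open import Data.Bool.Properties using (∨-assoc; ∨-identityʳ)
    go : ∀ is b → finAcc (foldAcc (suc (suc zero) , b , residue 0) (map v is)) ≡ b ∨ foldr (λ i b → v i ∨ b) false is
    go []       b = sym (∨-identityʳ b)
    go (i ∷ is) b = trans (go is (b ∨ v i)) (∨-assoc b (v i) _)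
  fold-gate v (MOD is) = trans (go (map v is) 0) (isZero-residue (countTrue (map v is)))
    where
    go : ∀ bs k → finAcc (foldAcc (suc (suc (suc zero)) , true , residue k) bs) ≡ isZero (residue (k + countTrue bs))
    go []           k = cong (isZero ∘ residue) (sym (+-identityʳ k))
    go (false ∷ bs) k = go bs k
    go (true ∷ bs)  k = trans (cong (λ c → finAcc (foldAcc (suc (suc (suc zero)) , true , c) bs)) (residue-suc k))
      (trans (go bs (suc k)) (cong (isZero ∘ residue) (sym (+-suc k (countTrue bs)))))

module Evaluator (M : NTM) (m₁ : ℕ) where
  open GenAdvice M m₁ public
  open Accumulate m₁ public

  -- A record is the depth in unary followed by the value; the bit doubles as end marker of the
  -- record.
  flatW : List (ℕ × Bool) → List A
  flatW = List.concatMap (λ { (d , v) → ticks d ++ inj₁ v ∷ [] })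

  flatW-++ : ∀ us vs → flatW (us ++ vs) ≡ flatW us ++ flatW vs
  flatW-++ = List.concatMap-++ _

  bitOf : Maybe A → Bool
  bitOf (just (inj₁ b)) = b
  bitOf _               = false

  opOf : Maybe A → Fin 5
  opOf (just (opTok o)) = o
  opOf _                = zero

  isOut : F → Bool
  isOut f = test (cur f)
    where
    test : Maybe A → Bool
    test (just (opTok (suc (suc (suc (suc zero)))))) = true
    test _ = false

  withAcc : Accum m → F → F
  withAcc a f = record f { acc = a }

  vregs : List A → List A → Registers → Registers
  vregs v v′ ρ = set rV v (set rV′ v′ ρ)

  skipRecord : Prog
  skipRecord = popc rV ⨾ pushc rV′ ⨾ while isTick (popc rV ⨾ pushc rV′)

  skipT : ℕ → ℕ
  skipT B = 2 + loopT B 2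

  private
    skip-loop : ∀ d {v v₀ v₁ f} {ρ : Registers} →
                Det (while isTick (popc rV ⨾ pushc rV′)) (withCur (just tck) f , vregs (ticks d ++ inj₁ v ∷ v₀) v₁ ρ) (loopT (suc d) 2)
                    (withCur (just (inj₁ v)) f , vregs v₀ (inj₁ v ∷ (ticks d ʳ++ v₁)) ρ)
    skip-loop zero                    = while-det refl (exec-pop then exec-push) (while-stop refl)
    skip-loop (suc d) {f = f} {ρ = ρ} = while-det refl (exec-pop then exec-push) (skip-loop d {f = f} {ρ = ρ})

    rec-ʳ++ : ∀ d v {v₁ : List A} → inj₁ v ∷ (ticks d ʳ++ v₁) ≡ (ticks d ++ inj₁ v ∷ []) ʳ++ v₁
    rec-ʳ++ d v = sym (ʳ++-snoc (inj₁ v) (ticks d))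

    rec-++ : ∀ d v {v₀ : List A} → (ticks d ++ inj₁ v ∷ []) ++ v₀ ≡ ticks d ++ inj₁ v ∷ v₀
    rec-++ d v = List.++-assoc (ticks d) (inj₁ v ∷ []) _

  exec-skip : ∀ d v {v₀ v₁ f B} {ρ : Registers} → d ≤ B →
              Det skipRecord (f , vregs (flatW ((d , v) ∷ []) ++ v₀) v₁ ρ) (skipT B)
                  (withCur (just (inj₁ v)) f , vregs v₀ (flatW ((d , v) ∷ []) ʳ++ v₁) ρ)
  exec-skip zero v le = exec-mono (s≤s (s≤s (loopT-monoˡ {0} 2 z≤n))) (exec-pop then exec-push then while-stop refl)
  exec-skip (suc d) v {v₀} {v₁} {f} {B} {ρ} le = exec-mono (s≤s (s≤s (loopT-monoˡ 2 le)))
    (exec-from (cong (λ z → f , vregs z v₁ ρ) (trans (cong (_++ v₀) (List.++-identityʳ (ticks (suc d) ++ inj₁ v ∷ []))) (rec-++ (suc d) v)))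
      (exec-pop then exec-push then det-≡ (cong (λ z → withCur (just (inj₁ v)) f , vregs v₀ z ρ)
        (trans (rec-ʳ++ d v) (cong (_ʳ++ v₁) (sym (List.++-identityʳ (ticks (suc d) ++ inj₁ v ∷ [])))))) (skip-loop d {f = f} {ρ = ρ})))

  -- Computes a maximum with stacks: for each tick of the record's depth d one tick leaves `rMX` and
  -- one enters `rTMP`. Pouring `rTMP` onto the remaining a ∸ d ticks gives d + (a ∸ d), the maximum
  -- of a and d.
  readBody : Prog
  readBody = pop rMX (λ f _ → f) ⨾ pusha rTMP tck ⨾ popc rV ⨾ pushc rV′

  readOff : Prog
  readOff = popc rV ⨾ pushc rV′ ⨾ while isTick readBody

  readRecord : Prog
  readRecord = readOff ⨾ upd (λ f → withAcc (stepAcc (acc f) (bitOf (cur f))) f) ⨾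
               pour rV′ rV ⨾ pour rTMP rMX

  readT : ℕ → ℕ
  readT B = (1 + (1 + loopT B 4)) + (1 + (pourT B + pourT B))

  mregs : ℕ → ℕ → List A → List A → Registers → Registers
  mregs a k v v′ ρ = set rMX (ticks a) (set rTMP (ticks k) (vregs v v′ ρ))

  private
    read-loop : ∀ d a k {v v₀ v₁ f} {ρ : Registers} →
                Det (while isTick readBody) (withCur (just tck) f , mregs (a ∸ k) k (ticks d ++ inj₁ v ∷ v₀) v₁ ρ) (loopT (suc d) 4)
                    (withCur (just (inj₁ v)) f , mregs (a ∸ (suc d + k)) (suc d + k) v₀ (inj₁ v ∷ (ticks d ʳ++ v₁)) ρ)
    read-loop zero a k {v} {v₀} {v₁} {f} {ρ} = while-det refl (exec-pop then exec-push then exec-pop then exec-push)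
      (exec-from (cong (λ z → withCur (just (inj₁ v)) f , set rMX z (set rTMP (ticks (suc k)) (vregs v₀ (inj₁ v ∷ v₁) ρ))) (ticks-drop a k)) (while-stop refl))
    read-loop (suc d) a k {v} {v₀} {v₁} {f} {ρ} = while-det refl (exec-pop then exec-push then exec-pop then exec-push)
      (exec-from (cong (λ z → withCur (just tck) f , set rMX z (set rTMP (ticks (suc k)) (vregs (ticks d ++ inj₁ v ∷ v₀) (tck ∷ v₁) ρ))) (ticks-drop a k))
        (det-≡ (cong (λ z → withCur (just (inj₁ v)) f , mregs (a ∸ z) z v₀ (inj₁ v ∷ (ticks (suc d) ʳ++ v₁)) ρ) (cong suc (+-suc d k)))
          (read-loop d a (suc k) {f = f} {ρ = ρ})))

    read-all : ∀ d a {v v₀ v₁ f B} {ρ : Registers} → d ≤ B →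
               Det readOff (f , mregs a 0 (flatW ((d , v) ∷ []) ++ v₀) v₁ ρ) (1 + (1 + loopT B 4))
                   (withCur (just (inj₁ v)) f , mregs (a ∸ d) d v₀ (flatW ((d , v) ∷ []) ʳ++ v₁) ρ)
    read-all zero a le = exec-mono (s≤s (s≤s (loopT-monoˡ {0} 4 z≤n))) (exec-pop then exec-push then while-stop refl)
    read-all (suc d) a {v} {v₀} {v₁} {f} {B} {ρ} le = exec-mono (s≤s (s≤s (loopT-monoˡ 4 le)))
      (exec-from (cong (λ z → f , mregs a 0 z v₁ ρ) (trans (cong (_++ v₀) (List.++-identityʳ (ticks (suc d) ++ inj₁ v ∷ []))) (rec-++ (suc d) v)))
        (exec-pop then exec-push then
         det-≡ (cong₂ (λ n z → withCur (just (inj₁ v)) f , mregs (a ∸ n) n v₀ z ρ) (+-identityʳ (suc d))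
           (trans (rec-ʳ++ d v) (cong (_ʳ++ v₁) (sym (List.++-identityʳ (ticks (suc d) ++ inj₁ v ∷ [])))))) (read-loop d a 0 {f = f} {ρ = ρ})))

  add-monus : ∀ d a → d + (a ∸ d) ≡ a ⊔ d
  add-monus d a with ≤-total d a
  ... | inj₁ d≤a = trans (m+[n∸m]≡n d≤a) (sym (m≥n⇒m⊔n≡m d≤a))
  ... | inj₂ a≤d = trans (cong (d +_) (m≤n⇒m∸n≡0 a≤d)) (trans (+-identityʳ d) (sym (m≤n⇒m⊔n≡n a≤d)))

  flatW-cons : ∀ r us → flatW (r ∷ us) ≡ flatW (r ∷ []) ++ flatW us
  flatW-cons r us = flatW-++ (r ∷ []) us

  length-rec : ∀ d v → d ≤ length (flatW ((d , v) ∷ []))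
  length-rec d v = ≤-trans (≤-reflexive (sym (length-ticks d))) (≤-trans (m≤m+n _ _) (≤-trans (m≤m+n _ _)
    (≤-reflexive (sym (trans (List.length-++ (ticks d ++ inj₁ v ∷ [])) (cong (_+ 0) (List.length-++ (ticks d))))))))

  exec-read : ∀ pre d v post a {f ρ B} → length (flatW (pre ++ (d , v) ∷ post)) ≤ B → d ≤ B →
              Det readRecord (f , mregs a 0 (flatW ((d , v) ∷ post)) (flatW pre ʳ++ []) ρ) (readT B)
                  (withAcc (stepAcc (acc f) v) (withCur nothing f) , mregs (a ⊔ d) 0 (flatW (pre ++ (d , v) ∷ post)) [] ρ)
  exec-read pre d v post a {f} {ρ} {B} le d≤ =
    exec-from (cong (λ z → f , mregs a 0 z (flatW pre ʳ++ []) ρ) (flatW-cons (d , v) post))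
    (read-all d a {f = f} {ρ = ρ} d≤ then exec-upd then
     det-≡ (cong (λ z → withAcc (stepAcc (acc f) v) (withCur nothing f) , mregs (a ∸ d) d z [] ρ) restored)
       (exec-pour rV′ rV (λ ()) {ρ = mregs (a ∸ d) d (flatW post) V′ ρ} (≤-trans (≤-reflexive lenV′) (≤-trans (m≤m+n _ _) (≤-trans (≤-reflexive (sym len)) le))))
     then det-≡ (cong (λ z → withAcc (stepAcc (acc f) v) (withCur nothing f) , set rMX z (set rTMP [] (vregs (flatW (pre ++ (d , v) ∷ post)) [] ρ)))
             (trans (ticks-ʳ++ d (a ∸ d)) (cong ticks (add-monus d a))))
       (exec-pour rTMP rMX (λ ()) {ρ = mregs (a ∸ d) d (flatW (pre ++ (d , v) ∷ post)) [] ρ} (≤-trans (≤-reflexive (length-ticks d)) d≤)))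
    where
    rec = flatW ((d , v) ∷ [])
    V′ = rec ʳ++ (flatW pre ʳ++ [])
    whole : flatW (pre ++ (d , v) ∷ post) ≡ flatW pre ++ rec ++ flatW post
    whole = trans (flatW-++ pre _) (cong (flatW pre ++_) (flatW-cons (d , v) post))
    restored : V′ ʳ++ flatW post ≡ flatW (pre ++ (d , v) ∷ post)
    restored = trans (List.ʳ++-ʳ++ rec) (trans (List.ʳ++-ʳ++ (flatW pre)) (sym whole))
    lenV′ : length V′ ≡ length rec + length (flatW pre)
    lenV′ = trans (List.length-ʳ++ rec) (cong (length rec +_) (trans (List.length-ʳ++ (flatW pre)) (+-identityʳ _)))
    len : length (flatW (pre ++ (d , v) ∷ post)) ≡ (length rec + length (flatW pre)) + length (flatW post)
    len = trans (cong length whole) (trans (List.length-++ (flatW pre)) (trans (cong (length (flatW pre) +_) (List.length-++ rec))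
      (trans (sym (+-assoc (length (flatW pre)) (length rec) _)) (cong (_+ length (flatW post)) (+-comm (length (flatW pre)) (length rec))))))

  -- Each 1 of the unary index skips a record and the closing 0 reads the next one. Skipped records
  -- wait in `rV′` until `readRecord` pours everything back.
  lookupWire : Prog
  lookupWire = while isTrue (pushc rE′ ⨾ skipRecord ⨾ popc rE) ⨾ pushc rE′ ⨾ readRecord

  lookupT : ℕ → ℕ
  lookupT B = loopT B (1 + (skipT B + 1)) + (1 + readT B)

  tregsE : List A → List A → Registers → Registers
  tregsE e e′ ρ = set rE e (set rE′ e′ ρ)

  private
    walk : ∀ pre rest a e e′ past f ρ {B} → (∀ r → r ∈ pre → proj₁ r ≤ B) →
           Det (while isTrue (pushc rE′ ⨾ skipRecord ⨾ popc rE))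
             (withCur (List.head (bits (unary (length pre)) ++ e)) f ,
              tregsE (drop 1 (bits (unary (length pre)) ++ e)) e′ (mregs a 0 (flatW (pre ++ rest)) past ρ))
             (loopT (length pre) (1 + (skipT B + 1)))
             (withCur (just (inj₁ false)) f ,
              tregsE e (replicate (length pre) (inj₁ true) ʳ++ e′) (mregs a 0 (flatW rest) (flatW pre ʳ++ past) ρ))
    walk [] rest a e e′ past f ρ ds = while-stop refl
    walk ((d , v) ∷ pre) rest a e e′ past f ρ {B} ds =
      exec-from (cong (λ z → withCur (just (inj₁ true)) f , tregsE (bits (unary (length pre)) ++ e) e′ (mregs a 0 z past ρ)) (flatW-cons (d , v) (pre ++ rest)))
      (while-det refl
        (exec-push then exec-skip d v {ρ = tregsE (bits (unary (length pre)) ++ e) (inj₁ true ∷ e′) (mregs a 0 [] [] ρ)} (ds _ (here refl)) then exec-pop)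
        (det-≡ (cong (λ z → withCur (just (inj₁ false)) f , tregsE e (replicate (length pre) (inj₁ true) ʳ++ (inj₁ true ∷ e′)) (mregs a 0 (flatW rest) z ρ)) past-eq)
          (walk pre rest a e (inj₁ true ∷ e′) (flatW ((d , v) ∷ []) ʳ++ past) f ρ (λ r i → ds r (there i)))))
      where
      past-eq : flatW pre ʳ++ (flatW ((d , v) ∷ []) ʳ++ past) ≡ flatW ((d , v) ∷ pre) ʳ++ past
      past-eq = trans (sym (List.++-ʳ++ (flatW ((d , v) ∷ [])))) (cong (_ʳ++ past) (sym (flatW-cons (d , v) pre)))

  depth≤flatW : ∀ W r → r ∈ W → proj₁ r ≤ length (flatW W)
  depth≤flatW (r ∷ W) .r (here refl) = ≤-trans (length-rec (proj₁ r) (proj₂ r)) (≤-trans (m≤m+n _ (length (flatW W)))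
    (≤-reflexive (trans (sym (List.length-++ (flatW (r ∷ [])))) (cong length (sym (flatW-cons r W))))))
  depth≤flatW (r′ ∷ W) r (there i) = ≤-trans (depth≤flatW W r i) (≤-trans (m≤n+m _ (length (flatW (r′ ∷ []))))
    (≤-reflexive (trans (sym (List.length-++ (flatW (r′ ∷ [])))) (cong length (sym (flatW-cons r′ W))))))

  length≤flatW : ∀ W → length W ≤ length (flatW W)
  length≤flatW [] = z≤n
  length≤flatW ((d , v) ∷ W) = ≤-trans (s≤s (length≤flatW W)) (≤-trans (m≤n+m _ d) (≤-reflexive (sym
    (trans (List.length-++ (ticks d ++ inj₁ v ∷ [])) (trans (cong (_+ length (flatW W)) (trans (List.length-++ (ticks d)) (cong (_+ 1) (length-ticks d)))) (+-assoc d 1 _))))))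

  idx-rev : ∀ {w} (i : Fin w) {e′} → inj₁ false ∷ (replicate (toℕ i) (inj₁ true) ʳ++ e′) ≡ idxTok i ʳ++ e′
  idx-rev i {e′} = trans (sym (ʳ++-snoc (inj₁ false) (replicate (toℕ i) (inj₁ true)))) (cong (_ʳ++ e′)
    (sym (trans (List.map-++ inj₁ (replicate (toℕ i) true) (false ∷ [])) (cong (_++ inj₁ false ∷ []) (List.map-replicate inj₁ (toℕ i) true)))))

  exec-lookup : ∀ {j g} (s : SLP m j g) (x : Vec Bool j) (i : Fin (g + j)) a e e′ f ρ {B} → length (flatW (wires s x)) ≤ B →
                Det lookupWire
                  (withCur (List.head (idxTok i ++ e)) f , tregsE (drop 1 (idxTok i ++ e)) e′ (mregs a 0 (flatW (wires s x)) [] ρ))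
                  (lookupT B)
                  (withAcc (stepAcc (acc f) (wireVal s x i)) (withCur nothing f) ,
                   tregsE e (idxTok i ʳ++ e′) (mregs (a ⊔ wireDepth s i) 0 (flatW (wires s x)) [] ρ))
  exec-lookup s x i a e e′ f ρ {B} le with wires-at s x i
  ... | pre , post , W≡ , len = exec-from (cong₂ (λ n W → withCur (List.head (bits (unary n) ++ e)) f , tregsE (drop 1 (bits (unary n) ++ e)) e′ (mregs a 0 (flatW W) [] ρ)) (sym len) W≡)
    (exec-mono (+-monoˡ-≤ (1 + readT B) (loopT-monoˡ _ len≤))
      (walk pre rest a e e′ [] f ρ (λ r i → ≤-trans (depth≤flatW (pre ++ rest) r (∈-++⁺ˡ i)) le′) then exec-push then
       det-≡ (cong₂ (λ z W → withAcc (stepAcc (acc f) (wireVal s x i)) (withCur nothing f) , tregsE e z (mregs (a ⊔ wireDepth s i) 0 (flatW W) [] ρ))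
               (trans (cong (λ n → inj₁ false ∷ (replicate n (inj₁ true) ʳ++ e′)) len) (idx-rev i)) (sym W≡))
         (exec-read pre (wireDepth s i) (wireVal s x i) post a {ρ = tregsE e (inj₁ false ∷ (replicate (length pre) (inj₁ true) ʳ++ e′)) ρ} le′
            (≤-trans (depth≤flatW (pre ++ rest) _ (∈-++⁺ʳ pre (here refl))) le′))))
    where
    open import Data.List.Membership.Propositional.Properties using (∈-++⁺ˡ; ∈-++⁺ʳ)
    rest = (wireDepth s i , wireVal s x i) ∷ post
    le′ : length (flatW (pre ++ rest)) ≤ B
    le′ = ≤-trans (≤-reflexive (cong (length ∘ flatW) (sym W≡))) le
    len≤ : length pre ≤ B
    len≤ = ≤-trans (m≤m+n _ (length rest)) (≤-trans (≤-reflexive (sym (List.length-++ pre))) (≤-trans (length≤flatW (pre ++ rest)) le′))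

foldl-⊔ : ∀ a ds → foldl _⊔_ a ds ≡ a ⊔ maxList ds
foldl-⊔ a []       = sym (⊔-identityʳ a)
foldl-⊔ a (d ∷ ds) = trans (foldl-⊔ (a ⊔ d) ds) (⊔-assoc a d (maxList ds))

-- The time for evaluating a gate depends on the length of its input list, which `size` does not
-- control.
FanIn : ∀ {m j g} → ℕ → SLP m j g → Set
FanIn B inputs  = ⊤
FanIn B (s ▷ c) = FanIn B s × length (gateInputs c) ≤ B

module EvalCircuit (M : NTM) (m₁ : ℕ) where
  open Evaluator M m₁ public

  evalGate : Prog
  evalGate = upd (λ f → withAcc (initAcc (opOf (cur f))) f) ⨾ pushc rE′ ⨾ popc rE ⨾
             while isBit (lookupWire ⨾ popc rE) ⨾ pushc rE′

  evalGateT : ℕ → ℕ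
  evalGateT B = 1 + (1 + (1 + (loopT B (lookupT B + 1) + 1)))

  idxToks : ∀ {w} → List (Fin w) → List A
  idxToks = List.concatMap idxTok

  private
    isBit-idx : ∀ n ys f → isBit (withCur (List.head (bits (unary n) ++ ys)) f) ≡ true
    isBit-idx zero    ys f = refl
    isBit-idx (suc n) ys f = refl

    inputs-loop : ∀ {j g} (s : SLP m j g) (x : Vec Bool j) is a e e′ f ρ {B} → length (flatW (wires s x)) ≤ B →
      Det (while isBit (lookupWire ⨾ popc rE))
        (withCur (List.head (idxToks is ++ endTok ∷ e)) f ,
         tregsE (drop 1 (idxToks is ++ endTok ∷ e)) e′ (mregs a 0 (flatW (wires s x)) [] ρ))
        (loopT (length is) (lookupT B + 1))
        (withAcc (foldAcc (acc f) (map (wireVal s x) is)) (withCur (just endTok) f) ,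
         tregsE e (idxToks is ʳ++ e′) (mregs (foldl _⊔_ a (map (wireDepth s) is)) 0 (flatW (wires s x)) [] ρ))
    inputs-loop s x [] a e e′ f ρ le = while-stop refl
    inputs-loop s x (i ∷ is) a e e′ f ρ le =
      exec-from (cong (λ z → withCur (List.head z) f , tregsE (drop 1 z) e′ (mregs a 0 (flatW (wires s x)) [] ρ)) (List.++-assoc (idxTok i) (idxToks is) (endTok ∷ e)))
      (while-det (isBit-idx (toℕ i) _ f)
        (exec-lookup s x i a (idxToks is ++ endTok ∷ e) e′ f ρ le then exec-pop)
        (det-≡ (cong (λ z → withAcc (foldAcc (stepAcc (acc f) (wireVal s x i)) (map (wireVal s x) is)) (withCur (just endTok) f) ,
                 tregsE e z (mregs (foldl _⊔_ (a ⊔ wireDepth s i) (map (wireDepth s) is)) 0 (flatW (wires s x)) [] ρ)) (sym (List.++-ʳ++ (idxTok i))))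
          (inputs-loop s x is (a ⊔ wireDepth s i) e (idxTok i ʳ++ e′) (withAcc (stepAcc (acc f) (wireVal s x i)) f) ρ le)))

  exec-gate : ∀ {j g} (s : SLP m j g) (x : Vec Bool j) o is e e′ f ρ {B} → length (flatW (wires s x)) ≤ B → length is ≤ B →
    Det evalGate
      (withCur (just (opTok o)) f , tregsE (idxToks is ++ endTok ∷ e) e′ (mregs 0 0 (flatW (wires s x)) [] ρ))
      (evalGateT B)
      (withAcc (foldAcc (initAcc o) (map (wireVal s x) is)) (withCur (just endTok) f) ,
       tregsE e ((opTok o ∷ idxToks is ++ endTok ∷ []) ʳ++ e′) (mregs (maxList (map (wireDepth s) is)) 0 (flatW (wires s x)) [] ρ))
  exec-gate s x o is e e′ f ρ {B} le len = exec-upd then exec-push then exec-pop then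
    exec-mono (+-monoˡ-≤ 1 (loopT-monoˡ _ len))
      (inputs-loop s x is 0 e (opTok o ∷ e′) (withAcc (initAcc o) f) ρ le then
       det-≡ (cong₂ (λ z a → withAcc (foldAcc (initAcc o) (map (wireVal s x) is)) (withCur (just endTok) f) ,
                tregsE e z (mregs a 0 (flatW (wires s x)) [] ρ))
              (sym (ʳ++-snoc endTok (idxToks is))) (foldl-⊔ 0 (map (wireDepth s) is)))
         exec-push)

  -- The record is built from the bottom: the value, the maximal depth of the inputs, and one more
  -- tick for the gate itself.
  pushResult : Prog
  pushResult = push rV (λ f → inj₁ (finAcc (acc f))) ⨾ forEach rMX (pusha rV tck) ⨾ pusha rV tck

  pushResultT : ℕ → ℕ
  pushResultT B = 1 + (forT B 1 + 1)

  private
    push-loop : ∀ a k z f ρ → Det (while isJust (pusha rV tck ⨾ popc rMX))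
      (withCur (List.head (ticks a)) f , set rMX (drop 1 (ticks a)) (set rV (ticks k ++ z) ρ)) (loopT a 2)
      (withCur nothing f , set rMX [] (set rV (ticks (a + k) ++ z) ρ))
    push-loop zero    k z f ρ = while-stop refl
    push-loop (suc a) k z f ρ = while-det refl (exec-push then exec-pop)
      (det-≡ (cong (λ n → withCur nothing f , set rMX [] (set rV (ticks n ++ z) ρ)) (+-suc a k)) (push-loop a (suc k) z f ρ))

  exec-pushResult : ∀ a z f ρ {B} → a ≤ B →
    Det pushResult (f , set rMX (ticks a) (set rV z ρ)) (pushResultT B)
        (withCur nothing f , set rMX [] (set rV ((ticks (suc a) ++ inj₁ (finAcc (acc f)) ∷ []) ++ z) ρ))
  exec-pushResult a z f ρ {B} le = exec-push then
    exec-mono (+-monoˡ-≤ 1 (forT-mono 1 le)) ((exec-pop then push-loop a 0 _ f ρ) then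
      det-≡ (cong (λ w → withCur nothing f , set rMX [] (set rV w ρ))
              (trans (cong (λ n → tck ∷ (ticks n ++ inj₁ (finAcc (acc f)) ∷ z)) (+-identityʳ a))
                     (sym (List.++-assoc (ticks (suc a)) (inj₁ (finAcc (acc f)) ∷ []) z))))
        exec-push)

  -- The last `evalGate` handles the output marker. Its result is not pushed: the value stays in the
  -- accumulator and the depth in `rMX`, without the extra tick of a real gate.
  evalLoop : Prog
  evalLoop = popc rE ⨾ while (not ∘ isOut) (evalGate ⨾ pushResult ⨾ popc rE) ⨾ evalGate

  evalLoopT : ℕ → ℕ
  evalLoopT B = 1 + (loopT B (evalGateT B + (pushResultT B + 1)) + evalGateT B)

  opOut : A
  opOut = opTok (suc (suc (suc (suc zero))))

  rest-tokens : ∀ {j g s} {p : SLP m j g} {t : SLP m j s} → Prefix p t → List A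
  rest-tokens base       = []
  rest-tokens (step c q) = tokGate c ++ rest-tokens q

  rest-snoc : ∀ {j g s} {p : SLP m j g} {t : SLP m j s} {c} (q : Prefix p t) →
              rest-tokens (prefix-snoc {c = c} q) ≡ rest-tokens q ++ tokGate c
  rest-snoc base       = List.++-identityʳ _
  rest-snoc (step c q) = trans (cong (tokGate c ++_) (rest-snoc q)) (sym (List.++-assoc (tokGate c) (rest-tokens q) _))

  rest-inputs : ∀ {j s} (t : SLP m j s) → rest-tokens (prefix-inputs t) ≡ tokSLP t
  rest-inputs inputs  = refl
  rest-inputs (t ▷ c) = trans (rest-snoc (prefix-inputs t)) (cong (_++ tokGate c) (rest-inputs t))

  rest-length : ∀ {j g s} {p : SLP m j g} {t : SLP m j s} → Prefix p t → ℕ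
  rest-length base       = 0
  rest-length (step c q) = suc (rest-length q)

  rest-length-≡ : ∀ {j g s} {p : SLP m j g} {t : SLP m j s} (q : Prefix p t) → rest-length q + g ≡ s
  rest-length-≡ base = refl
  rest-length-≡ {g = g} (step c q) = trans (sym (+-suc (rest-length q) g)) (rest-length-≡ q)

  private
    fanin-prefix : ∀ {j g s B} {p : SLP m j g} {t : SLP m j s} → Prefix p t → FanIn B t → FanIn B p
    fanin-prefix base       fi = fi
    fanin-prefix (step c q) fi = proj₁ (fanin-prefix q fi)

    flatW-prefix : ∀ {j g s} {p : SLP m j g} {t : SLP m j s} (x : Vec Bool j) → Prefix p t →
                   length (flatW (wires p x)) ≤ length (flatW (wires t x))
    flatW-prefix x base = ≤-refl
    flatW-prefix {p = p} x (step c q) = ≤-trans (≤-trans (m≤n+m _ _) (≤-reflexive (sym (trans (cong length (flatW-cons r (wires p x))) (List.length-++ (flatW (r ∷ []))))))) (flatW-prefix x q)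
      where r = wireDepth (p ▷ c) zero , wireVal (p ▷ c) x zero

    not-out : ∀ {w} (c : Gate m w) f → not (isOut (withCur (just (opTok (opCode c))) f)) ≡ true
    not-out (NOT i) f  = refl
    not-out (AND is) f = refl
    not-out (OR is) f  = refl
    not-out (MOD is) f = refl

    eregs : List A → List A → List A → Registers → Registers
    eregs e e′ v ρ = tregsE e e′ (mregs 0 0 v [] ρ)

    -- The accumulator left by the last gate is hidden in the existential, since the output marker
    -- starts by resetting it.
    gates-loop : ∀ {j g s} {p : SLP m j g} {t : SLP m j s} (q : Prefix p t) (x : Vec Bool j) e e′ f ρ {B} →
      FanIn B t → length (flatW (wires t x)) ≤ B → ∃[ a ]
      Det (while (not ∘ isOut) (evalGate ⨾ pushResult ⨾ popc rE))
        (withCur (List.head (rest-tokens q ++ opOut ∷ e)) f , eregs (drop 1 (rest-tokens q ++ opOut ∷ e)) e′ (flatW (wires p x)) ρ)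
        (loopT (rest-length q) (evalGateT B + (pushResultT B + 1)))
        (withAcc a (withCur (just opOut) f) , eregs e (rest-tokens q ʳ++ e′) (flatW (wires t x)) ρ)
    gates-loop base x e e′ f ρ fi le = acc f , while-stop refl
    gates-loop {p = p} {t} (step c q) x e e′ f ρ {B} fi le =
      let is = gateInputs c
          after = rest-tokens q ++ opOut ∷ e
          res = foldAcc (initAcc (opCode c)) (map (wireVal p x) is)
          a , ih = gates-loop q x e (tokGate c ʳ++ e′) (withAcc res f) ρ fi le
          tok≡ : (tokGate c ++ rest-tokens q) ++ opOut ∷ e ≡ opTok (opCode c) ∷ (idxToks is ++ endTok ∷ after)
          tok≡ = cong (opTok (opCode c) ∷_) (trans (cong (_++ opOut ∷ e) (List.++-assoc (idxToks is) (endTok ∷ []) (rest-tokens q)))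
                   (List.++-assoc (idxToks is) (endTok ∷ rest-tokens q) (opOut ∷ e)))
          mx = maxList (map (wireDepth p) is)
          mx≤ : mx ≤ B
          mx≤ = ≤-trans (n≤1+n mx) (≤-trans (depth≤flatW (wires (p ▷ c) x) _ (here refl)) (≤-trans (flatW-prefix x q) le))
      in a , exec-from (cong (λ z → withCur (List.head z) f , eregs (drop 1 z) e′ (flatW (wires p x)) ρ) tok≡)
        (while-det (not-out c f)
          (exec-gate p x (opCode c) is after e′ f ρ (≤-trans (flatW-prefix x (step c q)) le) (proj₂ (fanin-prefix q fi))
           then exec-pushResult mx (flatW (wires p x)) (withAcc res (withCur (just endTok) f)) (tregsE after (tokGate c ʳ++ e′) (set rTMP [] (set rV′ [] ρ))) mx≤
           then exec-pop)
          (exec-from (cong (λ v → withAcc res (withCur (List.head after) f) ,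
                eregs (drop 1 after) (tokGate c ʳ++ e′) ((ticks (suc mx) ++ inj₁ v ∷ []) ++ flatW (wires p x)) ρ) (fold-gate (wireVal p x) c))
            (det-≡ (cong (λ z → withAcc a (withCur (just opOut) f) , eregs e z (flatW (wires t x)) ρ) (sym (List.++-ʳ++ (tokGate c)))) ih)))

  noGates : ∀ {j} → SLP m j 0
  noGates = inputs

  exec-evalLoop : ∀ {j} (D : Circuit m j) (x : Vec Bool j) f ρ {B} →
    FanIn B (gates D) → length (flatW (wires (gates D) x)) ≤ B → size D ≤ B → 1 ≤ B →
    Det evalLoop (f , tregsE (tokens D) [] (mregs 0 0 (flatW (wires (noGates {j}) x)) [] ρ)) (evalLoopT B)
      (withAcc (suc (suc (suc (suc zero))) , eval D x , zero) (withCur (just endTok) f) ,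
       tregsE [] (tokens D ʳ++ []) (mregs (depth D) 0 (flatW (wires (gates D) x)) [] ρ))
  exec-evalLoop {j} D@(circuit s t o) x f ρ {B} fi le s≤ 1≤B =
    let a , loop = gates-loop (prefix-inputs t) x (idxTok o ++ endTok ∷ []) [] f ρ fi le
    in exec-from (cong (λ z → f , tregsE (z ++ opOut ∷ idxTok o ++ endTok ∷ []) [] (mregs 0 0 (flatW (wires (noGates {j}) x)) [] ρ)) (sym (rest-inputs t)))
      (exec-pop then
       exec-mono (loopT-monoˡ _ (≤-trans (≤-reflexive (trans (sym (+-identityʳ _)) (rest-length-≡ (prefix-inputs t)))) s≤)) loop then
       exec-from (cong (λ z → withAcc a (withCur (just opOut) f) , eregs (z ++ endTok ∷ []) (rest-tokens (prefix-inputs t) ʳ++ []) (flatW (wires t x)) ρ)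
                   (sym (List.++-identityʳ (idxTok o))))
         (det-≡ (cong₂ (λ z d → withAcc (suc (suc (suc (suc zero))) , eval D x , zero) (withCur (just endTok) f) ,
                     tregsE [] z (mregs d 0 (flatW (wires t x)) [] ρ)) tok-eq (⊔-identityʳ (depth D)))
           (exec-gate t x (suc (suc (suc (suc zero)))) (o ∷ []) [] (rest-tokens (prefix-inputs t) ʳ++ []) (withAcc a f) ρ le 1≤B)))
    where
    tok-eq : (opOut ∷ idxToks (o ∷ []) ++ endTok ∷ []) ʳ++ (rest-tokens (prefix-inputs t) ʳ++ []) ≡ tokens D ʳ++ []
    tok-eq = trans (sym (List.++-ʳ++ (rest-tokens (prefix-inputs t))))
      (cong₂ (λ p z → (p ++ opOut ∷ z ++ endTok ∷ []) ʳ++ []) (rest-inputs t) (List.++-identityʳ (idxTok o)))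

-- Binary counters, the depth check and the evaluation on one input.

decr : List Bool → Maybe (List Bool)
decr []          = nothing
decr (true ∷ l)  = just (false ∷ l)
decr (false ∷ l) = Maybe.map (true ∷_) (decr l)

-- Least significant bit first. The flag `false` reports the wrap-around from all ones to all zeros,
-- which ends the loop over the inputs.
inc : ∀ {n} → Vec Bool n → Bool × Vec Bool n
inc []          = false , []
inc (false ∷ x) = true , true ∷ x
inc (true ∷ x)  = let g , x' = inc x in g , false ∷ x'

allFalse : List Bool → Bool
allFalse []      = true
allFalse (b ∷ l) = not b ∧ allFalse l

module Simulate (M : NTM) (m₁ : ℕ) where
  open EvalCircuit M m₁ public

  F₀ : F
  F₀ = mkF nothing false acc₀ startM S

  unwind : ∀ {B : Set} (xs : List B) → (xs ʳ++ []) ʳ++ [] ≡ xs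
  unwind xs = trans (List.ʳ++-ʳ++ xs) (List.++-identityʳ xs)

  map-unwind : ∀ {B : Set} (h : A → B) (xs : List A) → map h (xs ʳ++ []) ʳ++ [] ≡ map h xs
  map-unwind h xs = trans (cong (_ʳ++ []) (List.map-ʳ++ h xs)) (unwind (map h xs))

  copyBack : Fin 17 → (A → A) → Prog
  copyBack r h = forEach rTMP (push r (λ f → h (fromMaybe tck (cur f))) ⨾ pushc rX)

  copyTo : Fin 17 → (A → A) → Prog
  copyTo r h = pour rX rTMP ⨾ copyBack r h

  copyT : ℕ → ℕ
  copyT B = pourT B + forT B 2

  private
    copy-loop : ∀ r h (regs : List A → List A → List A → Registers) →
      (∀ a b c → get rTMP (regs a b c) ≡ c) → (∀ a b c c' → set rTMP c' (regs a b c) ≡ regs a b c') →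
      (∀ y a b c → set r (y ∷ get r (regs a b c)) (regs a b c) ≡ regs (y ∷ a) b c) →
      (∀ y a b c → set rX (y ∷ get rX (regs a b c)) (regs a b c) ≡ regs a (y ∷ b) c) →
      ∀ ys a b f → Det (copyBack r h) (f , regs a b ys) (forT (length ys) 2) (withCur nothing f , regs (map h ys ʳ++ a) (ys ʳ++ b) [])
    copy-loop r h regs gT sT pr pX ys a b f = pops ys a b then loop ys a b
      where
      pops : ∀ ys a b {g} → Det (popc rTMP) (g , regs a b ys) 1 (withCur (List.head ys) g , regs a b (drop 1 ys))
      pops ys a b {g} = det-≡ (cong₂ (λ z ρ → withCur (List.head z) g , ρ) (gT a b ys)
        (trans (cong (λ z → set rTMP (drop 1 z) (regs a b ys)) (gT a b ys)) (sT a b ys (drop 1 ys)))) exec-pop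
      body = push r (λ f → h (fromMaybe tck (cur f))) ⨾ pushc rX
      loop : ∀ ys a b → Det (while isJust (body ⨾ popc rTMP)) (withCur (List.head ys) f , regs a b (drop 1 ys)) (loopT (length ys) 3)
               (withCur nothing f , regs (map h ys ʳ++ a) (ys ʳ++ b) [])
      loop [] a b = while-stop refl
      loop (y ∷ ys) a b = while-det refl
        ((det-≡ (cong (withCur (just y) f ,_) (pr (h y) a b ys)) exec-push
          then det-≡ (cong (withCur (just y) f ,_) (pX y (h y ∷ a) b ys)) exec-push) then pops ys (h y ∷ a) (y ∷ b))
        (loop ys (h y ∷ a) (y ∷ b))

  -- `regs` abstracts from where the target, the source `rX` and the scratch register lie among the
  -- others, so that one proof serves for copying the input both to the wires and to the tape of M;
  -- its equations then hold by computation.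
  exec-copy : ∀ r h (regs : List A → List A → List A → Registers) →
    (∀ a b c → get rTMP (regs a b c) ≡ c) → (∀ a b c c' → set rTMP c' (regs a b c) ≡ regs a b c') →
    (∀ y a b c → set r (y ∷ get r (regs a b c)) (regs a b c) ≡ regs (y ∷ a) b c) →
    (∀ y a b c → set rX (y ∷ get rX (regs a b c)) (regs a b c) ≡ regs a (y ∷ b) c) →
    (∀ a b c b' → set rX b' (regs a b c) ≡ regs a b' c) → (∀ a b c → get rX (regs a b c) ≡ b) →
    ∀ xs f {B} → length xs ≤ B → Det (copyTo r h) (f , regs [] xs []) (copyT B) (withCur nothing f , regs (map h xs) xs [])
  exec-copy r h regs gT sT pr pX sX gX xs f {B} le =
    det-≡ (cong (withCur nothing f ,_) (trans (sX _ _ _ []) refl) ) pourX then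
    exec-mono (forT-mono 2 (≤-trans (≤-reflexive (trans (List.length-ʳ++ xs) (+-identityʳ _))) le))
      (det-≡ (cong₂ (λ u v → withCur nothing f , regs u v []) (map-unwind h xs) (unwind xs))
        (copy-loop r h regs gT sT pr pX (xs ʳ++ []) [] [] (withCur nothing f)))
    where
    pourX : Det (pour rX rTMP) (f , regs [] xs []) (pourT B) (withCur nothing f , set rX [] (regs [] xs (xs ʳ++ [])))
    pourX = det-≡ (cong (withCur nothing f ,_) (cong (set rX []) (trans (sT [] xs [] _)
        (cong₂ (λ u v → regs [] xs (u ʳ++ v)) (gX [] xs []) (gT [] xs [])))))
      (exec-pour rX rTMP (λ ()) {ρ = regs [] xs []} (≤-trans (≤-reflexive (cong length (gX [] xs []))) le))

  depthBody : Prog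
  depthBody = popc rDEP ⨾ guard isTick ⨾ pusha rTMP tck

  -- Pairs off the ticks of `rMX` with those of `rDEP` and gets stuck if the latter run out. The
  -- ticks used are poured back, because the check is repeated for every input.
  checkDepth : Prog
  checkDepth = forEach rMX depthBody ⨾ pour rTMP rDEP

  dregs : ℕ → ℕ → List A → Registers → Registers
  dregs d k mx ρ = set rMX mx (set rTMP (ticks k) (set rDEP (ticks d) ρ))

  private
    depth-loop : ∀ a d k f ρ → Exec (while isJust (depthBody ⨾ popc rMX))
      (withCur (List.head (ticks a)) f , dregs d k (drop 1 (ticks a)) ρ) (loopT a 4) {a ≤ d}
      (λ _ → withCur nothing f , dregs (d ∸ a) (a + k) [] ρ)
    depth-loop zero d k f ρ = det-index z≤n (λ _ → refl) (while-stop refl)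
    depth-loop (suc a) zero k f ρ = reindex {I = Σ (⊥ × ⊤) λ _ → ⊥} {out = λ i → ⊥-elim (proj₂ i)} (⊥-elim ∘ proj₂) (⊥-elim ∘ proj₂) (λ ()) (λ ())
      (while-step {T₂ = loopT a 4} {J = λ _ → ⊥} {out₂ = λ _ → ⊥-elim} refl
        (exec-seq {T₂ = 1} {I = ⊥} {J = λ _ → ⊤} {out₁ = ⊥-elim} {out₂ = ⊥-elim}
          (exec-pop then exec-fail {T = 1} refl id) (λ ())) (λ { (() , _) }))
    depth-loop (suc a) (suc d) k f ρ = reindex s≤s (λ _ → cong (λ n → withCur nothing f , dregs (d ∸ a) n [] ρ) (+-suc a k))
      ≤-pred (λ _ → cong (λ n → withCur nothing f , dregs (d ∸ a) n [] ρ) (sym (+-suc a k)))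
      (while-det refl ((exec-pop then exec-guard refl then exec-push) then exec-pop) (depth-loop a d (suc k) f ρ))

  checkDepthT : ℕ → ℕ
  checkDepthT B = forT B 3 + pourT B

  exec-checkDepth : ∀ a d f ρ {B} → a ≤ B →
    Exec checkDepth (f , dregs d 0 (ticks a) ρ) (checkDepthT B) {a ≤ d} (λ _ → withCur nothing f , dregs d 0 [] ρ)
  exec-checkDepth a d f ρ {B} le = reindex proj₁ (λ _ → refl) (_, tt) (λ _ → refl)
    (exec-seq {J = λ _ → ⊤} {out₂ = λ _ _ → withCur nothing f , dregs d 0 [] ρ}
      (exec-mono (forT-mono 3 le) (exec-pop then depth-loop a d 0 f ρ))
      (λ a≤d → det-≡ (cong (λ z → withCur nothing f , set rMX [] (set rTMP [] (set rDEP z ρ)))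
                 (trans (ticks-ʳ++ (a + 0) (d ∸ a)) (cong ticks (trans (cong (_+ (d ∸ a)) (+-identityʳ a)) (m+[n∸m]≡n a≤d)))))
        (exec-pour rTMP rDEP (λ ()) {ρ = dregs (d ∸ a) (a + 0) [] ρ} (≤-trans (≤-reflexive (trans (length-ticks (a + 0)) (+-identityʳ a))) le))))

  evalCircuit : Prog
  evalCircuit = copyTo rV id ⨾ evalLoop ⨾ upd (λ f → record f { cur = nothing ; go = finAcc (acc f) ; acc = acc₀ }) ⨾
                checkDepth ⨾ drain rV ⨾ pour rE′ rE

  evalCircuitT : ℕ → ℕ
  evalCircuitT B = copyT B + (evalLoopT B + (1 + (checkDepthT B + (pourT B + pourT B))))

  flatW-bits : ∀ (xs : List Bool) → flatW (map (0 ,_) xs) ≡ bits xs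
  flatW-bits []       = refl
  flatW-bits (b ∷ xs) = cong (inj₁ b ∷_) (flatW-bits xs)

  record Bounds {j} (D : Circuit m j) (x : Vec Bool j) (B : ℕ) : Set where
    field
      fan-in  : FanIn B (gates D)
      wires≤  : length (flatW (wires (gates D) x)) ≤ B
      size≤   : size D ≤ B
      1≤B     : 1 ≤ B
      tokens≤ : length (tokens D) ≤ B
      input≤  : j ≤ B

  lregs : ∀ {j} → Circuit m j → ℕ → List Bool → List Bool → Registers → Registers
  lregs D d x t ρ = set rE (tokens D) (set rE′ [] (set rX (bits x) (set rV [] (set rV′ [] (set rMX [] (set rTMP []
    (set rDEP (ticks d) (set rT (bits t) (set rL [] (set rR [] ρ))))))))))

  exec-evalCircuit : ∀ {j} (D : Circuit m j) (x : Vec Bool j) d t ρ {B} → Bounds D x B →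
    Exec evalCircuit (F₀ , lregs D d (toList x) t ρ) (evalCircuitT B) {depth D ≤ d}
         (λ _ → record F₀ { go = eval D x } , lregs D d (toList x) t ρ)
  exec-evalCircuit {j} D x d t ρ {B} bd =
    exec-copy rV id (λ a b c → set rV a (set rX b (set rTMP c ρ₁))) (λ _ _ _ → refl) (λ _ _ _ _ → refl) (λ _ _ _ _ → refl)
      (λ _ _ _ _ → refl) (λ _ _ _ _ → refl) (λ _ _ _ → refl) (bits (toList x)) F₀
      (≤-trans (≤-reflexive (trans (List.length-map inj₁ (toList x)) (Vec.length-toList x))) input≤)
    then exec-from (cong (λ z → F₀ , set rV z ρ₁) (trans (List.map-id (bits (toList x))) (sym (flatW-bits (toList x)))))
      (exec-evalLoop D x F₀ ρ₁ fan-in wires≤ size≤ 1≤B)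
    then exec-upd
    then reindex proj₁ (λ _ → refl) (_, tt) (λ _ → refl)
      (exec-seq {J = λ _ → ⊤} {out₂ = λ _ _ → record F₀ { go = eval D x } , lregs D d (toList x) t ρ}
        (exec-checkDepth (depth D) d (record F₀ { go = eval D x })
           (tregsE [] (tokens D ʳ++ []) (set rV (flatW (wires (gates D) x)) ρ₁)) depth≤)
        (λ _ → exec-drain rV {ρ = tregsE [] (tokens D ʳ++ []) (set rV (flatW (wires (gates D) x)) ρ₁)} wires≤ then
          det-≡ (cong (λ z → record F₀ { go = eval D x } , set rE z ρ₁) (unwind (tokens D)))
            (exec-pour rE′ rE (λ ()) {ρ = tregsE [] (tokens D ʳ++ []) ρ₁}
              (≤-trans (≤-reflexive (trans (List.length-ʳ++ (tokens D)) (+-identityʳ _))) tokens≤))))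
    where
    import Data.Vec.Properties as Vec
    open Bounds bd
    ρ₁ = lregs D d (toList x) t ρ
    depth≤ : depth D ≤ B
    depth≤ = let pre , post , W≡ , _ = wires-at (gates D) x (out D) in
      ≤-trans (depth≤flatW (wires (gates D) x) (depth D , eval D x)
        (subst ((depth D , eval D x) ∈_) (sym W≡) (∈-++⁺ʳ pre (here refl)))) wires≤
      where open import Data.List.Membership.Propositional.Properties using (∈-++⁺ʳ)

  decT : Prog
  decT = popc rT ⨾ while isFalse (pusha rTMP (inj₁ true) ⨾ popc rT) ⨾ guard isTrue ⨾ pusha rT (inj₁ false) ⨾ pour rTMP rT

  decTT : ℕ → ℕ
  decTT B = 1 + (loopT B 2 + (1 + (1 + pourT B)))

  -- A borrow runs through the leading zeros to the first one. If there is no one, the number is 0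
  -- and the guard in `decT` fails: D accepts more inputs than claimed.
  data Lead : List Bool → Set where
    zeros : ∀ n → Lead (replicate n false)
    lead  : ∀ n r → Lead (replicate n false ++ true ∷ r)

  lead-view : ∀ t → Lead t
  lead-view [] = zeros 0
  lead-view (true ∷ t) = lead 0 t
  lead-view (false ∷ t) with lead-view t
  ... | zeros n  = zeros (suc n)
  ... | lead n r = lead (suc n) r

  decr-zeros : ∀ n → decr (replicate n false) ≡ nothing
  decr-zeros zero    = refl
  decr-zeros (suc n) = cong (Maybe.map (true ∷_)) (decr-zeros n)

  decr-lead : ∀ n r → decr (replicate n false ++ true ∷ r) ≡ just (replicate n true ++ false ∷ r)
  decr-lead zero    r = refl
  decr-lead (suc n) r = cong (Maybe.map (true ∷_)) (decr-lead n r)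

  private
    trues : ℕ → List A
    trues k = replicate k (inj₁ true)

    decT-loop : ∀ n r k ρ → isFalse (withCur (List.head (bits r)) F₀) ≡ false →
      Det (while isFalse (pusha rTMP (inj₁ true) ⨾ popc rT))
        (withCur (List.head (bits (replicate n false ++ r))) F₀ , set rT (drop 1 (bits (replicate n false ++ r))) (set rTMP (trues k) ρ))
        (loopT n 2) (withCur (List.head (bits r)) F₀ , set rT (drop 1 (bits r)) (set rTMP (trues (n + k)) ρ))
    decT-loop zero    r k ρ e = while-stop e
    decT-loop (suc n) r k ρ e = while-det refl (exec-push then exec-pop)
      (det-≡ (cong (λ z → withCur (List.head (bits r)) F₀ , set rT (drop 1 (bits r)) (set rTMP (trues z) ρ)) (+-suc n k)) (decT-loop n r (suc k) ρ e))

  exec-decT : ∀ t ρ {B} → length t ≤ B →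
    Exec decT (F₀ , set rT (bits t) (set rTMP [] ρ)) (decTT B) {∃[ t' ] decr t ≡ just t'} (λ i → F₀ , set rT (bits (proj₁ i)) (set rTMP [] ρ))
  exec-decT t ρ {B} le with lead-view t
  ... | zeros n = exec-pop then exec-mono (+-monoˡ-≤ _ (loopT-monoˡ 2 (≤-trans (≤-reflexive (sym (List.length-replicate n))) le)))
    (exec-from (cong (λ z → withCur (List.head (bits z)) F₀ , set rT (drop 1 (bits z)) (set rTMP [] ρ)) (sym (List.++-identityʳ (replicate n false))))
      (decT-loop n [] 0 ρ refl) then exec-fail refl (λ { (_ , e) → impossible (trans (sym (decr-zeros n)) e) }))
    where
    impossible : ∀ {t' : List Bool} → nothing ≢ just t'
    impossible ()
  ... | lead n r = det-index (_ , decr-lead n r)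
      (λ { (t' , e) → cong (λ z → F₀ , set rT (bits z) (set rTMP [] ρ)) (just-injective (trans (sym e) (decr-lead n r))) })
      (exec-pop then exec-mono (+-monoˡ-≤ _ (loopT-monoˡ 2 n≤)) (decT-loop n (true ∷ r) 0 ρ refl then exec-guard refl then exec-push then
         det-≡ (cong (λ z → F₀ , set rT z (set rTMP [] ρ)) eq)
           (exec-pour rTMP rT (λ ()) {ρ = set rT (inj₁ false ∷ bits r) (set rTMP (trues (n + 0)) ρ)} (≤-trans (≤-reflexive (trans (List.length-replicate (n + 0)) (+-identityʳ n))) n≤))))
    where
    open import Data.Maybe.Properties using (just-injective)
    n≤ : n ≤ B
    n≤ = ≤-trans (≤-reflexive (sym (List.length-replicate n))) (≤-trans (m≤m+n _ _) (≤-trans (≤-reflexive (sym (List.length-++ (replicate n false)))) le))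
    eq : trues (n + 0) ʳ++ (inj₁ false ∷ bits r) ≡ bits (replicate n true ++ false ∷ r)
    eq = trans (cong (λ k → trues k ʳ++ (inj₁ false ∷ bits r)) (+-identityʳ n)) (trans (replicate-ʳ++-++ (inj₁ true) n)
      (sym (trans (List.map-++ inj₁ (replicate n true) (false ∷ r)) (cong (_++ inj₁ false ∷ bits r) (List.map-replicate inj₁ n true)))))

  incX : Prog
  incX = popc rX ⨾ while isTrue (pusha rTMP (inj₁ false) ⨾ popc rX) ⨾
         ite isFalse (pusha rX (inj₁ true) ⨾ upd (λ f → record f { cur = nothing ; go = true })) (upd (λ f → record f { cur = nothing ; go = false })) ⨾
         pour rTMP rX

  incXT : ℕ → ℕ
  incXT B = 1 + (loopT B 2 + (3 + pourT B))

  data IncView {n} (x : Vec Bool n) : Set where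
    full : toList x ≡ replicate n true → proj₁ (inc x) ≡ false → toList (proj₂ (inc x)) ≡ replicate n false → IncView x
    room : ∀ i r → i ≤ n → toList x ≡ replicate i true ++ false ∷ r → proj₁ (inc x) ≡ true →
           toList (proj₂ (inc x)) ≡ replicate i false ++ true ∷ r → IncView x

  inc-view : ∀ {n} (x : Vec Bool n) → IncView x
  inc-view []          = full refl refl refl
  inc-view (false ∷ x) = room 0 (toList x) z≤n refl refl refl
  inc-view (true ∷ x) with inc-view x
  ... | full e₁ e₂ e₃         = full (cong (true ∷_) e₁) e₂ (cong (false ∷_) e₃)
  ... | room i r le e₁ e₂ e₃ = room (suc i) r (s≤s le) (cong (true ∷_) e₁) e₂ (cong (false ∷_) e₃)

  private
    falses : ℕ → List A
    falses k = replicate k (inj₁ false)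

    falses-ʳ++ : ∀ n r → falses n ʳ++ bits r ≡ bits (replicate n false ++ r)
    falses-ʳ++ n r = trans (replicate-ʳ++-++ (inj₁ false) n)
      (sym (trans (List.map-++ inj₁ (replicate n false) r) (cong (_++ bits r) (List.map-replicate inj₁ n false))))

    inc-loop : ∀ n r k ρ → isTrue (withCur (List.head (bits r)) F₀) ≡ false →
      Det (while isTrue (pusha rTMP (inj₁ false) ⨾ popc rX))
        (withCur (List.head (bits (replicate n true ++ r))) F₀ , set rX (drop 1 (bits (replicate n true ++ r))) (set rTMP (falses k) ρ))
        (loopT n 2) (withCur (List.head (bits r)) F₀ , set rX (drop 1 (bits r)) (set rTMP (falses (n + k)) ρ))
    inc-loop zero    r k ρ e = while-stop e
    inc-loop (suc n) r k ρ e = while-det refl (exec-push then exec-pop)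
      (det-≡ (cong (λ z → withCur (List.head (bits r)) F₀ , set rX (drop 1 (bits r)) (set rTMP (falses z) ρ)) (+-suc n k)) (inc-loop n r (suc k) ρ e))

  exec-incX : ∀ {n} (x : Vec Bool n) ρ {B} → n ≤ B →
    Det incX (F₀ , set rX (bits (toList x)) (set rTMP [] ρ)) (incXT B)
        (record F₀ { go = proj₁ (inc x) } , set rX (bits (toList (proj₂ (inc x)))) (set rTMP [] ρ))
  exec-incX {n} x ρ {B} le with inc-view x
  ... | full e₁ e₂ e₃ = exec-from (cong (λ z → F₀ , set rX (bits z) (set rTMP [] ρ)) (trans e₁ (sym (List.++-identityʳ _))))
    (exec-pop then exec-mono (loopT-monoˡ 2 le) (inc-loop n [] 0 ρ refl) then
     exec-mono {T' = 3} (s≤s (s≤s z≤n)) (exec-false refl exec-upd) then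
     det-≡ (cong₂ (λ g z → record F₀ { go = g } , set rX z (set rTMP [] ρ)) (sym e₂)
             (trans (falses-ʳ++ (n + 0) []) (cong bits (trans (List.++-identityʳ _) (trans (cong (λ k → replicate k false) (+-identityʳ n)) (sym e₃))))))
       (exec-pour rTMP rX (λ ()) {ρ = set rX [] (set rTMP (falses (n + 0)) ρ)} (≤-trans (≤-reflexive (trans (List.length-replicate (n + 0)) (+-identityʳ n))) le)))
  ... | room i r i≤ e₁ e₂ e₃ = exec-from (cong (λ z → F₀ , set rX (bits z) (set rTMP [] ρ)) e₁)
    (exec-pop then exec-mono (loopT-monoˡ 2 (≤-trans i≤ le)) (inc-loop i (false ∷ r) 0 ρ refl) then
     exec-true refl (exec-push then exec-upd) then
     det-≡ (cong₂ (λ g z → record F₀ { go = g } , set rX z (set rTMP [] ρ)) (sym e₂)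
             (trans (falses-ʳ++ (i + 0) (true ∷ r)) (cong bits (trans (cong (λ k → replicate k false ++ true ∷ r) (+-identityʳ i)) (sym e₃)))))
       (exec-pour rTMP rX (λ ()) {ρ = set rX (bits (true ∷ r)) (set rTMP (falses (i + 0)) ρ)} (≤-trans (≤-reflexive (trans (List.length-replicate (i + 0)) (+-identityʳ i))) (≤-trans i≤ le))))

-- Simulation of a nondeterministic machine by a program

module _ (M : NTM) where
  open NTM M

  hd : List (Sym nΓ) → Sym nΓ
  hd []      = blank
  hd (s ∷ _) = s

  tapeOf : List (Sym nΓ) → List (Sym nΓ) → Tape nΓ
  tapeOf l r = tape l (hd r) (drop 1 r)

  moved : Move → Sym nΓ → List (Sym nΓ) → List (Sym nΓ) → List (Sym nΓ) × List (Sym nΓ)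
  moved S a l r       = l , a ∷ drop 1 r
  moved R a l r       = a ∷ l , drop 1 r
  moved L a [] r      = [] , blank ∷ a ∷ drop 1 r
  moved L a (s ∷ l) r = l , s ∷ a ∷ drop 1 r

  tapeOf-moved : ∀ mv a l r → tapeOf (proj₁ (moved mv a l r)) (proj₂ (moved mv a l r)) ≡ move mv (write a (tapeOf l r))
  tapeOf-moved S a l r           = refl
  tapeOf-moved R a l []          = refl
  tapeOf-moved R a l (_ ∷ [])    = refl
  tapeOf-moved R a l (_ ∷ s ∷ r) = refl
  tapeOf-moved L a [] r          = refl
  tapeOf-moved L a (s ∷ l) r     = refl

  -- Accepting runs cut off at the first visit to the accepting state, which is where the simulating
  -- loop stops. The tape is held in two stacks, the scanned cell on top of the right one.
  data Sim (q : Fin nQ) (l r : List (Sym nΓ)) : Set where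
    halted  : q ≡ accept → Sim q l r
    stepped : q ≢ accept → ∀ q' a mv → (q' , a , mv) ∈ δ q (hd r) →
              Sim q' (proj₁ (moved mv a l r)) (proj₂ (moved mv a l r)) → Sim q l r

  accepted : ∀ {n q l r c} → NRun M n (cfg q (tapeOf l r)) c → state c ≡ accept → Sim q l r
  accepted done e = halted e
  accepted {q = q} {l} {r} (more (nstep {q' = q'} {a} {mv} i) run) e with q Fin.≟ accept
  ... | yes e′ = halted e′
  ... | no ne  = stepped ne q' a mv i (accepted (subst (λ t → NRun M _ (cfg q' t) _) (sym (tapeOf-moved mv a l r)) run) e)

  sim-run : ∀ {q l r} → Sim q l r → ∃[ n ] ∃[ c ] (NRun M n (cfg q (tapeOf l r)) c × state c ≡ accept)
  sim-run (halted e) = 0 , _ , done , e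
  sim-run {q} {l} {r} (stepped _ q' a mv i s) =
    let n , c , run , e = sim-run s
    in suc n , c , more (nstep i) (subst (λ t → NRun M n (cfg q' t) c) (tapeOf-moved mv a l r) run) , e

  init-tape : ∀ x → initTape x ≡ tapeOf [] (map bitSym x)
  init-tape []      = refl
  init-tape (b ∷ x) = refl

  sim-accepts : ∀ x → Sim start [] (map bitSym x) ⇔ NAccepts M x
  sim-accepts x = mk⇔
    (λ s → let n , c , run , e = sim-run s in n , c , subst (λ t → NRun M n (cfg start t) c) (sym (init-tape x)) run , e)
    (λ { (n , c , run , e) → accepted (subst (λ t → NRun M n (cfg start t) c) (init-tape x) run) e })

module SimulateM (M : NTM) (m₁ : ℕ) where
  open Simulate M m₁ public

  symOf : Maybe A → Sym nΓ
  symOf (just (inj₂ (ms s))) = s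
  symOf _                    = blank

  msA : Sym nΓ → A
  msA s = inj₂ (ms s)

  transitions : F → List F
  transitions f = map (λ { (q , a , mv) → record f { cur = just (msA a) ; st = q ; dir = mv } }) (δM (st f) (symOf (cur f)))

  isS isR notAccepting : F → Bool
  isS f = test (dir f)
    where test : Move → Bool
          test S = true
          test _ = false
  isR f = test (dir f)
    where test : Move → Bool
          test R = true
          test _ = false
  notAccepting f = not ⌊ st f Fin.≟ acceptM ⌋

  moveHead : Prog
  moveHead = ite isS (pushc rR) (ite isR (pushc rL) (pushc rR ⨾ popc rL ⨾ push rR (λ f → msA (symOf (cur f)))))

  simStep : Prog
  simStep = popc rR ⨾ choose transitions ⨾ moveHead

  sregs : List (Sym nΓ) → List (Sym nΓ) → Registers → Registers
  sregs l r ρ = set rL (map msA l) (set rR (map msA r) ρ)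

  simF : Maybe A → Fin nQ → Move → F
  simF c q d = mkF c false acc₀ q d

  -- What `cur` contains after the move; it is tracked because `Exec` determines the whole control
  -- data.
  lastRead : Move → Sym nΓ → List (Sym nΓ) → Maybe A
  lastRead L a l = List.head (map msA l)
  lastRead _ a l = just (msA a)

  private
    symOf-head : ∀ r → symOf (List.head (map msA r)) ≡ hd M r
    symOf-head []      = refl
    symOf-head (s ∷ r) = refl

    drop-map : ∀ r → drop 1 (map msA r) ≡ map msA (drop 1 r)
    drop-map []      = refl
    drop-map (s ∷ r) = refl

    exec-moveHead : ∀ q a mv l r ρ → Det moveHead (simF (just (msA a)) q mv , set rL (map msA l) (set rR (drop 1 (map msA r)) ρ)) 5
      (simF (lastRead mv a l) q mv , sregs (proj₁ (moved M mv a l r)) (proj₂ (moved M mv a l r)) ρ)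
    exec-moveHead q a S l r ρ = exec-from (cong (λ z → simF (just (msA a)) q S , set rL (map msA l) (set rR z ρ)) (drop-map r))
      (exec-mono (s≤s (s≤s z≤n)) (exec-true refl exec-push))
    exec-moveHead q a R l r ρ = exec-from (cong (λ z → simF (just (msA a)) q R , set rL (map msA l) (set rR z ρ)) (drop-map r))
      (exec-mono (s≤s (s≤s (s≤s z≤n))) (exec-false refl (exec-true refl exec-push)))
    exec-moveHead q a L [] r ρ = exec-from (cong (λ z → simF (just (msA a)) q L , set rL [] (set rR z ρ)) (drop-map r))
      (exec-false refl (exec-false refl (exec-push then exec-pop then exec-push)))
    exec-moveHead q a L (s ∷ l) r ρ = exec-from (cong (λ z → simF (just (msA a)) q L , set rL (map msA (s ∷ l)) (set rR z ρ)) (drop-map r))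
      (exec-false refl (exec-false refl (exec-push then exec-pop then exec-push)))

    exec-transitions : ∀ c q d r ρ → symOf c ≡ hd M r →
      Exec (choose transitions) (simF c q d , ρ) 1 {∃[ x ] x ∈ δM q (hd M r)} (λ { ((q' , a , mv) , _) → simF (just (msA a)) q' mv , ρ })
    exec-transitions c q d r ρ e = reindex
      (λ { (f' , i) → let x , x∈ , _ = ∈-map⁻ g i in x , subst (λ s → x ∈ δM q s) e x∈ })
      (λ { (f' , i) → cong (_, ρ) (proj₂ (proj₂ (∈-map⁻ g i))) })
      (λ { (x , x∈) → g x , ∈-map⁺ g (subst (λ s → x ∈ δM q s) (sym e) x∈) })
      (λ _ → refl) exec-choose
      where
      g : Fin nQ × Sym nΓ × Move → F
      g (q' , a , mv) = simF (just (msA a)) q' mv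

    exec-simStep : ∀ c q d l r ρ → Exec simStep (simF c q d , sregs l r ρ) 7 {∃[ x ] x ∈ δM q (hd M r)}
      (λ { ((q' , a , mv) , _) → simF (lastRead mv a l) q' mv , sregs (proj₁ (moved M mv a l r)) (proj₂ (moved M mv a l r)) ρ })
    exec-simStep c q d l r ρ = exec-pop then
      reindex proj₁ (λ _ → refl) (_, tt) (λ _ → refl)
        (exec-seq {J = λ _ → ⊤} {out₂ = λ { ((q' , a , mv) , _) _ → simF (lastRead mv a l) q' mv , sregs (proj₁ (moved M mv a l r)) (proj₂ (moved M mv a l r)) ρ }}
          (exec-transitions (List.head (map msA r)) q d r (set rL (map msA l) (set rR (drop 1 (map msA r)) ρ)) (symOf-head r))
          (λ { ((q' , a , mv) , _) → exec-moveHead q' a mv l r ρ }))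

  finalF : ∀ {q l r} → Maybe A → Move → Sim M q l r → F
  finalF {q} c d (halted _)               = simF c q d
  finalF {l = l} c d (stepped _ q' a mv _ s) = finalF (lastRead mv a l) mv s

  finalTape : ∀ {q l r} → Sim M q l r → List (Sym nΓ) × List (Sym nΓ)
  finalTape {l = l} {r} (halted _)       = l , r
  finalTape (stepped _ _ _ _ _ s)        = finalTape s

  tapeSize : List (Sym nΓ) × List (Sym nΓ) → ℕ
  tapeSize (l , r) = length l + length r

  moved-size : ∀ mv a l r → tapeSize (moved M mv a l r) ≤ 2 + (length l + length r)
  moved-size S a l [] = ≤-trans (≤-reflexive (trans (+-comm (length l) 1) (cong suc (sym (+-identityʳ (length l)))))) (n≤1+n _)
  moved-size S a l (s ∷ r) = ≤-trans (n≤1+n _) (n≤1+n _)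
  moved-size R a l [] = n≤1+n _
  moved-size R a l (s ∷ r) = ≤-trans (s≤s (+-monoʳ-≤ (length l) (n≤1+n _))) (n≤1+n _)
  moved-size L a [] [] = ≤-refl
  moved-size L a [] (s ∷ r) = n≤1+n _
  moved-size L a (x ∷ l) [] = ≤-trans (≤-reflexive (trans (+-comm (length l) 2) (cong (2 +_) (sym (+-identityʳ (length l)))))) (n≤1+n _)
  moved-size L a (x ∷ l) (s ∷ r) = ≤-trans (≤-reflexive (+-suc (length l) (suc (length r)))) (≤-trans (n≤1+n _) (n≤1+n _))

  simLoop : Prog
  simLoop = while notAccepting simStep

  private
    no-steps : ∀ {q l r} → (∀ c → ¬ NRun M 1 (cfg q (tapeOf M l r)) c) → ∀ x → ¬ (x ∈ δM q (hd M r))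
    no-steps bd (q' , a , mv) i = bd _ (more (nstep i) done)

    fewer : ∀ {T q l r q' a mv} → (∀ c → ¬ NRun M (suc (suc T)) (cfg q (tapeOf M l r)) c) → (q' , a , mv) ∈ δM q (hd M r) →
            ∀ c → ¬ NRun M (suc T) (cfg q' (tapeOf M (proj₁ (moved M mv a l r)) (proj₂ (moved M mv a l r)))) c
    fewer {T} {q} {l} {r} {q'} {a} {mv} bd i c run =
      bd c (more (nstep i) (subst (λ t → NRun M (suc T) (cfg q' t) c) (tapeOf-moved M mv a l r) run))

    not-accepting : ∀ c q d → q ≢ acceptM → notAccepting (simF c q d) ≡ true
    not-accepting c q d ne with q Fin.≟ acceptM
    ... | yes e = ⊥-elim (ne e)
    ... | no _  = refl

    accepting : ∀ c q d → q ≡ acceptM → notAccepting (simF c q d) ≡ false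
    accepting c q d e with q Fin.≟ acceptM
    ... | yes _ = refl
    ... | no ne = ⊥-elim (ne e)

  -- A move lengthens the two stacks by at most two cells: a virtual blank that becomes real and a
  -- new one beyond the left end. The result bounds the cost of clearing the tape before the next
  -- input.
  final-size : ∀ T {q l r} → (∀ c → ¬ NRun M (suc T) (cfg q (tapeOf M l r)) c) → (s : Sim M q l r) →
               tapeSize (finalTape s) ≤ 2 * T + (length l + length r)
  final-size T bd (halted _) = m≤n+m _ (2 * T)
  final-size zero {l = l} {r = r} bd (stepped _ q' a mv i s) = ⊥-elim (no-steps {l = l} {r = r} bd _ i)
  final-size (suc T) {q} {l} {r} bd (stepped _ q' a mv i s) = ≤-trans (final-size T (fewer {l = l} {r = r} bd i) s)
    (≤-trans (+-monoʳ-≤ (2 * T) (moved-size mv a l r)) (≤-reflexive (trans (sym (+-assoc (2 * T) 2 _))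
      (cong (_+ (length l + length r)) (trans (+-comm (2 * T) 2) (sym (*-suc 2 T)))))))

  -- The program keeps no clock: the time bound concerns all paths of M, so every path of the loop
  -- accepts or gets stuck within T + 1 rounds.
  exec-simLoop : ∀ T c q d l r ρ → (∀ c → ¬ NRun M (suc T) (cfg q (tapeOf M l r)) c) →
    Exec simLoop (simF c q d , sregs l r ρ) (loopT (suc T) 7) {Sim M q l r}
         (λ s → finalF c d s , sregs (proj₁ (finalTape s)) (proj₂ (finalTape s)) ρ)
  exec-simLoop T c q d l r ρ bd with q Fin.≟ acceptM
  ... | yes e = exec-mono (s≤s z≤n) (det-index (halted e)
    (λ { (halted _) → refl ; (stepped ne _ _ _ _ _) → ⊥-elim (ne e) }) (while-stop (accepting c q d e)))
  ... | no ne = reindex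
    (λ { (((q' , a , mv) , i) , s) → stepped ne q' a mv i s }) (λ _ → refl)
    (λ { (halted e) → ⊥-elim (ne e) ; (stepped _ q' a mv i s) → ((q' , a , mv) , i) , s })
    (λ { (halted e) → ⊥-elim (ne e) ; (stepped _ q' a mv i s) → refl })
    (while-step {J = λ { ((q' , a , mv) , _) → Sim M q' (proj₁ (moved M mv a l r)) (proj₂ (moved M mv a l r)) }}
                {out₂ = λ { ((q' , a , mv) , _) s → finalF (lastRead mv a l) mv s , sregs (proj₁ (finalTape s)) (proj₂ (finalTape s)) ρ }}
      (not-accepting c q d ne) (exec-simStep c q d l r ρ) (λ { ((q' , a , mv) , i) → continue T bd q' a mv i }))
    where
    continue : ∀ T → (∀ c → ¬ NRun M (suc T) (cfg q (tapeOf M l r)) c) → ∀ q' a mv → (q' , a , mv) ∈ δM q (hd M r) →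
      Exec simLoop (simF (lastRead mv a l) q' mv , sregs (proj₁ (moved M mv a l r)) (proj₂ (moved M mv a l r)) ρ) (loopT T 7)
        {Sim M q' (proj₁ (moved M mv a l r)) (proj₂ (moved M mv a l r))}
        (λ s → finalF (lastRead mv a l) mv s , sregs (proj₁ (finalTape s)) (proj₂ (finalTape s)) ρ)
    continue zero bd q' a mv i = ⊥-elim (no-steps {l = l} {r = r} bd _ i)
    continue (suc T) bd q' a mv i = exec-simLoop T (lastRead mv a l) q' mv _ _ ρ (fewer {l = l} {r = r} bd i)

  toMS : A → A
  toMS (inj₁ b) = msA (bitSym b)
  toMS a        = a

  simulate : Prog
  simulate = copyTo rR toMS ⨾ simLoop ⨾ drain rL ⨾ drain rR ⨾ upd (λ _ → F₀)

  simulateT : ℕ → ℕ → ℕ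
  simulateT T B = copyT B + (loopT (suc T) 7 + (pourT (2 * T + B) + (pourT (2 * T + B) + 1)))

  exec-simulate : ∀ T x ρ {B} → NTimeBounded M x T → length x ≤ B →
    Exec simulate (F₀ , set rX (bits x) (set rTMP [] (set rL [] (set rR [] ρ)))) (simulateT T B) {NAccepts M x}
         (λ _ → F₀ , set rX (bits x) (set rTMP [] (set rL [] (set rR [] ρ))))
  exec-simulate T x ρ {B} bd le = exec-copy rR toMS (λ a b c → set rR a (set rX b (set rTMP c (set rL [] ρ))))
      (λ _ _ _ → refl) (λ _ _ _ _ → refl) (λ _ _ _ _ → refl) (λ _ _ _ _ → refl) (λ _ _ _ _ → refl) (λ _ _ _ → refl)
      (bits x) F₀ (≤-trans (≤-reflexive (List.length-map inj₁ x)) le)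
    then exec-from (cong (λ z → F₀ , set rL [] (set rR z ρ₁)) (trans (sym (List.map-∘ x)) (List.map-∘ x)))
    (reindex (λ { (s , _) → Equivalence.to (sim-accepts M x) s }) (λ _ → refl) (λ a → Equivalence.from (sim-accepts M x) a , tt) (λ _ → refl)
      (exec-seq {J = λ _ → ⊤} {out₂ = λ _ _ → F₀ , set rL [] (set rR [] ρ₁)}
        (exec-simLoop T nothing startM S [] (map bitSym x) ρ₁ bd′)
        (λ s → let l = proj₁ (finalTape s) ; r = proj₂ (finalTape s) ; sz = sizes s in
          exec-drain rL {ρ = sregs l r ρ₁} (≤-trans (≤-reflexive (List.length-map msA l)) (≤-trans (m≤m+n (length l) (length r)) sz)) then
          exec-drain rR {ρ = set rL [] (set rR (map msA r) ρ₁)} (≤-trans (≤-reflexive (List.length-map msA r)) (≤-trans (m≤n+m (length r) (length l)) sz)) then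
          exec-upd)))
    where
    ρ₁ = set rX (bits x) (set rTMP [] ρ)
    bd′ : ∀ c → ¬ NRun M (suc T) (cfg startM (tapeOf M [] (map bitSym x))) c
    bd′ c run = bd c (subst (λ t → NRun M (suc T) (cfg startM t) c) (sym (init-tape M x)) run)
    sizes : (s : Sim M startM [] (map bitSym x)) → tapeSize (finalTape s) ≤ 2 * T + B
    sizes s = ≤-trans (final-size T bd′ s) (+-monoʳ-≤ (2 * T) (≤-trans (≤-reflexive (List.length-map bitSym x)) le))

-- The verifier

val : ∀ {n} → Vec Bool n → ℕ
val []          = 0
val (false ∷ x) = 2 * val x
val (true ∷ x)  = suc (2 * val x)

val-< : ∀ {n} (x : Vec Bool n) → val x < 2 ^ n
val-< []          = s≤s z≤n
val-< (false ∷ x) = *-monoʳ-< 2 (val-< x)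
val-< (true ∷ x)  = ≤-trans (≤-reflexive (sym (*-suc 2 (val x)))) (*-monoʳ-≤ 2 (val-< x))

val-inc : ∀ {n} (x : Vec Bool n) → proj₁ (inc x) ≡ true → val (proj₂ (inc x)) ≡ suc (val x)
val-inc (false ∷ x) e = refl
val-inc (true ∷ x)  e = trans (cong (2 *_) (val-inc x e)) (*-suc 2 (val x))

wireDepth-≤ : ∀ {m j g} (s : SLP m j g) i → wireDepth s i ≤ g
wireDepth-≤ inputs i = z≤n
wireDepth-≤ (s ▷ c) zero = s≤s (max≤ (gateInputs c))
  where
  max≤ : ∀ is → maxList (map (wireDepth s) is) ≤ _
  max≤ []       = z≤n
  max≤ (i ∷ is) = ⊔-lub (wireDepth-≤ s i) (max≤ is)
wireDepth-≤ (s ▷ c) (suc i) = ≤-trans (wireDepth-≤ s i) (n≤1+n _)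

length-encIdxs : ∀ {w} (is : List (Fin w)) → length is ≤ length (encIdxs is)
length-encIdxs [] = z≤n
length-encIdxs (i ∷ is) = ≤-trans (s≤s (length-encIdxs is)) (≤-trans
  (≤-trans (+-monoˡ-≤ (length (encIdxs is)) (m≤n+m 1 (toℕ i)))
    (≤-reflexive (cong (_+ length (encIdxs is)) (sym (trans (List.length-++ (replicate (toℕ i) true)) (cong (_+ 1) (List.length-replicate (toℕ i))))))))
  (≤-reflexive (sym (List.length-++ (unary (toℕ i))))))

length-++-≤ˡ : ∀ {A : Set} (xs : List A) {ys} → length xs ≤ length (xs ++ ys)
length-++-≤ˡ xs {ys} = ≤-trans (m≤m+n _ (length ys)) (≤-reflexive (sym (List.length-++ xs)))

length-++-≤ʳ : ∀ {A : Set} (xs : List A) {ys} → length ys ≤ length (xs ++ ys)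
length-++-≤ʳ xs {ys} = ≤-trans (m≤n+m _ (length xs)) (≤-reflexive (sym (List.length-++ xs)))

fan-in-≤ : ∀ {m w} (c : Gate m w) → length (gateInputs c) ≤ length (encGate c)
fan-in-≤ (NOT i)  = s≤s z≤n
fan-in-≤ (AND is) = ≤-trans (length-encIdxs is) (length-++-≤ʳ (unary 1 ++ unary (length is)))
fan-in-≤ (OR is)  = ≤-trans (length-encIdxs is) (length-++-≤ʳ (unary 2 ++ unary (length is)))
fan-in-≤ (MOD is) = ≤-trans (length-encIdxs is) (length-++-≤ʳ (unary 3 ++ unary (length is)))

FanIn-mono : ∀ {m j g B B'} (s : SLP m j g) → B ≤ B' → FanIn B s → FanIn B' s
FanIn-mono inputs  le _        = tt
FanIn-mono (s ▷ c) le (f , f') = FanIn-mono s le f , ≤-trans f' le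

FanIn-encSLP : ∀ {m j g} (s : SLP m j g) → FanIn (length (encSLP s)) s
FanIn-encSLP inputs  = tt
FanIn-encSLP (s ▷ c) = FanIn-mono s (length-++-≤ˡ (encSLP s)) (FanIn-encSLP s) ,
  ≤-trans (fan-in-≤ c) (length-++-≤ʳ (encSLP s))

encSLP-≤ : ∀ {m j} (D : Circuit m j) → length (encSLP (gates D)) ≤ length (encode D)
encSLP-≤ {m} {j} D = ≤-trans (length-++-≤ˡ (encSLP (gates D)))
  (≤-trans (length-++-≤ʳ (unary (size D))) (≤-trans (length-++-≤ʳ (unary j)) (length-++-≤ʳ (unary m))))

size-≤ : ∀ {m j} (D : Circuit m j) → size D ≤ length (encode D)
size-≤ {m} {j} D = ≤-trans (≤-trans (≤-reflexive (sym (List.length-replicate (size D)))) (length-++-≤ˡ (replicate (size D) true)))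
  (≤-trans (length-++-≤ˡ (unary (size D))) (≤-trans (length-++-≤ʳ (unary j)) (length-++-≤ʳ (unary m))))

out-≤ : ∀ {m j} (D : Circuit m j) → length (unary (toℕ (out D))) ≤ length (encode D)
out-≤ {m} {j} D = ≤-trans (length-++-≤ʳ (encSLP (gates D))) (≤-trans (length-++-≤ʳ (unary (size D)))
  (≤-trans (length-++-≤ʳ (unary j)) (length-++-≤ʳ (unary m))))

decr-length : ∀ t {t'} → decr t ≡ just t' → length t' ≡ length t
decr-length (true ∷ t) refl = refl
decr-length (false ∷ t) e with decr t in eq
decr-length (false ∷ t) refl | just u = cong suc (decr-length t eq)

module MainLoop (M : NTM) (m₁ : ℕ) where
  open SimulateM M m₁ public

  -- One bound for all loops over a circuit with encoding length at most N: at most N + j wires with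
  -- records of length at most N + 1, then the tokens, then enough for N itself and for the j + 1
  -- bits of the counter.
  bound : ℕ → ℕ → ℕ
  bound N j = (N + j) * suc N + (tokensBound N + (1 + (N + suc j)))

  private
    wires-bound : ∀ {j g N} (s : SLP m j g) (x : Vec Bool j) → g ≤ N → length (flatW (wires s x)) ≤ (g + j) * suc N
    wires-bound {j} {N = N} inputs x _ = ≤-trans (≤-reflexive (trans (cong length (flatW-bits (toList x))) (trans (List.length-map inj₁ (toList x)) (Vec.length-toList x))))
      (m≤m*n j (suc N))
      where import Data.Vec.Properties as Vec
    wires-bound {j} {suc g} {N} (s ▷ c) x le = ≤-trans (≤-reflexive (trans (cong length (flatW-cons r (wires s x))) (List.length-++ (flatW (r ∷ [])))))
      (+-mono-≤ (≤-trans (≤-reflexive rec-length) (s≤s (≤-trans (wireDepth-≤ (s ▷ c) zero) le))) (wires-bound s x (≤-trans (n≤1+n g) le)))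
      where
      r = wireDepth (s ▷ c) zero , wireVal (s ▷ c) x zero
      rec-length : length (flatW (r ∷ [])) ≡ suc (proj₁ r)
      rec-length = trans (cong length (List.++-identityʳ (ticks (proj₁ r) ++ inj₁ (proj₂ r) ∷ []))) (trans (List.length-++ (ticks (proj₁ r)))
        (trans (+-comm _ 1) (cong suc (length-ticks (proj₁ r)))))

  bounds : ∀ {j N} (D : Circuit m j) (x : Vec Bool j) → length (encode D) ≤ N → Bounds D x (bound N j)
  bounds {j} {N} D x le = record
    { fan-in = FanIn-mono (gates D) (≤-trans (encSLP-≤ D) (≤-trans le N≤)) (FanIn-encSLP (gates D))
    ; wires≤ = ≤-trans (wires-bound (gates D) x s≤N) (≤-trans (*-monoˡ-≤ (suc N) (+-monoˡ-≤ j s≤N)) (m≤m+n _ _))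
    ; size≤ = ≤-trans s≤N N≤
    ; 1≤B = ≤-trans (s≤s z≤n) (≤-trans (m≤n+m _ (tokensBound N)) (m≤n+m _ ((N + j) * suc N)))
    ; tokens≤ = ≤-trans tok (≤-trans (m≤m+n (tokensBound N) _) (m≤n+m _ ((N + j) * suc N)))
    ; input≤ = ≤-trans (≤-trans (n≤1+n j) (m≤n+m (suc j) N)) (≤-trans (n≤1+n _) (≤-trans (m≤n+m _ (tokensBound N)) (m≤n+m _ ((N + j) * suc N))))
    }
    where
    s≤N = ≤-trans (size-≤ D) le
    N≤ : N ≤ bound N j
    N≤ = ≤-trans (m≤m+n N (suc j)) (≤-trans (n≤1+n _) (≤-trans (m≤n+m _ (tokensBound N)) (m≤n+m _ ((N + j) * suc N))))
    e≤ : length (encSLP (gates D)) ≤ N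
    e≤ = ≤-trans (encSLP-≤ D) le
    tok : length (tokens D) ≤ tokensBound N
    tok = ≤-trans (≤-reflexive (trans (List.length-++ (tokSLP (gates D))) (trans (+-comm (length (tokSLP (gates D))) _)
        (cong (λ k → suc (k + length (tokSLP (gates D)))) (trans (List.length-++ (idxTok (out D))) (+-comm _ 1))))))
      (s≤s (≤-trans (≤-reflexive (sym (+-suc _ _))) (+-mono-≤
         (≤-trans (≤-reflexive (List.length-map inj₁ (unary (toℕ (out D))))) (≤-trans (out-≤ D) le))
         (s≤s (≤-trans (length-tokSLP (gates D)) (+-mono-≤ e≤ e≤))))))

  -- The claimed count goes down by one for each accepted input, so that it ends at 0 exactly if it
  -- was right. The increment leaves in `go` whether another input follows.
  loopBody : Prog
  loopBody = upd (λ _ → F₀) ⨾ evalCircuit ⨾ ite go (upd (λ _ → F₀) ⨾ decT ⨾ simulate) skip ⨾ incX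

  afterT : ℕ → ℕ → ℕ
  afterT T B = 1 + (1 + (decTT B + simulateT T B))

  loopBodyT : ℕ → ℕ → ℕ
  loopBodyT T B = 1 + (evalCircuitT B + (afterT T B + incXT B))

  -- A rejected input imposes no condition: only soundness is checked here, and members missed by D
  -- show up only in the comparison of counts.
  After : Bool → Str → List Bool → Set
  After true  x t = (∃[ t' ] decr t ≡ just t') × NAccepts M x
  After false x t = ⊤

  after : ∀ b {x t} → After b x t → List Bool
  after true  ((t' , _) , _) = t'
  after false {t = t} _      = t

  after-length : ∀ b {x t} (a : After b x t) → length (after b a) ≡ length t
  after-length true  {t = t} ((t' , e) , _) = decr-length t e
  after-length false _ = refl

  module _ {j : ℕ} (D : Circuit m j) (d : ℕ) where

    Step : Vec Bool j → List Bool → Set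
    Step x t = depth D ≤ d × After (eval D x) (toList x) t

    stepT : ∀ {x t} → Step x t → List Bool
    stepT {x} (_ , a) = after (eval D x) a

    -- The index type for the halting states of the loop entered at input x with remaining count t;
    -- `runT` and `runX` read off what it leaves in the registers.
    data Run (x : Vec Bool j) (t : List Bool) : Set where
      last : proj₁ (inc x) ≡ false → Step x t → Run x t
      more : proj₁ (inc x) ≡ true → (s : Step x t) → Run (proj₂ (inc x)) (stepT s) → Run x t

    runT : ∀ {x t} → Run x t → List Bool
    runT (last _ s)   = stepT s
    runT (more _ _ r) = runT r

    runX : ∀ {x t} → Run x t → Vec Bool j
    runX {x} (last _ _) = proj₂ (inc x)
    runX (more _ _ r)   = runX r

    runT-length : ∀ {x t} (r : Run x t) → length (runT r) ≡ length t
    runT-length {x} (last _ s)   = after-length (eval D x) (proj₂ s)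
    runT-length {x} (more _ s r) = trans (runT-length r) (after-length (eval D x) (proj₂ s))

    module _ {T B : ℕ} (ρ : Registers) (bd : ∀ x → Bounds D x B) (time : ∀ (x : Vec Bool j) → NTimeBounded M (toList x) T) where
      private
        length-toList≤ : ∀ (x : Vec Bool j) → length (toList x) ≤ B
        length-toList≤ x = ≤-trans (≤-reflexive (Vec.length-toList x)) (Bounds.input≤ (bd x))
          where import Data.Vec.Properties as Vec

        exec-after : ∀ b (x : Vec Bool j) t → length t ≤ B →
          Exec (ite go (upd (λ _ → F₀) ⨾ decT ⨾ simulate) skip) (record F₀ { go = b } , lregs D d (toList x) t ρ) (afterT T B)
            {After b (toList x) t} (λ a → F₀ , lregs D d (toList x) (after b a) ρ)
        exec-after false x t le = exec-mono (s≤s (s≤s z≤n)) (exec-false refl (det-index tt (λ _ → refl) exec-upd))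
        exec-after true x t le = exec-true refl (exec-upd then
          exec-seq {J = λ _ → NAccepts M (toList x)} {out₂ = λ i _ → F₀ , lregs D d (toList x) (proj₁ i) ρ}
            (exec-decT t (lregs D d (toList x) t ρ) le)
            (λ i → exec-simulate T (toList x) (lregs D d (toList x) (proj₁ i) ρ) (time x) (length-toList≤ x)))

        exec-body : ∀ x t → length t ≤ B → Exec loopBody (record F₀ { go = true } , lregs D d (toList x) t ρ) (loopBodyT T B)
          {Step x t} (λ s → record F₀ { go = proj₁ (inc x) } , lregs D d (toList (proj₂ (inc x))) (stepT s) ρ)
        exec-body x t le = exec-upd then
          exec-seq {J = λ _ → After (eval D x) (toList x) t}
            {out₂ = λ _ a → record F₀ { go = proj₁ (inc x) } , lregs D d (toList (proj₂ (inc x))) (after (eval D x) a) ρ}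
            (exec-evalCircuit D x d t ρ (bd x))
            (λ _ → reindex proj₁ (λ _ → refl) (_, tt) (λ _ → refl)
              (exec-seq {J = λ _ → ⊤} {out₂ = λ a _ → record F₀ { go = proj₁ (inc x) } , lregs D d (toList (proj₂ (inc x))) (after (eval D x) a) ρ}
                (exec-after (eval D x) x t le)
                (λ a → exec-incX x (lregs D d (toList x) (after (eval D x) a) ρ) (Bounds.input≤ (bd x)))))

      -- An increment raises `val x` by one and uses up one round, so the hypothesis is preserved;
      -- it can fail to leave a round only after the last input, since `val x` stays below 2^j.
      exec-loop : ∀ n x t → length t ≤ B → 2 ^ j ≤ val x + suc n →
        Exec (while go loopBody) (record F₀ { go = true } , lregs D d (toList x) t ρ) (loopT (suc n) (loopBodyT T B))
          {Run x t} (λ r → F₀ , lregs D d (toList (runX r)) (runT r) ρ)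
      exec-loop n x t le enough with proj₁ (inc x) in e
      ... | false = reindex
        (λ { (s , _) → last e s }) (λ _ → refl)
        (λ { (last _ s) → s , tt ; (more e′ _ _) → ⊥-elim (contra (trans (sym e) e′)) })
        (λ { (last _ s) → refl ; (more e′ _ _) → ⊥-elim (contra (trans (sym e) e′)) })
        (while-step {J = λ _ → ⊤} {out₂ = λ s _ → F₀ , lregs D d (toList (proj₂ (inc x))) (stepT s) ρ} refl (exec-body x t le)
          (λ s → exec-from (cong (λ g → record F₀ { go = g } , lregs D d (toList (proj₂ (inc x))) (stepT s) ρ) e)
             (exec-mono (loopT-monoˡ {0} {n} _ z≤n) (while-stop refl))))
        where
        contra : false ≢ true
        contra ()
      ... | true = reindex
        (λ { (s , r) → more e s r }) (λ _ → refl)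
        (λ { (last e′ s) → ⊥-elim (contra (trans (sym e′) e)) ; (more _ s r) → s , r })
        (λ { (last e′ s) → ⊥-elim (contra (trans (sym e′) e)) ; (more _ s r) → refl })
        (while-step {J = λ s → Run (proj₂ (inc x)) (stepT s)} {out₂ = λ _ r → F₀ , lregs D d (toList (runX r)) (runT r) ρ} refl (exec-body x t le)
          (λ s → exec-from (cong (λ g → record F₀ { go = g } , lregs D d (toList (proj₂ (inc x))) (stepT s) ρ) e)
             (next n (≤-trans enough (≤-reflexive (trans (+-suc (val x) n) (cong (_+ n) (sym (val-inc x e)))))) s)))
        where
        contra : false ≢ true
        contra ()
        next : ∀ n → 2 ^ j ≤ val (proj₂ (inc x)) + n → (s : Step x t) →
          Exec (while go loopBody) (record F₀ { go = true } , lregs D d (toList (proj₂ (inc x))) (stepT s) ρ) (loopT n (loopBodyT T B))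
            {Run (proj₂ (inc x)) (stepT s)} (λ r → F₀ , lregs D d (toList (runX r)) (runT r) ρ)
        next zero h s = ⊥-elim (<⇒≱ (val-< (proj₂ (inc x))) (≤-trans h (≤-reflexive (+-identityʳ _))))
        next (suc n) h s = exec-loop n (proj₂ (inc x)) (stepT s) (≤-trans (≤-reflexive (after-length (eval D x) (proj₂ s))) le) h

  finalCheck : Prog
  finalCheck = forEach rT (guard isFalse)

  exec-finalCheck : ∀ t ρ {B} → length t ≤ B → Exec finalCheck (F₀ , set rT (bits t) ρ) (forT B 1) {allFalse t ≡ true} (λ _ → F₀ , set rT [] ρ)
  exec-finalCheck t ρ le = exec-mono (forT-mono 1 le) (exec-pop then loop t)
    where
    loop : ∀ t → Exec (while isJust (guard isFalse ⨾ popc rT)) (withCur (List.head (bits t)) F₀ , set rT (drop 1 (bits t)) ρ) (loopT (length t) 2)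
             {allFalse t ≡ true} (λ _ → F₀ , set rT [] ρ)
    loop [] = det-index refl (λ _ → refl) (while-stop refl)
    loop (true ∷ t) = reindex {I = Σ ⊥ λ _ → ⊥} {out = λ i → ⊥-elim (proj₂ i)} (⊥-elim ∘ proj₂) (⊥-elim ∘ proj₂) (λ ()) (λ ())
      (while-step {T₁ = 2} {T₂ = loopT (length t) 2} {J = λ _ → ⊥} {out₁ = ⊥-elim} {out₂ = λ _ → ⊥-elim} refl (exec-fail refl id) (λ ()))
    loop (false ∷ t) = while-det refl (exec-guard refl then exec-pop) (loop t)

falsesV : ∀ n → Vec Bool n
falsesV zero    = []
falsesV (suc n) = false ∷ falsesV n

module Verifier (M : NTM) (m₁ q : ℕ) where
  open MainLoop M m₁ public

  budget : ℕ → ℕ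
  budget j = q * suc j ^ q

  ρ∅ : Registers
  ρ∅ = initRegs 16 []

  each : Fin 17 → Prog → Prog
  each r p = forEach r (upd (λ _ → F₀) ⨾ p)

  det-each : ∀ r p (regs : ℕ → Registers) {T} →
             (∀ i k → Det p (F₀ , set r (ticks i) (regs k)) T (F₀ , set r (ticks i) (regs (suc k)))) →
             ∀ n → Det (each r p) (F₀ , set r (ticks n) (regs 0)) (forT n (suc T)) (F₀ , set r [] (regs n))
  det-each r p regs {T} body n =
    pops n 0 then det-≡ (cong (λ k → F₀ , set r [] (regs k)) (+-identityʳ n)) (loop n 0)
    where
    pops : ∀ n k → Det (popc r) (F₀ , set r (ticks n) (regs k)) 1 (withCur (List.head (ticks n)) F₀ , set r (drop 1 (ticks n)) (regs k))
    pops n k = det-≡ (cong₂ (λ h ρ → withCur h F₀ , ρ) (cong List.head (get-set r (ticks n) (regs k)))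
      (trans (cong (λ z → set r (drop 1 z) (set r (ticks n) (regs k))) (get-set r (ticks n) (regs k))) (set-set r _ _ (regs k)))) exec-pop
    loop : ∀ n k → Det (while isJust ((upd (λ _ → F₀) ⨾ p) ⨾ popc r)) (withCur (List.head (ticks n)) F₀ , set r (drop 1 (ticks n)) (regs k))
             (loopT n (suc T + 1)) (F₀ , set r [] (regs (n + k)))
    loop zero    k = while-stop refl
    loop (suc n) k = while-det refl ((exec-upd then body n k) then pops n (suc k))
      (det-≡ (cong (λ k → F₀ , set r [] (regs k)) (+-suc n k)) (loop n (suc k)))

  addJ : Prog
  addJ = pusha rS tck ⨾ each rJ (pusha rS tck ⨾ pusha rTMP tck) ⨾ pour rTMP rJ

  addJT : ℕ → ℕ
  addJT j = 1 + (forT j 3 + pourT j)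

  mulB : Prog
  mulB = each rB addJ ⨾ pour rS rB

  mulBT : ℕ → ℕ → ℕ
  mulBT N j = forT N (suc (addJT j)) + pourT N

  bregs : ℕ → ℕ → ℕ → Registers → Registers
  bregs j b s ρ = set rB (ticks b) (set rJ (ticks j) (set rTMP [] (set rS (ticks s) ρ)))

  det-addJ : ∀ j b s ρ → Det addJ (F₀ , bregs j b s ρ) (addJT j) (F₀ , bregs j b (suc j + s) ρ)
  det-addJ j b s ρ = exec-push then
    det-≡ (cong (λ k → F₀ , set rJ [] (set rTMP (ticks j) (set rS (ticks k) (set rB (ticks b) ρ)))) (+-suc j s))
      (det-each rJ (pusha rS tck ⨾ pusha rTMP tck) (λ k → set rTMP (ticks k) (set rS (ticks (k + suc s)) (set rB (ticks b) ρ)))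
        (λ i k → exec-push then exec-push) j) then
    det-≡ (cong (λ z → F₀ , set rJ z (set rTMP [] (set rS (ticks (suc j + s)) (set rB (ticks b) ρ)))) (ticks-ʳ++[] j))
      (exec-pour rTMP rJ (λ ()) {ρ = set rJ [] (set rTMP (ticks j) (set rS (ticks (suc j + s)) (set rB (ticks b) ρ)))} (≤-reflexive (length-ticks j)))

  det-mulB : ∀ j b ρ {N} → b ≤ N → b * suc j ≤ N → Det mulB (F₀ , bregs j b 0 ρ) (mulBT N j) (F₀ , bregs j (b * suc j) 0 ρ)
  det-mulB j b ρ le le' =
    exec-mono (forT-mono (suc (addJT j)) le)
      (det-each rB addJ (λ k → bregs j 0 (k * suc j) ρ) (λ i k → det-addJ j i (k * suc j) ρ) b) then
    det-≡ (cong (λ z → F₀ , set rB z (bregs j 0 0 ρ)) (ticks-ʳ++[] (b * suc j)))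
      (exec-pour rS rB (λ ()) {ρ = bregs j 0 (b * suc j) ρ} (≤-trans (≤-reflexive (length-ticks (b * suc j))) le'))

  repeatT : ℕ → ℕ → ℕ
  repeatT zero    T = 1
  repeatT (suc n) T = T + repeatT n T

  det-repeat-mulB : ∀ i j b ρ {N} → b * suc j ^ i ≤ N → Det (repeat i mulB) (F₀ , bregs j b 0 ρ) (repeatT i (mulBT N j)) (F₀ , bregs j (b * suc j ^ i) 0 ρ)
  det-repeat-mulB zero    j b ρ le = det-≡ (cong (λ k → F₀ , bregs j k 0 ρ) (sym (*-identityʳ b))) exec-upd
  det-repeat-mulB (suc i) j b ρ {N} le =
    det-mulB j b ρ (≤-trans (m≤m*n b (suc j)) bj≤) bj≤ then
    det-≡ (cong (λ k → F₀ , bregs j k 0 ρ) (*-assoc b (suc j) (suc j ^ i))) (det-repeat-mulB i j (b * suc j) ρ (≤-trans (≤-reflexive (*-assoc b (suc j) (suc j ^ i))) le))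
    where
    bj≤ : b * suc j ≤ N
    bj≤ = ≤-trans (m≤m*n (b * suc j) (suc j ^ i) {{m^n≢0 (suc j) i}}) (≤-trans (≤-reflexive (*-assoc b (suc j) (suc j ^ i))) le)

  det-repeat-push : ∀ i j b ρ → Det (repeat i (pusha rB tck)) (F₀ , bregs j b 0 ρ) (repeatT i 1) (F₀ , bregs j (i + b) 0 ρ)
  det-repeat-push zero    j b ρ = exec-upd
  det-repeat-push (suc i) j b ρ = exec-push then
    det-≡ (cong (λ k → F₀ , bregs j k 0 ρ) (+-suc i b)) (det-repeat-push i j (suc b) ρ)

  -- The oracle input gives only 1^j, so the machine computes the budget itself: q ticks, multiplied
  -- q times by j + 1. Using q both as factor and as exponent leaves one constant to choose.
  setBudget : Prog
  setBudget = repeat q (pusha rB tck) ⨾ repeat q mulB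

  setBudgetT : ℕ → ℕ
  setBudgetT j = repeatT q 1 + repeatT q (mulBT (budget j) j)

  det-setBudget : ∀ j ρ → Det setBudget (F₀ , bregs j 0 0 ρ) (setBudgetT j) (F₀ , bregs j (budget j) 0 ρ)
  det-setBudget j ρ =
    det-≡ (cong (λ k → F₀ , bregs j k 0 ρ) (+-identityʳ q)) (det-repeat-push q j 0 ρ) then
    det-repeat-mulB q j q ρ ≤-refl

  -- After generation `rP` must be empty: only then is the whole given prefix a prefix of the
  -- certificate.
  work : Prog
  work = setBudget ⨾ generator ⨾ (popc rP ⨾ guard isNone) ⨾ each rJ (pusha rX (inj₁ false)) ⨾
         upd (λ f → record f { go = true }) ⨾ while go loopBody ⨾ finalCheck

  verifier : Prog
  verifier = popc rP ⨾ while isTrue (pusha rJ tck ⨾ popc rP) ⨾ guard isFalse ⨾ upd (λ _ → F₀) ⨾ work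

  boundOf : ℕ → ℕ
  boundOf j = bound (budget j) j

  workT : (ℕ → ℕ) → ℕ → ℕ
  workT time j = setBudgetT j + (generatorT (budget j) j + (2 + (forT j 2 + (1 +
    (loopT (suc (2 ^ j)) (loopBodyT (time j) (boundOf j)) + forT (boundOf j) 1)))))

  -- The index type of the halting states on input 1^j 0 p, in terms of streams and runs;
  -- `certified-⇔` translates it into the existence of a certificate extending p.
  Certified : (j : ℕ) → Str → Set
  Certified j p = Σ (Outcome {Vec Bool (suc j) × ℕ × Circuit m j} (λ { (t , d , D) → certificate t d D }) (budget j , p))
    λ { ((t , d , D) , (_ , ps) , _) → ps ≡ [] × Σ (Run D d (falsesV j) (toList t ʳ++ [])) λ r → allFalse (runT D d r) ≡ true }

  bits-falsesV : ∀ j → bits (toList (falsesV j)) ≡ replicate j (inj₁ false)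
  bits-falsesV zero    = refl
  bits-falsesV (suc j) = cong (inj₁ false ∷_) (bits-falsesV j)

  exec-none : ∀ ps ρ → Exec (popc rP ⨾ guard isNone) (F₀ , set rP (bits ps) ρ) 2 {ps ≡ []} (λ _ → F₀ , set rP [] ρ)
  exec-none [] ρ = det-index refl (λ _ → refl) (exec-pop then exec-guard refl)
  exec-none (b ∷ ps) ρ = exec-pop then
    reindex {I = ⊥} {out = ⊥-elim} (λ ()) (λ ()) (λ ()) (λ ()) fails
    where
    fails : Exec (guard isNone) (withCur (just (inj₁ b)) F₀ , set rP (bits ps) ρ) 1 {⊥} ⊥-elim
    fails = reindex (λ { (_ , ()) }) (λ { (_ , ()) }) (λ ()) (λ ()) exec-choose

  certRegs : ∀ {j p} → Certified j p → Registers
  certRegs {j} (((t , d , D) , (β , _) , _) , _ , r , _) =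
    set rT [] (lregs D d (toList (runX D d r)) (runT D d r) (set rB (ticks β) ρ∅))

  exec-work : ∀ (time : ℕ → ℕ) → (∀ x → NTimeBounded M x (time (length x))) → ∀ j p →
    Exec work (F₀ , set rJ (ticks j) (set rP (bits p) ρ∅)) (workT time j) {Certified j p} (λ c → F₀ , certRegs c)
  exec-work time bd j p =
    det-setBudget j (set rP (bits p) ρ∅) then
    exec-seq {J = λ { ((t , d , D) , (_ , ps) , _) → ps ≡ [] × Σ (Run D d (falsesV j) (toList t ʳ++ [])) λ r → allFalse (runT D d r) ≡ true }}
             {out₂ = λ o c → F₀ , certRegs {j} {p} (o , c)}
      (runs (emits-generator j ρ∅) F₀ (budget j) p ≤-refl)
      (λ { ((t , d , D) , (β , ps) , e) →
        let ρ₁ = load (β , []) (genRegs j (toList t ʳ++ []) d (tokens D) ρ∅)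
            ρ₂ = set rB (ticks β) ρ∅
            le : length (encode D) ≤ budget j
            le = ≤-trans (length-++-≤ʳ (depWord d)) (≤-trans (length-++-≤ʳ (pairs (toList t)))
                   (≤-trans (m≤m+n _ β) (≤-reflexive (sym (advance-≤ (certificate t d D) e)))))
            bds = λ x → bounds D x le
            tlen : length (toList t ʳ++ []) ≤ boundOf j
            tlen = ≤-trans (≤-reflexive (trans (List.length-ʳ++ (toList t)) (trans (+-identityʳ _) (Vec.length-toList t))))
                     (≤-trans (m≤n+m (suc j) (budget j)) (≤-trans (n≤1+n _) (≤-trans (m≤n+m _ (tokensBound (budget j))) (m≤n+m _ ((budget j + j) * suc (budget j))))))
            times = λ (x : Vec Bool j) → subst (λ n → NTimeBounded M (toList x) (time n)) (Vec.length-toList x) (bd (toList x))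
            init : Det (each rJ (pusha rX (inj₁ false))) (F₀ , ρ₁) (forT j 2) (F₀ , lregs D d (toList (falsesV j)) (toList t ʳ++ []) ρ₂)
            init = det-≡ (cong (λ z → F₀ , set rJ [] (set rX z ρ₁)) (sym (bits-falsesV j)))
                     (det-each rJ (pusha rX (inj₁ false)) (λ k → set rX (replicate k (inj₁ false)) ρ₁) (λ i k → exec-push) j)
        in exec-seq {J = λ _ → Σ (Run D d (falsesV j) (toList t ʳ++ [])) λ r → allFalse (runT D d r) ≡ true}
             {out₂ = λ { ps≡ c → F₀ , certRegs {j} {p} (((t , d , D) , (β , ps) , e) , ps≡ , c) }}
             (exec-none ps ρ₁)
             (λ _ → init then exec-upd then
               exec-seq {J = λ r → allFalse (runT D d r) ≡ true}
                 {out₂ = λ r _ → F₀ , set rT [] (lregs D d (toList (runX D d r)) (runT D d r) ρ₂)}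
                 (exec-loop D d ρ₂ bds times (2 ^ j) (falsesV j) (toList t ʳ++ []) tlen (≤-trans (n≤1+n _) (m≤n+m _ (val (falsesV j)))))
                 (λ r → exec-finalCheck (runT D d r) (lregs D d (toList (runX D d r)) (runT D d r) ρ₂)
                    (≤-trans (≤-reflexive (runT-length D d r)) tlen))) })
    where import Data.Vec.Properties as Vec

  verifierT : (ℕ → ℕ) → ℕ → ℕ
  verifierT time j = 1 + (loopT j 2 + (1 + (1 + workT time j)))

  Verified : ℕ → Str → Set
  Verified j []          = ⊥
  Verified j (true ∷ p)  = ⊥
  Verified j (false ∷ p) = Certified j p

  verifiedRegs : ∀ j r → Verified j r → Registers
  verifiedRegs j (false ∷ p) = certRegs {j} {p}

  private
    parse-loop : ∀ j k r → isTrue (withCur (List.head (bits r)) F₀) ≡ false →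
      Det (while isTrue (pusha rJ tck ⨾ popc rP))
        (withCur (List.head (bits (replicate j true ++ r))) F₀ , set rJ (ticks k) (set rP (drop 1 (bits (replicate j true ++ r))) ρ∅))
        (loopT j 2) (withCur (List.head (bits r)) F₀ , set rJ (ticks (j + k)) (set rP (drop 1 (bits r)) ρ∅))
    parse-loop zero    k r e = while-stop e
    parse-loop (suc j) k r e = while-det refl (exec-push then exec-pop)
      (det-≡ (cong (λ n → withCur (List.head (bits r)) F₀ , set rJ (ticks n) (set rP (drop 1 (bits r)) ρ∅)) (+-suc j k)) (parse-loop j (suc k) r e))

  exec-verifier : ∀ (time : ℕ → ℕ) → (∀ x → NTimeBounded M x (time (length x))) → ∀ j r → NotTrue r →
    Exec verifier (F₀ , initRegs 16 (bits (replicate j true ++ r))) (verifierT time j) {Verified j r} (λ v → F₀ , verifiedRegs j r v)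
  exec-verifier time bd j [] nt = exec-pop then parse-loop j 0 [] refl then exec-fail refl id
  exec-verifier time bd j (true ∷ p) nt = ⊥-elim (nt refl)
  exec-verifier time bd j (false ∷ p) nt = exec-pop then parse-loop j 0 (false ∷ p) refl then exec-guard refl then exec-upd then
    exec-from (cong (λ n → F₀ , set rJ (ticks n) (set rP (bits p) ρ∅)) (+-identityʳ j)) (exec-work time bd j p)

-- Exponential time bounds and the NE language of the verifier.

Small : (ℕ → ℕ) → Set
Small f = ∃[ c ] ∀ j → f j ≤ 2 ^ (c * suc j)

n≤2^n : ∀ n → n ≤ 2 ^ n
n≤2^n zero    = z≤n
n≤2^n (suc n) = ≤-trans (≤-trans (s≤s (n≤2^n n)) (+-monoˡ-≤ (2 ^ n) (m^n>0 2 n))) (≤-reflexive (cong (2 ^ n +_) (sym (+-identityʳ (2 ^ n)))))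

small-const : ∀ k → Small (λ _ → k)
small-const k = k , λ j → ≤-trans (n≤2^n k) (^-monoʳ-≤ 2 (m≤m*n k (suc j)))

small-id : Small id
small-id = 1 , λ j → ≤-trans (n≤2^n j) (^-monoʳ-≤ 2 (≤-trans (n≤1+n j) (m≤m+n (suc j) 0)))

small-2^ : Small (2 ^_)
small-2^ = 1 , λ j → ^-monoʳ-≤ 2 (≤-trans (n≤1+n j) (m≤m+n (suc j) 0))

small-≤ : ∀ {f g} → (∀ j → f j ≤ g j) → Small g → Small f
small-≤ h (c , b) = c , λ j → ≤-trans (h j) (b j)

small-* : ∀ {f g} → Small f → Small g → Small (λ j → f j * g j)
small-* (c , b) (c' , b') = c + c' , λ j → ≤-trans (*-mono-≤ (b j) (b' j))
  (≤-reflexive (trans (sym (^-distribˡ-+-* 2 (c * suc j) (c' * suc j))) (cong (2 ^_) (sym (*-distribʳ-+ (suc j) c c')))))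

infixl 6 _⊕_
-- Adding two powers costs one doubling, which is absorbed by raising the constant by one.
_⊕_ : ∀ {f g} → Small f → Small g → Small (λ j → f j + g j)
_⊕_ {f} {g} (c , b) (c' , b') = suc (c + c') , λ j → ≤-trans
  (+-mono-≤ (≤-trans (b j) (^-monoʳ-≤ 2 (*-monoˡ-≤ (suc j) (m≤m+n c c')))) (≤-trans (b' j) (^-monoʳ-≤ 2 (*-monoˡ-≤ (suc j) (m≤n+m c' c)))))
  (≤-trans (≤-reflexive (cong (2 ^ ((c + c') * suc j) +_) (sym (+-identityʳ _)))) (^-monoʳ-≤ 2 (s≤s (m≤n+m ((c + c') * suc j) j))))

small-^ : ∀ {f} q → Small f → Small (λ j → f j ^ q)
small-^ zero    s = small-const 1
small-^ (suc q) s = small-* s (small-^ q s)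

loopT-≡ : ∀ n C → loopT n C ≡ suc (n * suc C)
loopT-≡ zero    C = refl
loopT-≡ (suc n) C = cong suc (trans (cong (C +_) (loopT-≡ n C)) (+-suc C (n * suc C)))

small-loop : ∀ {n C} → Small n → Small C → Small (λ j → loopT (n j) (C j))
small-loop {n} {C} s t = small-≤ (λ j → ≤-reflexive (loopT-≡ (n j) (C j))) (small-const 1 ⊕ small-* s (small-const 1 ⊕ t))

small-for : ∀ {n C} → Small n → Small C → Small (λ j → forT (n j) (C j))
small-for s t = small-const 1 ⊕ small-loop s (t ⊕ small-const 1)

nrun-prefix : ∀ {M m n c d} → m ≤ n → NRun M n c d → ∃[ e ] NRun M m c e
nrun-prefix z≤n      r          = _ , done
nrun-prefix (s≤s le) (more s r) = let e , r' = nrun-prefix le r in e , more s r'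

time-mono : ∀ {M x T T'} → T ≤ T' → NTimeBounded M x T → NTimeBounded M x T'
time-mono le b c r = let e , r' = nrun-prefix (s≤s le) r in b e r'

module VerifierLanguage (M : NTM) (m₁ q : ℕ) (cM : ℕ) (timeM : ∀ x → NTimeBounded M x (2 ^ (cM * (length x + 1)))) where
  open Verifier M m₁ q public

  private
    time : ℕ → ℕ
    time n = 2 ^ (cM * (n + 1))

    k = small-const

    module _ {N B : ℕ → ℕ} (sN : Small N) (sB : Small B) where
      s-many : ∀ {T} → Small T → Small (λ j → guessManyT (N j) (T j))
      s-many t = k 1 ⊕ small-loop (k 1 ⊕ sN) (k 1 ⊕ (t ⊕ k 1))

      s-pourB : Small (pourT ∘ B)
      s-pourB = small-for sB (k 1)

      s-idx : Small (λ j → idxGuessT (N j) (B j))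
      s-idx = s-many (k 9) ⊕ (k 3 ⊕ (s-pourB ⊕ k 6))

      s-list : Small (λ j → listGuessT (N j) (B j))
      s-list = s-many (k 6) ⊕ (k 5 ⊕ small-for sN (k 1 ⊕ s-idx))

      s-gate : Small (λ j → gateGuessT (N j) (B j))
      s-gate = (k 3 ⊕ ((k 6 ⊕ (k 1 ⊕ s-idx)) ⊕
        (k 3 ⊕ ((k 11 ⊕ (k 1 ⊕ s-list)) ⊕ (k 3 ⊕ ((k 16 ⊕ (k 1 ⊕ s-list)) ⊕ (k 21 ⊕ (k 1 ⊕ s-list)))))))) ⊕ k 2

    module _ {N : ℕ → ℕ} (sN : Small N) where
      s-pour : Small (pourT ∘ N)
      s-pour = small-for sN (k 1)

      s-tokens : Small (tokensBound ∘ N)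
      s-tokens = (k 1 ⊕ sN) ⊕ (k 1 ⊕ (sN ⊕ sN))

      s-circuit : Small (λ j → genCircuitT (N j) j)
      s-circuit = k (emitWordT (unary m)) ⊕ ((small-for small-id (k 7) ⊕ (small-for small-id (k 1) ⊕ k 5)) ⊕ (s-many sN sN (k 6) ⊕ (k 5 ⊕
        ((small-for small-id (k 3) ⊕ small-for small-id (k 1)) ⊕ (small-for sN (k 1 ⊕ s-gate sN (sN ⊕ small-id)) ⊕ (k 1 ⊕ (s-idx sN (sN ⊕ small-id) ⊕
          (k 1 ⊕ (small-for (sN ⊕ small-id) (k 1) ⊕ small-for s-tokens (k 1))))))))))

      s-generator : Small (λ j → generatorT (N j) j)
      s-generator = (k 25 ⊕ (small-for small-id (k 27) ⊕ small-for small-id (k 1))) ⊕ ((s-many sN sN (k 11) ⊕ k 16) ⊕ s-circuit)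

      s-bound : Small (λ j → bound (N j) j)
      s-bound = small-* (sN ⊕ small-id) (k 1 ⊕ sN) ⊕ (s-tokens ⊕ (k 1 ⊕ (sN ⊕ (k 1 ⊕ small-id))))

    module _ {T B : ℕ → ℕ} (sT : Small T) (sB : Small B) where
      s-lookup : Small (lookupT ∘ B)
      s-lookup = small-loop sB (k 1 ⊕ ((k 2 ⊕ small-loop sB (k 2)) ⊕ k 1)) ⊕
                 (k 1 ⊕ ((k 1 ⊕ (k 1 ⊕ small-loop sB (k 4))) ⊕ (k 1 ⊕ (s-pour sB ⊕ s-pour sB))))

      s-evalGate : Small (evalGateT ∘ B)
      s-evalGate = k 3 ⊕ (small-loop sB (s-lookup ⊕ k 1) ⊕ k 1)

      s-evalLoop : Small (evalLoopT ∘ B)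
      s-evalLoop = k 1 ⊕ (small-loop sB (s-evalGate ⊕ ((k 1 ⊕ (small-for sB (k 1) ⊕ k 1)) ⊕ k 1)) ⊕ s-evalGate)

      s-copy : Small (copyT ∘ B)
      s-copy = s-pour sB ⊕ small-for sB (k 2)

      s-evalCircuit : Small (evalCircuitT ∘ B)
      s-evalCircuit = s-copy ⊕ (s-evalLoop ⊕ (k 1 ⊕ ((small-for sB (k 3) ⊕ s-pour sB) ⊕ (s-pour sB ⊕ s-pour sB))))

      s-simulate : Small (λ j → simulateT (T j) (B j))
      s-simulate = s-copy ⊕ (small-loop (k 1 ⊕ sT) (k 7) ⊕ (s-pour (small-* (k 2) sT ⊕ sB) ⊕ (s-pour (small-* (k 2) sT ⊕ sB) ⊕ k 1)))

      s-loopBody : Small (λ j → loopBodyT (T j) (B j))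
      s-loopBody = k 1 ⊕ (s-evalCircuit ⊕ ((k 2 ⊕ ((k 1 ⊕ (small-loop sB (k 2) ⊕ (k 2 ⊕ s-pour sB))) ⊕ s-simulate)) ⊕
                   (k 1 ⊕ (small-loop sB (k 2) ⊕ (k 3 ⊕ s-pour sB)))))

    s-repeat : ∀ n {T} → Small T → Small (λ j → repeatT n (T j))
    s-repeat zero    t = k 1
    s-repeat (suc n) t = t ⊕ s-repeat n t

    s-budget : Small budget
    s-budget = small-* (k q) (small-^ q (k 1 ⊕ small-id))

    s-time : Small time
    s-time = cM , λ j → ≤-reflexive (cong (λ n → 2 ^ (cM * n)) (+-comm j 1))

    abstract
      s-verifier : Small (verifierT time)
      s-verifier = k 1 ⊕ (small-loop small-id (k 2) ⊕ (k 2 ⊕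
       (((s-repeat q (k 1)) ⊕ s-repeat q (small-for s-budget (k 1 ⊕ (k 1 ⊕ (small-for small-id (k 3) ⊕ s-pour small-id))) ⊕ s-pour s-budget)) ⊕
        (s-generator s-budget ⊕ (k 2 ⊕ (small-for small-id (k 2) ⊕ (k 1 ⊕
          (small-loop (k 1 ⊕ small-2^) (s-loopBody s-time (s-bound s-budget)) ⊕ small-for (s-bound s-budget) (k 1)))))))))

  private
    module Asm = Assemble {k = 16} (finite-Aux nΓ) finite-F F₀ verifier

    runTime-mono : ∀ u {T T'} → T ≤ T' → Asm.runTime u T ≤ Asm.runTime u T'
    runTime-mono u {T} {T'} le = +-monoʳ-≤ 18 (*-mono-≤ le (cost-mono (+-monoˡ-≤ 3 (+-monoʳ-≤ (17 + u) le))))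
      where
      cost-mono : ∀ {B B'} → B ≤ B' → B + (B + (B + (B + (B + B)))) ≤ B' + (B' + (B' + (B' + (B' + B'))))
      cost-mono h = +-mono-≤ h (+-mono-≤ h (+-mono-≤ h (+-mono-≤ h (+-mono-≤ h h))))

    abstract
      -- One tape costs a factor proportional to the register contents, which are bounded by input
      -- length plus time. The product of two bounds 2^O(n) is again of this kind.
      s-machine : ∃[ c ] ∀ n j → j ≤ n → Asm.runTime n (verifierT time j) ≤ 2 ^ (c * suc n)
      s-machine =
       let c₁ , b₁ = s-verifier
           g : ℕ → ℕ
           g n = 2 ^ (c₁ * suc n)
           sg : Small g
           sg = c₁ , λ _ → ≤-refl
           sB = ((k 17 ⊕ small-id) ⊕ sg) ⊕ k 3
           c₂ , b₂ = k 18 ⊕ small-* sg (sB ⊕ (sB ⊕ (sB ⊕ (sB ⊕ (sB ⊕ sB)))))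
       in c₂ , λ n j le → ≤-trans (runTime-mono n (≤-trans (b₁ j) (^-monoʳ-≤ 2 (*-monoʳ-≤ c₁ (s≤s le))))) (b₂ n)

  private
    machine-timed : ∀ j r → NotTrue r → NTimeBounded Asm.machine (replicate j true ++ r)
                    (Asm.runTime (length (replicate j true ++ r)) (verifierT time j))
    machine-timed j r nt = Asm.machine-time {u = replicate j true ++ r} {T = verifierT time j} {J = Verified j r}
      {out = verifiedRegs j r} (exec-verifier time timeM j r nt)

    cost : ℕ
    cost = proj₁ s-machine

    machine-fast : ∀ j r → Asm.runTime (length (replicate j true ++ r)) (verifierT time j) ≤ 2 ^ (cost * (length (replicate j true ++ r) + 1))
    machine-fast j r = ≤-trans (proj₂ s-machine (length (replicate j true ++ r)) j
        (≤-trans (≤-reflexive (sym (List.length-replicate j))) (length-++-≤ˡ (replicate j true))))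
      (≤-reflexive (cong (λ n → 2 ^ (cost * n)) (+-comm 1 (length (replicate j true ++ r)))))

    machine-timed-2^ : ∀ u → NTimeBounded Asm.machine u (2 ^ (cost * (length u + 1)))
    machine-timed-2^ u = subst (λ v → NTimeBounded Asm.machine v (2 ^ (cost * (length v + 1)))) (sym (proj₁ (proj₂ (proj₂ (split-ones u)))))
      (time-mono {Asm.machine} {replicate j true ++ r} {Asm.runTime (length (replicate j true ++ r)) (verifierT time j)}
        {2 ^ (cost * (length (replicate j true ++ r) + 1))} (machine-fast j r) (machine-timed j r (proj₂ (proj₂ (proj₂ (split-ones u))))))
      where
      j = proj₁ (split-ones u)
      r = proj₁ (proj₂ (split-ones u))

  abstract
    language : Language
    language u = NAccepts Asm.machine u

    language-NE : InNE language
    language-NE = Asm.machine , cost , λ u → machine-timed-2^ u , mk⇔ (λ a → a) (λ a → a)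

    language-⇔ : ∀ j p → Certified j p ⇔ language (replicate j true ++ false ∷ p)
    language-⇔ j p = Asm.machine-accepts {u = replicate j true ++ false ∷ p} {T = verifierT time j} {J = Certified j p}
      {out = verifiedRegs j (false ∷ p)} (exec-verifier time timeM j (false ∷ p) (λ ()))

-- Certificates and their lexicographic order

valL : List Bool → ℕ
valL []          = 0
valL (false ∷ l) = 2 * valL l
valL (true ∷ l)  = suc (2 * valL l)

valL-toList : ∀ {n} (x : Vec Bool n) → valL (toList x) ≡ val x
valL-toList []          = refl
valL-toList (false ∷ x) = cong (2 *_) (valL-toList x)
valL-toList (true ∷ x)  = cong (λ k → suc (2 * k)) (valL-toList x)

val-injective : ∀ {n} (x y : Vec Bool n) → val x ≡ val y → x ≡ y
val-injective []          []          e = refl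
val-injective (false ∷ x) (false ∷ y) e = cong (false ∷_) (val-injective x y (*-cancelˡ-≡ (val x) (val y) 2 e))
val-injective (true ∷ x)  (true ∷ y)  e = cong (true ∷_) (val-injective x y (*-cancelˡ-≡ (val x) (val y) 2 (suc-injective e)))
val-injective (false ∷ x) (true ∷ y)  e = ⊥-elim (even≢odd (val x) (val y) e)
val-injective (true ∷ x)  (false ∷ y) e = ⊥-elim (even≢odd (val y) (val x) (sym e))

val-full : ∀ {n} (x : Vec Bool n) → proj₁ (inc x) ≡ false → suc (val x) ≡ 2 ^ n
val-full []         e = refl
val-full (true ∷ x) e = trans (sym (*-suc 2 (val x))) (cong (2 *_) (val-full x e))

decr-val : ∀ t {t'} → decr t ≡ just t' → valL t ≡ suc (valL t')
decr-val (true ∷ t) refl = refl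
decr-val (false ∷ t) e with decr t in eq
decr-val (false ∷ t) refl | just u = trans (cong (2 *_) (decr-val t eq)) (*-suc 2 (valL u))

val-decr : ∀ t {v} → valL t ≡ suc v → ∃[ t' ] decr t ≡ just t'
val-decr (true ∷ t) e = false ∷ t , refl
val-decr (false ∷ t) e with valL t in eq
... | suc v = let t' , e' = val-decr t eq in true ∷ t' , cong (Maybe.map (true ∷_)) e'

allFalse-val : ∀ t → allFalse t ≡ true → valL t ≡ 0
allFalse-val [] e = refl
allFalse-val (false ∷ t) e = cong (2 *_) (allFalse-val t e)

val-allFalse : ∀ t → valL t ≡ 0 → allFalse t ≡ true
val-allFalse [] e = refl
val-allFalse (false ∷ t) e with valL t in eq
... | zero = val-allFalse t eq

enum : ∀ {j} → ℕ → Vec Bool j → List (Vec Bool j)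
enum zero    x = []
enum (suc n) x = x ∷ enum n (proj₂ (inc x))

∈-enum : ∀ {j} n (x y : Vec Bool j) → val x + n ≡ 2 ^ j → val x ≤ val y → y ∈ enum n x
∈-enum zero x y e le = ⊥-elim (<-irrefl (trans (sym (+-identityʳ _)) e) (val-< x))
∈-enum (suc n) x y e le with val x Data.Nat.≟ val y
... | yes eq = here (sym (val-injective x y eq))
... | no ne with proj₁ (inc x) in i
...   | false = ⊥-elim (<⇒≱ (val-< y) (≤-trans (≤-reflexive (sym (val-full x i))) (≤∧≢⇒< le ne)))
...   | true  = there (∈-enum n (proj₂ (inc x)) y
  (trans (cong (_+ n) (val-inc x i)) (trans (sym (+-suc (val x) n)) e))
  (≤-trans (≤-reflexive (val-inc x i)) (≤∧≢⇒< le ne)))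

val-surjective : ∀ {n} k → k < 2 ^ n → ∃[ x ] val {n} x ≡ k
val-surjective {n} zero lt = falsesV n , go n
  where
  go : ∀ n → val (falsesV n) ≡ 0
  go zero    = refl
  go (suc n) = cong (2 *_) (go n)
val-surjective {n} (suc k) lt with val-surjective {n} k (≤-trans (n≤1+n _) lt)
... | x , e with proj₁ (inc x) in i
... | true  = proj₂ (inc x) , trans (val-inc x i) (cong suc e)
... | false = ⊥-elim (<-irrefl (trans (cong suc (sym e)) (val-full x i)) lt)

vec-of-list : ∀ {A : Set} {n} (l : List A) → length l ≡ n → ∃[ v ] toList {n = n} v ≡ l
vec-of-list [] refl = [] , refl
vec-of-list (a ∷ l) refl = let v , e = vec-of-list l refl in a ∷ v , cong (a ∷_) e

bigEndian : ℕ → List Bool → ℕ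
bigEndian a []          = a
bigEndian a (false ∷ u) = bigEndian (2 * a) u
bigEndian a (true ∷ u)  = bigEndian (suc (2 * a)) u

-- Pushing bits onto a stack whose top is the least significant bit is Horner's rule, so the
-- generator's register holds the number written in the certificate.
valL-ʳ++ : ∀ u w → valL (u ʳ++ w) ≡ bigEndian (valL w) u
valL-ʳ++ []          w = refl
valL-ʳ++ (false ∷ u) w = valL-ʳ++ u (false ∷ w)
valL-ʳ++ (true ∷ u)  w = valL-ʳ++ u (true ∷ w)

-- With `bigEndian-upper`, the value lies between 2^|u| a and 2^|u| (a + 1), the latter excluded: a
-- larger leading part a wins whatever follows.
bigEndian-lower : ∀ u a → 2 ^ length u * a ≤ bigEndian a u
bigEndian-lower [] a = ≤-reflexive (+-identityʳ a)
bigEndian-lower (b ∷ u) a = ≤-trans (≤-reflexive (trans (cong (_* a) (*-comm 2 (2 ^ length u))) (*-assoc (2 ^ length u) 2 a))) (go b)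
  where
  go : ∀ b → 2 ^ length u * (2 * a) ≤ bigEndian a (b ∷ u)
  go false = bigEndian-lower u (2 * a)
  go true  = ≤-trans (*-monoʳ-≤ (2 ^ length u) (n≤1+n (2 * a))) (bigEndian-lower u (suc (2 * a)))

bigEndian-upper : ∀ u a → bigEndian a u < 2 ^ length u * suc a
bigEndian-upper [] a = ≤-reflexive (sym (+-identityʳ (suc a)))
bigEndian-upper (b ∷ u) a = ≤-trans (go b) (≤-reflexive (sym (trans (cong (_* suc a) (*-comm 2 (2 ^ length u))) (*-assoc (2 ^ length u) 2 (suc a)))))
  where
  go : ∀ b → bigEndian a (b ∷ u) < 2 ^ length u * (2 * suc a)
  go false = ≤-trans (bigEndian-upper u (2 * a)) (*-monoʳ-≤ (2 ^ length u) (≤-trans (n≤1+n _) (≤-reflexive (sym (*-suc 2 a)))))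
  go true  = ≤-trans (bigEndian-upper u (suc (2 * a))) (*-monoʳ-≤ (2 ^ length u) (≤-reflexive (sym (*-suc 2 a))))

data _⊑_ : Str → Str → Set where
  empty : ∀ {z} → [] ⊑ z
  less₀ : ∀ {v z} → (false ∷ v) ⊑ (true ∷ z)
  same  : ∀ {b v z} → v ⊑ z → (b ∷ v) ⊑ (b ∷ z)

-- Both numbers have the same length, so the first pair in which they differ decides their order; if
-- there is none, the comparison passes to the remainders.
⊑-pairs : ∀ {n} (u v : Vec Bool n) a {r r'} → (pairs (toList u) ++ r) ⊑ (pairs (toList v) ++ r') →
          bigEndian a (toList u) < bigEndian a (toList v) ⊎ (u ≡ v × r ⊑ r')
⊑-pairs [] [] a le = inj₂ (refl , le)
⊑-pairs (false ∷ u) (false ∷ v) a (same (same le)) with ⊑-pairs u v (2 * a) le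
... | inj₁ lt = inj₁ lt
... | inj₂ (refl , le') = inj₂ (refl , le')
⊑-pairs (true ∷ u) (true ∷ v) a (same (same le)) with ⊑-pairs u v (suc (2 * a)) le
... | inj₁ lt = inj₁ lt
... | inj₂ (refl , le') = inj₂ (refl , le')
⊑-pairs (false ∷ u) (true ∷ v) a (same less₀) = inj₁ (≤-trans (bigEndian-upper (toList u) (2 * a))
  (≤-trans (≤-reflexive (cong (λ n → 2 ^ n * suc (2 * a)) (trans (Vec.length-toList u) (sym (Vec.length-toList v))))) (bigEndian-lower (toList v) (suc (2 * a)))))
  where import Data.Vec.Properties as Vec

⊑-depth : ∀ d d' {r r'} → (power d (true ∷ false ∷ []) ++ true ∷ true ∷ r) ⊑ (power d' (true ∷ false ∷ []) ++ true ∷ true ∷ r') → d' ≤ d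
⊑-depth d zero le = z≤n
⊑-depth zero (suc d') (same ())
⊑-depth (suc d) (suc d') (same (same le)) = s≤s (⊑-depth d d' le)

countTrue-mono : ∀ {A : Set} (f g : A → Bool) xs → (∀ x → f x ≡ true → g x ≡ true) → countTrue (map f xs) ≤ countTrue (map g xs)
countTrue-mono f g [] h = z≤n
countTrue-mono f g (x ∷ xs) h with f x in e
... | true rewrite h x e = s≤s (countTrue-mono f g xs h)
... | false with g x
...   | true  = ≤-trans (countTrue-mono f g xs h) (n≤1+n _)
...   | false = countTrue-mono f g xs h

-- The counting step of the argument: since f implies g, an entry satisfying only g would make the
-- count of g strictly larger.
countTrue-≡ : ∀ {A : Set} (f g : A → Bool) xs → (∀ x → f x ≡ true → g x ≡ true) →
              countTrue (map g xs) ≤ countTrue (map f xs) → ∀ x → x ∈ xs → g x ≡ true → f x ≡ true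
countTrue-≡ f g (x ∷ xs) h le .x (here refl) gx with f x in e
... | true = refl
... | false rewrite gx = ⊥-elim (<⇒≱ le (countTrue-mono f g xs h))
countTrue-≡ f g (x ∷ xs) h le y (there i) gy with f x in e
... | true rewrite h x e = countTrue-≡ f g xs h (≤-pred le) y i gy
... | false with g x
...   | true  = countTrue-≡ f g xs h (≤-trans (n≤1+n _) le) y i gy
...   | false = countTrue-≡ f g xs h le y i gy

countTrue-≤ : ∀ bs → countTrue bs ≤ length bs
countTrue-≤ [] = z≤n
countTrue-≤ (true ∷ bs)  = s≤s (countTrue-≤ bs)
countTrue-≤ (false ∷ bs) = ≤-trans (countTrue-≤ bs) (n≤1+n _)

inputsOf : ∀ j → List (Vec Bool j)
inputsOf j = enum (2 ^ j) (falsesV j)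

length-enum : ∀ {j} n (x : Vec Bool j) → length (enum n x) ≡ n
length-enum zero    x = refl
length-enum (suc n) x = cong suc (length-enum n _)

val-falses : ∀ n → val (falsesV n) ≡ 0
val-falses zero    = refl
val-falses (suc n) = cong (2 *_) (val-falses n)

∈-inputs : ∀ {j} (x : Vec Bool j) → x ∈ inputsOf j
∈-inputs {j} x = ∈-enum (2 ^ j) (falsesV j) x (cong (_+ 2 ^ j) (val-falses j)) (≤-trans (≤-reflexive (val-falses j)) z≤n)

module Semantics (M : NTM) (m₁ q : ℕ) where
  open Verifier M m₁ q public

  count : ∀ {j} → Circuit m j → ℕ
  count {j} D = countTrue (map (eval D) (inputsOf j))

  record Valid {j} (t : Vec Bool (suc j)) (d : ℕ) (D : Circuit m j) : Set where
    field
      depth-ok : depth D ≤ d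
      sound    : ∀ x → eval D x ≡ true → NAccepts M (toList x)
      counted  : bigEndian 0 (toList t) ≡ count D

  private
    step-val : ∀ b {x t} (a : After b x t) → valL t ≡ countTrue (b ∷ []) + valL (after b a)
    step-val true  {t = t} ((t' , e) , _) = decr-val t e
    step-val false _ = refl

    count-∷ : ∀ b bs → countTrue (b ∷ bs) ≡ countTrue (b ∷ []) + countTrue bs
    count-∷ true  bs = refl
    count-∷ false bs = refl

    after-accepts : ∀ {b x t} → After b x t → b ≡ true → NAccepts M x
    after-accepts {true} (_ , acc) refl = acc

    module _ {j} (D : Circuit m j) (d : ℕ) where
      run-sound : ∀ n {x t} (r : Run D d x t) → allFalse (runT D d r) ≡ true → val x + n ≡ 2 ^ j →
        valL t ≡ countTrue (map (eval D) (enum n x)) × (∀ y → y ∈ enum n x → eval D y ≡ true → NAccepts M (toList y)) × depth D ≤ d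
      run-sound zero {x} r af e = ⊥-elim (<-irrefl (trans (sym (+-identityʳ _)) e) (val-< x))
      run-sound (suc n) {x} (last i (dp , a)) af e with n≡0
        where
        n≡0 : n ≡ 0
        n≡0 = +-cancelˡ-≡ (suc (val x)) n 0 (trans (sym (+-suc (val x) n)) (trans e (trans (sym (val-full x i)) (sym (+-identityʳ _)))))
      ... | refl = trans (step-val (eval D x) a) (trans (cong (countTrue (eval D x ∷ []) +_) (allFalse-val (after (eval D x) a) af)) (sym (count-∷ (eval D x) []))) ,
        (λ { y (here refl) → after-accepts a }) , dp
      run-sound (suc n) {x} {t} (more i (dp , a) r) af e =
        let v , s , dp' = run-sound n r af (trans (cong (_+ n) (val-inc x i)) (trans (sym (+-suc (val x) n)) e))
        in trans (step-val (eval D x) a) (trans (cong (countTrue (eval D x ∷ []) +_) v) (sym (count-∷ (eval D x) _))) ,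
           (λ { y (here refl) → after-accepts a ; y (there k) → s y k }) , dp'

      run-step : ∀ x t c → (eval D x ≡ true → NAccepts M (toList x)) → valL t ≡ countTrue (eval D x ∷ []) + c →
                 Σ (After (eval D x) (toList x) t) λ a → valL (after (eval D x) a) ≡ c
      run-step x t c s v with eval D x
      ... | true  = let t' , e = val-decr t v in ((t' , e) , s refl) , suc-injective (trans (sym (decr-val t e)) v)
      ... | false = tt , v

      -- The flag of `inc` and the number of inputs left agree, because both are determined by
      -- `val x`; of the four combinations, the two mixed ones contradict the equation for 2^j.
      run-complete : ∀ n x t → val x + suc n ≡ 2 ^ j → depth D ≤ d → (∀ y → eval D y ≡ true → NAccepts M (toList y)) →
        valL t ≡ countTrue (map (eval D) (enum (suc n) x)) → Σ (Run D d x t) λ r → allFalse (runT D d r) ≡ true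
      run-complete n x t e dp s v with run-step x t _ (s x) (trans v (count-∷ (eval D x) _)) | proj₁ (inc x) in i
      run-complete zero x t e dp s v | a , v' | false = last i (dp , a) , val-allFalse (after (eval D x) a) v'
      run-complete (suc n) x t e dp s v | a , v' | false =
        ⊥-elim (m≢1+m+n (suc (val x)) (trans (val-full x i) (trans (sym e) (trans (+-suc (val x) (suc n)) (cong suc (+-suc (val x) n))))))
      run-complete zero x t e dp s v | a , v' | true =
        ⊥-elim (<-irrefl (trans (val-inc x i) (trans (sym (+-comm (val x) 1)) e)) (val-< (proj₂ (inc x))))
      run-complete (suc n) x t e dp s v | a , v' | true =
        let r , af = run-complete n (proj₂ (inc x)) (after (eval D x) a)
                       (trans (cong (_+ suc n) (val-inc x i)) (trans (sym (+-suc (val x) (suc n))) e)) dp s v'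
        in more i (dp , a) r , af

  -- The length bound belongs to the notion itself: it is the budget of the generator, and it makes
  -- the search terminate.
  record Certificate (j : ℕ) (z : Str) : Set where
    constructor cert
    field
      t       : Vec Bool (suc j)
      d       : ℕ
      D       : Circuit m j
      valid   : Valid t d D
      written : z ≡ certificate t d D
      short   : length z ≤ budget j

  advance-prefix : ∀ w {β p β'} → advance w (β , p) ≡ just (β' , []) → ∃[ y ] w ≡ p ++ y
  advance-prefix [] {p = []} refl = [] , refl
  advance-prefix (b ∷ w) {suc β} {[]} e = b ∷ w , refl
  advance-prefix (true ∷ w) {suc β} {true ∷ p} e = let y , e' = advance-prefix w e in y , cong (true ∷_) e'
  advance-prefix (false ∷ w) {suc β} {false ∷ p} e = let y , e' = advance-prefix w e in y , cong (false ∷_) e'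

  prefix-advance : ∀ p y {β} → length (p ++ y) ≤ β → ∃[ β' ] advance (p ++ y) (β , p) ≡ just (β' , [])
  prefix-advance [] [] le = _ , refl
  prefix-advance [] (b ∷ y) {suc β} (s≤s le) = prefix-advance [] y le
  prefix-advance (true ∷ p) y {suc β} (s≤s le) = prefix-advance p y le
  prefix-advance (false ∷ p) y {suc β} (s≤s le) = prefix-advance p y le

  certified-⇔ : ∀ j p → Certified j p ⇔ (∃[ y ] Certificate j (p ++ y))
  certified-⇔ j p = mk⇔ to from
    where
    to : Certified j p → ∃[ y ] Certificate j (p ++ y)
    to (((t , d , D) , (β , .[]) , e) , refl , r , af) =
      let y , ez = advance-prefix (certificate t d D) e
          v , s , dp = run-sound D d (2 ^ j) r af (cong (_+ 2 ^ j) (val-falses j))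
      in y , cert t d D
        (record { depth-ok = dp ; sound = λ x → s x (∈-inputs x) ; counted = trans (sym (valL-ʳ++ (toList t) [])) v })
        (sym ez) (≤-trans (≤-reflexive (cong length (sym ez))) (≤-trans (m≤m+n _ β) (≤-reflexive (sym (advance-≤ (certificate t d D) e)))))
    from : ∃[ y ] Certificate j (p ++ y) → Certified j p
    from (y , cert t d D v ez le) =
      let open Valid v
          β , e = prefix-advance p y le
          n , n≡ = pow-suc j
          r , af = run-complete D d n (falsesV j) (toList t ʳ++ []) (trans (cong (_+ suc n) (val-falses j)) (sym n≡)) depth-ok sound
                     (trans (valL-ʳ++ (toList t) []) (trans counted (cong (λ k → countTrue (map (eval D) (enum k (falsesV j)))) n≡)))
      in ((t , d , D) , (β , []) , subst (λ w → advance w (budget j , p) ≡ just (β , [])) ez e) , refl , r , af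
      where
      pow-suc : ∀ j → ∃[ n ] 2 ^ j ≡ suc n
      pow-suc j with 2 ^ j | m^n>0 2 j
      ... | suc n | _ = n , refl

-- Greedy lexicographic search: the current string is extended by 1, else by 0, as long as
-- some extension lies in the (bounded) set V.
module Greedy (V : Str → Set) (extends? : ∀ p → Dec (∃[ y ] V (p ++ y))) (N : ℕ) (short : ∀ {z} → V z → length z ≤ N) where

  data Stuck : Str → Set where
    stuck : ∀ {p} → ¬ (∃[ y ] V ((p ++ true ∷ []) ++ y)) → ¬ (∃[ y ] V ((p ++ false ∷ []) ++ y)) → Stuck p

  Top : Str → Str → Set
  Top p z = ∀ y → V (p ++ y) → ∃[ r ] (z ≡ p ++ r × y ⊑ r)

  snoc-++ : ∀ (p : Str) b y → (p ++ b ∷ []) ++ y ≡ p ++ b ∷ y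
  snoc-++ p b y = List.++-assoc p (b ∷ []) y

  -- The course of the search as data: membership and maximality of the result and the run of the
  -- oracle machine are all obtained by recursion on it.
  data Search : Str → Str → Set where
    finish : ∀ {p} → Stuck p → Search p p
    one    : ∀ {p z} → ∃[ y ] V ((p ++ true ∷ []) ++ y) → Search (p ++ true ∷ []) z → Search p z
    nought : ∀ {p z} → ¬ (∃[ y ] V ((p ++ true ∷ []) ++ y)) → ∃[ y ] V ((p ++ false ∷ []) ++ y) →
             Search (p ++ false ∷ []) z → Search p z

  -- A prefix of a member has length at most N, so the measure N minus the length drops with each
  -- accepted symbol.
  search : ∀ n p → N ∸ length p < n → ∃[ y ] V (p ++ y) → ∃[ z ] Search p z
  search (suc n) p lt e with extends? (p ++ true ∷ [])
  ... | yes e₁ = let z , s = search n (p ++ true ∷ []) (shrink e₁) e₁ in z , one e₁ s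
    where
    shrink : ∃[ y ] V ((p ++ true ∷ []) ++ y) → N ∸ length (p ++ true ∷ []) < n
    shrink (y , v) = ≤-trans (∸-monoʳ-< (≤-reflexive (trans (+-comm 1 (length p)) (sym (List.length-++ p)))) (≤-trans (length-++-≤ˡ (p ++ true ∷ [])) (short v))) (≤-pred lt)
  ... | no n₁ with extends? (p ++ false ∷ [])
  ...   | yes e₀ = let z , s = search n (p ++ false ∷ []) (shrink e₀) e₀ in z , nought n₁ e₀ s
    where
    shrink : ∃[ y ] V ((p ++ false ∷ []) ++ y) → N ∸ length (p ++ false ∷ []) < n
    shrink (y , v) = ≤-trans (∸-monoʳ-< (≤-reflexive (trans (+-comm 1 (length p)) (sym (List.length-++ p)))) (≤-trans (length-++-≤ˡ (p ++ false ∷ [])) (short v))) (≤-pred lt)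
  ...   | no n₀ = p , finish (stuck n₁ n₀)

  -- Some member extends the current string throughout. When neither symbol can follow, that member
  -- must be the current string itself.
  search-∈ : ∀ {p z} → Search p z → ∃[ y ] V (p ++ y) → V z
  search-∈ (finish (stuck n₁ n₀)) ([] , v)          = subst V (List.++-identityʳ _) v
  search-∈ (finish {p} (stuck n₁ n₀)) (true ∷ y , v)  = ⊥-elim (n₁ (y , subst V (sym (snoc-++ p true y)) v))
  search-∈ (finish {p} (stuck n₁ n₀)) (false ∷ y , v) = ⊥-elim (n₀ (y , subst V (sym (snoc-++ p false y)) v))
  search-∈ (one e s) _      = search-∈ s e
  search-∈ (nought _ e s) _ = search-∈ s e

  search-prefix : ∀ {p z} → Search p z → ∃[ r ] z ≡ p ++ r
  search-prefix (finish _) = [] , sym (List.++-identityʳ _)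
  search-prefix (one {p} e s) = let r , eq = search-prefix s in true ∷ r , trans eq (snoc-++ p true r)
  search-prefix (nought {p} _ e s) = let r , eq = search-prefix s in false ∷ r , trans eq (snoc-++ p false r)

  search-top : ∀ {p z} → Search p z → Top p z
  search-top (finish (stuck n₁ n₀)) [] v = [] , sym (List.++-identityʳ _) , empty
  search-top (finish {p} (stuck n₁ n₀)) (true ∷ y) v = ⊥-elim (n₁ (y , subst V (sym (snoc-++ p true y)) v))
  search-top (finish {p} (stuck n₁ n₀)) (false ∷ y) v = ⊥-elim (n₀ (y , subst V (sym (snoc-++ p false y)) v))
  search-top (one {p} e s) [] v = let r , eq = search-prefix s in true ∷ r , trans eq (snoc-++ p true r) , empty
  search-top (one {p} e s) (false ∷ y) v = let r , eq = search-prefix s in true ∷ r , trans eq (snoc-++ p true r) , less₀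
  search-top (one {p} e s) (true ∷ y) v =
    let r , eq , le = search-top s y (subst V (sym (snoc-++ p true y)) v) in true ∷ r , trans eq (snoc-++ p true r) , same le
  search-top (nought {p} n₁ e s) [] v = let r , eq = search-prefix s in false ∷ r , trans eq (snoc-++ p false r) , empty
  search-top (nought {p} n₁ e s) (true ∷ y) v = ⊥-elim (n₁ (y , subst V (sym (snoc-++ p true y)) v))
  search-top (nought {p} n₁ e s) (false ∷ y) v =
    let r , eq , le = search-top s y (subst V (sym (snoc-++ p false y)) v) in false ∷ r , trans eq (snoc-++ p false r) , same le

  search-max : ∀ {z} → Search [] z → ∀ v → V v → v ⊑ z
  search-max s v vv with search-top s v vv
  ... | r , refl , le = le

-- Correctness and depth of the circuit in the largest certificate.

module Optimal (M : NTM) (m₁ q : ℕ) where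
  open Semantics M m₁ q public

  module _ {j : ℕ} (D* : Circuit m j) (correct : ∀ x → eval D* x ≡ true ⇔ NAccepts M (toList x))
           (fits : ∀ (t : Vec Bool (suc j)) → length (certificate t (depth D*) D*) ≤ budget j) where
    private
      encoded : ∃[ t ] bigEndian 0 (toList {n = suc j} t) ≡ count D*
      encoded =
        let x , ex = val-surjective {suc j} (count D*) (≤-trans (s≤s count≤) (m<m+n (2 ^ j) (≤-trans (m^n>0 2 j) (m≤m+n _ 0))))
            -- `val` reads the least significant bit first, the certificate the most significant
            -- one.
            v , ev = vec-of-list (reverse (toList x)) (trans (List.length-reverse (toList x)) (Vec.length-toList x))
        in v , trans (sym (valL-ʳ++ (toList v) [])) (trans (cong valL (trans (cong (_ʳ++ []) ev) (unwind (toList x)))) (trans (valL-toList x) ex))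
        where
        import Data.Vec.Properties as Vec
        count≤ : count D* ≤ 2 ^ j
        count≤ = ≤-trans (countTrue-≤ (map (eval D*) (inputsOf j)))
          (≤-reflexive (trans (List.length-map (eval D*) (inputsOf j)) (length-enum (2 ^ j) (falsesV j))))

      t* = proj₁ encoded

      valid* : Valid t* (depth D*) D*
      valid* = record { depth-ok = ≤-refl ; sound = λ x → Equivalence.to (correct x) ; counted = proj₂ encoded }

    certificate* : Certificate j (certificate t* (depth D*) D*)
    certificate* = cert t* (depth D*) D* valid* refl (fits t*)

    -- The lexicographically largest certificate contains a correct circuit, no deeper than D*.
    module _ {z : Str} (C : Certificate j z) (top : ∀ v → Certificate j v → v ⊑ z) where
      open Certificate C
      open Valid valid

      private
        stronger : ∀ x → eval D x ≡ true → eval D* x ≡ true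
        stronger x e = Equivalence.from (correct x) (sound x e)

        comparison : bigEndian 0 (toList t*) < bigEndian 0 (toList t) ⊎
                  (t* ≡ t × (depWord (depth D*) ++ encode D*) ⊑ (depWord d ++ encode D))
        comparison = ⊑-pairs t* t 0 (subst (certificate t* (depth D*) D* ⊑_) written
          (top _ certificate*))

        agree : t* ≡ t × (depWord (depth D*) ++ encode D*) ⊑ (depWord d ++ encode D)
        agree with comparison
        ... | inj₂ e  = e
        -- A strictly larger count is impossible: D is sound and `D*` accepts every member, so D
        -- accepts no more inputs than `D*`.
        ... | inj₁ lt = ⊥-elim (<⇒≱ lt (≤-trans (≤-reflexive counted)
          (≤-trans (countTrue-mono (eval D) (eval D*) (inputsOf j) stronger) (≤-reflexive (sym (proj₂ encoded))))))

      optimal-correct : ∀ x → eval D x ≡ true ⇔ NAccepts M (toList x)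
      optimal-correct x = mk⇔ (sound x) λ a →
        countTrue-≡ (eval D) (eval D*) (inputsOf j) stronger
          (≤-reflexive (trans (sym (proj₂ encoded)) (trans (cong (bigEndian 0 ∘ toList) (proj₁ agree)) counted)))
          x (∈-inputs x) (Equivalence.from (correct x) a)

      optimal-depth : depth D ≤ depth D*
      optimal-depth = ≤-trans depth-ok (⊑-depth (depth D*) d
        (subst₂ _⊑_ (List.++-assoc (power (depth D*) (true ∷ false ∷ [])) _ (encode D*)) (List.++-assoc (power d (true ∷ false ∷ [])) _ (encode D)) (proj₂ agree)))

-- Circuits with short encodings

ΣFin : ∀ {n} → (Fin n → ℕ) → ℕ
ΣFin {zero}  f = 0
ΣFin {suc n} f = f zero + ΣFin (f ∘ suc)

ΣFin-cong : ∀ {n} {f g : Fin n → ℕ} → (∀ i → f i ≡ g i) → ΣFin f ≡ ΣFin g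
ΣFin-cong {zero}  h = refl
ΣFin-cong {suc n} h = cong₂ _+_ (h zero) (ΣFin-cong (h ∘ suc))

ΣFin-+ : ∀ {n} (f g : Fin n → ℕ) → ΣFin (λ i → f i + g i) ≡ ΣFin f + ΣFin g
ΣFin-+ {zero}  f g = refl
ΣFin-+ {suc n} f g = trans (cong (f zero + g zero +_) (ΣFin-+ (f ∘ suc) (g ∘ suc)))
  (trans (+-assoc (f zero) (g zero) _) (trans (cong (f zero +_)
    (trans (sym (+-assoc (g zero) _ _)) (trans (cong (_+ ΣFin (g ∘ suc)) (+-comm (g zero) _)) (+-assoc (ΣFin (f ∘ suc)) _ _))))
    (sym (+-assoc (f zero) _ _))))

ΣFin-0 : ∀ n → ΣFin {n} (λ _ → 0) ≡ 0
ΣFin-0 zero    = refl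
ΣFin-0 (suc n) = ΣFin-0 n

δ : ∀ {n} → Fin n → Fin n → ℕ
δ zero    zero    = 1
δ (suc i) (suc j) = δ i j
δ _       _       = 0

weight : Bool → ℕ → ℕ
weight true  k = k
weight false k = 0

weight-0 : ∀ b → weight b 0 ≡ 0
weight-0 true  = refl
weight-0 false = refl

weight-+ : ∀ b k l → weight b (k + l) ≡ weight b k + weight b l
weight-+ true  k l = refl
weight-+ false k l = refl

ΣFin-δ : ∀ {n} (v : Fin n → Bool) a → ΣFin (λ i → weight (v i) (δ i a)) ≡ weight (v a) 1
ΣFin-δ {suc n} v zero = trans (cong (weight (v zero) 1 +_) (trans (ΣFin-cong (λ i → weight-0 (v (suc i)))) (ΣFin-0 n))) (+-identityʳ _)
ΣFin-δ {suc n} v (suc a) = trans (cong (_+ ΣFin (λ i → weight (v (suc i)) (δ i a))) (weight-0 (v zero))) (ΣFin-δ (v ∘ suc) a)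

occ : ∀ {w} → Fin w → List (Fin w) → ℕ
occ i []       = 0
occ i (a ∷ is) = δ i a + occ i is

-- Groups the list entries by wire. The count then depends on the list only through multiplicities,
-- which is what normalisation changes.
countTrue-occ : ∀ {w} (v : Fin w → Bool) is → countTrue (map v is) ≡ ΣFin (λ i → weight (v i) (occ i is))
countTrue-occ {w} v [] = sym (trans (ΣFin-cong (λ i → weight-0 (v i))) (ΣFin-0 w))
countTrue-occ v (a ∷ is) = trans (head-count (v a) (map v is)) (sym (trans
  (trans (ΣFin-cong (λ i → weight-+ (v i) (δ i a) (occ i is))) (ΣFin-+ (λ i → weight (v i) (δ i a)) (λ i → weight (v i) (occ i is)))) (cong₂ _+_ (ΣFin-δ v a) (sym (countTrue-occ v is)))))
  where
  head-count : ∀ b bs → countTrue (b ∷ bs) ≡ weight b 1 + countTrue bs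
  head-count true  bs = refl
  head-count false bs = refl

-- Rebuilds a list from multiplicities, in the direction opposite to `occ`. It is used with e the
-- identity; a general e is needed for the recursion on n.
spread : ∀ {n w} → (Fin n → Fin w) → (Fin n → ℕ) → List (Fin w)
spread {zero}  e r = []
spread {suc n} e r = replicate (r zero) (e zero) ++ spread (e ∘ suc) (r ∘ suc)

countTrue-++ : ∀ as bs → countTrue (as ++ bs) ≡ countTrue as + countTrue bs
countTrue-++ []           bs = refl
countTrue-++ (true ∷ as)  bs = cong suc (countTrue-++ as bs)
countTrue-++ (false ∷ as) bs = countTrue-++ as bs

countTrue-replicate : ∀ k b → countTrue (replicate k b) ≡ weight b k
countTrue-replicate zero    b     = sym (weight-0 b)
countTrue-replicate (suc k) true  = cong suc (countTrue-replicate k true)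
countTrue-replicate (suc k) false = countTrue-replicate k false

countTrue-spread : ∀ {n w} (v : Fin w → Bool) (e : Fin n → Fin w) r → countTrue (map v (spread e r)) ≡ ΣFin (λ i → weight (v (e i)) (r i))
countTrue-spread {zero}  v e r = refl
countTrue-spread {suc n} v e r = trans (cong countTrue (List.map-++ v (replicate (r zero) (e zero)) _))
  (trans (countTrue-++ (map v (replicate (r zero) (e zero))) _)
    (cong₂ _+_ (trans (cong countTrue (List.map-replicate v (r zero) (e zero))) (countTrue-replicate (r zero) (v (e zero)))) (countTrue-spread v (e ∘ suc) (r ∘ suc))))

length-spread : ∀ {n w} (e : Fin n → Fin w) r b → (∀ i → r i ≤ b) → length (spread e r) ≤ n * b
length-spread {zero}  e r b h = z≤n
length-spread {suc n} e r b h = ≤-trans (≤-reflexive (trans (List.length-++ (replicate (r zero) (e zero))) (cong (_+ length (spread (e ∘ suc) (r ∘ suc))) (List.length-replicate (r zero)))))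
  (+-mono-≤ (h zero) (length-spread (e ∘ suc) (r ∘ suc) b (h ∘ suc)))

∈-spread : ∀ {n w} (e : Fin n → Fin w) r {x} → x ∈ spread e r → ∃[ i ] (x ≡ e i × 1 ≤ r i)
∈-spread {suc n} e r i with ∈-++⁻ (replicate (r zero) (e zero)) i
  where open import Data.List.Membership.Propositional.Properties using (∈-++⁻)
... | inj₂ k = let i , eq , le = ∈-spread (e ∘ suc) (r ∘ suc) k in suc i , eq , le
... | inj₁ k = zero , from-replicate (r zero) k
  where
  from-replicate : ∀ k {x a} → x ∈ replicate k a → x ≡ a × 1 ≤ k
  from-replicate (suc k) (here refl) = refl , s≤s z≤n
  from-replicate (suc k) (there i)   = proj₁ (from-replicate k i) , s≤s z≤n

occ-∈ : ∀ {w} (i : Fin w) is → 1 ≤ occ i is → i ∈ is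
occ-∈ i (a ∷ is) le with i Fin.≟ a
... | yes refl = here refl
... | no ne    = there (occ-∈ i is (≤-trans le (≤-reflexive (cong (_+ occ i is) (δ-≢ i a ne)))))
  where
  δ-≢ : ∀ {n} (i a : Fin n) → i ≢ a → δ i a ≡ 0
  δ-≢ zero    zero    ne = ⊥-elim (ne refl)
  δ-≢ zero    (suc a) ne = refl
  δ-≢ (suc i) zero    ne = refl
  δ-≢ (suc i) (suc a) ne = δ-≢ i a (ne ∘ cong suc)

maxList-≤ : ∀ {A : Set} (f : A → ℕ) xs M → (∀ x → x ∈ xs → f x ≤ M) → maxList (map f xs) ≤ M
maxList-≤ f []       M h = z≤n
maxList-≤ f (x ∷ xs) M h = ⊔-lub (h x (here refl)) (maxList-≤ f xs M (λ y i → h y (there i)))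

≤-maxList : ∀ {A : Set} (f : A → ℕ) {xs x} → x ∈ xs → f x ≤ maxList (map f xs)
≤-maxList f (here refl) = m≤m⊔n _ _
≤-maxList f {y ∷ xs} (there i) = ≤-trans (≤-maxList f i) (m≤n⊔m (f y) _)

isZeroℕ : ℕ → Bool
isZeroℕ zero    = true
isZeroℕ (suc _) = false

isZeroℕ-+ : ∀ a b → isZeroℕ (a + b) ≡ isZeroℕ a ∧ isZeroℕ b
isZeroℕ-+ zero    b = refl
isZeroℕ-+ (suc a) b = refl

-- Gates with every input repeated at most m times: encodings of circuits of polynomial
-- size become polynomially long.
module Normalise (m₁ : ℕ) where
  open Accumulate m₁

  m : ℕ
  m = suc m₁

  -- AND and OR depend only on which wires occur, MOD only on the multiplicities modulo m.
  once residues : ∀ {w} → List (Fin w) → List (Fin w)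
  once is     = spread id (λ i → occ i is ⊓ 1)
  residues is = spread id (λ i → occ i is % m)

  normGate : ∀ {w} → Gate m w → Gate m w
  normGate (NOT i)  = NOT i
  normGate (AND is) = AND (once is)
  normGate (OR is)  = OR (once is)
  normGate (MOD is) = MOD (residues is)

  norm : ∀ {j g} → SLP m j g → SLP m j g
  norm inputs  = inputs
  norm (s ▷ c) = norm s ▷ normGate c

  private
    -- AND says that no input is false and OR that some input is true. Both ask whether a count
    -- vanishes, and capping multiplicities at 1 does not affect the answer.
    zero-⊓ : ∀ {n} (v : Fin n → Bool) (k : Fin n → ℕ) →
             isZeroℕ (ΣFin (λ i → weight (v i) (k i ⊓ 1))) ≡ isZeroℕ (ΣFin (λ i → weight (v i) (k i)))
    zero-⊓ {zero}  v k = refl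
    zero-⊓ {suc n} v k =
      trans (isZeroℕ-+ (weight (v zero) (k zero ⊓ 1)) (ΣFin (λ i → weight (v (suc i)) (k (suc i) ⊓ 1))))
        (trans (cong₂ _∧_ (one (v zero) (k zero)) (zero-⊓ (λ i → v (suc i)) (λ i → k (suc i))))
          (sym (isZeroℕ-+ (weight (v zero) (k zero)) (ΣFin (λ i → weight (v (suc i)) (k (suc i)))))))
      where
      one : ∀ b k → isZeroℕ (weight b (k ⊓ 1)) ≡ isZeroℕ (weight b k)
      one false k             = refl
      one true  zero          = refl
      one true  (suc zero)    = refl
      one true  (suc (suc k)) = refl

    zero-once : ∀ {w} (v : Fin w → Bool) is → isZeroℕ (countTrue (map v (once is))) ≡ isZeroℕ (countTrue (map v is))
    zero-once v is = trans (cong isZeroℕ (countTrue-spread v id (λ i → occ i is ⊓ 1))) (trans (zero-⊓ v (λ i → occ i is)) (cong isZeroℕ (sym (countTrue-occ v is))))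

    or-count : ∀ {w} (v : Fin w → Bool) is → foldr (λ i b → v i ∨ b) false is ≡ not (isZeroℕ (countTrue (map v is)))
    or-count v [] = refl
    or-count v (i ∷ is) with v i
    ... | true  = refl
    ... | false = or-count v is

    and-count : ∀ {w} (v : Fin w → Bool) is → foldr (λ i b → v i ∧ b) true is ≡ isZeroℕ (countTrue (map (not ∘ v) is))
    and-count v [] = refl
    and-count v (i ∷ is) with v i
    ... | true  = and-count v is
    ... | false = refl

    mod-sum : ∀ {n} (v : Fin n → Bool) (k : Fin n → ℕ) → ΣFin (λ i → weight (v i) (k i % m)) % m ≡ ΣFin (λ i → weight (v i) (k i)) % m
    mod-sum {zero}  v k = refl
    mod-sum {suc n} v k = trans (%-distribˡ-+ (weight (v zero) (k zero % m)) (ΣFin (λ i → weight (v (suc i)) (k (suc i) % m))) m)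
      (trans (cong₂ (λ a b → (a + b) % m) (one (v zero) (k zero)) (mod-sum (λ i → v (suc i)) (λ i → k (suc i))))
        (sym (%-distribˡ-+ (weight (v zero) (k zero)) (ΣFin (λ i → weight (v (suc i)) (k (suc i)))) m)))
      where
      one : ∀ b k → weight b (k % m) % m ≡ weight b k % m
      one false k = refl
      one true  k = m%n%n≡m%n k m

    divides-cong : ∀ a b → a % m ≡ b % m → ⌊ m ∣? a ⌋ ≡ ⌊ m ∣? b ⌋
    divides-cong a b e = trans (sym (isZero-residue a)) (trans (cong isZero (Fin.toℕ-injective
      (trans (Fin.toℕ-fromℕ< (m%n<n a m)) (trans e (sym (Fin.toℕ-fromℕ< (m%n<n b m))))))) (isZero-residue b))

  normGate-val : ∀ {w} (v : Fin w → Bool) (c : Gate m w) → gateVal v (normGate c) ≡ gateVal v c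
  normGate-val v (NOT i)  = refl
  normGate-val v (AND is) = trans (and-count v (once is)) (trans (zero-once (not ∘ v) is) (sym (and-count v is)))
  normGate-val v (OR is)  = trans (or-count v (once is)) (trans (cong not (zero-once v is)) (sym (or-count v is)))
  normGate-val v (MOD is) = divides-cong (countTrue (map v (residues is))) (countTrue (map v is))
    (trans (cong (_% m) (countTrue-spread v id (λ i → occ i is % m))) (trans (mod-sum v (λ i → occ i is)) (cong (_% m) (sym (countTrue-occ v is)))))

  gateVal-cong : ∀ {w} {u v : Fin w → Bool} (c : Gate m w) → (∀ i → u i ≡ v i) → gateVal u c ≡ gateVal v c
  gateVal-cong (NOT i) h = cong not (h i)
  gateVal-cong {u = u} {v} (AND is) h = go is
    where go : ∀ is → foldr (λ i b → u i ∧ b) true is ≡ foldr (λ i b → v i ∧ b) true is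
          go []       = refl
          go (i ∷ is) = cong₂ _∧_ (h i) (go is)
  gateVal-cong {u = u} {v} (OR is) h = go is
    where go : ∀ is → foldr (λ i b → u i ∨ b) false is ≡ foldr (λ i b → v i ∨ b) false is
          go []       = refl
          go (i ∷ is) = cong₂ _∨_ (h i) (go is)
  gateVal-cong (MOD is) h = cong (λ bs → ⌊ m ∣? countTrue bs ⌋) (List.map-cong h is)

  norm-val : ∀ {j g} (s : SLP m j g) x i → wireVal (norm s) x i ≡ wireVal s x i
  norm-val inputs  x i       = refl
  norm-val (s ▷ c) x zero    = trans (gateVal-cong (normGate c) (norm-val s x)) (normGate-val (wireVal s x) c)
  norm-val (s ▷ c) x (suc i) = norm-val s x i

  -- The new multiplicities never exceed the old ones, so no wire is added; hence normalisation
  -- cannot increase depth.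
  normGate-inputs : ∀ {w} (c : Gate m w) i → i ∈ gateInputs (normGate c) → i ∈ gateInputs c
  normGate-inputs (NOT _)  i h = h
  normGate-inputs (AND is) i h with ∈-spread id (λ i → occ i is ⊓ 1) h
  ... | _ , refl , le = occ-∈ i is (≤-trans le (m⊓n≤m (occ i is) 1))
  normGate-inputs (OR is)  i h with ∈-spread id (λ i → occ i is ⊓ 1) h
  ... | _ , refl , le = occ-∈ i is (≤-trans le (m⊓n≤m (occ i is) 1))
  normGate-inputs (MOD is) i h with ∈-spread id (λ i → occ i is % m) h
  ... | _ , refl , le = occ-∈ i is (≤-trans le (m%n≤m (occ i is) m))
    where open import Data.Nat.DivMod using (m%n≤m)

  norm-depth : ∀ {j g} (s : SLP m j g) i → wireDepth (norm s) i ≤ wireDepth s i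
  norm-depth inputs  i       = z≤n
  norm-depth (s ▷ c) zero    = s≤s (maxList-≤ (wireDepth (norm s)) (gateInputs (normGate c)) _
    (λ i h → ≤-trans (norm-depth s i) (≤-maxList (wireDepth s) (normGate-inputs c i h))))
  norm-depth (s ▷ c) (suc i) = norm-depth s i

  fan-in-norm : ∀ {w} (is : List (Fin w)) → length (once is) ≤ w * m × length (residues is) ≤ w * m
  fan-in-norm is = length-spread id (λ i → occ i is ⊓ 1) m (λ i → ≤-trans (m⊓n≤n (occ i is) 1) (s≤s z≤n)) ,
                   length-spread id (λ i → occ i is % m) m (λ i → <⇒≤ (m%n<n (occ i is) m))

  -- At most four symbols for the operation, the closing 0 of the input count, the count itself, at
  -- most w m, and as many indices of length at most w + 1.
  gateLength : ℕ → ℕ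
  gateLength w = 5 + (w * m + w * m * suc w)

  encIdxs-≤ : ∀ {w} (is : List (Fin w)) → length (encIdxs is) ≤ length is * suc w
  encIdxs-≤ [] = z≤n
  encIdxs-≤ {w} (i ∷ is) = ≤-trans (≤-reflexive (List.length-++ (unary (toℕ i)))) (+-mono-≤
    (≤-trans (≤-reflexive (trans (List.length-++ (replicate (toℕ i) true)) (trans (cong (_+ 1) (List.length-replicate (toℕ i))) (+-comm _ 1))))
      (s≤s (<⇒≤ (Fin.toℕ<n i)))) (encIdxs-≤ is))

  length-unary : ∀ n → length (unary n) ≡ suc n
  length-unary n = trans (List.length-++ (replicate n true)) (trans (cong (_+ 1) (List.length-replicate n)) (+-comm n 1))

  listLength : ∀ {w} (is : List (Fin w)) → length is ≤ w * m → length (unary (length is) ++ encIdxs is) ≤ suc (w * m + w * m * suc w)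
  listLength {w} is le = ≤-trans (≤-reflexive (trans (List.length-++ (unary (length is))) (cong (_+ length (encIdxs is)) (length-unary (length is)))))
    (s≤s (+-mono-≤ le (≤-trans (encIdxs-≤ is) (*-monoˡ-≤ (suc w) le))))

  encGate-norm : ∀ {w} (c : Gate m w) → length (encGate (normGate c)) ≤ gateLength w
  encGate-norm {w} (NOT i) = ≤-trans (≤-reflexive (cong suc (length-unary (toℕ i)))) (s≤s (s≤s (≤-trans (<⇒≤ (Fin.toℕ<n i))
    (≤-trans (≤-trans (m≤m*n w m) (m≤m+n (w * m) _)) (m≤n+m _ 3)))))
  encGate-norm (AND is) = s≤s (s≤s (≤-trans (listLength (once is) (proj₁ (fan-in-norm is))) (m≤n+m _ 2)))
  encGate-norm (OR is)  = s≤s (s≤s (s≤s (≤-trans (listLength (once is) (proj₁ (fan-in-norm is))) (m≤n+m _ 1))))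
  encGate-norm (MOD is) = s≤s (s≤s (s≤s (s≤s (listLength (residues is) (proj₂ (fan-in-norm is))))))

  gateLength-mono : ∀ {w w'} → w ≤ w' → gateLength w ≤ gateLength w'
  gateLength-mono le = +-monoʳ-≤ 5 (+-mono-≤ (*-monoˡ-≤ m le) (*-mono-≤ (*-monoˡ-≤ m le) (s≤s le)))

  encSLP-norm : ∀ {j g W} (s : SLP m j g) → g + j ≤ W → length (encSLP (norm s)) ≤ g * gateLength W
  encSLP-norm inputs le = z≤n
  encSLP-norm {j} {suc g} {W} (s ▷ c) le = ≤-trans (≤-reflexive (trans (List.length-++ (encSLP (norm s))) (+-comm _ (length (encGate (normGate c))))))
    (+-mono-≤ (≤-trans (encGate-norm c) (gateLength-mono (≤-trans (n≤1+n _) le))) (encSLP-norm s (≤-trans (n≤1+n _) le)))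

  normalise : ∀ {j} → Circuit m j → Circuit m j
  normalise (circuit s t o) = circuit s (norm t) o

  certLength : ℕ → ℕ → ℕ
  certLength s j = (suc j * 2) + ((s * 2 + 3) + (suc m + (suc j + (suc s + (s * gateLength (s + j) + suc (s + j))))))

  private
    length-pairs : ∀ (u : Str) → length (pairs u) ≡ length u * 2
    length-pairs []      = refl
    length-pairs (b ∷ u) = cong (2 +_) (length-pairs u)

    length-power : ∀ d → length (power d (true ∷ false ∷ [])) ≡ d * 2
    length-power zero    = refl
    length-power (suc d) = cong (2 +_) (length-power d)

    length-++-mono : ∀ {A : Set} (xs : List A) {ys a b} → length xs ≤ a → length ys ≤ b → length (xs ++ ys) ≤ a + b
    length-++-mono xs h h' = ≤-trans (≤-reflexive (List.length-++ xs)) (+-mono-≤ h h')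

  certificate-length : ∀ {j} (D : Circuit m j) (t : Vec Bool (suc j)) →
    length (certificate t (depth (normalise D)) (normalise D)) ≤ certLength (size D) j
  certificate-length {j} D@(circuit s g o) t =
    length-++-mono (pairs (toList t)) (≤-reflexive (trans (length-pairs (toList t)) (cong (_* 2) (Vec.length-toList t))))
    (length-++-mono (depWord (depth (normalise D))) (length-++-mono (power (depth (normalise D)) (true ∷ false ∷ []))
        (≤-trans (≤-reflexive (length-power (depth (normalise D)))) (*-monoˡ-≤ 2 (wireDepth-≤ (norm g) o))) ≤-refl)
    (length-++-mono (unary m) (≤-reflexive (length-unary m)) (length-++-mono (unary j) (≤-reflexive (length-unary j))
      (length-++-mono (unary s) (≤-reflexive (length-unary s)) (length-++-mono (encSLP (norm g)) (encSLP-norm g ≤-refl)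
        (≤-trans (≤-reflexive (length-unary (toℕ o))) (s≤s (<⇒≤ (Fin.toℕ<n o)))))))))
    where import Data.Vec.Properties as Vec

-- Polynomial bounds.

Poly : (ℕ → ℕ) → Set
Poly f = ∃[ c ] ∀ j → f j ≤ c * suc j ^ c

poly-≤ : ∀ {f g} → (∀ j → f j ≤ g j) → Poly g → Poly f
poly-≤ h (c , b) = c , λ j → ≤-trans (h j) (b j)

poly-const : ∀ k → Poly (λ _ → k)
poly-const k = k , λ j → m≤m*n k (suc j ^ k) {{m^n≢0 (suc j) k}}

poly-id : Poly id
poly-id = 1 , λ j → ≤-trans (n≤1+n j) (≤-reflexive (sym (trans (+-identityʳ _) (*-identityʳ (suc j)))))

infixl 6 _⊞_
infixl 7 _⊠_
_⊞_ : ∀ {f g} → Poly f → Poly g → Poly (λ j → f j + g j)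
(c , b) ⊞ (c' , b') = c + c' , λ j → ≤-trans (+-mono-≤ (≤-trans (b j) (*-monoʳ-≤ c (^-monoʳ-≤ (suc j) (m≤m+n c c')))) (≤-trans (b' j) (*-monoʳ-≤ c' (^-monoʳ-≤ (suc j) (m≤n+m c' c)))))
  (≤-reflexive (sym (*-distribʳ-+ (suc j ^ (c + c')) c c')))

_⊠_ : ∀ {f g} → Poly f → Poly g → Poly (λ j → f j * g j)
(c , b) ⊠ (c' , b') = c * c' + (c + c') , λ j → ≤-trans (*-mono-≤ (b j) (b' j))
  (≤-trans (≤-reflexive (trans (*-assoc c _ _) (trans (cong (c *_) (trans (sym (*-assoc (suc j ^ c) c' _)) (trans (cong (_* suc j ^ c') (*-comm (suc j ^ c) c')) (*-assoc c' _ _))))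
      (trans (sym (*-assoc c c' _)) (cong (c * c' *_) (sym (^-distribˡ-+-* (suc j) c c')))))))
    (*-mono-≤ (m≤m+n (c * c') (c + c')) (^-monoʳ-≤ (suc j) (m≤n+m (c + c') (c * c')))))

-- `IsACC` bounds the size only from some j₀ on, while the budget must suffice for every j.
-- Induction on j₀ absorbs one exceptional value at a time into an additive constant.
poly-eventually : ∀ (f : ℕ → ℕ) c j₀ → (∀ j → j₀ ≤ j → f j ≤ c * j ^ c) → Poly f
poly-eventually f c zero h = c , λ j → ≤-trans (h j z≤n) (*-monoʳ-≤ c (^-monoˡ-≤ c (n≤1+n j)))
poly-eventually f c (suc j₀) h = poly-≤ bound (poly-const (f j₀) ⊞ poly-eventually g c j₀ h')
  where
  g : ℕ → ℕ
  g j with j Data.Nat.≟ j₀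
  ... | yes _ = 0
  ... | no _  = f j
  h' : ∀ j → j₀ ≤ j → g j ≤ c * j ^ c
  h' j le with j Data.Nat.≟ j₀
  ... | yes _ = z≤n
  ... | no ne = h j (≤∧≢⇒< le (ne ∘ sym))
  bound : ∀ j → f j ≤ f j₀ + g j
  bound j with j Data.Nat.≟ j₀
  ... | yes refl = m≤m+n _ 0
  ... | no _     = m≤n+m _ (f j₀)

-- The oracle machine: q0 turns 1^j into 1^j 0; q1 appends a 1 (and is the yes-state); q2
-- rewinds to the query q3; q4, q5 replace a rejected final 1 by 0, or remove a rejected
-- final 0; q6 rewinds; q7 skips 1^j 0; q8, q9 skip the advice pairs; q10 halts.
module _ where
  pattern q0 = zero
  pattern q1 = suc q0
  pattern q2 = suc q1
  pattern q3 = suc q2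
  pattern q4 = suc q3
  pattern q5 = suc q4
  pattern q6 = suc q5
  pattern q7 = suc q6
  pattern q8 = suc q7
  pattern q9 = suc q8
  pattern q10 = suc q9

  pattern s0 = suc zero
  pattern s1 = suc (suc zero)

  searchδ : Fin 11 → Sym 0 → Fin 11 × Sym 0 × Move
  searchδ q0 zero = q1 , s0 , R
  searchδ q0 a    = q0 , a , R
  searchδ q1 zero = q2 , s1 , L
  searchδ q1 a    = q1 , a , R
  searchδ q2 zero = q3 , zero , R
  searchδ q2 a    = q2 , a , L
  searchδ q4 zero = q5 , zero , L
  searchδ q4 a    = q4 , a , R
  searchδ q5 s1   = q2 , s0 , L
  searchδ q5 a    = q6 , zero , L
  searchδ q6 zero = q7 , zero , R
  searchδ q6 a    = q6 , a , L
  searchδ q7 s1   = q7 , s1 , R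
  searchδ q7 a    = q8 , a , R
  searchδ q8 s1   = q9 , s1 , R
  searchδ q8 a    = q10 , a , R
  searchδ q9 a    = q8 , a , R
  searchδ q a     = q , a , S

  searcher : OTM
  searcher = record { nQ = 11 ; nΓ = 0 ; start = q0 ; halt = q10 ; qquery = q3 ; qyes = q1 ; qno = q4 ; δ = searchδ }

tapeAt : List (Sym 0) → List (Sym 0) → Tape 0
tapeAt l []      = tape l blank []
tapeAt l (s ∷ r) = tape l s r

blanks₀ : ℕ → List (Sym 0)
blanks₀ n = replicate n blank

-- The word u ʳ++ v on an otherwise blank tape, the head on the first symbol of v.
bitTape : ℕ → Str → Str → ℕ → Tape 0
bitTape a u v b = tapeAt (map bitSym u ++ blanks₀ a) (map bitSym v ++ blanks₀ b)

tapeAt-R : ∀ l s r → move R (tape l s r) ≡ tapeAt (s ∷ l) r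
tapeAt-R l s []      = refl
tapeAt-R l s (_ ∷ r) = refl

readBitsList-bits : ∀ v b → readBitsList (map bitSym v ++ blanks₀ b) ≡ v
readBitsList-bits []          zero    = refl
readBitsList-bits []          (suc b) = refl
readBitsList-bits (true ∷ v)  b       = cong (true ∷_) (readBitsList-bits v b)
readBitsList-bits (false ∷ v) b       = cong (false ∷_) (readBitsList-bits v b)

readBits-bitTape : ∀ a u v b → readBits (bitTape a u v b) ≡ v
readBits-bitTape a u []          zero    = refl
readBits-bitTape a u []          (suc b) = refl
readBits-bitTape a u (true ∷ v)  b       = cong (true ∷_) (readBitsList-bits v b)
readBits-bitTape a u (false ∷ v) b       = cong (false ∷_) (readBitsList-bits v b)

module SearchRun (O : Language) where

  record Reach (T : ℕ) (c c' : Config 11 0) : Set where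
    constructor reach
    field
      {steps} : ℕ
      steps≤  : steps ≤ T
      run     : ORun searcher O steps c c'

  orun-trans : ∀ {m n a b c} → ORun searcher O m a b → ORun searcher O n b c → ORun searcher O (m + n) a c
  orun-trans done r = r
  orun-trans (more s r) r' = more s (orun-trans r r')

  infixr 4 _⟫_
  _⟫_ : ∀ {T T' a b c} → Reach T a b → Reach T' b c → Reach (T + T') a c
  reach le r ⟫ reach le' r' = reach (+-mono-≤ le le') (orun-trans r r')

  within : ∀ {T T' a b} → T ≤ T' → Reach T a b → Reach T' a b
  within le (reach le' r) = reach (≤-trans le' le) r

  one-step : ∀ {c c'} → OStep searcher O c c' → Reach 1 c c'
  one-step s = reach ≤-refl (more s done)

  reach-≡ : ∀ {T a b c} → b ≡ c → Reach T a b → Reach T a c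
  reach-≡ refl r = r

  record Working (q : Fin 11) : Set where
    constructor working
    field
      not-halt  : q ≢ q10
      not-query : q ≢ q3
  open Working

  move-step : ∀ {q t q' a mv} → Working q → searchδ q (head t) ≡ (q' , a , mv) → Reach 1 (cfg q t) (cfg q' (move mv (write a t)))
  move-step w e = one-step (ostep (not-halt w) (not-query w) e)

  step-R : ∀ {q q'} → Working q → ∀ a u c c' v b → searchδ q (bitSym c) ≡ (q' , bitSym c' , R) →
           Reach 1 (cfg q (bitTape a u (c ∷ v) b)) (cfg q' (bitTape a (c' ∷ u) v b))
  step-R w a u c c' v b e = reach-≡ (cong (cfg _) (tapeAt-R _ _ _)) (move-step w e)

  seek-R : ∀ {q} → Working q → (∀ c → searchδ q (bitSym c) ≡ (q , bitSym c , R)) → ∀ a u v b →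
           Reach (length v) (cfg q (bitTape a u v b)) (cfg q (bitTape a (v ʳ++ u) [] b))
  seek-R w h a u [] b = reach z≤n done
  seek-R w h a u (c ∷ v) b = step-R w a u c c v b (h c) ⟫ seek-R w h a (c ∷ u) v b

  step-back : ∀ {q q'} → Working q → ∀ a c u b x → searchδ q zero ≡ (q' , x , L) →
              Reach 1 (cfg q (bitTape a (c ∷ u) [] b)) (cfg q' (tapeAt (map bitSym u ++ blanks₀ a) (bitSym c ∷ x ∷ blanks₀ (b ∸ 1))))
  step-back w a c u zero    x e = move-step w e
  step-back w a c u (suc b) x e = move-step w e

  -- The head runs one cell beyond the left end and comes back, so afterwards at least one blank is
  -- stored on the left: `suc (a ∸ 1)`, whether it was there before or has just been created.
  seek-L : ∀ {q q'} → Working q → (∀ c → searchδ q (bitSym c) ≡ (q , bitSym c , L)) → searchδ q zero ≡ (q' , zero , R) → ∀ a u c v b →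
           Reach (2 + length u) (cfg q (bitTape a u (c ∷ v) b)) (cfg q' (bitTape (suc (a ∸ 1)) [] (u ʳ++ (c ∷ v)) b))
  seek-L w h e zero    [] c v b = move-step w (h c) ⟫ move-step w e
  seek-L w h e (suc a) [] c v b = move-step w (h c) ⟫ move-step w e
  seek-L w h e a (d ∷ u) c v b = move-step w (h c) ⟫ seek-L w h e a u d (c ∷ v) b

  w0 : Working q0
  w0 = working (λ ()) (λ ())
  w1 : Working q1
  w1 = working (λ ()) (λ ())
  w2 : Working q2
  w2 = working (λ ()) (λ ())
  w4 : Working q4
  w4 = working (λ ()) (λ ())
  w5 : Working q5
  w5 = working (λ ()) (λ ())
  w6 : Working q6
  w6 = working (λ ()) (λ ())
  w7 : Working q7
  w7 = working (λ ()) (λ ())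
  w8 : Working q8
  w8 = working (λ ()) (λ ())
  w9 : Working q9
  w9 = working (λ ()) (λ ())

  both : ∀ {A : Set} {f g : Bool → A} → f true ≡ g true → f false ≡ g false → ∀ c → f c ≡ g c
  both e e' true  = e
  both e e' false = e'

  ask-yes : ∀ {a w b} → O w → Reach 1 (cfg q3 (bitTape a [] w b)) (cfg q1 (bitTape a [] w b))
  ask-yes {a} {w} {b} o = one-step (oyes (λ ()) refl (subst O (sym (readBits-bitTape a [] w b)) o))

  ask-no : ∀ {a w b} → ¬ O w → Reach 1 (cfg q3 (bitTape a [] w b)) (cfg q4 (bitTape a [] w b))
  ask-no {a} {w} {b} n = one-step (ono (λ ()) refl (λ o → n (subst O (readBits-bitTape a [] w b) o)))

  -- A nonempty word seen from its last symbol d, on which the head lands when it steps back from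
  -- the blank after the word.
  record Backwards (w : Str) : Set where
    constructor backwards
    field
      d         : Bool
      u         : Str
      reversed  : w ʳ++ [] ≡ d ∷ u
      forwards  : ∀ z → u ʳ++ (d ∷ z) ≡ w ++ z
      length-u  : suc (length u) ≡ length w

  backwards-view : ∀ b w → Backwards (b ∷ w)
  backwards-view b w with (b ∷ w) ʳ++ [] in e
  ... | [] = ⊥-elim (0≢1+n (trans (sym (cong length e)) (List.length-ʳ++ (b ∷ w))))
  ... | d ∷ u = backwards d u e (λ z → trans (cong (_ʳ++ z) (sym e)) (List.ʳ++-ʳ++ (b ∷ w)))
                  (trans (sym (cong length e)) (trans (List.length-ʳ++ (b ∷ w)) (+-identityʳ _)))

  module _ {w : Str} (back : Backwards w) {W : ℕ} (fits : 3 + length w ≤ W) where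
    open Backwards back

    private
      rewind : ∀ {q q'} → Working q → (∀ c → searchδ q (bitSym c) ≡ (q , bitSym c , L)) → searchδ q zero ≡ (q' , zero , R) → ∀ a z b →
               Reach W (cfg q (bitTape a u (d ∷ z) b)) (cfg q' (bitTape (suc (a ∸ 1)) [] (w ++ z) b))
      rewind wk h e a z b = within (≤-trans (s≤s (s≤s (≤-trans (n≤1+n _) (≤-reflexive length-u)))) (≤-trans (n≤1+n _) fits))
        (reach-≡ (cong (λ y → cfg _ (bitTape (suc (a ∸ 1)) [] y b)) (forwards z)) (seek-L wk h e a u d z b))

      reverse-snoc : ∀ c → (w ++ c ∷ []) ʳ++ [] ≡ c ∷ d ∷ u
      reverse-snoc c = trans (ʳ++-snoc c w) (cong (c ∷_) reversed)

      to-end : ∀ c a b → Reach W (cfg q4 (bitTape a [] (w ++ c ∷ []) b)) (cfg q4 (bitTape a (c ∷ d ∷ u) [] b))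
      to-end c a b = within (≤-trans (≤-reflexive (trans (List.length-++ w) (+-comm _ 1))) (≤-trans (≤-trans (n≤1+n _) (n≤1+n _)) fits))
        (reach-≡ (cong (λ y → cfg _ (bitTape a y [] b)) (reverse-snoc c)) (seek-R w4 (both refl refl) a [] (w ++ c ∷ []) b))

    append-one : ∀ a u₁ v b → v ʳ++ u₁ ≡ w ʳ++ [] → ∃[ a' ] ∃[ b' ]
      Reach (W + (1 + W)) (cfg q1 (bitTape a u₁ v b)) (cfg q3 (bitTape a' [] (w ++ true ∷ []) b'))
    append-one a u₁ v b e = _ , _ ,
      (within v≤ (reach-≡ (cong (λ y → cfg _ (bitTape a y [] b)) (trans e reversed)) (seek-R w1 (both refl refl) a u₁ v b))
       ⟫ step-back w1 a d u b s1 refl ⟫ rewind w2 (both refl refl) refl a (true ∷ []) (b ∸ 1))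
      where
      v≤ : length v ≤ W
      v≤ = ≤-trans (≤-trans (m≤m+n (length v) (length u₁)) (≤-reflexive (trans (sym (List.length-ʳ++ v)) (trans (cong length e) (trans (List.length-ʳ++ w) (+-identityʳ _))))))
             (≤-trans (m≤n+m (length w) 3) fits)

    replace-one : ∀ a b → ∃[ a' ] ∃[ b' ]
      Reach (W + (1 + (1 + W))) (cfg q4 (bitTape a [] (w ++ true ∷ []) b)) (cfg q3 (bitTape a' [] (w ++ false ∷ []) b'))
    replace-one a b = _ , _ , (to-end true a b ⟫ step-back w4 a true (d ∷ u) b zero refl ⟫
      move-step w5 refl ⟫ rewind w2 (both refl refl) refl a (false ∷ []) (suc (b ∸ 1)))

    remove-zero : ∀ a b → ∃[ a' ] ∃[ b' ]
      Reach (W + (1 + (1 + W))) (cfg q4 (bitTape a [] (w ++ false ∷ []) b)) (cfg q7 (bitTape a' [] w b'))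
    remove-zero a b = _ , _ , (to-end false a b ⟫ step-back w4 a false (d ∷ u) b zero refl ⟫
      move-step w5 refl ⟫ reach-≡ (cong (λ y → cfg q7 (bitTape (suc (a ∸ 1)) [] y (suc (suc (b ∸ 1))))) (List.++-identityʳ w))
        (rewind w6 (both refl refl) refl a [] (suc (suc (b ∸ 1)))))

  -- The longest round: append 1 and rewind, query, replace the 1 by 0 and rewind, query, remove the
  -- 0 and rewind.
  roundT : ℕ → ℕ
  roundT W = (W + (1 + W)) + (1 + ((W + (1 + (1 + W))) + (1 + (W + (1 + (1 + W))))))

  module _ (j : ℕ) (V : Str → Set) (extends? : ∀ p → Dec (∃[ y ] V (p ++ y))) (N : ℕ) (short : ∀ {z} → V z → length z ≤ N)
           (oracle : ∀ p → (∃[ y ] V (p ++ y)) ⇔ O (replicate j true ++ false ∷ p)) where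
    open Greedy V extends? N short

    private
      input : Str → Str
      input p = replicate j true ++ false ∷ p

      back : ∀ p → Backwards (input p)
      back p = go j
        where
        go : ∀ j → Backwards (replicate j true ++ false ∷ p)
        go zero    = backwards-view false p
        go (suc j) = backwards-view true (replicate j true ++ false ∷ p)

      input-snoc : ∀ p c → input p ++ c ∷ [] ≡ input (p ++ c ∷ [])
      input-snoc p c = List.++-assoc (replicate j true) (false ∷ p) (c ∷ [])

      width : ℕ
      width = 4 + (j + N)

      fits : ∀ p → length p ≤ N → 3 + length (input p) ≤ width
      fits p le = s≤s (s≤s (s≤s (≤-trans (≤-reflexive (trans (List.length-++ (replicate j true)) (cong (_+ suc (length p)) (List.length-replicate j))))
        (≤-trans (≤-reflexive (+-suc j (length p))) (s≤s (+-monoʳ-≤ j le))))))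

      ask-one : ∀ p c → ∃[ y ] V ((p ++ c ∷ []) ++ y) → O (input p ++ c ∷ [])
      ask-one p c e = subst O (sym (input-snoc p c)) (Equivalence.to (oracle (p ++ c ∷ [])) e)

      deny : ∀ p c → ¬ (∃[ y ] V ((p ++ c ∷ []) ++ y)) → ¬ O (input p ++ c ∷ [])
      deny p c n o = n (Equivalence.from (oracle (p ++ c ∷ [])) (subst O (input-snoc p c) o))

      shift : ∀ (p : Str) (c : Bool) n → suc N ≤ length p + suc n → suc N ≤ length (p ++ c ∷ []) + n
      shift p c n h = ≤-trans h (≤-reflexive (trans (+-suc (length p) n) (cong (_+ n) (trans (+-comm 1 (length p)) (sym (List.length-++ p))))))

      extended : ∀ (p : Str) (c : Bool) → ∃[ y ] V ((p ++ c ∷ []) ++ y) → length (p ++ c ∷ []) ≤ N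
      extended p c (y , vy) = ≤-trans (length-++-≤ˡ (p ++ c ∷ [])) (short vy)

    -- The string grows by one symbol per round and never exceeds length N, so n bounds the
    -- remaining rounds. The head may be anywhere on the word: at its right end when the search
    -- starts, at its left end after a query.
    run-search : ∀ n {p z} → Search p z → suc N ≤ length p + n → length p ≤ N → ∀ a u v b → v ʳ++ u ≡ input p ʳ++ [] →
      ∃[ a' ] ∃[ b' ] Reach (n * roundT width) (cfg q1 (bitTape a u v b)) (cfg q7 (bitTape a' [] (input z) b'))
    run-search zero s h le a u v b e = ⊥-elim (<⇒≱ h (≤-trans (≤-reflexive (+-identityʳ _)) le))
    run-search (suc n) {p} (finish (stuck n₁ n₀)) h le a u v b e =
      let a₁ , b₁ , r₁ = append-one (back p) (fits p le) a u v b e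
          a₂ , b₂ , r₂ = replace-one (back p) (fits p le) a₁ b₁
          a₃ , b₃ , r₃ = remove-zero (back p) (fits p le) a₂ b₂
      in a₃ , b₃ , within (m≤m+n _ (n * roundT width)) (r₁ ⟫ ask-no (deny p true n₁) ⟫ r₂ ⟫ ask-no (deny p false n₀) ⟫ r₃)
    run-search (suc n) {p} (one e₁ s) h le a u v b e =
      let a₁ , b₁ , r₁ = append-one (back p) (fits p le) a u v b e
          a₂ , b₂ , r₂ = run-search n s (shift p true n h) (extended p true e₁) a₁ [] (input (p ++ true ∷ [])) b₁ refl
      in a₂ , b₂ , (within (+-monoʳ-≤ (width + (1 + width)) (s≤s z≤n)) (r₁ ⟫ reach-≡ (cong (λ w → cfg q1 (bitTape a₁ [] w b₁)) (input-snoc p true)) (ask-yes (ask-one p true e₁))) ⟫ r₂)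
    run-search (suc n) {p} (nought n₁ e₀ s) h le a u v b e =
      let a₁ , b₁ , r₁ = append-one (back p) (fits p le) a u v b e
          a₂ , b₂ , r₂ = replace-one (back p) (fits p le) a₁ b₁
          a₃ , b₃ , r₃ = run-search n s (shift p false n h) (extended p false e₀) a₂ [] (input (p ++ false ∷ [])) b₂ refl
      in a₃ , b₃ , (within (+-monoʳ-≤ (width + (1 + width)) (s≤s (+-monoʳ-≤ (width + (1 + (1 + width))) (s≤s z≤n))))
             (r₁ ⟫ ask-no (deny p true n₁) ⟫ r₂ ⟫ reach-≡ (cong (λ w → cfg q1 (bitTape a₂ [] w b₂)) (input-snoc p false)) (ask-yes (ask-one p false e₀))) ⟫ r₃)

    skip-pairs : ∀ w e a u b → ∃[ u' ] Reach (length (pairs w) + 1) (cfg q8 (bitTape a u (pairs w ++ false ∷ e) b)) (cfg q10 (bitTape a u' e b))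
    skip-pairs [] e a u b = false ∷ u , step-R w8 a u false false e b refl
    skip-pairs (c ∷ w) e a u b =
      let u' , r = skip-pairs w e a (c ∷ true ∷ u) b
      in u' , (step-R w8 a u true true (c ∷ pairs w ++ false ∷ e) b refl ⟫ step-R w9 a (true ∷ u) c c (pairs w ++ false ∷ e) b (both {f = λ c → searchδ q9 (bitSym c)} {g = λ c → q8 , bitSym c , R} refl refl c) ⟫ r)

    skip-ones : ∀ i z a u b → ∃[ u' ] Reach (i + 1) (cfg q7 (bitTape a u (replicate i true ++ false ∷ z) b)) (cfg q8 (bitTape a u' z b))
    skip-ones zero z a u b = false ∷ u , step-R w7 a u false false z b refl
    skip-ones (suc i) z a u b = let u' , r = skip-ones i z a (true ∷ u) b in
      u' , (step-R w7 a u true true (replicate i true ++ false ∷ z) b refl ⟫ r)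

    searchTime : ℕ
    searchTime = (j + 1) + (suc N * roundT width + ((j + 1) + (N + 1)))

    search-computes : ∀ {w e} → Search [] (pairs w ++ false ∷ e) → length (pairs w ++ false ∷ e) ≤ N →
      OComputesIn searcher O (replicate j true) searchTime e
    search-computes {w} {e} s le =
      let a₁ , b₁ , r₁ = run-search (suc N) s (≤-refl) z≤n 0 (false ∷ (replicate j true ʳ++ [])) [] 0 (sym (ʳ++-snoc false (replicate j true)))
          u₂ , r₂ = skip-ones j (pairs w ++ false ∷ e) a₁ [] b₁
          u₃ , r₃ = skip-pairs w e a₁ u₂ b₁
          reach {n} n≤ run = setup ⟫ r₁ ⟫ r₂ ⟫ within (+-monoˡ-≤ 1 (≤-trans (length-++-≤ˡ (pairs w)) le)) r₃
      in n , _ , n≤ , run , refl , readBits-bitTape a₁ u₃ e b₁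
      where
      start-tape : ∀ j → initTape (replicate j true) ≡ bitTape 0 [] (replicate j true) 0
      start-tape zero    = refl
      start-tape (suc j) = cong (tape [] s1) (sym (List.++-identityʳ _))
      setup : Reach (j + 1) (oInit searcher O (replicate j true)) (cfg q1 (bitTape 0 (false ∷ (replicate j true ʳ++ [])) [] 0))
      setup = within (≤-reflexive (cong (_+ 1) (List.length-replicate j)))
        (subst (λ t → Reach (length (replicate j true) + 1) (cfg q0 t) (cfg q1 (bitTape 0 (false ∷ (replicate j true ʳ++ [])) [] 0))) (sym (start-tape j))
          (seek-R w0 (both refl refl) 0 [] (replicate j true) 0 ⟫ move-step w0 refl))

-- The depth word is itself made of pairs, those of 0^d 1 followed by the final 0. The oracle
-- machine can thus skip count and depth alike, without knowing where one ends and the other begins.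
advice : ∀ {m j} (t : Vec Bool (suc j)) d (D : Circuit m j) →
         certificate t d D ≡ pairs (toList t ++ replicate d false ++ true ∷ []) ++ false ∷ encode D
advice t d D = sym (trans (cong (_++ false ∷ encode D) (trans (pairs-++ (toList t) _) (cong (pairs (toList t) ++_) (trans (pairs-++ (replicate d false) _) (cong (_++ true ∷ true ∷ []) (pairs-false d))))))
  (trans (List.++-assoc (pairs (toList t)) _ _) (cong (pairs (toList t) ++_) (trans (List.++-assoc (power d (true ∷ false ∷ [])) _ _)
    (sym (List.++-assoc (power d (true ∷ false ∷ [])) _ _))))))
  where
  pairs-++ : ∀ u v → pairs (u ++ v) ≡ pairs u ++ pairs v
  pairs-++ u v = List.concatMap-++ _ u v
  pairs-false : ∀ d → pairs (replicate d false) ≡ power d (true ∷ false ∷ [])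
  pairs-false zero    = refl
  pairs-false (suc d) = cong (λ z → true ∷ false ∷ z) (pairs-false d)

-- For positive j, j + 1 is at most 2j, which costs the factor 2^q; adding q to the constant makes
-- it large enough as an exponent as well.
poly-size : ∀ q j → 1 ≤ j → q * suc j ^ q ≤ (q * 2 ^ q + q) * j ^ (q * 2 ^ q + q)
poly-size q (suc i) _ = ≤-trans (*-monoʳ-≤ q (≤-trans (^-monoˡ-≤ q (s≤s (≤-trans (s≤s (m≤m+n i (i + 0))) (≤-reflexive (sym (+-suc i (i + 0)))))))
    (≤-reflexive (^-distribʳ-* 2 (suc i) q))))
  (≤-trans (≤-reflexive (sym (*-assoc q (2 ^ q) (suc i ^ q)))) (*-mono-≤ (m≤m+n (q * 2 ^ q) q) (^-monoʳ-≤ (suc i) (m≤n+m q (q * 2 ^ q)))))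
  where
  ^-distribʳ-* : ∀ a b n → (a * b) ^ n ≡ a ^ n * b ^ n
  ^-distribʳ-* a b zero    = refl
  ^-distribʳ-* a b (suc n) = trans (cong (a * b *_) (^-distribʳ-* a b n)) (trans (*-assoc a b _) (trans (cong (a *_)
    (trans (sym (*-assoc b (a ^ n) (b ^ n))) (trans (cong (_* b ^ n) (*-comm b (a ^ n))) (*-assoc (a ^ n) b (b ^ n))))) (sym (*-assoc a (a ^ n) _))))

certLength-poly : ∀ m₁ {s} → Poly s → Poly (λ j → Normalise.certLength m₁ (s j) j)
certLength-poly m₁ ps =
  (k 1 ⊞ poly-id) ⊠ k 2 ⊞ ((ps ⊠ k 2 ⊞ k 3) ⊞ (k (suc m) ⊞ ((k 1 ⊞ poly-id) ⊞ ((k 1 ⊞ ps) ⊞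
    (ps ⊠ (k 5 ⊞ (W ⊠ k m ⊞ W ⊠ k m ⊠ (k 1 ⊞ W))) ⊞ (k 1 ⊞ W))))))
  where
  m = suc m₁
  k = poly-const
  W = ps ⊞ poly-id

searchBound : (ℕ → ℕ) → ℕ → ℕ
-- The cost of a round does not depend on the oracle, so an arbitrary language fills the module
-- parameter.
searchBound N j = (j + 1) + (suc (N j) * SearchRun.roundT (λ _ → ⊤) (4 + (j + N j)) + ((j + 1) + (N j + 1)))

searchBound-poly : ∀ {N} → Poly N → Poly (searchBound N)
searchBound-poly pN = (poly-id ⊞ k 1) ⊞ ((k 1 ⊞ pN) ⊠ ((W ⊞ (k 1 ⊞ W)) ⊞ (k 1 ⊞ ((W ⊞ (k 1 ⊞ (k 1 ⊞ W))) ⊞ (k 1 ⊞ (W ⊞ (k 1 ⊞ (k 1 ⊞ W)))))))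
                      ⊞ ((poly-id ⊞ k 1) ⊞ (pN ⊞ k 1)))
  where
  k = poly-const
  W = k 4 ⊞ (poly-id ⊞ pN)

decide : ∀ {k A} → HasACC k A → ∀ u → Dec (A u)
decide {A = A} (m , _ , C , _ , dec) u with eval (C (length u)) (Vec.fromList u) in e
... | true  = yes (subst A (Vec.toList∘fromList u) (Equivalence.to (dec (length u) (Vec.fromList u)) e))
  where import Data.Vec.Properties as Vec
... | false = no λ a → false≢true (trans (sym e) (Equivalence.from (dec (length u) (Vec.fromList u)) (subst A (sym (Vec.toList∘fromList u)) a)))
  where
  import Data.Vec.Properties as Vec
  false≢true : false ≢ true
  false≢true ()

-- The uniform circuit family and the theorem.

module Uniform (k : ℕ) (A : Language) (M : NTM) (c : ℕ)
               (timeM : ∀ x → NTimeBounded M x (2 ^ (c * (length x + 1)))) (acceptsM : ∀ x → A x ⇔ NAccepts M x)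
               (m₁ : ℕ) (m≥2 : 2 ≤ suc m₁) (C : (j : ℕ) → Circuit (suc m₁) j) (C-ACC : IsACC k (suc m₁) C) (C-decides : Decides C A)
               (q : ℕ) (q-bound : ∀ j → Normalise.certLength m₁ (size (C j)) j ≤ q * suc j ^ q)
               (O? : ∀ u → Dec (VerifierLanguage.language M m₁ q c timeM u)) where

  open Optimal M m₁ q using (Certificate; certified-⇔; certificate*; optimal-correct; optimal-depth; budget)

  O : Language
  O = VerifierLanguage.language M m₁ q c timeM

  D* : (j : ℕ) → Circuit (suc m₁) j
  D* j = Normalise.normalise m₁ (C j)

  correct* : ∀ j x → eval (D* j) x ≡ true ⇔ NAccepts M (toList x)
  correct* j x = mk⇔
    (λ e → Equivalence.to (acceptsM (toList x)) (Equivalence.to (C-decides j x) (trans (sym same-val) e)))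
    (λ a → trans same-val (Equivalence.from (C-decides j x) (Equivalence.from (acceptsM (toList x)) a)))
    where
    same-val : eval (D* j) x ≡ eval (C j) x
    same-val = Normalise.norm-val m₁ (gates (C j)) x (out (C j))

  fits* : ∀ j (t : Vec Bool (suc j)) → length (certificate t (depth (D* j)) (D* j)) ≤ budget j
  fits* j t = ≤-trans (Normalise.certificate-length m₁ (C j) t) (q-bound j)

  oracle : ∀ j p → (∃[ y ] Certificate j (p ++ y)) ⇔ O (replicate j true ++ false ∷ p)
  oracle j p = mk⇔
    (λ e → Equivalence.to (VerifierLanguage.language-⇔ M m₁ q c timeM j p) (Equivalence.from (certified-⇔ j p) e))
    (λ o → Equivalence.to (certified-⇔ j p) (Equivalence.from (VerifierLanguage.language-⇔ M m₁ q c timeM j p) o))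

  extends? : ∀ j p → Dec (∃[ y ] Certificate j (p ++ y))
  extends? j p = map′ (Equivalence.from (oracle j p)) (Equivalence.to (oracle j p)) (O? (replicate j true ++ false ∷ p))

  module At (j : ℕ) where
    open Greedy (Certificate j) (extends? j) (budget j) Certificate.short public

    some : ∃[ y ] Certificate j y
    some = _ , certificate* (D* j) (correct* j) (fits* j)

    found : ∃[ z ] Search [] z
    found = search (suc (budget j)) [] ≤-refl some

    best : Certificate j (proj₁ found)
    best = search-∈ (proj₂ found) some

    circuit-of : Circuit (suc m₁) j
    circuit-of = Certificate.D best

    decides : ∀ x → eval circuit-of x ≡ true ⇔ NAccepts M (toList x)
    decides = optimal-correct (D* j) (correct* j) (fits* j) best (search-max (proj₂ found))

    shallow : depth circuit-of ≤ depth (C j)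
    shallow = ≤-trans (optimal-depth (D* j) (correct* j) (fits* j) best (search-max (proj₂ found)))
                      (Normalise.norm-depth m₁ (gates (C j)) (out (C j)))

    small : size circuit-of ≤ budget j
    small = ≤-trans (size-≤ circuit-of) (≤-trans (length-++-≤ʳ (depWord (Certificate.d best)))
      (≤-trans (length-++-≤ʳ (pairs (toList (Certificate.t best)))) (≤-trans (≤-reflexive (cong length (sym (Certificate.written best)))) (Certificate.short best))))

    computed : OComputesIn searcher O (replicate j true) (searchBound budget j) (encode circuit-of)
    computed = SearchRun.search-computes O j (Certificate j) (extends? j) (budget j) Certificate.short (oracle j)
      {w = toList (Certificate.t best) ++ replicate (Certificate.d best) false ++ true ∷ []} {e = encode circuit-of}
      (subst (Search []) z≡ (proj₂ found)) (≤-trans (≤-reflexive (cong length (sym z≡))) (Certificate.short best))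
      where
      z≡ : proj₁ found ≡ pairs (toList (Certificate.t best) ++ replicate (Certificate.d best) false ++ true ∷ []) ++ false ∷ encode circuit-of
      z≡ = trans (Certificate.written best) (advice (Certificate.t best) (Certificate.d best) circuit-of)

  computes-mono : ∀ {x T T' y} → T ≤ T' → OComputesIn searcher O x T y → OComputesIn searcher O x T' y
  computes-mono le (n , d , n≤ , r) = n , d , ≤-trans n≤ le , r

  uniform : HasUniformACC k A
  uniform = suc m₁ , m≥2 , At.circuit-of ,
    ((q * 2 ^ q + q , 1 , λ j 1≤j → ≤-trans (At.small j) (poly-size q j 1≤j)) ,
     (proj₁ (proj₂ C-ACC) , proj₁ (proj₂ (proj₂ C-ACC)) , λ j le → ≤-trans (At.shallow j) (proj₂ (proj₂ (proj₂ C-ACC)) j le))) ,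
    (λ j x → mk⇔ (λ e → Equivalence.from (acceptsM (toList x)) (Equivalence.to (At.decides j x) e))
                 (λ a → Equivalence.from (At.decides j x) (Equivalence.to (acceptsM (toList x)) a))) ,
    (O , VerifierLanguage.language-NE M m₁ q c timeM , searcher , proj₁ poly , λ j →
      computes-mono (≤-trans (proj₂ poly j) (≤-reflexive (cong (λ n → proj₁ poly * n ^ proj₁ poly) (+-comm 1 j)))) (At.computed j))
    where
    poly : Poly (searchBound budget)
    poly = searchBound-poly {budget} (q , λ j → ≤-refl)

theorem1 : (k : ℕ) →
    ((A : Language) → InNE A → HasACC k A) ⇔
    ((A : Language) → InNE A → HasUniformACC k A)
theorem1 k = mk⇔ forward λ U A A∈NE → let m , m≥2 , C , acc , dec , _ = U A A∈NE in m , m≥2 , C , acc , dec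
  where
  forward : ((A : Language) → InNE A → HasACC k A) → (A : Language) → InNE A → HasUniformACC k A
  forward H A A∈NE@(M , c , hM) with H A A∈NE
  ... | zero , () , _
  -- The nonuniform family C enters the verifier only through its modulus and the constant q
  -- bounding certificate lengths; this is why one NE language serves as oracle for all j. The
  -- hypothesis H is applied a second time, to that language, to decide the queries.
  ... | suc m₁ , m≥2 , C , C-ACC@((e , j₀ , sizes) , _) , dec = Uniform.uniform k A M c timeM (λ x → proj₂ (hM x)) m₁ m≥2 C C-ACC dec
      (proj₁ bounded) (proj₂ bounded) (decide {k} (H _ (VerifierLanguage.language-NE M m₁ (proj₁ bounded) c timeM)))
    where
    timeM : ∀ x → NTimeBounded M x (2 ^ (c * (length x + 1)))
    timeM x = proj₁ (hM x)
    bounded : Poly (λ j → Normalise.certLength m₁ (size (C j)) j)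
    bounded = certLength-poly m₁ (poly-eventually (size ∘ C) e j₀ sizes)
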